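{- Let $G$ be an $n$-vertex $2$-connected near triangulation that is not isomorphic to any of the graphs $K_4^{ - }$, $K_4$, $W_5$, $G_6^1$, $G_6^2$, $G_6^3$, $G_8^1$. Then $\overrightarrow{\mathrm{diam}}(G)\le \lceil n/2\rceil$.
   Context: A near triangulation is a (simple) plane graph in which every face, except possibly the outer face, is bounded by a triangle; $2$-connected means its outer face is bounded by a cycle (the outer cycle). An orientation of an undirected graph $G$ assigns a direction to each edge; it is strongly connected if every vertex can reach every other vertex by a directed path. The distance $d_D(u,v)$ is the length of a shortest directed $u$–$v$ path in $D$, and $\mathrm{diam}(D)=\max_{u,v} d_D(u,v)$. The oriented diameter $\overrightarrow{\mathrm{diam}}(G)$ is the minimum of $\mathrm{diam}(D)$ over all strongly connected orientations $D$ of $G$. An outerplanar graph is a planar graph embedded so that all vertices lie on the outer face; maximal outerplanar means edge-maximal. The exceptional graphs: $K_4^-$ is $K_4$ minus an edge; $K_4$ is embedded with an outer triangle and one interior vertex; $W_5$ is the wheel on six vertices (a $5$-cycle as outer cycle plus an interior vertex adjacent to all five). $G_6^1,G_6^2$ are the two $6$-vertex maximal outerplanar graphs of oriented diameter greater than $3$, namely the fan (vertices $h,p_1,\dots,p_5$, outer cycle $hp_1p_2p_3p_4p_5h$, $h$ adjacent to all $p_i$) and the zigzag (outer cycle $w_1w_2\cdots w_6w_1$ with chords $w_1w_3,w_1w_4,w_4w_6$). $G_8^1$ is the $8$-vertex maximal outerplanar graph whose oriented diameter exceeds $4$ (the unique $8$-vertex exception in the result of Wang, Chen, Dankelmann,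 Guo, Surmacs and Volkmann that every maximal outerplanar graph on $n\ge 3$ vertices other than $K_4^-,G_6^1,G_6^2,G_8^1$ has oriented diameter at most $\lceil n/2\rceil$). $G_6^3$ is the near triangulation with vertices $u_1,u_2,u_3,x,a,b$, edges $u_1u_2,u_1u_3,u_2u_3,xu_1,xu_2,xu_3,u_2a,ab,bu_3,u_2b$, outer cycle $u_1u_2abu_3u_1$ and $x$ in the interior of the triangle $u_1u_2u_3$. -}

module Defs where

open import Data.Nat using (ℕ; zero; suc; _+_; _*_; _≤ᵇ_)
open import Data.Fin using (Fin; toℕ; #_)
open import Data.Fin.Properties using (_≟_)
open import Data.Bool using (Bool; true; false; _∧_; _∨_; if_then_else_)
open import Data.Product using (Σ; ∃; _×_; _,_; proj₁; proj₂)
open import Data.Sum using (_⊎_)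
open import Data.List using (List; []; _∷_; upTo; allFin; cartesianProduct)
open import Data.Bool.ListAction using (any; all)
open import Relation.Binary.PropositionalEquality using (_≡_; _≢_)
open import Relation.Nullary using (¬_)
open import Relation.Nullary.Decidable using (⌊_⌋)
open import Function.Bundles using (_↔_; Inverse)

Graph : ℕ → Set
Graph n = Fin n → Fin n → Bool

IsSimple : ∀ {n} → Graph n → Set
IsSimple {n} G = (∀ (v : Fin n) → G v v ≡ false) × (∀ (u v : Fin n) → G u v ≡ G v u)

-- Walk G k u v : there is a walk (directed, following G u w ≡ true)
-- from u to v of length at most k.
data Walk {n : ℕ} (G : Graph n) : ℕ → Fin n → Fin n → Set where
  here : ∀ {k v} → Walk G k v v
  step : ∀ {k u w v} → G u w ≡ true → Walk G k w v → Walk G (suc k) u v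

Connected : ∀ {n} → Graph n → Set
Connected {n} G = ∀ (u v : Fin n) → ∃ λ k → Walk G k u v

_≅_ : ∀ {n k} → Graph n → Graph k → Set
_≅_ {n} {k} G H =
  Σ (Fin n ↔ Fin k) λ f → ∀ u v → G u v ≡ H (Inverse.to f u) (Inverse.to f v)

IsOrientation : ∀ {n} → Graph n → Graph n → Set
IsOrientation {n} G D =
  (∀ (u v : Fin n) → D u v ≡ true → G u v ≡ true) ×
  (∀ (u v : Fin n) → G u v ≡ true → D u v ≡ true ⊎ D v u ≡ true) ×
  (∀ (u v : Fin n) → D u v ≡ true → D v u ≡ true → Data.Empty.⊥)
  where import Data.Empty

-- the oriented diameter of G is at most k: some orientation D of G has
-- d_D(u,v) ≤ k for all u, v (such a D is automatically strongly connected;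
-- if G has no strongly connected orientation, this is false, matching
-- the convention that the oriented diameter is then infinite).
OrientedDiamLE : ∀ {n} → Graph n → ℕ → Set
OrientedDiamLE {n} G k =
  ∃ λ (D : Graph n) → IsOrientation G D × (∀ (u v : Fin n) → Walk D k u v)

iter : ∀ {A : Set} → (A → A) → ℕ → A → A
iter f zero    x = x
iter f (suc k) x = f (iter f k x)

-- ρ v u = the neighbour of v following u in the cyclic (say
-- counter-clockwise) order of the neighbours around v.
Rotation : ℕ → Set
Rotation n = Fin n → Fin n → Fin n

IsRotationSystem : ∀ {n} → Graph n → Rotation n → Set
IsRotationSystem {n} G ρ =
  (∀ (v u : Fin n) → G v u ≡ true → G v (ρ v u) ≡ true) ×
  (∀ (v u w : Fin n) → G v u ≡ true → G v w ≡ true → ρ v u ≡ ρ v w → u ≡ w) ×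
  (∀ (v u w : Fin n) → G v u ≡ true → G v w ≡ true → ∃ λ k → iter (ρ v) k u ≡ w)

Dart : ℕ → Set
Dart n = Fin n × Fin n

isDart : ∀ {n} → Graph n → Dart n → Bool
isDart G (u , v) = G u v

-- face-tracing permutation: after traversing u → v, continue along
-- v → ρ v u.  Faces of the embedding = orbits of faceStep on darts.
faceStep : ∀ {n} → Rotation n → Dart n → Dart n
faceStep ρ (u , v) = (v , ρ v u)

count : ∀ {A : Set} → (A → Bool) → List A → ℕ
count p []       = 0
count p (x ∷ xs) = if p x then suc (count p xs) else count p xs

allDarts : (n : ℕ) → List (Dart n)
allDarts n = cartesianProduct (allFin n) (allFin n)

rank : ∀ {n} → Dart n → ℕ
rank {n} (u , v) = toℕ u * n + toℕ v

numDarts : ∀ {n} → Graph n → ℕ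
numDarts {n} G = count (isDart G) (allDarts n)

-- d is the rank-minimal dart of its face (every orbit has length < n * n)
isFaceRep : ∀ {n} → Rotation n → Dart n → Bool
isFaceRep {n} ρ d = all (λ k → rank d ≤ᵇ rank (iter (faceStep ρ) k d)) (upTo (n * n))

numFaces : ∀ {n} → Graph n → Rotation n → ℕ
numFaces {n} G ρ = count (λ d → isDart G d ∧ isFaceRep ρ d) (allDarts n)

-- (G , ρ) is a plane graph: G simple and connected, ρ a rotation system of
-- genus 0, i.e. Euler's formula  n - m + f = 2  (written as 2n + 2f = 2m + 4).
IsPlane : ∀ {n} → Graph n → Rotation n → Set
IsPlane {n} G ρ =
  IsSimple G × Connected G × IsRotationSystem G ρ ×
  (2 * n + 2 * numFaces G ρ ≡ numDarts G + 4)

OnFace : ∀ {n} → Rotation n → Dart n → Dart n → Set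
OnFace ρ o d = ∃ λ k → iter (faceStep ρ) k o ≡ d

-- (G , ρ , o) is a 2-connected near triangulation with outer face the face
-- containing the dart o: a plane graph in which every other face is bounded
-- by a triangle, and the outer face is bounded by a cycle.
Is2ConnNearTriangulation : ∀ {n} → Graph n → Rotation n → Dart n → Set
Is2ConnNearTriangulation {n} G ρ o =
  IsPlane G ρ ×
  isDart G o ≡ true ×
  (∀ (d : Dart n) → isDart G d ≡ true → ¬ OnFace ρ o d →
     iter (faceStep ρ) 3 d ≡ d) ×
  -- the outer facial walk has length ≥ 3 and repeats no vertex: a cycle
  (iter (faceStep ρ) 2 o ≢ o) ×
  (∀ (i j : ℕ) → proj₁ (iter (faceStep ρ) i o) ≡ proj₁ (iter (faceStep ρ) j o) →
     iter (faceStep ρ) i o ≡ iter (faceStep ρ) j o)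

fromEdges : ∀ {k} → List (Fin k × Fin k) → Graph k
fromEdges es u v =
  any (λ e → (⌊ proj₁ e ≟ u ⌋ ∧ ⌊ proj₂ e ≟ v ⌋) ∨ (⌊ proj₁ e ≟ v ⌋ ∧ ⌊ proj₂ e ≟ u ⌋)) es

K4⁻ : Graph 4
K4⁻ = fromEdges ((# 0 , # 1) ∷ (# 1 , # 2) ∷ (# 2 , # 3) ∷ (# 3 , # 0) ∷ (# 0 , # 2) ∷ [])

K4 : Graph 4
K4 = fromEdges ((# 0 , # 1) ∷ (# 0 , # 2) ∷ (# 0 , # 3) ∷ (# 1 , # 2) ∷ (# 1 , # 3) ∷ (# 2 , # 3) ∷ [])

W5 : Graph 6
W5 = fromEdges ((# 0 , # 1) ∷ (# 1 , # 2) ∷ (# 2 , # 3) ∷ (# 3 , # 4) ∷ (# 4 , # 0) ∷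
                (# 5 , # 0) ∷ (# 5 , # 1) ∷ (# 5 , # 2) ∷ (# 5 , # 3) ∷ (# 5 , # 4) ∷ [])

-- fan: h = 0, p_i = i
G6¹ : Graph 6
G6¹ = fromEdges ((# 0 , # 1) ∷ (# 0 , # 2) ∷ (# 0 , # 3) ∷ (# 0 , # 4) ∷ (# 0 , # 5) ∷
                 (# 1 , # 2) ∷ (# 2 , # 3) ∷ (# 3 , # 4) ∷ (# 4 , # 5) ∷ [])

-- zigzag: w_i = i - 1; outer cycle plus chords w1w3, w1w4, w4w6
G6² : Graph 6
G6² = fromEdges ((# 0 , # 1) ∷ (# 1 , # 2) ∷ (# 2 , # 3) ∷ (# 3 , # 4) ∷ (# 4 , # 5) ∷ (# 5 , # 0) ∷
                 (# 0 , # 2) ∷ (# 0 , # 3) ∷ (# 3 , # 5) ∷ [])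

-- u1 = 0, u2 = 1, u3 = 2, x = 3, a = 4, b = 5
G6³ : Graph 6
G6³ = fromEdges ((# 0 , # 1) ∷ (# 0 , # 2) ∷ (# 1 , # 2) ∷ (# 3 , # 0) ∷ (# 3 , # 1) ∷
                 (# 3 , # 2) ∷ (# 1 , # 4) ∷ (# 4 , # 5) ∷ (# 5 , # 2) ∷ (# 1 , # 5) ∷ [])

-- the unique 8-vertex maximal outerplanar graph with oriented diameter > 4:
-- outer cycle 01234567 with chords 17, 27, 37, 35, 36
-- (identified by exhaustive computer search over all triangulations of the octagon)
G8¹ : Graph 8
G8¹ = fromEdges ((# 0 , # 1) ∷ (# 1 , # 2) ∷ (# 2 , # 3) ∷ (# 3 , # 4) ∷ (# 4 , # 5) ∷
                 (# 5 , # 6) ∷ (# 6 , # 7) ∷ (# 7 , # 0) ∷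
                 (# 1 , # 7) ∷ (# 2 , # 7) ∷ (# 3 , # 7) ∷ (# 3 , # 5) ∷ (# 3 , # 6) ∷ [])

{-# OPTIONS --safe #-}

-- Idea.  The bounded faces form a disc, which is taken apart by removing boundary vertices without
-- chords.  Such a vertex exists in an innermost pocket cut off by a chord: a chord does separate,
-- since a dual cycle crossing it once would by Euler's formula be the coboundary of a function
-- that is constant along the boundary.  In the resulting order of the vertices, the earlier
-- neighbours of every vertex induce a graph without isolated vertices.
-- For all graphs with such an order the bound is shown by induction in steps of two vertices.
-- Two suitable late vertices are deleted, and put back along directed paths so that distances grow
-- by at most one; otherwise there are four vertices without later neighbours, and these are put
-- back with distances growing by at most two.  The bound fails only for the exceptional graphs of
-- the theorem and for one more graph on six vertices, a book of three triangles with an ear, in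
-- which three faces would meet at an edge.  Orientations for all extensions of exceptional graphs,
-- and for all graphs on at most six vertices, are given by certificates.
module Submission where

open import Defs
open import Data.Bool using (Bool; true; false; _∧_; _∨_; not; if_then_else_; _xor_)
open import Data.Empty using (⊥; ⊥-elim)
open import Data.Fin using (Fin; zero; suc; toℕ; fromℕ<)
open import Data.Fin.Properties using (_≟_; all?; any?; pigeonhole; toℕ<n; toℕ-combine; combine-injective; toℕ-injective; toℕ-fromℕ<)
open import Data.List using (List; []; _∷_; _++_; applyUpTo; upTo; map; concatMap; zipWith; length; filterᵇ; cartesianProduct; allFin)
open import Data.List.Membership.Propositional using (_∈_; lose)
open import Data.List.Membership.Propositional.Properties using (∈-++⁺ˡ; ∈-++⁺ʳ; ∈-++⁻; ∈-map⁺; ∈-concatMap⁺; ∈-upTo⁺; ∈-upTo⁻; ∈-cartesianProduct⁺; ∈-cartesianProduct⁻; ∈-allFin)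
open import Data.List.Properties using (length-tabulate)
open import Data.List.Relation.Unary.All using (lookup)
open import Data.List.Relation.Unary.Any using (here; there)
open import Data.List.Relation.Unary.Unique.Propositional using (Unique; []; _∷_)
open import Data.List.Relation.Unary.Unique.Propositional.Properties using (allFin⁺; cartesianProduct⁺)
open import Data.Nat using (ℕ; suc; _≤_; s≤s; zero; _+_; _<_; _<?_; z≤n; _≡ᵇ_; _/_; _%_; _<ᵇ_; _*_; _∸_; _≤ᵇ_; ⌈_/2⌉; ⌊_/2⌋)
open import Data.Nat.Properties using (≤-refl; ≤-trans; m≤n+m; m≤m+n; n≤1+n; +-suc; ≤-total; <-irrefl; <-asym; <-cmp; <-≤-trans; suc-injective; ≡ᵇ⇒≡; m<n⇒m<1+n; ≤∧≢⇒<; ≤-pred; <ᵇ⇒<; <-trans; ≤-reflexive; m≤n⇒m≤1+n; +-monoʳ-≤; n<1+n; m≤n⇒m<n∨m≡n; m<n⇒0<n∸m; m+[n∸m]≡n; <⇒≤; m∸n≤m; +-comm; ≤-antisym; +-identityʳ; ≤ᵇ⇒≤; +-monoˡ-≤; +-mono-≤; *-comm; +-cancelˡ-≤; ≤-<-trans; m∸n+n≡m; +-assoc)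
open import Data.Product using (Σ; _×_; _,_; proj₁; proj₂; ∃; swap)
open import Data.Product.Properties using (,-injective; ≡-dec)
open import Data.Sum using (_⊎_; inj₁; inj₂)
open import Data.Unit using (tt; ⊤)
open import Function using (_∘_)
open import Function.Bundles using (mk↔ₛ′)
open import Relation.Binary.Definitions using (tri<; tri≈; tri>)
open import Relation.Binary.PropositionalEquality using (_≡_; _≢_; refl; sym; trans; subst; cong; ≢-sym; cong₂)
open import Relation.Nullary using (¬_; yes; no; Dec)
open import Relation.Nullary.Decidable using (⌊_⌋; _→-dec_; _×-dec_; ¬?; toWitness; True)
import Data.Bool.Properties as Bool
import Data.Bool.Solver
import Data.Bool.ListAction as LA

-- The bound grows by one for every two vertices, but two new vertices v and w put on ears over an
-- orientation of diameter d are a priori joined only by walks of length d + 2. The missing unit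
-- comes from pruning: in the smaller graph some vertex u keeps just two neighbours a and b, so an
-- orientation passes it along a → u → b up to reversal, and a is reached, and b left, one step
-- faster than u. Near triangulations are not closed under such deletions of edges, but the graphs
-- with an order of the described kind are, which is why the induction runs in the larger class and
-- why the book appears. Deleting edges does no harm because `Good` directs only some of the edges;
-- the rest are directed arbitrarily at the end. If at most three vertices lack later neighbours,
-- they can be removed, some of them together with one neighbour, and a vertex that then loses its
-- last later neighbour must be adjacent to two of the removed groups. It ties these groups closely
-- enough together for the short walks between v and w. With four such vertices no unit has to be
-- saved: a walk between two of them gains one arc at either end, and four vertices are worth two
-- steps.

infix 4 _==_

_==_ : ∀ {n} → Fin n → Fin n → Bool
u == v = ⌊ u ≟ v ⌋

≡⇒== : ∀ {n} {u v : Fin n} → u ≡ v → (u == v) ≡ true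
≡⇒== {u = u} {v} p with u ≟ v
... | yes _ = refl
... | no q = ⊥-elim (q p)

==⇒≡ : ∀ {n} {u v : Fin n} → (u == v) ≡ true → u ≡ v
==⇒≡ {u = u} {v} p with u ≟ v
... | yes q = q
==⇒≡ () | no _

≢⇒==f : ∀ {n} {u v : Fin n} → u ≢ v → (u == v) ≡ false
≢⇒==f {u = u} {v} p with u ≟ v
... | yes q = ⊥-elim (p q)
... | no _ = refl

==f⇒≢ : ∀ {n} {u v : Fin n} → (u == v) ≡ false → u ≢ v
==f⇒≢ {u = u} {v} p q with u ≟ v
==f⇒≢ () q | yes _
... | no r = r q

split : (b : Bool) → b ≡ true ⊎ b ≡ false
split true = inj₁ refl
split false = inj₂ refl

clash : ∀ {b : Bool} {A : Set} → b ≡ true → b ≡ false → A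
clash refl ()

≢true : ∀ {b} → ¬ (b ≡ true) → b ≡ false
≢true {true} p = ⊥-elim (p refl)
≢true {false} p = refl

≢false : ∀ {b} → ¬ (b ≡ false) → b ≡ true
≢false {true} p = refl
≢false {false} p = ⊥-elim (p refl)

∧-true : ∀ {a b} → a ∧ b ≡ true → a ≡ true × b ≡ true
∧-true {true} {true} _ = refl , refl

∧-intro : ∀ {a b} → a ≡ true → b ≡ true → a ∧ b ≡ true
∧-intro refl refl = refl

∨-true : ∀ {a b} → a ∨ b ≡ true → a ≡ true ⊎ b ≡ true
∨-true {true} _ = inj₁ refl
∨-true {false} p = inj₂ p

∨-introˡ : ∀ {a b} → a ≡ true → a ∨ b ≡ true
∨-introˡ refl = refl

∨-introʳ : ∀ {a b} → b ≡ true → a ∨ b ≡ true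
∨-introʳ {true} _ = refl
∨-introʳ {false} p = p

not-true : ∀ {a} → not a ≡ true → a ≡ false
not-true {false} _ = refl

not-false : ∀ {a} → a ≡ false → not a ≡ true
not-false refl = refl

-- Vertex subsets.

infixl 6 _-_

abstract
  _-_ : ∀ {n} → (Fin n → Bool) → Fin n → (Fin n → Bool)
  (S - w) u = S u ∧ not (u == w)

  -def : ∀ {n} (S : Fin n → Bool) w u → (S - w) u ≡ S u ∧ not (u == w)
  -def S w u = refl

  -⊆ : ∀ {n} {S : Fin n → Bool} {w u} → (S - w) u ≡ true → S u ≡ true
  -⊆ p = proj₁ (∧-true p)

  -≢ : ∀ {n} {S : Fin n → Bool} {w u} → (S - w) u ≡ true → u ≢ w
  -≢ {S = S} {w} {u} p = ==f⇒≢ (not-true (proj₂ (∧-true {S u} p)))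

  -intro : ∀ {n} {S : Fin n → Bool} {w u} → S u ≡ true → u ≢ w → (S - w) u ≡ true
  -intro p q = ∧-intro p (not-false (≢⇒==f q))

-- Directed walks, partial orientations and ears.

module _ {n : ℕ} where

  weaken : ∀ {D : Graph n} {k l u v} → k ≤ l → Walk D k u v → Walk D l u v
  weaken p here = here
  weaken (s≤s p) (step e w) = step e (weaken p w)

  weaken₁ : ∀ {D : Graph n} {k u v} → Walk D k u v → Walk D (suc k) u v
  weaken₁ here = here
  weaken₁ (step e w) = step e (weaken₁ w)

  infixl 5 _▷_

  _▷_ : ∀ {D : Graph n} {k u v w} → Walk D k u v → D v w ≡ true → Walk D (suc k) u w
  here ▷ e = step e here
  step d p ▷ e = step d (p ▷ e)

  mapW : ∀ {D D' : Graph n} {k u v} → (∀ x y → D x y ≡ true → D' x y ≡ true) → Walk D k u v → Walk D' k u v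
  mapW f here = here
  mapW f (step e w) = step (f _ _ e) (mapW f w)

  rev : Graph n → Graph n
  rev D u v = D v u

  revW : ∀ {D : Graph n} {k u v} → Walk D k u v → Walk (rev D) k v u
  revW here = here
  revW {D} (step e w) = _▷_ {D = rev D} (revW w) e

  abstract
    -- A previous arc b → a is dropped, so antisymmetry survives and the same operation also
    -- reverses arcs.
    ins : Fin n → Fin n → Graph n → Graph n
    ins a b D u v = if (u == a) ∧ (v == b) then true else
                    (if (u == b) ∧ (v == a) then false else D u v)

    ins-new : ∀ a b D → ins a b D a b ≡ true
    ins-new a b D rewrite ≡⇒== {u = a} refl | ≡⇒== {u = b} refl = refl

    ins-old : ∀ a b D u v → ¬ (u ≡ b × v ≡ a) → D u v ≡ true → ins a b D u v ≡ true
    ins-old a b D u v ne d with (u == a) ∧ (v == b)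
    ... | true = refl
    ... | false with split ((u == b) ∧ (v == a))
    ...   | inj₂ p rewrite p = d
    ...   | inj₁ p = ⊥-elim (ne (==⇒≡ (proj₁ (∧-true p)) , ==⇒≡ (proj₂ (∧-true {u == b} p))))

    ins-inv : ∀ a b D u v → ins a b D u v ≡ true →
              (u ≡ a × v ≡ b) ⊎ ((D u v ≡ true) × ¬ (u ≡ b × v ≡ a))
    ins-inv a b D u v p with split ((u == a) ∧ (v == b))
    ... | inj₁ q = inj₁ (==⇒≡ (proj₁ (∧-true q)) , ==⇒≡ (proj₂ (∧-true {u == a} q)))
    ... | inj₂ q with split ((u == b) ∧ (v == a))
    ...   | inj₁ r = clash p (lem q r)
      where
      lem : (u == a) ∧ (v == b) ≡ false → (u == b) ∧ (v == a) ≡ true → ins a b D u v ≡ false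
      lem q r rewrite q | r = refl
    ...   | inj₂ r = inj₂ (trans (sym (lem q r)) p , λ { (refl , refl) → clash (∧-intro (≡⇒== {u = u} refl) (≡⇒== {u = v} refl)) r })
      where
      lem : (u == a) ∧ (v == b) ≡ false → (u == b) ∧ (v == a) ≡ false → ins a b D u v ≡ D u v
      lem q r rewrite q | r = refl

  -- Edges of E may stay undirected. Bounds on distances are therefore inherited from a subgraph on
  -- the same vertices.
  record Or (E : Graph n) (S : Fin n → Bool) (D : Graph n) : Set where
    constructor or
    field
      edge : ∀ u v → D u v ≡ true → E u v ≡ true
      anti : ∀ u v → D u v ≡ true → D v u ≡ true → ⊥
      inˡ : ∀ u v → D u v ≡ true → S u ≡ true
      inʳ : ∀ u v → D u v ≡ true → S v ≡ true

  ins-or : ∀ {E S D a b} → (∀ u → E u u ≡ false) → Or E S D →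
           E a b ≡ true → S a ≡ true → S b ≡ true → Or E S (ins a b D)
  ins-or {E} {S} {D} {a} {b} irr (or ed an il ir) e sa sb = or ed' an' il' ir'
    where
    ed' : ∀ u v → ins a b D u v ≡ true → E u v ≡ true
    ed' u v p with ins-inv a b D u v p
    ... | inj₁ (refl , refl) = e
    ... | inj₂ (q , _) = ed _ _ q
    an' : ∀ u v → ins a b D u v ≡ true → ins a b D v u ≡ true → ⊥
    an' u v p q with ins-inv a b D u v p | ins-inv a b D v u q
    ... | inj₁ (refl , refl) | inj₁ (x , y) = clash (subst (λ z → E a z ≡ true) x e) (irr a)
    ... | inj₁ (refl , refl) | inj₂ (_ , ne) = ne (refl , refl)
    ... | inj₂ (_ , ne) | inj₁ (refl , refl) = ne (refl , refl)
    ... | inj₂ (x , _) | inj₂ (y , _) = an _ _ x y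
    il' : ∀ u v → ins a b D u v ≡ true → S u ≡ true
    il' u v p with ins-inv a b D u v p
    ... | inj₁ (refl , refl) = sa
    ... | inj₂ (q , _) = il _ _ q
    ir' : ∀ u v → ins a b D u v ≡ true → S v ≡ true
    ir' u v p with ins-inv a b D u v p
    ... | inj₁ (refl , refl) = sb
    ... | inj₂ (q , _) = ir _ _ q

  Fresh : Graph n → Fin n → Set
  Fresh D w = ∀ u → (D u w ≡ true → ⊥) × (D w u ≡ true → ⊥)

  infix 4 _⊑_

  _⊑_ : Graph n → Graph n → Set
  D ⊑ D' = ∀ u v → D u v ≡ true → D' u v ≡ true

  ins-⊑ : ∀ {a b D} → ¬ (D b a ≡ true) → D ⊑ ins a b D
  ins-⊑ {a} {b} {D} f u v d = ins-old a b D u v (λ { (refl , refl) → f d }) d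

  ins-fresh : ∀ {a b D w} → Fresh D w → w ≢ a → w ≢ b → Fresh (ins a b D) w
  ins-fresh {a} {b} {D} {w} f na nb u = l , r
    where
    l : ins a b D u w ≡ true → ⊥
    l p with ins-inv a b D u w p
    ... | inj₁ (_ , q) = nb q
    ... | inj₂ (q , _) = proj₁ (f u) q
    r : ins a b D w u ≡ true → ⊥
    r p with ins-inv a b D w u p
    ... | inj₁ (q , _) = na q
    ... | inj₂ (q , _) = proj₂ (f u) q

  ear : Fin n → Fin n → Fin n → Graph n → Graph n
  ear x w y D = ins x w (ins w y D)

  ear-⊑ : ∀ {x w y D} → Fresh D w → x ≢ y → w ≢ x → w ≢ y → D ⊑ ear x w y D
  ear-⊑ {x} {w} {y} {D} f ne nx ny u v d =
    ins-⊑ {x} {w} {ins w y D} back u v (ins-⊑ {w} {y} {D} (proj₁ (f y)) u v d)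
    where
    back : ¬ (ins w y D w x ≡ true)
    back p with ins-inv w y D w x p
    ... | inj₁ (_ , q) = ne q
    ... | inj₂ (q , _) = proj₂ (f x) q

  ear-in : ∀ {x w y D} → ear x w y D x w ≡ true
  ear-in {x} {w} {y} {D} = ins-new x w (ins w y D)

  ear-out : ∀ {x w y D} → x ≢ y → ear x w y D w y ≡ true
  ear-out {x} {w} {y} {D} ne = ins-old x w (ins w y D) w y (λ { (_ , q) → ne (sym q) }) (ins-new w y D)

  ear-fresh : ∀ {x w y D z} → Fresh D z → z ≢ x → z ≢ w → z ≢ y → Fresh (ear x w y D) z
  ear-fresh f nx nw ny = ins-fresh (ins-fresh f nw ny) nx nw

  ear-or : ∀ {E S D x w y} → (∀ u → E u u ≡ false) → Or E S D →
           E x w ≡ true → E w y ≡ true → S x ≡ true → S w ≡ true → S y ≡ true → Or E S (ear x w y D)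
  ear-or irr o e f sx sw sy = ins-or irr (ins-or irr o f sw sy) e sx sw

  All-walks : (S : Fin n → Bool) → ℕ → Graph n → Set
  All-walks S k D = ∀ {u v} → S u ≡ true → S v ≡ true → Walk D k u v

  Good : Graph n → (Fin n → Bool) → ℕ → Set
  Good E S k = Σ (Graph n) λ D → Or E S D × All-walks S k D

-- Vertices of degree two in an orientation.

module _ {n : ℕ} where

  lastStep : ∀ {D : Graph n} {k u v} → Walk D (suc k) u v → u ≢ v → Σ (Fin n) λ x → Walk D k u x × D x v ≡ true
  lastStep here ne = ⊥-elim (ne refl)
  lastStep {k = zero} (step e here) ne = _ , here , e
  lastStep {k = suc k} {v = v} (step {w = w} e p) ne with w ≟ v
  ... | yes refl = _ , here , e
  ... | no q with lastStep p q
  ...   | x , r , d = x , step e r , d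

  infixr 5 _⋯_

  _⋯_ : ∀ {D : Graph n} {k l u v w} → Walk D k u v → Walk D l v w → Walk D (k + l) u w
  _⋯_ {k = k} {l} here q = weaken (m≤n+m l k) q
  step e p ⋯ q = step e (p ⋯ q)

  -- In D the vertex u is only passed along a → u → b, so a is reached, and b left,
  -- one step faster than u.
  record Thru (S : Fin n → Bool) (K : ℕ) (D : Graph n) (a u b : Fin n) : Set where
    field
      arcᵢ : D a u ≡ true
      arcₒ : D u b ≡ true
      onlyᵢ : ∀ x → D x u ≡ true → x ≡ a
      onlyₒ : ∀ x → D u x ≡ true → x ≡ b
      to : ∀ {h} → S h ≡ true → h ≢ u → Walk D K h a
      from : ∀ {h} → S h ≡ true → h ≢ u → Walk D K b h

  rev-thru : ∀ {S K} {D : Graph n} {a u b} → Thru S K D a u b → Thru S K (rev D) b u a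
  rev-thru t = record
    { arcᵢ = arcₒ ; arcₒ = arcᵢ ; onlyᵢ = onlyₒ ; onlyₒ = onlyᵢ
    ; to = λ s q → revW (from s q) ; from = λ s q → revW (to s q) }
    where open Thru t

  module _ {E : Graph n} {S : Fin n → Bool} {K : ℕ} {D : Graph n} (o : Or E S D)
           (aw : All-walks S (suc K) D) {u a b : Fin n}
           (su : S u ≡ true) (sa : S a ≡ true) (u≢a : u ≢ a)
           (nbr : ∀ x → E u x ≡ true → x ≡ a ⊎ x ≡ b) (nbr' : ∀ x → E x u ≡ true → x ≡ a ⊎ x ≡ b) where

    private
      mk : ∀ {a b} → D a u ≡ true → D u b ≡ true →
           (∀ x → E u x ≡ true → x ≡ a ⊎ x ≡ b) → (∀ x → E x u ≡ true → x ≡ a ⊎ x ≡ b) → Thru S K D a u b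
      mk {a} {b} i j n₁ n₂ = record { arcᵢ = i ; arcₒ = j ; onlyᵢ = oi ; onlyₒ = oo ; to = to ; from = from }
        where
        oi : ∀ x → D x u ≡ true → x ≡ a
        oi x d with n₂ x (Or.edge o _ _ d)
        ... | inj₁ q = q
        ... | inj₂ refl = ⊥-elim (Or.anti o _ _ d j)
        oo : ∀ x → D u x ≡ true → x ≡ b
        oo x d with n₁ x (Or.edge o _ _ d)
        ... | inj₂ q = q
        ... | inj₁ refl = ⊥-elim (Or.anti o _ _ d i)
        to : ∀ {h} → S h ≡ true → h ≢ u → Walk D K h a
        to sh q with lastStep (aw sh su) q
        ... | x , p , d = subst (Walk D K _) (oi x d) p
        from : ∀ {h} → S h ≡ true → h ≢ u → Walk D K b h
        from {h} sh q with aw su sh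
        ... | here = ⊥-elim (q refl)
        ... | step {w = x} d p = subst (λ z → Walk D K z h) (oo x d) p

    -- Both a walk from u to a and one from a to u exist, so u has an arc out and an arc in. With
    -- only two neighbours these are its only arcs, and cutting the forced last or first arc off a
    -- walk saves one step.
    thru : Thru S K D a u b ⊎ Thru S K D b u a
    thru with aw su sa | lastStep (aw sa su) (≢-sym u≢a)
    ... | here | _ = ⊥-elim (u≢a refl)
    ... | step {w = x} d _ | y , _ , d' with nbr x (Or.edge o _ _ d) | nbr' y (Or.edge o _ _ d')
    ...   | inj₂ refl | inj₁ refl = inj₁ (mk d' d nbr nbr')
    ...   | inj₁ refl | inj₂ refl = inj₂ (mk d' d (λ x e → swap⊎ (nbr x e)) (λ x e → swap⊎ (nbr' x e)))
      where
      swap⊎ : ∀ {A B : Set} → A ⊎ B → B ⊎ A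
      swap⊎ (inj₁ x) = inj₂ x
      swap⊎ (inj₂ x) = inj₁ x
    ...   | inj₁ refl | inj₁ refl = ⊥-elim (Or.anti o _ _ d d')
    ...   | inj₂ refl | inj₂ refl = ⊥-elim (Or.anti o _ _ d d')

  record Start (E : Graph n) (S S' : Fin n → Bool) (K : ℕ) (D : Graph n) : Set where
    field
      oriented : Or E S D
      fresh : ∀ w → S' w ≡ false → Fresh D w
      walks : All-walks S' K D

  start : ∀ {E E' : Graph n} {S S' K D} → (∀ u v → E' u v ≡ true → E u v ≡ true) → (∀ u → S' u ≡ true → S u ≡ true) →
          Or E' S' D → All-walks S' K D → Start E S S' K D
  start i j o aw = record
    { oriented = or (λ u v d → i u v (Or.edge o u v d)) (Or.anti o) (λ u v d → j u (Or.inˡ o u v d)) (λ u v d → j v (Or.inʳ o u v d))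
    ; fresh = λ w s u → (λ d → clash (Or.inʳ o _ _ d) s) , (λ d → clash (Or.inˡ o _ _ d) s)
    ; walks = aw }

  or-rev : ∀ {E : Graph n} {S D} → (∀ u v → E u v ≡ E v u) → Or E S D → Or E S (rev D)
  or-rev s o = or (λ u v d → trans (s u v) (Or.edge o v u d)) (λ u v d d' → Or.anti o v u d d') (λ u v d → Or.inʳ o v u d) (λ u v d → Or.inˡ o v u d)

  start-rev : ∀ {E : Graph n} {S S' K D} → (∀ u v → E u v ≡ E v u) → Start E S S' K D → Start E S S' K (rev D)
  start-rev s st = record
    { oriented = or-rev s oriented ; fresh = λ w q u → proj₂ (fresh w q u) , proj₁ (fresh w q u)
    ; walks = λ p q → revW (walks q p) }
    where open Start st

  gone : ∀ {S : Fin n → Bool} {w} → (S - w) w ≡ false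
  gone {S} {w} = ≢true λ p → -≢ {S = S} p refl

  gone₂ : ∀ {S : Fin n → Bool} {w v} → (S - w - v) w ≡ false
  gone₂ {S} {w} {v} = ≢true λ p → -≢ {S = S} (-⊆ {S = S - w} {v} p) refl

  ear-only-out : ∀ {x w y} {D : Graph n} {u} → Fresh D w → x ≢ w → ear x w y D w u ≡ true → u ≡ y
  ear-only-out {x} {w} {y} {D} {u} f ne p with ins-inv x w (ins w y D) w u p
  ... | inj₁ (q , _) = ⊥-elim (ne (sym q))
  ... | inj₂ (q , _) with ins-inv w y D w u q
  ...   | inj₁ (_ , r) = r
  ...   | inj₂ (r , _) = ⊥-elim (proj₂ (f u) r)

-- Adding one or two vertices to an orientation.

module Extend {n : ℕ} (E : Graph n) (irr : ∀ u → E u u ≡ false) (E-sym : ∀ u v → E u v ≡ E v u)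
              (S : Fin n → Bool) where

  flip : ∀ {u v} → E u v ≡ true → E v u ≡ true
  flip {u} {v} e = trans (E-sym v u) e

  module Add₂ {v w : Fin n} (sv : S v ≡ true) (sw : S w ≡ true) (v≢w : v ≢ w) where

    S' : Fin n → Bool
    S' = S - w - v

    S'⊆ : ∀ {u} → S' u ≡ true → S u ≡ true
    S'⊆ p = -⊆ {S = S} (-⊆ {S = S - w} p)

    ≢w : ∀ {u} → S' u ≡ true → u ≢ w
    ≢w p = -≢ {S = S} (-⊆ {S = S - w} p)

    ≢v : ∀ {u} → S' u ≡ true → u ≢ v
    ≢v p = -≢ {S = S - w} p

    finish : ∀ {K D} → Or E S D →
      (∀ {h h'} → S' h ≡ true → S' h' ≡ true → Walk D K h h') →
      (∀ {h} → S' h ≡ true → Walk D K h v) → (∀ {h} → S' h ≡ true → Walk D K v h) →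
      (∀ {h} → S' h ≡ true → Walk D K h w) → (∀ {h} → S' h ≡ true → Walk D K w h) →
      Walk D K v w → Walk D K w v → Good E S K
    finish {K} {D} o hh hv vh hw wh vw wv = D , o , all
      where
      S'-intro : ∀ {u} → S u ≡ true → u ≢ w → u ≢ v → S' u ≡ true
      S'-intro p q r = -intro {S = S - w} (-intro {S = S} p q) r
      all : All-walks S K D
      all {a} {b} sa sb with a ≟ v | a ≟ w | b ≟ v | b ≟ w
      ... | yes refl | _ | yes refl | _ = here
      ... | yes refl | _ | no _ | yes refl = vw
      ... | yes refl | _ | no q | no r = vh (S'-intro sb r q)
      ... | no _ | yes refl | yes refl | _ = wv
      ... | no _ | yes refl | no _ | yes refl = here
      ... | no _ | yes refl | no q | no r = wh (S'-intro sb r q)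
      ... | no p | no p' | yes refl | _ = hv (S'-intro sa p' p)
      ... | no p | no p' | no _ | yes refl = hw (S'-intro sa p' p)
      ... | no p | no p' | no q | no r = hh (S'-intro sa p' p) (S'-intro sb r q)

  module _ {w : Fin n} (sw : S w ≡ true) where

    add-one : ∀ {K D x y} → Start E S (S - w) K D → E w x ≡ true → E w y ≡ true → x ≢ y →
      (S - w) x ≡ true → (S - w) y ≡ true → Good E S (suc K)
    add-one {K} {D} {x} {y} st ex ey ne sx sy = D' , or' , all
      where
      open Start st
      x≢w = -≢ {S = S} sx
      y≢w = -≢ {S = S} sy
      fw = fresh w (gone {S = S})
      D' = ear x w y D
      or' = ear-or irr oriented (flip ex) ey (-⊆ {S = S} sx) sw (-⊆ {S = S} sy)
      up : D ⊑ D'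
      up = ear-⊑ fw ne (≢-sym x≢w) (≢-sym y≢w)
      all : All-walks S (suc K) D'
      all {a} {b} sa sb with a ≟ w | b ≟ w
      ... | yes refl | yes refl = here
      ... | yes refl | no q = step (ear-out ne) (mapW up (walks sy (-intro {S = S} sb q)))
      ... | no p | yes refl = mapW up (walks (-intro {S = S} sa p) sx) ▷ ear-in
      ... | no p | no q = weaken₁ (mapW up (walks (-intro {S = S} sa p) (-intro {S = S} sb q)))

  module Two {v w : Fin n} (sv : S v ≡ true) (sw : S w ≡ true) (v≢w : v ≢ w) where
    open Add₂ sv sw v≢w

    private
      fv : ∀ {K D} → Start E S S' K D → Fresh D v
      fv st = Start.fresh st v (gone {S = S - w})
      fw : ∀ {K D} → Start E S S' K D → Fresh D w
      fw st = Start.fresh st w (gone₂ {S = S})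

    -- With ears x → v → y and x' → w → y' all distances grow by at most one, except those between v
    -- and w, which may grow by two. Only two walks remain to be supplied to `done`; most of the
    -- lemmas below differ in where these come from.
    module Ears {K D} (st : Start E S S' K D) {x y x' y'}
      (exv : E x v ≡ true) (evy : E v y ≡ true) (exw : E x' w ≡ true) (ewy : E w y' ≡ true)
      (x≢y : x ≢ y) (x'≢y' : x' ≢ y')
      (sx : S' x ≡ true) (sy : S' y ≡ true) (sx' : S' x' ≡ true) (sy' : S' y' ≡ true) where

      D₁ = ear x v y D
      D₂ = ear x' w y' D₁

      fw₁ : Fresh D₁ w
      fw₁ = ear-fresh (fw st) (≢-sym (≢w sx)) (≢-sym v≢w) (≢-sym (≢w sy))
      up₁ : D ⊑ D₁
      up₁ = ear-⊑ (fv st) x≢y (≢-sym (≢v sx)) (≢-sym (≢v sy))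
      up₂ : D₁ ⊑ D₂
      up₂ = ear-⊑ fw₁ x'≢y' (≢-sym (≢w sx')) (≢-sym (≢w sy'))
      up : D ⊑ D₂
      up a b d = up₂ a b (up₁ a b d)
      o₂ : Or E S D₂
      o₂ = ear-or irr (ear-or irr (Start.oriented st) exv evy (S'⊆ sx) sv (S'⊆ sy)) exw ewy (S'⊆ sx') sw (S'⊆ sy')
      xv : D₂ x v ≡ true
      xv = up₂ _ _ ear-in
      vy : D₂ v y ≡ true
      vy = up₂ _ _ (ear-out x≢y)
      xw : D₂ x' w ≡ true
      xw = ear-in
      wy : D₂ w y' ≡ true
      wy = ear-out x'≢y'
      lift : ∀ {k a b} → Walk D k a b → Walk D₂ k a b
      lift = mapW up
      W : ∀ {h h'} → S' h ≡ true → S' h' ≡ true → Walk D₂ K h h'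
      W p q = lift (Start.walks st p q)

      done : Walk D₂ (suc K) v w → Walk D₂ (suc K) w v → Good E S (suc K)
      done = finish o₂ (λ p q → weaken₁ (W p q)) (λ p → W p sx ▷ xv) (λ p → step vy (W sy p)) (λ p → W p sx' ▷ xw) (λ p → step wy (W sy' p))

    module _ {j D} (st : Start E S S' (3 + j) D) where

      -- The triangle is directed v → w → x → v, which leaves v and w at most two steps apart.
      add-B : ∀ {x y z} → E v w ≡ true → E v x ≡ true → E w x ≡ true → E v y ≡ true → E w z ≡ true → x ≢ y → x ≢ z →
              S' x ≡ true → S' y ≡ true → S' z ≡ true → Good E S (4 + j)
      add-B {x} {y} {z} vw vx wx vy wz x≢y x≢z sx sy sz =
        finish (ins-or irr o₂ vw sv sw) (λ p q → weaken₁ (mapW up₃ (W p q))) (λ p → mapW up₃ (W p sx ▷ xv)) (λ p → mapW up₃ (step vy' (W sy p)))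
          (λ p → mapW up₃ (W p sz ▷ xw)) (λ p → mapW up₃ (step wy' (W sx p)))
          (step (ins-new v w D₂) here) (mapW up₃ (step wy' (step xv here)))
        where
        open Ears st (flip vx) vy (flip wz) wx x≢y (≢-sym x≢z) sx sy sz sx renaming (vy to vy'; wy to wy')
        up₃ : D₂ ⊑ ins v w D₂
        up₃ = ins-⊑ λ e → ≢v sx (sym (ear-only-out {D = D₁} fw₁ (≢w sz) e))

      -- Both ears start at e. Every vertex but u reaches e in 2 + j steps, because e precedes u. So
      -- v → x ⋯ e → w has at most 4 + j arcs, and the same holds in the other direction.
      add-111 : ∀ {e u x y z} → Thru S' (2 + j) D e u z → S' e ≡ true → S' x ≡ true → S' y ≡ true → x ≢ u → y ≢ u →
                E v e ≡ true → E v x ≡ true → E w e ≡ true → E w y ≡ true → e ≢ x → e ≢ y → Good E S (4 + j)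
      add-111 {e} t se sx sy xu yu ve vx we wy e≢x e≢y =
        done (step vy' (lift (Thru.to t sx xu) ▷ xw)) (step wy' (lift (Thru.to t sy yu) ▷ xv))
        where open Ears st (flip ve) vx (flip we) wy e≢x e≢y se sx se sy renaming (vy to vy'; wy to wy')

      -- One direction is v → c → w. The other is w → y ⋯ x → v, where x is reached in 2 + j steps
      -- since it precedes c.
      add-G : ∀ {x c e y} → Thru S' (2 + j) D x c e → S' x ≡ true → S' c ≡ true → S' y ≡ true → x ≢ c → y ≢ c →
              E v x ≡ true → E v c ≡ true → E w c ≡ true → E w y ≡ true → Good E S (4 + j)
      add-G t sx sc sy x≢c y≢c vx vc wc wy =
        done (step vy' (step xw here)) (step wy' (lift (Thru.to t sy y≢c) ▷ xv))
        where open Ears st (flip vx) vc (flip wc) wy x≢c (≢-sym y≢c) sx sc sc sy renaming (vy to vy'; wy to wy')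

      -- The added arc c → u gives v → c → u → w. It reverses nothing, as u is left only towards y
      -- and c is not y. The return is w → y ⋯ x → v, where y reaches x in 2 + j steps since it
      -- follows u.
      add-12a : ∀ {s u y c x} → Thru S' (2 + j) D s u y → S' u ≡ true → S' y ≡ true → S' c ≡ true → S' x ≡ true →
                u ≢ y → x ≢ u → x ≢ c → c ≢ y → E c u ≡ true →
                E w u ≡ true → E w y ≡ true → E v c ≡ true → E v x ≡ true → Good E S (4 + j)
      add-12a {s} {u} {y} {c} {x} t su sy sc sx u≢y x≢u x≢c c≢y ecu wu wy vc vx =
        done (step vy' (step (up _ _ (ins-new c u D)) (step xw here)))
             (step wy' (lift (mapW up₀ (Thru.from t sx x≢u)) ▷ xv))
        where
        up₀ : D ⊑ ins c u D
        up₀ = ins-⊑ λ d → c≢y (Thru.onlyₒ t c d)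
        st' : Start E S S' (3 + j) (ins c u D)
        st' = record
          { oriented = ins-or irr (Start.oriented st) ecu (S'⊆ sc) (S'⊆ su)
          ; fresh = λ a q → ins-fresh (Start.fresh st a q) (λ { refl → clash sc q }) (λ { refl → clash su q })
          ; walks = λ p q → mapW up₀ (Start.walks st p q) }
        open Ears st' (flip vx) vc (flip wu) wy x≢c u≢y sx sc su sy renaming (vy to vy'; wy to wy')

      -- This is the previous situation with c in the role of y. The ear at v is directed according
      -- to whether x → c is already an arc; the supplied walks stay among v, w, c, u, x and have at
      -- most four arcs.
      add-12b : ∀ {c u s x} → Thru S' (2 + j) D c u s → S' u ≡ true → S' c ≡ true → S' x ≡ true →
                u ≢ c → x ≢ c → E c x ≡ true →
                E w u ≡ true → E w c ≡ true → E v c ≡ true → E v x ≡ true → Good E S (4 + j)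
      add-12b {c} {u} {s} {x} t su sc sx u≢c x≢c cx wu wc vc vx with split (D x c)
      ... | inj₁ d = done (step vy' (step (up _ _ d) (step (up _ _ (Thru.arcᵢ t)) (step xw here)))) (step wy' (step xv here))
        where open Ears st (flip vc) vx (flip wu) wc (≢-sym x≢c) u≢c sc sx su sc renaming (vy to vy'; wy to wy')
      ... | inj₂ d = done (step vy' (step (up _ _ (up₀ _ _ (Thru.arcᵢ t))) (step xw here))) (step wy' (step (up _ _ (ins-new c x D)) (step xv here)))
        where
        up₀ : D ⊑ ins c x D
        up₀ = ins-⊑ λ e → clash e d
        st' : Start E S S' (3 + j) (ins c x D)
        st' = record
          { oriented = ins-or irr (Start.oriented st) cx (S'⊆ sc) (S'⊆ sx)
          ; fresh = λ a q → ins-fresh (Start.fresh st a q) (λ { refl → clash sc q }) (λ { refl → clash sx q })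
          ; walks = λ p q → mapW up₀ (Start.walks st p q) }
        open Ears st' (flip vx) vc (flip wu) wc x≢c u≢c sx sc su sc renaming (vy to vy'; wy to wy')

      -- The walk v → y₁ ⋯ u₂ → w saves a step because y₁ follows u₁, and the walk w → y₂ ⋯ u₁ → v
      -- because y₂ follows u₂.
      add-22-same : ∀ {s₁ u₁ y₁ s₂ u₂ y₂} → Thru S' (2 + j) D s₁ u₁ y₁ → Thru S' (2 + j) D s₂ u₂ y₂ →
        S' u₁ ≡ true → S' y₁ ≡ true → S' u₂ ≡ true → S' y₂ ≡ true → u₁ ≢ y₁ → u₂ ≢ y₂ → u₁ ≢ u₂ →
        E v u₁ ≡ true → E v y₁ ≡ true → E w u₂ ≡ true → E w y₂ ≡ true → Good E S (4 + j)
      add-22-same t₁ t₂ su₁ sy₁ su₂ sy₂ n₁ n₂ n₃ vu vy wu wy =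
        done (step vy' (lift (Thru.from t₁ su₂ (≢-sym n₃)) ▷ xw)) (step wy' (lift (Thru.from t₂ su₁ n₃) ▷ xv))
        where open Ears st (flip vu) vy (flip wu) wy n₁ n₂ su₁ sy₁ su₂ sy₂ renaming (vy to vy'; wy to wy')

      -- Since u₁ and u₂ are passed in opposite senses, only v → y₁ ⋯ y₂ → w saves a step. The way
      -- back is w → u₂ → c → u₁ → v, over two arcs added at the common neighbour c.
      add-22-mixed : ∀ {s₁ u₁ y₁ s₂ u₂ y₂ c} → Thru S' (2 + j) D s₁ u₁ y₁ → Thru S' (2 + j) D y₂ u₂ s₂ →
        S' u₁ ≡ true → S' y₁ ≡ true → S' u₂ ≡ true → S' y₂ ≡ true → S' c ≡ true →
        u₁ ≢ y₁ → u₂ ≢ y₂ → u₁ ≢ u₂ → y₂ ≢ u₁ → c ≢ y₁ → c ≢ y₂ → E c u₁ ≡ true → E u₂ c ≡ true →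
        E v u₁ ≡ true → E v y₁ ≡ true → E w u₂ ≡ true → E w y₂ ≡ true → Good E S (4 + j)
      add-22-mixed {s₁} {u₁} {y₁} {s₂} {u₂} {y₂} {c} t₁ t₂ su₁ sy₁ su₂ sy₂ sc n₁ n₂ n₃ n₄ n₅ n₆ cu₁ u₂c vu vy wu wy =
        done (step vy' (lift (mapW up₀ (Thru.from t₁ sy₂ n₄)) ▷ xw))
             (step wy' (step (up _ _ (up₀₂ _ _ (ins-new u₂ c D))) (step (up _ _ (ins-new c u₁ D₀)) (step xv here))))
        where
        D₀ = ins u₂ c D
        up₀₁ : D ⊑ D₀
        up₀₁ = ins-⊑ λ d → n₆ (Thru.onlyᵢ t₂ c d)
        back : ¬ (D₀ u₁ c ≡ true)
        back p with ins-inv u₂ c D u₁ c p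
        ... | inj₁ (q , _) = n₃ q
        ... | inj₂ (q , _) = n₅ (Thru.onlyₒ t₁ c q)
        up₀₂ : D₀ ⊑ ins c u₁ D₀
        up₀₂ = ins-⊑ back
        up₀ : D ⊑ ins c u₁ D₀
        up₀ a b d = up₀₂ a b (up₀₁ a b d)
        st' : Start E S S' (3 + j) (ins c u₁ D₀)
        st' = record
          { oriented = ins-or irr (ins-or irr (Start.oriented st) u₂c (S'⊆ su₂) (S'⊆ sc)) cu₁ (S'⊆ sc) (S'⊆ su₁)
          ; fresh = λ a q → ins-fresh (ins-fresh (Start.fresh st a q) (λ { refl → clash su₂ q }) (λ { refl → clash sc q }))
                              (λ { refl → clash sc q }) (λ { refl → clash su₁ q })
          ; walks = λ p q → mapW up₀ (Start.walks st p q) }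
        open Ears st' (flip vu) vy (flip wy) wu n₁ (≢-sym n₂) su₁ sy₁ sy₂ su₂ renaming (vy to vy'; wy to wy')

      -- Here c is the common neighbour of all four vertices v, u₁, w, u₂. The supplied walks pass
      -- through c and have at most four arcs, whichever way u₂ is passed.
      add-22-hub : ∀ {c u₁ s₁ u₂ s₂} → Thru S' (2 + j) D c u₁ s₁ → Thru S' (2 + j) D c u₂ s₂ ⊎ Thru S' (2 + j) D s₂ u₂ c →
        S' u₁ ≡ true → S' u₂ ≡ true → S' c ≡ true → u₁ ≢ c → u₂ ≢ c →
        E v u₁ ≡ true → E v c ≡ true → E w u₂ ≡ true → E w c ≡ true → Good E S (4 + j)
      add-22-hub t₁ (inj₁ t₂) su₁ su₂ sc n₁ n₂ vu vc wu wc =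
        done (step vy' (step (up _ _ (Thru.arcᵢ t₂)) (step xw here))) (step wy' (step (up _ _ (Thru.arcᵢ t₁)) (step xv here)))
        where open Ears st (flip vu) vc (flip wu) wc n₁ n₂ su₁ sc su₂ sc renaming (vy to vy'; wy to wy')
      add-22-hub t₁ (inj₂ t₂) su₁ su₂ sc n₁ n₂ vu vc wu wc =
        done (step vy' (step xw here)) (step wy' (step (up _ _ (Thru.arcₒ t₂)) (step (up _ _ (Thru.arcᵢ t₁)) (step xv here))))
        where open Ears st (flip vu) vc (flip wc) wu n₁ (≢-sym n₂) su₁ sc sc su₂ renaming (vy to vy'; wy to wy')

      -- The vertex w is entered through v, so v itself must be reached in 3 + j steps. The arc a →
      -- v achieves this from every vertex but u, as a precedes u, and u gets an arc to v of its
      -- own.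
      add-F₁ : ∀ {a u b y} → Thru S' (2 + j) D a u b → S' a ≡ true → S' u ≡ true → S' y ≡ true →
        a ≢ y → u ≢ y → E v a ≡ true → E v u ≡ true → E v y ≡ true → E w v ≡ true → E w y ≡ true → Good E S (4 + j)
      add-F₁ {a} {u} {b} {y} t sa su sy a≢y u≢y va vu vy wv wy =
        finish o₃ (λ p q → weaken₁ (W p q)) (λ p → weaken₁ (hv p)) (λ p → step v→y (W sy p)) (λ p → hv p ▷ ear-in) (λ p → step w→y (W sy p))
          (step ear-in here) (step w→y (mapW up (Thru.to t sy (≢-sym u≢y)) ▷ a→v))
        where
        D₁ = ear a v y D
        D₂ = ins u v D₁
        D₃ = ear v w y D₂
        fw₂ : Fresh D₂ w
        fw₂ = ins-fresh (ear-fresh (fw st) (≢-sym (≢w sa)) (≢-sym v≢w) (≢-sym (≢w sy))) (≢-sym (≢w su)) (≢-sym v≢w)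
        up₁ : D ⊑ D₁
        up₁ = ear-⊑ (fv st) a≢y (≢-sym (≢v sa)) (≢-sym (≢v sy))
        up₂ : D₁ ⊑ D₂
        up₂ = ins-⊑ λ e → u≢y (ear-only-out {D = D} (fv st) (≢v sa) e)
        up₃ : D₂ ⊑ D₃
        up₃ = ear-⊑ fw₂ (≢-sym (≢v sy)) (≢-sym v≢w) (≢-sym (≢w sy))
        up : D ⊑ D₃
        up p q d = up₃ _ _ (up₂ _ _ (up₁ _ _ d))
        o₃ : Or E S D₃
        o₃ = ear-or irr (ins-or irr (ear-or irr (Start.oriented st) (flip va) vy (S'⊆ sa) sv (S'⊆ sy)) (flip vu) (S'⊆ su) sv)
               (flip wv) wy sv sw (S'⊆ sy)
        W : ∀ {h h'} → S' h ≡ true → S' h' ≡ true → Walk D₃ (3 + j) h h'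
        W p q = mapW up (Start.walks st p q)
        a→v : D₃ a v ≡ true
        a→v = up₃ _ _ (up₂ _ _ ear-in)
        v→y : D₃ v y ≡ true
        v→y = up₃ _ _ (up₂ _ _ (ear-out a≢y))
        w→y : D₃ w y ≡ true
        w→y = ear-out (≢-sym (≢v sy))
        hv : ∀ {h} → S' h ≡ true → Walk D₃ (3 + j) h v
        hv {h} p with h ≟ u
        ... | yes refl = step (up₃ _ _ (ins-new u v D₁)) here
        ... | no q = mapW up (Thru.to t p q) ▷ a→v

      -- A walk stays a walk after reversing the arc a → u up to the first visit of a, and after the last visit of u.
      private
        cut : ∀ {a u k h h'} → Walk D k h h' → Walk (ins u a D) k h h' ⊎
              (Σ ℕ λ p → Σ ℕ λ q → suc (p + q) ≤ k × Walk (ins u a D) p h a × Walk (ins u a D) q u h')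
        cut here = inj₁ here
        cut {a} {u} {suc k} {h} (step {w = x} e p) with h ≟ a | x ≟ u | cut {a} {u} p
        ... | yes refl | yes refl | inj₁ r = inj₂ (0 , k , ≤-refl , here , r)
        ... | yes refl | yes refl | inj₂ (i , l , le , _ , r) = inj₂ (0 , l , s≤s (≤-trans (m≤n+m l (suc i)) le) , here , r)
        ... | no q | _ | inj₁ r = inj₁ (step (ins-old u a D h x (λ { (z , _) → q z }) e) r)
        ... | no q | _ | inj₂ (i , l , le , s , r) = inj₂ (suc i , l , s≤s le , step (ins-old u a D h x (λ { (z , _) → q z }) e) s , r)
        ... | yes _ | no q | inj₁ r = inj₁ (step (ins-old u a D h x (λ { (_ , z) → q z }) e) r)
        ... | yes _ | no q | inj₂ (i , l , le , s , r) = inj₂ (suc i , l , s≤s le , step (ins-old u a D h x (λ { (_ , z) → q z }) e) s , r)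

        cut-to : ∀ {a u k h} → Walk D k h a → Walk (ins u a D) k h a
        cut-to {a} {u} p with cut {a} {u} p
        ... | inj₁ r = r
        ... | inj₂ (i , l , le , s , _) = weaken (≤-trans (m≤m+n i l) (≤-trans (n≤1+n _) le)) s

        cut-from : ∀ {a u k h} → Walk D k u h → Walk (ins u a D) k u h
        cut-from {a} {u} p with cut {a} {u} p
        ... | inj₁ r = r
        ... | inj₂ (i , l , le , _ , r) = weaken (≤-trans (m≤n+m l (suc i)) le) r

      -- The arc a → u is reversed and replaced by the path a → v → u, which lengthens a walk by
      -- one. Now u reaches v along u → a → v, so v is near enough for w to be put on v → w → u.
      add-F₂ : ∀ {a u b} → Thru S' (2 + j) D a u b → S' a ≡ true → S' u ≡ true → a ≢ u → E u a ≡ true →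
        E v a ≡ true → E v u ≡ true → E w v ≡ true → E w u ≡ true → Good E S (4 + j)
      add-F₂ {a} {u} {b} t sa su a≢u ua va vu wv wu =
        finish o₃ hh (λ p → weaken₁ (hv p)) (λ p → step v→u (uh p)) (λ p → hv p ▷ ear-in) (λ p → step w→u (uh p))
          (step ear-in here) (step w→u (step u→a (step a→v here)))
        where
        D₁ = ins u a D
        D₂ = ear a v u D₁
        D₃ = ear v w u D₂
        fv₁ : Fresh D₁ v
        fv₁ = ins-fresh (fv st) (≢-sym (≢v su)) (≢-sym (≢v sa))
        fw₂ : Fresh D₂ w
        fw₂ = ear-fresh (ins-fresh (fw st) (≢-sym (≢w su)) (≢-sym (≢w sa))) (≢-sym (≢w sa)) (≢-sym v≢w) (≢-sym (≢w su))
        up₂ : D₁ ⊑ D₂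
        up₂ = ear-⊑ fv₁ a≢u (≢-sym (≢v sa)) (≢-sym (≢v su))
        up₃ : D₂ ⊑ D₃
        up₃ = ear-⊑ fw₂ (≢-sym (≢v su)) (≢-sym v≢w) (≢-sym (≢w su))
        up : D₁ ⊑ D₃
        up p q d = up₃ _ _ (up₂ _ _ d)
        o₃ : Or E S D₃
        o₃ = ear-or irr (ear-or irr (ins-or irr (Start.oriented st) ua (S'⊆ su) (S'⊆ sa)) (flip va) vu (S'⊆ sa) sv (S'⊆ su))
               (flip wv) wu sv sw (S'⊆ su)
        u→a : D₃ u a ≡ true
        u→a = up _ _ (ins-new u a D)
        a→v : D₃ a v ≡ true
        a→v = up₃ _ _ ear-in
        v→u : D₃ v u ≡ true
        v→u = up₃ _ _ (ear-out a≢u)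
        w→u : D₃ w u ≡ true
        w→u = ear-out (≢-sym (≢v su))
        hh : ∀ {h h'} → S' h ≡ true → S' h' ≡ true → Walk D₃ (4 + j) h h'
        hh {h} {h'} p q with cut {a} {u} (Start.walks st p q)
        ... | inj₁ r = weaken₁ (mapW up r)
        ... | inj₂ (i , l , le , x , y) = weaken (s≤s le) (subst (λ k → Walk D₃ k h h') (trans (+-suc i (suc l)) (cong suc (+-suc i l)))
                                            (mapW up x ⋯ step a→v (step v→u (mapW up y))))
        hv : ∀ {h} → S' h ≡ true → Walk D₃ (3 + j) h v
        hv {h} p with h ≟ u
        ... | yes refl = step u→a (step a→v here)
        ... | no q = mapW up (cut-to (Thru.to t p q)) ▷ a→v
        uh : ∀ {h} → S' h ≡ true → Walk D₃ (3 + j) u h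
        uh p = mapW up (cut-from (Start.walks st su p))

      -- If b → a is an arc, then u reaches v along u → b → a → v and nothing has to be reversed.
      -- Otherwise a → u is reversed and the new arc a → b takes over from a → u → b; only walks
      -- that end at u are affected, and they arrive through v.
      add-F₃ : ∀ {a u b} → Thru S' (2 + j) D a u b → S' a ≡ true → S' u ≡ true → S' b ≡ true → a ≢ u → a ≢ b → u ≢ b →
        E u a ≡ true → E a b ≡ true →
        E v a ≡ true → E v u ≡ true → E w v ≡ true → E w a ≡ true → Good E S (4 + j)
      add-F₃ {a} {u} {b} t sa su sb a≢u a≢b u≢b ua ab va vu wv wa with split (D b a)
      ... | inj₁ ba =
        finish o₂' (λ p q → weaken₁ (W p q)) (λ p → weaken₁ (hv p)) (λ p → step v→u (W su p)) (λ p → hv p ▷ ear-in) (λ p → step w→a (W sa p))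
          (step ear-in here) (step w→a (step a→v here))
        where
        D₁ = ear a v u D
        D₂ = ear v w a D₁
        fw₁ : Fresh D₁ w
        fw₁ = ear-fresh (fw st) (≢-sym (≢w sa)) (≢-sym v≢w) (≢-sym (≢w su))
        up₁ : D ⊑ D₁
        up₁ = ear-⊑ (fv st) a≢u (≢-sym (≢v sa)) (≢-sym (≢v su))
        up₂ : D₁ ⊑ D₂
        up₂ = ear-⊑ fw₁ (≢-sym (≢v sa)) (≢-sym v≢w) (≢-sym (≢w sa))
        up : D ⊑ D₂
        up p q d = up₂ _ _ (up₁ _ _ d)
        o₂' : Or E S D₂
        o₂' = ear-or irr (ear-or irr (Start.oriented st) (flip va) vu (S'⊆ sa) sv (S'⊆ su)) (flip wv) wa sv sw (S'⊆ sa)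
        W : ∀ {h h'} → S' h ≡ true → S' h' ≡ true → Walk D₂ (3 + j) h h'
        W p q = mapW up (Start.walks st p q)
        a→v : D₂ a v ≡ true
        a→v = up₂ _ _ ear-in
        v→u : D₂ v u ≡ true
        v→u = up₂ _ _ (ear-out a≢u)
        w→a : D₂ w a ≡ true
        w→a = ear-out (≢-sym (≢v sa))
        hv : ∀ {h} → S' h ≡ true → Walk D₂ (3 + j) h v
        hv {h} p with h ≟ u
        ... | yes refl = step (up _ _ (Thru.arcₒ t)) (step (up _ _ ba) (step a→v here))
        ... | no q = mapW up (Thru.to t p q) ▷ a→v
      ... | inj₂ ¬ba =
        finish o₃ hh (λ p → weaken₁ (hv p)) (λ p → vh p) (λ p → hv p ▷ ear-in) wh
          (step ear-in here) (step w→a (step a→v here))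
        where
        D₀ = ins a b D
        D₁ = ins u a D₀
        D₂ = ear a v u D₁
        D₃ = ear v w a D₂
        fv₁ : Fresh D₁ v
        fv₁ = ins-fresh (ins-fresh (fv st) (≢-sym (≢v sa)) (≢-sym (≢v sb))) (≢-sym (≢v su)) (≢-sym (≢v sa))
        fw₁ : Fresh D₁ w
        fw₁ = ins-fresh (ins-fresh (fw st) (≢-sym (≢w sa)) (≢-sym (≢w sb))) (≢-sym (≢w su)) (≢-sym (≢w sa))
        fw₂ : Fresh D₂ w
        fw₂ = ear-fresh fw₁ (≢-sym (≢w sa)) (≢-sym v≢w) (≢-sym (≢w su))
        up₂ : D₁ ⊑ D₂
        up₂ = ear-⊑ fv₁ a≢u (≢-sym (≢v sa)) (≢-sym (≢v su))
        up₃ : D₂ ⊑ D₃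
        up₃ = ear-⊑ fw₂ (≢-sym (≢v sa)) (≢-sym v≢w) (≢-sym (≢w sa))
        up : D₁ ⊑ D₃
        up p q d = up₃ _ _ (up₂ _ _ d)
        o₃ : Or E S D₃
        o₃ = ear-or irr (ear-or irr (ins-or irr (ins-or irr (Start.oriented st) ab (S'⊆ sa) (S'⊆ sb)) ua (S'⊆ su) (S'⊆ sa))
               (flip va) vu (S'⊆ sa) sv (S'⊆ su)) (flip wv) wa sv sw (S'⊆ sa)
        u→a : D₃ u a ≡ true
        u→a = up _ _ (ins-new u a D₀)
        a→b : D₁ a b ≡ true
        a→b = ins-old u a D₀ a b (λ { (_ , z) → u≢b (sym z) }) (ins-new a b D)
        a→v : D₃ a v ≡ true
        a→v = up₃ _ _ ear-in
        v→u : D₃ v u ≡ true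
        v→u = up₃ _ _ (ear-out a≢u)
        w→a : D₃ w a ≡ true
        w→a = ear-out (≢-sym (≢v sa))
        keep : ∀ x y → ¬ (x ≡ a × y ≡ u) → D x y ≡ true → D₁ x y ≡ true
        keep x y ne d = ins-old u a D₀ x y ne (ins-⊑ {D = D} (λ e → clash e ¬ba) x y d)
        -- The detour a → u → b is replaced by the arc a → b.
        short : ∀ {k h h'} → h' ≢ u → Walk D k h h' → Walk D₁ k h h'
        short ne here = here
        short {h = h} ne (step {w = x} e p) with h ≟ a | x ≟ u
        ... | no q | _ = step (keep _ _ (λ { (z , _) → q z }) e) (short ne p)
        ... | yes _ | no q = step (keep _ _ (λ { (_ , z) → q z }) e) (short ne p)
        ... | yes refl | yes refl with p
        ...   | here = ⊥-elim (ne refl)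
        ...   | step {w = y} e' p' with Thru.onlyₒ t y e'
        ...     | refl = step a→b (weaken₁ (short ne p'))
        S-walk : ∀ {h h'} → S' h ≡ true → S' h' ≡ true → h' ≢ u → Walk D₃ (3 + j) h h'
        S-walk p q ne = mapW up (short ne (Start.walks st p q))
        ha : ∀ {h} → S' h ≡ true → h ≢ u → Walk D₃ (2 + j) h a
        ha p q = mapW up (short a≢u (Thru.to t p q))
        hv : ∀ {h} → S' h ≡ true → Walk D₃ (3 + j) h v
        hv {h} p with h ≟ u
        ... | yes refl = step u→a (step a→v here)
        ... | no q = ha p q ▷ a→v
        hh : ∀ {h h'} → S' h ≡ true → S' h' ≡ true → Walk D₃ (4 + j) h h'
        hh {h} {h'} p q with h' ≟ u
        ... | no ne = weaken₁ (S-walk p q ne)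
        ... | yes refl = hv p ▷ v→u
        vh : ∀ {h} → S' h ≡ true → Walk D₃ (4 + j) v h
        vh {h} p with h ≟ u
        ... | yes refl = step v→u here
        ... | no ne = step v→u (S-walk su p ne)
        wh : ∀ {h} → S' h ≡ true → Walk D₃ (4 + j) w h
        wh {h} p with h ≟ u
        ... | yes refl = step w→a (step a→v (step v→u here))
        ... | no ne = step w→a (S-walk sa p ne)

  -- Attaching any number of vertices to a core.

  -- Vertices attached to a core S' along arcs from In and into Out.
  module Near (S' : Fin n → Bool) (S'⊆S : ∀ u → S' u ≡ true → S u ≡ true) (K : ℕ) (In Out : Fin n → Set)
              (In⊆ : ∀ x → In x → S' x ≡ true) (Out⊆ : ∀ y → Out y → S' y ≡ true) where

    -- A walk spends one step on the arc leaving a new vertex and one on the arc entering a new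
    -- vertex. What remains for its part inside the core is 2 + K, 1 + K or K, according to how many
    -- of its ends are new, whatever the number of new vertices.
    record Stage (T : Fin n → Bool) : Set where
      field
        D : Graph n
        oriented : Or E S D
        fresh : ∀ u → T u ≡ false → Fresh D u
        core-core : ∀ {u v} → S' u ≡ true → S' v ≡ true → Walk D (2 + K) u v
        core-in : ∀ {u x} → S' u ≡ true → In x → Walk D (1 + K) u x
        out-core : ∀ {y v} → Out y → S' v ≡ true → Walk D (1 + K) y v
        out-in : ∀ {y x} → Out y → In x → Walk D K y x
        attached : ∀ u → T u ≡ true → S' u ≡ true ⊎
                   ((Σ (Fin n) λ x → In x × D x u ≡ true) × (Σ (Fin n) λ y → Out y × D u y ≡ true))

    finish-all : Stage S → Good E S (2 + K)
    finish-all st = D , oriented , all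
      where
      open Stage st
      all : All-walks S (2 + K) D
      all {u} {v} p q with attached u p | attached v q
      ... | inj₁ a | inj₁ b = core-core a b
      ... | inj₁ a | inj₂ ((x , ix , d) , _) = core-in a ix ▷ d
      ... | inj₂ (_ , (y , oy , d)) | inj₁ b = step d (out-core oy b)
      ... | inj₂ (_ , (y , oy , d)) | inj₂ ((x , ix , d') , _) = step d (out-in oy ix ▷ d')

    grow : ∀ {T w x y} → Stage (T - w) → S w ≡ true → T w ≡ true → (∀ u → S' u ≡ true → T u ≡ true × u ≢ w) →
           In x → Out y → x ≢ y → E w x ≡ true → E w y ≡ true → Stage T
    grow {T} {w} {x} {y} st sw tw out' ix oy ne ex ey = record
      { D = ear x w y D
      ; oriented = ear-or irr oriented (flip ex) ey (S'⊆S _ (In⊆ x ix)) sw (S'⊆S _ (Out⊆ y oy))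
      ; fresh = fresh'
      ; core-core = λ p q → mapW up (core-core p q)
      ; core-in = λ p q → mapW up (core-in p q)
      ; out-core = λ p q → mapW up (out-core p q)
      ; out-in = λ p q → mapW up (out-in p q)
      ; attached = att }
      where
      open Stage st
      x∈ = out' x (In⊆ x ix)
      y∈ = out' y (Out⊆ y oy)
      fw = fresh w (gone {S = T})
      up : D ⊑ ear x w y D
      up = ear-⊑ fw ne (≢-sym (proj₂ x∈)) (≢-sym (proj₂ y∈))
      fresh' : ∀ u → T u ≡ false → Fresh (ear x w y D) u
      fresh' u p = ear-fresh (fresh u (≢true λ q → clash (-⊆ {S = T} q) p)) (λ { refl → clash (proj₁ x∈) p })
                     (λ { refl → clash tw p }) (λ { refl → clash (proj₁ y∈) p })
      att : ∀ u → T u ≡ true → S' u ≡ true ⊎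
            ((Σ (Fin n) λ a → In a × ear x w y D a u ≡ true) × (Σ (Fin n) λ b → Out b × ear x w y D u b ≡ true))
      att u p with u ≟ w
      ... | yes refl = inj₂ ((x , ix , ear-in) , (y , oy , ear-out ne))
      ... | no q with attached u (-intro {S = T} p q)
      ...   | inj₁ r = inj₁ r
      ...   | inj₂ ((a , ia , d) , (b , ob , d')) = inj₂ ((a , ia , up _ _ d) , (b , ob , up _ _ d'))

-- Sizes of vertex subsets and maxima.

size : ∀ {n} → (Fin n → Bool) → ℕ
size {zero} S = 0
size {suc n} S = (if S zero then 1 else 0) + size (λ u → S (suc u))

size-cong : ∀ {n} {S T : Fin n → Bool} → (∀ u → S u ≡ T u) → size S ≡ size T
size-cong {zero} e = refl
size-cong {suc n} e rewrite e zero = cong (_ +_) (size-cong (λ u → e (suc u)))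

size-remove : ∀ {n} (S : Fin n → Bool) {w} → S w ≡ true → size S ≡ suc (size (S - w))
size-remove {suc n} S {zero} p rewrite p | -def S zero zero | p =
  cong suc (size-cong λ u → sym (trans (-def S zero (suc u)) (Bool.∧-identityʳ (S (suc u)))))
size-remove {suc n} S {suc w} p = trans (cong ((if S zero then 1 else 0) +_) (trans (size-remove (λ u → S (suc u)) p) (cong suc (size-cong ext))))
  (trans (+-suc (if S zero then 1 else 0) _) (cong (λ b → suc ((if b then 1 else 0) + size (λ u → (S - suc w) (suc u)))) (sym (trans (-def S (suc w) zero) (Bool.∧-identityʳ (S zero))))))
  where
  ext : ∀ u → ((λ x → S (suc x)) - w) u ≡ (S - suc w) (suc u)
  ext u = trans (-def (λ x → S (suc x)) w u) (sym (trans (-def S (suc w) (suc u)) (cong (λ b → S (suc u) ∧ not b) (lem u))))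
    where
    lem : ∀ u → (suc u == suc w) ≡ (u == w)
    lem u with u ≟ w
    ... | yes _ = refl
    ... | no _ = refl

size-full : ∀ n → size {n} (λ _ → true) ≡ n
size-full zero = refl
size-full (suc n) = cong suc (size-full n)

size-inhabited : ∀ {n} (S : Fin n → Bool) {k} → size S ≡ suc k → ∃ λ w → S w ≡ true
size-inhabited {suc n} S p with split (S zero)
... | inj₁ q = zero , q
... | inj₂ q rewrite q with size-inhabited (λ u → S (suc u)) p
...   | w , r = suc w , r

size-empty : ∀ {n} (S : Fin n → Bool) → size S ≡ 0 → ∀ u → S u ≡ false
size-empty S p u = ≢true λ q → lem (trans (sym p) (size-remove S q))
  where
  lem : ∀ {k} → 0 ≡ suc k → ⊥
  lem ()

argmax : ∀ {n} (r : Fin n → ℕ) (P : Fin n → Bool) → (∃ λ w → P w ≡ true) →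
         ∃ λ w → P w ≡ true × (∀ x → P x ≡ true → r x ≤ r w)
argmax {suc n} r P (w₀ , p₀) with any? (λ u → P (suc u) Bool.≟ true) | split (P zero)
... | no q | _ = zero , p0 w₀ p₀ , λ { zero _ → ≤-refl ; (suc x) px → ⊥-elim (q (x , px)) }
  where
  p0 : ∀ w → P w ≡ true → P zero ≡ true
  p0 zero p = p
  p0 (suc w) p = ⊥-elim (q (w , p))
... | yes q | inj₂ z with argmax (λ u → r (suc u)) (λ u → P (suc u)) q
...   | w , pw , m = suc w , pw , λ { zero p → clash p z ; (suc x) p → m x p }
argmax {suc n} r P (w₀ , p₀) | yes q | inj₁ z with argmax (λ u → r (suc u)) (λ u → P (suc u)) q
...   | w , pw , m with ≤-total (r zero) (r (suc w))
...     | inj₁ le = suc w , pw , λ { zero p → le ; (suc x) p → m x p }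
...     | inj₂ ge = zero , z , λ { zero p → ≤-refl ; (suc x) p → ≤-trans (m x p) ge }

-- Computable checks of orientations of labelled graphs.

allᵇ anyᵇ : ∀ {A : Set} → (A → Bool) → List A → Bool
allᵇ p [] = true
allᵇ p (x ∷ xs) = p x ∧ allᵇ p xs
anyᵇ p [] = false
anyᵇ p (x ∷ xs) = p x ∨ anyᵇ p xs

allᵇ-∈ : ∀ {A : Set} {p : A → Bool} {xs x} → allᵇ p xs ≡ true → x ∈ xs → p x ≡ true
allᵇ-∈ {p = p} {y ∷ _} e (here refl) = proj₁ (∧-true e)
allᵇ-∈ {p = p} {y ∷ _} e (there m) = allᵇ-∈ (proj₂ (∧-true {p y} e)) m

allᵇ-intro : ∀ {A : Set} {p : A → Bool} xs → (∀ x → x ∈ xs → p x ≡ true) → allᵇ p xs ≡ true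
allᵇ-intro [] f = refl
allᵇ-intro (x ∷ xs) f = ∧-intro (f x (here refl)) (allᵇ-intro xs λ y m → f y (there m))

anyᵇ-intro : ∀ {A : Set} {p : A → Bool} {xs x} → x ∈ xs → p x ≡ true → anyᵇ p xs ≡ true
anyᵇ-intro (here refl) e = ∨-introˡ e
anyᵇ-intro {p = p} {y ∷ _} (there m) e = ∨-introʳ {p y} (anyᵇ-intro m e)

anyᵇ-elim : ∀ {A : Set} {p : A → Bool} xs → anyᵇ p xs ≡ true → ∃ λ x → x ∈ xs × p x ≡ true
anyᵇ-elim {p = p} (x ∷ xs) e with ∨-true {p x} e
... | inj₁ q = x , here refl , q
... | inj₂ q with anyᵇ-elim xs q
...   | y , m , r = y , there m , r

≡ᵇ-true : ∀ {i j} → (i ≡ᵇ j) ≡ true → i ≡ j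
≡ᵇ-true {i} {j} e = ≡ᵇ⇒≡ i j (subst Data.Bool.T (sym e) tt)

≡ᵇ-refl : ∀ i → (i ≡ᵇ i) ≡ true
≡ᵇ-refl zero = refl
≡ᵇ-refl (suc i) = ≡ᵇ-refl i

≡ᵇ-false : ∀ {i j} → i ≢ j → (i ≡ᵇ j) ≡ false
≡ᵇ-false ne = ≢true λ e → ne (≡ᵇ-true e)

Edges : Set
Edges = List (ℕ × ℕ)

arc : Edges → ℕ → ℕ → Bool
arc es i j = anyᵇ (λ e → (proj₁ e ≡ᵇ i) ∧ (proj₂ e ≡ᵇ j)) es

adj : Edges → ℕ → ℕ → Bool
adj es i j = arc es i j ∨ arc es j i

arc-∈ : ∀ es {i j} → arc es i j ≡ true → (i , j) ∈ es
arc-∈ es {i} {j} e with anyᵇ-elim es e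
... | (a , b) , m , q with ≡ᵇ-true {a} {i} (proj₁ (∧-true q)) | ≡ᵇ-true {b} {j} (proj₂ (∧-true {a ≡ᵇ i} q))
...   | refl | refl = m

∈-arc : ∀ {es i j} → (i , j) ∈ es → arc es i j ≡ true
∈-arc {es} {i} {j} m = anyᵇ-intro m (∧-intro (≡ᵇ-refl i) (≡ᵇ-refl j))

adj-∈ : ∀ es {i j} → adj es i j ≡ true → (i , j) ∈ es ⊎ (j , i) ∈ es
adj-∈ es {i} {j} e with ∨-true {arc es i j} e
... | inj₁ q = inj₁ (arc-∈ es q)
... | inj₂ q = inj₂ (arc-∈ es q)

-- The binary digits of b, lowest first, direct the edges: 1 keeps the listed direction and 0
-- reverses it.
orient : Edges → ℕ → Edges
orient [] b = []
orient ((i , j) ∷ es) b = (if (b % 2) ≡ᵇ 1 then (i , j) else (j , i)) ∷ orient es (b / 2)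

orient-∈ : ∀ es b {i j} → (i , j) ∈ orient es b → (i , j) ∈ es ⊎ (j , i) ∈ es
orient-∈ ((i , j) ∷ es) b m with (b % 2) ≡ᵇ 1
orient-∈ ((i , j) ∷ es) b (here refl) | true = inj₁ (here refl)
orient-∈ ((i , j) ∷ es) b (here refl) | false = inj₂ (here refl)
orient-∈ ((i , j) ∷ es) b (there m) | _ with orient-∈ es (b / 2) m
... | inj₁ z = inj₁ (there z)
... | inj₂ z = inj₂ (there z)

∈-orient : ∀ es b {i j} → (i , j) ∈ es → (i , j) ∈ orient es b ⊎ (j , i) ∈ orient es b
∈-orient ((i , j) ∷ es) b m with (b % 2) ≡ᵇ 1
∈-orient ((i , j) ∷ es) b (here refl) | true = inj₁ (here refl)
∈-orient ((i , j) ∷ es) b (here refl) | false = inj₂ (here refl)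
∈-orient ((i , j) ∷ es) b (there m) | _ with ∈-orient es (b / 2) m
... | inj₁ z = inj₁ (there z)
... | inj₂ z = inj₂ (there z)

at : List Bool → ℕ → Bool
at [] _ = false
at (b ∷ bs) zero = b
at (b ∷ bs) (suc i) = at bs i

at-applyUpTo : ∀ g m {i} → at (applyUpTo g m) i ≡ true → i < m × g i ≡ true
at-applyUpTo g (suc m) {zero} e = s≤s z≤n , e
at-applyUpTo g (suc m) {suc i} e with at-applyUpTo (g ∘ suc) m e
... | lt , q = s≤s lt , q

applyUpTo-at : ∀ g m {i} → i < m → at (applyUpTo g m) i ≡ g i
applyUpTo-at g (suc m) {zero} _ = refl
applyUpTo-at g (suc m) {suc i} (s≤s lt) = applyUpTo-at (g ∘ suc) m lt

nth : ∀ {A : Set} → List (List A) → ℕ → List A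
nth [] _ = []
nth (x ∷ xs) zero = x
nth (x ∷ xs) (suc i) = nth xs i

nth-applyUpTo : ∀ {A : Set} (g : ℕ → List A) m i → nth (applyUpTo g m) i ≡ [] ⊎ nth (applyUpTo g m) i ≡ g i
nth-applyUpTo g zero i = inj₁ refl
nth-applyUpTo g (suc m) zero = inj₂ refl
nth-applyUpTo g (suc m) (suc i) = nth-applyUpTo (g ∘ suc) m i

_∪_ : List Bool → List Bool → List Bool
_∪_ = zipWith _∨_

∪-at : ∀ xs ys i → at (xs ∪ ys) i ≡ true → at xs i ≡ true ⊎ at ys i ≡ true
∪-at (x ∷ xs) (y ∷ ys) zero e = ∨-true e
∪-at (x ∷ xs) (y ∷ ys) (suc i) e = ∪-at xs ys i e

-- Row i of reach m as k lists which vertices are reached from i within k steps.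
reachRow : ℕ → Edges → List (List Bool) → ℕ → List Bool
reachRow m [] t i = applyUpTo (i ≡ᵇ_) m
reachRow m ((a , b) ∷ as) t i = if a ≡ᵇ i then nth t b ∪ reachRow m as t i else reachRow m as t i

reach : ℕ → Edges → ℕ → List (List Bool)
reach m as zero = applyUpTo (λ i → applyUpTo (i ≡ᵇ_) m) m
reach m as (suc k) = applyUpTo (reachRow m as (reach m as k)) m

antisymᵇ : Edges → Bool
antisymᵇ as = allᵇ (λ a → not (arc as (proj₂ a) (proj₁ a))) as

check : ℕ → ℕ → Edges → Bool
check m k as = antisymᵇ as ∧ allᵇ (λ i → allᵇ (at (nth (reach m as k) i)) (upTo m)) (upTo m)

-- Orientation as of a core for which new vertices may be attached on all edges of σ.
check₄ : ℕ → ℕ → Edges → Edges → Bool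
check₄ m k as σ = antisymᵇ as ∧ (full (reach m as (2 + k)) ∧ (half (reach m as (1 + k)) ∧ quarter (reach m as k)))
  where
  full half quarter : List (List Bool) → Bool
  full t = allᵇ (λ i → allᵇ (at (nth t i)) (upTo m)) (upTo m)
  half t = allᵇ (λ a → allᵇ (λ h → at (nth t h) (proj₁ a) ∧ at (nth t (proj₂ a)) h) (upTo m)) σ
  quarter t = allᵇ (λ a → allᵇ (λ b → at (nth t (proj₂ a)) (proj₁ b)) σ) σ

-- Further edges of E are allowed here, because directing the listed ones already bounds the
-- distances. `Exact` excludes them, as an isomorphism with an exceptional graph requires.
record Emb {n : ℕ} (m : ℕ) (es : Edges) (E : Graph n) (S : Fin n → Bool) : Set where
  field
    f : ℕ → Fin n
    inS : ∀ {i} → i < m → S (f i) ≡ true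
    onto : ∀ {v} → S v ≡ true → ∃ λ i → i < m × f i ≡ v
    inj : ∀ {i j} → i < m → j < m → f i ≡ f j → i ≡ j
    edge : ∀ {i j} → (i , j) ∈ es → i < m × j < m × E (f i) (f j) ≡ true

record Exact {n : ℕ} (m : ℕ) (es : Edges) (E : Graph n) (S : Fin n → Bool) : Set where
  field
    f : ℕ → Fin n
    inS : ∀ {i} → i < m → S (f i) ≡ true
    onto : ∀ {v} → S v ≡ true → ∃ λ i → i < m × f i ≡ v
    inj : ∀ {i j} → i < m → j < m → f i ≡ f j → i ≡ j
    same : ∀ {i j} → i < m → j < m → E (f i) (f j) ≡ adj es i j

module Realise {n : ℕ} (E : Graph n) (irr : ∀ u → E u u ≡ false) (E-sym : ∀ u v → E u v ≡ E v u) (S : Fin n → Bool)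
               {m : ℕ} {es : Edges} (emb : Emb m es E S) (b : ℕ) where
  open Emb emb

  as : Edges
  as = orient es b

  as-edge : ∀ {i j} → (i , j) ∈ as → i < m × j < m × E (f i) (f j) ≡ true
  as-edge mem with orient-∈ es b mem
  ... | inj₁ q = edge q
  ... | inj₂ q with edge q
  ...   | x , y , e = y , x , trans (E-sym _ _) e

  D : Graph n
  D u v = anyᵇ (λ a → (f (proj₁ a) == u) ∧ (f (proj₂ a) == v)) as

  D-intro : ∀ {i j} → (i , j) ∈ as → D (f i) (f j) ≡ true
  D-intro {i} {j} mem = anyᵇ-intro mem (∧-intro (≡⇒== {u = f i} refl) (≡⇒== {u = f j} refl))

  D-elim : ∀ {u v} → D u v ≡ true → ∃ λ i → ∃ λ j → (i , j) ∈ as × f i ≡ u × f j ≡ v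
  D-elim {u} {v} d with anyᵇ-elim as d
  ... | (i , j) , mem , q = i , j , mem , ==⇒≡ (proj₁ (∧-true q)) , ==⇒≡ (proj₂ (∧-true {f i == u} q))

  D-or : ∀ {S'} → (∀ u → S u ≡ true → S' u ≡ true) → antisymᵇ as ≡ true → Or E S' D
  D-or {S'} sub an = or ed anti inl inr
    where
    ed : ∀ u v → D u v ≡ true → E u v ≡ true
    ed u v d with D-elim d
    ... | i , j , mem , refl , refl = proj₂ (proj₂ (as-edge mem))
    anti : ∀ u v → D u v ≡ true → D v u ≡ true → ⊥
    anti u v d d' with D-elim d | D-elim d'
    ... | i , j , mem , refl , refl | i' , j' , mem' , p , q
      with inj (proj₁ (as-edge mem')) (proj₁ (proj₂ (as-edge mem))) p | inj (proj₁ (proj₂ (as-edge mem'))) (proj₁ (as-edge mem)) q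
    ...   | refl | refl = clash (∈-arc mem') (not-true (allᵇ-∈ an mem))
    inl : ∀ u v → D u v ≡ true → S' u ≡ true
    inl u v d with D-elim d
    ... | i , j , mem , refl , refl = sub _ (inS (proj₁ (as-edge mem)))
    inr : ∀ u v → D u v ≡ true → S' v ≡ true
    inr u v d with D-elim d
    ... | i , j , mem , refl , refl = sub _ (inS (proj₁ (proj₂ (as-edge mem))))

  unit-walk : ∀ {k i j} → at (applyUpTo (i ≡ᵇ_) m) j ≡ true → Walk D k (f i) (f j)
  unit-walk {i = i} {j} e with ≡ᵇ-true {i} {j} (proj₂ (at-applyUpTo (i ≡ᵇ_) m e))
  ... | refl = here

  row-walk : ∀ {k} t → (∀ i j → at (nth t i) j ≡ true → Walk D k (f i) (f j)) →
             ∀ i j bs → (∀ a → a ∈ bs → a ∈ as) → at (reachRow m bs t i) j ≡ true → Walk D (suc k) (f i) (f j)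
  row-walk t h i j [] sub e = unit-walk e
  row-walk t h i j ((a , c) ∷ bs) sub e with split (a ≡ᵇ i)
  ... | inj₂ q rewrite q = row-walk t h i j bs (λ x mem → sub x (there mem)) e
  ... | inj₁ q rewrite q with ≡ᵇ-true {a} {i} q | ∪-at (nth t c) (reachRow m bs t i) j e
  ...   | refl | inj₁ x = step (D-intro (sub _ (here refl))) (h c j x)
  ...   | refl | inj₂ x = row-walk t h i j bs (λ x mem → sub x (there mem)) x

  reach-walk : ∀ k i j → at (nth (reach m as k) i) j ≡ true → Walk D k (f i) (f j)
  reach-walk zero i j e with nth-applyUpTo (λ i → applyUpTo (i ≡ᵇ_) m) m i
  ... | inj₁ q rewrite q = clash e refl
  ... | inj₂ q rewrite q = unit-walk e
  reach-walk (suc k) i j e with nth-applyUpTo (reachRow m as (reach m as k)) m i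
  ... | inj₁ q rewrite q = clash e refl
  ... | inj₂ q rewrite q = row-walk (reach m as k) (reach-walk k) i j as (λ _ mem → mem) e

  realise : ∀ {k} → check m k as ≡ true → Good E S k
  realise {k} ok = D , D-or (λ _ s → s) (proj₁ (∧-true ok)) , walks
    where
    walks : All-walks S k D
    walks su sv with onto su | onto sv
    ... | i , li , refl | j , lj , refl =
      reach-walk k i j (allᵇ-∈ (allᵇ-∈ (proj₂ (∧-true {antisymᵇ as} ok)) (∈-upTo⁺ li)) (∈-upTo⁺ lj))

-- Exhaustive lists of small ordered graphs.

-- Codes: row i lists the adjacencies of vertex i with the vertices 0 … i-1; newest row first.
Code : Set
Code = List (List Bool)

rowEdges : ℕ → ℕ → List Bool → Edges
rowEdges i j [] = []
rowEdges i j (b ∷ bs) = if b then (i , j) ∷ rowEdges i (suc j) bs else rowEdges i (suc j) bs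

edgesOf : Code → Edges
edgesOf [] = []
edgesOf (row ∷ c) = rowEdges (length c) 0 row ++ edgesOf c

allRows : ℕ → List (List Bool)
allRows zero = [] ∷ []
allRows (suc k) = map (true ∷_) (allRows k) ++ map (false ∷_) (allRows k)

-- This is the condition on the order: the earlier neighbours of the new vertex induce a nonempty
-- graph without isolated vertices. Hence `codes` runs over all small graphs of the class, with many
-- isomorphic repetitions.
validRow : ℕ → Edges → List Bool → Bool
validRow i es row = anyᵇ (at row) (upTo i) ∧
  allᵇ (λ j → not (at row j) ∨ anyᵇ (λ l → at row l ∧ adj es j l) (upTo i)) (upTo i)

codes : ℕ → List Code
codes zero = ((true ∷ []) ∷ [] ∷ []) ∷ []
codes (suc k) = concatMap (λ c → map (_∷ c) (filterᵇ (validRow (2 + k) (edgesOf c)) (allRows (2 + k)))) (codes k)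

filterᵇ-∈ : ∀ {A : Set} {p : A → Bool} {xs x} → x ∈ xs → p x ≡ true → x ∈ filterᵇ p xs
filterᵇ-∈ {p = p} {x ∷ xs} (here refl) e rewrite e = here refl
filterᵇ-∈ {p = p} {y ∷ xs} (there m) e with p y
... | true = there (filterᵇ-∈ m e)
... | false = filterᵇ-∈ m e

filterᵇ-∈⁻ : ∀ {A : Set} {p : A → Bool} xs {x} → x ∈ filterᵇ p xs → x ∈ xs × p x ≡ true
filterᵇ-∈⁻ {p = p} (y ∷ xs) m with split (p y)
filterᵇ-∈⁻ {p = p} (y ∷ xs) m | inj₂ q rewrite q with filterᵇ-∈⁻ xs m
... | a , b = there a , b
filterᵇ-∈⁻ {p = p} (y ∷ xs) m | inj₁ q rewrite q with m
... | here refl = here refl , q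
... | there m' with filterᵇ-∈⁻ xs m'
...   | a , b = there a , b

applyUpTo-∈ : ∀ (g : ℕ → Bool) k → applyUpTo g k ∈ allRows k
applyUpTo-∈ g zero = here refl
applyUpTo-∈ g (suc k) with g 0
... | true = ∈-++⁺ˡ (∈-map⁺ (true ∷_) (applyUpTo-∈ (g ∘ suc) k))
... | false = ∈-++⁺ʳ (map (true ∷_) (allRows k)) (∈-map⁺ (false ∷_) (applyUpTo-∈ (g ∘ suc) k))

module Coding {n : ℕ} (E : Graph n) (irr : ∀ u → E u u ≡ false) (E-sym : ∀ u v → E u v ≡ E v u) (f : ℕ → Fin n) where

  codeOf : ℕ → Code
  codeOf zero = []
  codeOf (suc i) = applyUpTo (λ j → E (f i) (f j)) i ∷ codeOf i

  length-codeOf : ∀ i → length (codeOf i) ≡ i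
  length-codeOf zero = refl
  length-codeOf (suc i) = cong suc (length-codeOf i)

  rowEdges-∈ : ∀ i d k (g : ℕ → Bool) {a b} → (a , b) ∈ rowEdges i d (applyUpTo g k) → a ≡ i × ∃ λ j → j < k × b ≡ d + j × g j ≡ true
  rowEdges-∈ i d (suc k) g mem with split (g 0)
  rowEdges-∈ i d (suc k) g mem | inj₁ q rewrite q with mem
  ... | here refl = refl , 0 , s≤s z≤n , sym (+-identityʳ d) , q
  ... | there mem' with rowEdges-∈ i (suc d) k (g ∘ suc) mem'
  ...   | e , j , lt , e' , q' = e , suc j , s≤s lt , trans e' (sym (+-suc d j)) , q'
  rowEdges-∈ i d (suc k) g mem | inj₂ q rewrite q with rowEdges-∈ i (suc d) k (g ∘ suc) mem
  ...   | e , j , lt , e' , q' = e , suc j , s≤s lt , trans e' (sym (+-suc d j)) , q'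

  ∈-rowEdges : ∀ i d k (g : ℕ → Bool) {j} → j < k → g j ≡ true → (i , d + j) ∈ rowEdges i d (applyUpTo g k)
  ∈-rowEdges i d (suc k) g {zero} lt e rewrite e = here (cong (i ,_) (+-identityʳ d))
  ∈-rowEdges i d (suc k) g {suc j} (s≤s lt) e with g 0 | subst (λ z → (i , z) ∈ rowEdges i (suc d) (applyUpTo (g ∘ suc) k)) (sym (+-suc d j)) (∈-rowEdges i (suc d) k (g ∘ suc) lt e)
  ... | true | r = there r
  ... | false | r = r

  edges-sound : ∀ m {a b} → (a , b) ∈ edgesOf (codeOf m) → a < m × b < a × E (f a) (f b) ≡ true
  edges-sound (suc i) mem rewrite length-codeOf i with ∈-++⁻ (rowEdges i 0 (applyUpTo (λ j → E (f i) (f j)) i)) mem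
  ... | inj₁ x with rowEdges-∈ i 0 i _ x
  ...   | refl , j , lt , refl , e = ≤-refl , lt , e
  edges-sound (suc i) mem | inj₂ x with edges-sound i x
  ...   | l , l' , e = m<n⇒m<1+n l , l' , e

  edges-complete : ∀ m {a b} → a < m → b < a → E (f a) (f b) ≡ true → (a , b) ∈ edgesOf (codeOf m)
  edges-complete (suc i) {a} {b} la lb e with a Data.Nat.≟ i
  ... | yes refl rewrite length-codeOf i = ∈-++⁺ˡ (∈-rowEdges i 0 i _ lb e)
  ... | no ne = ∈-++⁺ʳ (rowEdges (length (codeOf i)) 0 (applyUpTo (λ j → E (f i) (f j)) i)) (edges-complete i (≤∧≢⇒< (≤-pred la) ne) lb e)

  adj-code : ∀ m {i j} → i < m → j < m → adj (edgesOf (codeOf m)) i j ≡ E (f i) (f j)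
  adj-code m {i} {j} li lj with split (E (f i) (f j))
  ... | inj₂ q = trans (≢true bad) (sym q)
    where
    bad : ¬ (adj (edgesOf (codeOf m)) i j ≡ true)
    bad a with adj-∈ (edgesOf (codeOf m)) a
    ... | inj₁ x = clash (proj₂ (proj₂ (edges-sound m x))) q
    ... | inj₂ x = clash (trans (E-sym _ _) (proj₂ (proj₂ (edges-sound m x)))) q
  ... | inj₁ q with <-cmp i j
  ...   | tri< lt _ _ = trans (∨-introʳ {arc (edgesOf (codeOf m)) i j} (∈-arc (edges-complete m lj lt (trans (E-sym _ _) q)))) (sym q)
  ...   | tri≈ _ refl _ = clash q (irr _)
  ...   | tri> _ _ gt = trans (∨-introˡ (∈-arc (edges-complete m li gt q))) (sym q)

  Valid : ℕ → Set
  Valid m = ∀ i → 2 ≤ i → i < m → (∃ λ j → j < i × E (f i) (f j) ≡ true) ×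
            (∀ j → j < i → E (f i) (f j) ≡ true → ∃ λ l → l < i × E (f i) (f l) ≡ true × E (f j) (f l) ≡ true)

  codeOf-∈ : ∀ k → E (f 1) (f 0) ≡ true → Valid (2 + k) → codeOf (2 + k) ∈ codes k
  codeOf-∈ zero e _ rewrite e = here refl
  codeOf-∈ (suc k) e v = ∈-concatMap⁺ _ (lose (codeOf-∈ k e (λ i p q → v i p (m<n⇒m<1+n q))) (∈-map⁺ (_∷ codeOf (2 + k)) (filterᵇ-∈ (applyUpTo-∈ g (2 + k)) ok)))
    where
    g : ℕ → Bool
    g j = E (f (2 + k)) (f j)
    at-g : ∀ {j} → j < 2 + k → at (applyUpTo g (2 + k)) j ≡ g j
    at-g = applyUpTo-at g (2 + k)
    v' = v (2 + k) (s≤s (s≤s z≤n)) ≤-refl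
    ok : validRow (2 + k) (edgesOf (codeOf (2 + k))) (applyUpTo g (2 + k)) ≡ true
    ok = ∧-intro (anyᵇ-intro {p = at (applyUpTo g (2 + k))} (∈-upTo⁺ (proj₁ (proj₂ (proj₁ v')))) (trans (at-g (proj₁ (proj₂ (proj₁ v')))) (proj₂ (proj₂ (proj₁ v')))))
                 (allᵇ-intro (upTo (2 + k)) each)
      where
      each : ∀ j → j ∈ upTo (2 + k) → not (at (applyUpTo g (2 + k)) j) ∨ anyᵇ (λ l → at (applyUpTo g (2 + k)) l ∧ adj (edgesOf (codeOf (2 + k))) j l) (upTo (2 + k)) ≡ true
      each j mem with split (g j)
      ... | inj₂ q = ∨-introˡ (not-false (trans (at-g (∈-upTo⁻ mem)) q))
      ... | inj₁ q with proj₂ v' j (∈-upTo⁻ mem) q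
      ...   | l , ll , e₁ , e₂ = ∨-introʳ {not (at (applyUpTo g (2 + k)) j)} (anyᵇ-intro {p = λ l → at (applyUpTo g (2 + k)) l ∧ adj (edgesOf (codeOf (2 + k))) j l} (∈-upTo⁺ ll) (∧-intro (trans (at-g ll) e₁) (trans (adj-code (2 + k) (∈-upTo⁻ mem) ll) e₂)))

-- Certificates for small graphs and for extensions of exceptional ones.

zipAll : ∀ {A B : Set} → (A → B → Bool) → List A → List B → Bool
zipAll f [] [] = true
zipAll f (x ∷ xs) (y ∷ ys) = f x y ∧ zipAll f xs ys
zipAll f _ _ = false

zipAll-∈ : ∀ {A B : Set} {f : A → B → Bool} xs ys {x} → zipAll f xs ys ≡ true → x ∈ xs → ∃ λ y → f x y ≡ true
zipAll-∈ {f = f} (x ∷ xs) (y ∷ ys) e (here refl) = y , proj₁ (∧-true e)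
zipAll-∈ {f = f} (x ∷ xs) (y ∷ ys) e (there m) = zipAll-∈ xs ys (proj₂ (∧-true {f x y} e)) m

-- A certificate: the bits of an orientation, or a relabelling onto an exceptional graph.
data Certificate : Set where
  good : ℕ → Certificate
  iso : ℕ → List ℕ → Certificate

image : List ℕ → ℕ → ℕ
image [] _ = 0
image (x ∷ xs) zero = x
image (x ∷ xs) (suc i) = image xs i

permᵇ : ℕ → List ℕ → Bool
permᵇ m π = allᵇ (λ i → (image π i <ᵇ m) ∧ (anyᵇ (λ j → image π j ≡ᵇ i) (upTo m) ∧
  allᵇ (λ j → (i ≡ᵇ j) ∨ not (image π i ≡ᵇ image π j)) (upTo m))) (upTo m)

exactᵇ : ℕ → Edges → Edges → List ℕ → Bool
exactᵇ m X es π = permᵇ m π ∧ allᵇ (λ i → allᵇ (λ j → not (adj X i j xor adj es (image π i) (image π j))) (upTo m)) (upTo m)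

subᵇ : ℕ → Edges → Edges → List ℕ → Bool
subᵇ m X es π = permᵇ m π ∧ allᵇ (λ a → adj es (image π (proj₁ a)) (image π (proj₂ a))) X

checkCode : ℕ → ℕ → List Edges → Code → Certificate → Bool
checkCode m k Xs c (good b) = check m k (orient (edgesOf c) b)
checkCode m k Xs c (iso i π) = exactᵇ m (nth Xs i) (edgesOf c) π

-- An extension is known only up to further edges, so in place of an orientation a certificate can
-- show no more than that Y is contained in it. Equality is decided later, edge by edge.
checkExt : Bool → ℕ → ℕ → Edges → Edges → Certificate → Bool
checkExt _ m k Y es (good b) = check m k (orient es b)
checkExt allowed m k Y es (iso _ π) = allowed ∧ subᵇ m Y es π

record Table : Set where
  constructor table
  field
    graph : Edges
    ext₁ : List ℕ
    ext₂ : List (List Certificate)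
    extra : List ℕ
    core cover : ℕ

onEdge : ℕ → ℕ × ℕ → Edges → Edges
onEdge v (i , j) X = (v , i) ∷ (v , j) ∷ X

-- Vertices c of degree two with a neighbour x and a non-neighbour y.
cond : ℕ → Edges → ℕ × ℕ × ℕ → Bool
cond m X (c , x , y) = (adj X c x ∧ not (c ≡ᵇ y)) ∧ (not (adj X c y) ∧
  anyᵇ (λ e → allᵇ (λ l → not (adj X c l) ∨ ((l ≡ᵇ x) ∨ (l ≡ᵇ e))) (upTo m)) (upTo m))

triples : ℕ → Edges → List (ℕ × ℕ × ℕ)
triples m X = filterᵇ (cond m X) (cartesianProduct (upTo m) (cartesianProduct (upTo m) (upTo m)))

-- The edge c y is missing in X because pruning at c has removed it. It is put back together with
-- the new vertices m on c x and m + 1 on c y.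
extraEdges : ℕ → Edges → ℕ × ℕ × ℕ → Edges
extraEdges m X (c , x , y) = onEdge (suc m) (c , y) ((c , y) ∷ onEdge m (c , x) X)

okFour : ℕ → ℕ → Edges → ℕ → ℕ → Bool
okFour m h X b b' = check₄ m h (orient X b) (orient X b')

-- All certificates for an exceptional graph on m = 2 h vertices; Y is the exceptional graph on m + 2 vertices, if allowed.
okTable : Bool → ℕ → ℕ → Edges → Table → Bool
okTable allowed m h Y (table X t₁ t₂ t₃ a b) =
  zipAll (λ e c → check (1 + m) (1 + h) (orient (onEdge m e X) c)) X t₁ ∧
  (zipAll (λ e row → zipAll (λ e' c → checkExt allowed (2 + m) (1 + h) Y (onEdge (1 + m) e' (onEdge m e X)) c) (onEdge m e X) row) X t₂ ∧
  (zipAll (λ t c → check (2 + m) (1 + h) (orient (extraEdges m X t) c)) (triples m X) t₃ ∧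
  okFour m h X a b))

nonEdges : ℕ → Edges → List (ℕ × ℕ)
nonEdges m X = filterᵇ (λ a → not (adj X (proj₁ a) (proj₂ a)) ∧ not (proj₁ a ≡ᵇ proj₂ a)) (cartesianProduct (upTo m) (upTo m))

nonEdges-∈ : ∀ m X {i j} → i < m → j < m → adj X i j ≡ false → i ≢ j → (i , j) ∈ nonEdges m X
nonEdges-∈ m X li lj q ne = filterᵇ-∈ {p = λ a → not (adj X (proj₁ a) (proj₂ a)) ∧ not (proj₁ a ≡ᵇ proj₂ a)}
  (∈-cartesianProduct⁺ (∈-upTo⁺ li) (∈-upTo⁺ lj)) (∧-intro (not-false q) (not-false (≡ᵇ-false ne)))

nonEdges-bound : ∀ m X {i j} → (i , j) ∈ nonEdges m X → i < m × j < m
nonEdges-bound m X mem with ∈-cartesianProduct⁻ (upTo m) (upTo m)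
  (proj₁ (filterᵇ-∈⁻ {p = λ a → not (adj X (proj₁ a) (proj₂ a)) ∧ not (proj₁ a ≡ᵇ proj₂ a)} (cartesianProduct (upTo m) (upTo m)) mem))
... | x , y = ∈-upTo⁻ x , ∈-upTo⁻ y

triples-∈ : ∀ m X {c x y} → c < m → x < m → y < m → cond m X (c , x , y) ≡ true → (c , x , y) ∈ triples m X
triples-∈ m X lc lx ly ok = filterᵇ-∈ {p = cond m X} (∈-cartesianProduct⁺ (∈-upTo⁺ lc) (∈-cartesianProduct⁺ (∈-upTo⁺ lx) (∈-upTo⁺ ly))) ok

-- The results of checks are wrapped in records, which keeps them folded.
record Certified (m k : ℕ) (es : Edges) : Set where
  constructor certified
  field
    bits : ℕ
    ok : check m k (orient es bits) ≡ true

record Relabels (m : ℕ) (X es : Edges) : Set where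
  constructor relabels
  field
    π : List ℕ
    ok : subᵇ m X es π ≡ true

record Matches (m : ℕ) (X es : Edges) : Set where
  constructor matches
  field
    π : List ℕ
    ok : exactᵇ m X es π ≡ true

record Certified₄ (m k : ℕ) (X : Edges) : Set where
  constructor certified₄
  field
    core cover : ℕ
    ok : check₄ m k (orient X core) (orient X cover) ≡ true

record CodeTable (k l : ℕ) (Xs : List Edges) : Set where
  constructor codeTable
  field
    entries : List Certificate
    ok : zipAll (checkCode (2 + k) l Xs) (codes k) entries ≡ true

record EdgeTable (m k : ℕ) (X : Edges) : Set where
  constructor edgeTable
  field
    entries : List ℕ
    ok : zipAll (λ a b → check m k (orient (a ∷ X) b)) (nonEdges m X) entries ≡ true

record ExtTable (allowed : Bool) (m h : ℕ) (Y X : Edges) : Set where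
  constructor extTable
  field
    ext₁ : List ℕ
    ext₂ : List (List Certificate)
    extra : List ℕ
    core cover : ℕ
    ok : okTable allowed m h Y (table X ext₁ ext₂ extra core cover) ≡ true

code-lookup : ∀ {k l Xs c} → CodeTable k l Xs → c ∈ codes k → Certified (2 + k) l (edgesOf c) ⊎ (∃ λ i → Matches (2 + k) (nth Xs i) (edgesOf c))
code-lookup {k} {l} {Xs} {c} (codeTable es ok) mem = go (zipAll-∈ {f = checkCode (2 + k) l Xs} (codes k) es ok mem)
  where
  go : (∃ λ e → checkCode (2 + k) l Xs c e ≡ true) → Certified (2 + k) l (edgesOf c) ⊎ (∃ λ i → Matches (2 + k) (nth Xs i) (edgesOf c))
  go (good b , z) = inj₁ (certified b z)
  go (iso i π , z) = inj₂ (i , matches π z)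

edge-lookup : ∀ {m k X a} → EdgeTable m k X → a ∈ nonEdges m X → Certified m k (a ∷ X)
edge-lookup {m} {k} {X} {a} (edgeTable bs ok) mem = go (zipAll-∈ {f = λ a b → check m k (orient (a ∷ X) b)} (nonEdges m X) bs ok mem)
  where
  go : (∃ λ b → check m k (orient (a ∷ X) b) ≡ true) → Certified m k (a ∷ X)
  go (b , z) = certified b z

module _ {allowed : Bool} {m h : ℕ} {Y X : Edges} (t : ExtTable allowed m h Y X) where
  open ExtTable t

  private
    f₁ : ℕ × ℕ → ℕ → Bool
    f₁ e c = check (1 + m) (1 + h) (orient (onEdge m e X) c)
    f₂ : ℕ × ℕ → ℕ × ℕ → Certificate → Bool
    f₂ e e' c = checkExt allowed (2 + m) (1 + h) Y (onEdge (1 + m) e' (onEdge m e X)) c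
    g₂ : ℕ × ℕ → List Certificate → Bool
    g₂ e row = zipAll (f₂ e) (onEdge m e X) row
    f₃ : ℕ × ℕ × ℕ → ℕ → Bool
    f₃ t c = check (2 + m) (1 + h) (orient (extraEdges m X t) c)
    r₁ = proj₂ (∧-true {zipAll f₁ X ext₁} ok)
    r₂ = proj₂ (∧-true {zipAll g₂ X ext₂} r₁)

  table-ext₁ : ∀ {e} → e ∈ X → Certified (1 + m) (1 + h) (onEdge m e X)
  table-ext₁ mem = let c , z = zipAll-∈ {f = f₁} X ext₁ (proj₁ (∧-true {zipAll f₁ X ext₁} ok)) mem in certified c z

  table-ext₂ : ∀ {e e'} → e ∈ X → e' ∈ onEdge m e X →
    Certified (2 + m) (1 + h) (onEdge (1 + m) e' (onEdge m e X)) ⊎ (allowed ≡ true × Relabels (2 + m) Y (onEdge (1 + m) e' (onEdge m e X)))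
  table-ext₂ {e} {e'} mem mem' = let row , okr = zipAll-∈ {f = g₂} X ext₂ (proj₁ (∧-true {zipAll g₂ X ext₂} r₁)) mem in
    go (zipAll-∈ {f = f₂ e} (onEdge m e X) row okr mem')
    where
    go : (∃ λ c → f₂ e e' c ≡ true) → Certified (2 + m) (1 + h) (onEdge (1 + m) e' (onEdge m e X)) ⊎ (allowed ≡ true × Relabels (2 + m) Y (onEdge (1 + m) e' (onEdge m e X)))
    go (good c , z) = inj₁ (certified c z)
    go (iso _ π , z) = inj₂ (proj₁ (∧-true {allowed} z) , relabels π (proj₂ (∧-true {allowed} z)))

  table-extra : ∀ {t} → t ∈ triples m X → Certified (2 + m) (1 + h) (extraEdges m X t)
  table-extra mem = let c , z = zipAll-∈ {f = f₃} (triples m X) extra (proj₁ (∧-true {zipAll f₃ (triples m X) extra} r₂)) mem in certified c z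

  table-four : Certified₄ m h X
  table-four = certified₄ core cover (proj₂ (∧-true {zipAll f₃ (triples m X) extra} r₂))

-- The exceptional graphs and their certificates.

K₄⁻ᵉ : Edges
K₄⁻ᵉ = (0 , 1) ∷ (1 , 2) ∷ (2 , 3) ∷ (3 , 0) ∷ (0 , 2) ∷ []

K₄ᵉ : Edges
K₄ᵉ = (0 , 1) ∷ (0 , 2) ∷ (0 , 3) ∷ (1 , 2) ∷ (1 , 3) ∷ (2 , 3) ∷ []

fanᵉ : Edges
fanᵉ = (0 , 1) ∷ (0 , 2) ∷ (0 , 3) ∷ (0 , 4) ∷ (0 , 5) ∷ (1 , 2) ∷ (2 , 3) ∷ (3 , 4) ∷ (4 , 5) ∷ []

zigzagᵉ : Edges
zigzagᵉ = (0 , 1) ∷ (1 , 2) ∷ (2 , 3) ∷ (3 , 4) ∷ (4 , 5) ∷ (5 , 0) ∷ (0 , 2) ∷ (0 , 3) ∷ (3 , 5) ∷ []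

wheelᵉ : Edges
wheelᵉ = (0 , 1) ∷ (1 , 2) ∷ (2 , 3) ∷ (3 , 4) ∷ (4 , 0) ∷ (5 , 0) ∷ (5 , 1) ∷ (5 , 2) ∷ (5 , 3) ∷ (5 , 4) ∷ []

hatᵉ : Edges
hatᵉ = (0 , 1) ∷ (0 , 2) ∷ (1 , 2) ∷ (3 , 0) ∷ (3 , 1) ∷ (3 , 2) ∷ (1 , 4) ∷ (4 , 5) ∷ (5 , 2) ∷ (1 , 5) ∷ []

-- The spine is the edge 4 5, the pages have the apices 1, 2 and 3, and the ear 0 sits on the edge 3
-- 5.
bookᵉ : Edges
bookᵉ = (0 , 3) ∷ (0 , 5) ∷ (1 , 4) ∷ (1 , 5) ∷ (2 , 4) ∷ (2 , 5) ∷ (3 , 4) ∷ (3 , 5) ∷ (4 , 5) ∷ []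

eightᵉ : Edges
eightᵉ = (0 , 1) ∷ (1 , 2) ∷ (2 , 3) ∷ (3 , 4) ∷ (4 , 5) ∷ (5 , 6) ∷ (6 , 7) ∷ (7 , 0) ∷ (1 , 7) ∷ (2 , 7) ∷ (3 , 7) ∷ (3 , 5) ∷ (3 , 6) ∷ []

codes3 : List Certificate
codes3 =
  good 6 ∷
  []

codes4 : List Certificate
codes4 =
  iso 1 (0 ∷ 1 ∷ 2 ∷ 3 ∷ []) ∷ iso 0 (0 ∷ 2 ∷ 1 ∷ 3 ∷ []) ∷ iso 0 (0 ∷ 1 ∷ 2 ∷ 3 ∷ []) ∷ iso 0 (1 ∷ 0 ∷ 2 ∷ 3 ∷ []) ∷
  []

codes5 : List Certificate
codes5 =
  good 429 ∷ good 284 ∷ good 428 ∷ good 205 ∷ good 27 ∷ good 198 ∷ good 201 ∷ good 426 ∷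
  good 241 ∷ good 118 ∷ good 138 ∷ good 185 ∷ good 147 ∷ good 213 ∷ good 106 ∷ good 179 ∷
  good 102 ∷ good 90 ∷ good 209 ∷ good 101 ∷ good 89 ∷ good 184 ∷ good 211 ∷ good 162 ∷
  good 105 ∷ good 54 ∷ good 101 ∷ good 122 ∷ good 46 ∷ good 22 ∷ good 121 ∷ good 149 ∷
  good 178 ∷ good 213 ∷ good 101 ∷ good 213 ∷ good 102 ∷ good 210 ∷ good 58 ∷ good 58 ∷
  good 70 ∷
  []

codes6 : List Certificate
codes6 =
  good 26348 ∷ good 7255 ∷ good 13909 ∷ good 7907 ∷ good 7589 ∷ good 2549 ∷ good 2561 ∷ good 3881 ∷
  good 1177 ∷ good 1322 ∷ good 5661 ∷ good 2706 ∷ good 4382 ∷ good 1505 ∷ good 2734 ∷ good 12710 ∷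
  good 1294 ∷ good 4149 ∷ good 2738 ∷ good 6294 ∷ good 1813 ∷ good 2633 ∷ good 3557 ∷ good 1814 ∷
  good 3930 ∷ good 3313 ∷ good 5273 ∷ good 8045 ∷ good 478 ∷ good 2786 ∷ good 7164 ∷ good 78 ∷
  good 779 ∷ good 1738 ∷ good 6874 ∷ good 677 ∷ good 1833 ∷ good 1990 ∷ good 1377 ∷ good 1962 ∷
  good 470 ∷ good 4291 ∷ good 1908 ∷ good 1130 ∷ good 854 ∷ good 3510 ∷ good 1477 ∷ good 1929 ∷
  good 1889 ∷ good 102 ∷ good 1577 ∷ good 10451 ∷ good 1336 ∷ good 1892 ∷ good 2724 ∷ good 1828 ∷
  good 100 ∷ good 2802 ∷ good 1942 ∷ good 4653 ∷ good 819 ∷ good 3926 ∷ good 1130 ∷ good 2270 ∷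
  good 1066 ∷ good 1418 ∷ good 2498 ∷ good 89 ∷ good 116 ∷ good 938 ∷ good 1294 ∷ good 401 ∷
  good 645 ∷ good 1290 ∷ good 1778 ∷ good 645 ∷ good 3957 ∷ good 1133 ∷ good 2286 ∷ good 426 ∷
  good 1837 ∷ good 1738 ∷ good 1489 ∷ good 277 ∷ good 2951 ∷ good 403 ∷ good 554 ∷ good 698 ∷
  good 618 ∷ good 822 ∷ iso 3 (2 ∷ 0 ∷ 1 ∷ 3 ∷ 5 ∷ 4 ∷ []) ∷ good 3482 ∷ good 372 ∷ good 1101 ∷ good 713 ∷ good 619 ∷
  good 537 ∷ iso 3 (2 ∷ 1 ∷ 0 ∷ 3 ∷ 5 ∷ 4 ∷ []) ∷ good 969 ∷ good 10867 ∷ good 1339 ∷ good 731 ∷ good 3337 ∷ good 3812 ∷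
  good 140 ∷ good 1292 ∷ good 569 ∷ good 156 ∷ good 1365 ∷ good 661 ∷ good 1614 ∷ good 940 ∷
  good 46 ∷ good 1722 ∷ good 5157 ∷ good 2267 ∷ good 851 ∷ good 1650 ∷ good 741 ∷ good 1577 ∷
  good 3957 ∷ good 678 ∷ good 113 ∷ good 101 ∷ good 7620 ∷ good 1965 ∷ good 1898 ∷ good 717 ∷
  good 921 ∷ good 1772 ∷ good 1134 ∷ good 742 ∷ good 1132 ∷ good 693 ∷ good 2002 ∷ good 825 ∷
  good 1613 ∷ good 186 ∷ iso 3 (1 ∷ 0 ∷ 2 ∷ 3 ∷ 5 ∷ 4 ∷ []) ∷ good 348 ∷ good 1141 ∷ good 910 ∷ good 793 ∷ good 681 ∷
  good 1750 ∷ good 858 ∷ iso 3 (1 ∷ 2 ∷ 0 ∷ 3 ∷ 5 ∷ 4 ∷ []) ∷ good 7769 ∷ good 743 ∷ good 892 ∷ good 948 ∷ good 2284 ∷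
  good 908 ∷ good 1971 ∷ good 22 ∷ good 826 ∷ good 1363 ∷ good 653 ∷ good 325 ∷ good 949 ∷
  good 745 ∷ iso 3 (1 ∷ 0 ∷ 3 ∷ 2 ∷ 5 ∷ 4 ∷ []) ∷ good 3305 ∷ good 372 ∷ good 1002 ∷ good 938 ∷ good 837 ∷ good 1738 ∷
  good 805 ∷ iso 3 (1 ∷ 3 ∷ 0 ∷ 2 ∷ 5 ∷ 4 ∷ []) ∷ good 5529 ∷ good 6980 ∷ good 2345 ∷ good 3149 ∷ good 4884 ∷ good 606 ∷
  good 73 ∷ good 101 ∷ good 1173 ∷ good 2126 ∷ good 3226 ∷ good 1237 ∷ good 1811 ∷ good 1778 ∷
  good 6574 ∷ good 2222 ∷ good 1102 ∷ good 397 ∷ good 934 ∷ good 1646 ∷ good 1713 ∷ good 854 ∷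
  good 301 ∷ good 182 ∷ good 945 ∷ good 1868 ∷ good 4005 ∷ good 211 ∷ good 1942 ∷ good 1882 ∷
  good 115 ∷ good 444 ∷ good 549 ∷ good 4003 ∷ good 1486 ∷ good 561 ∷ good 790 ∷ good 186 ∷
  good 670 ∷ good 2005 ∷ good 1692 ∷ good 474 ∷ good 2002 ∷ good 490 ∷ iso 3 (0 ∷ 1 ∷ 2 ∷ 3 ∷ 5 ∷ 4 ∷ []) ∷ good 1649 ∷
  good 58 ∷ iso 3 (0 ∷ 2 ∷ 1 ∷ 3 ∷ 5 ∷ 4 ∷ []) ∷ good 213 ∷ good 878 ∷ good 4006 ∷ good 1422 ∷ good 1145 ∷ good 465 ∷
  good 675 ∷ good 165 ∷ good 2798 ∷ good 691 ∷ good 197 ∷ good 370 ∷ good 826 ∷ good 3865 ∷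
  good 1580 ∷ good 1493 ∷ good 857 ∷ good 1987 ∷ good 550 ∷ iso 3 (0 ∷ 1 ∷ 3 ∷ 2 ∷ 5 ∷ 4 ∷ []) ∷ good 60 ∷ good 250 ∷
  iso 3 (0 ∷ 3 ∷ 1 ∷ 2 ∷ 5 ∷ 4 ∷ []) ∷ good 3460 ∷ good 4056 ∷ good 2275 ∷ good 1997 ∷ good 2812 ∷ good 1491 ∷ good 570 ∷
  good 1297 ∷ good 915 ∷ good 466 ∷ good 805 ∷ good 1998 ∷ good 553 ∷ good 3258 ∷ good 41 ∷
  good 778 ∷ good 149 ∷ good 177 ∷ good 553 ∷ good 309 ∷ good 217 ∷ iso 3 (0 ∷ 2 ∷ 3 ∷ 1 ∷ 5 ∷ 4 ∷ []) ∷ iso 3 (0 ∷ 3 ∷ 2 ∷ 1 ∷ 5 ∷ 4 ∷ []) ∷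
  good 6391 ∷ good 406 ∷ good 3141 ∷ good 3830 ∷ good 6806 ∷ good 3358 ∷ good 3107 ∷ good 141 ∷
  good 6716 ∷ good 858 ∷ good 3533 ∷ good 1689 ∷ good 3764 ∷ good 390 ∷ good 790 ∷ good 7898 ∷
  good 924 ∷ good 3113 ∷ good 1165 ∷ good 2025 ∷ good 582 ∷ good 1354 ∷ good 3317 ∷ good 278 ∷
  good 337 ∷ good 3459 ∷ good 3127 ∷ good 2322 ∷ good 396 ∷ good 2885 ∷ good 1555 ∷ good 1710 ∷
  good 45 ∷ good 3239 ∷ good 865 ∷ good 621 ∷ good 718 ∷ good 417 ∷ iso 3 (2 ∷ 0 ∷ 1 ∷ 4 ∷ 5 ∷ 3 ∷ []) ∷ good 849 ∷
  good 184 ∷ good 1579 ∷ good 1705 ∷ good 817 ∷ good 884 ∷ iso 3 (2 ∷ 1 ∷ 0 ∷ 4 ∷ 5 ∷ 3 ∷ []) ∷ good 837 ∷ good 817 ∷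
  good 105 ∷ good 4012 ∷ good 2242 ∷ good 1762 ∷ good 970 ∷ good 1649 ∷ good 1678 ∷ good 213 ∷
  good 2600 ∷ good 1443 ∷ good 1630 ∷ iso 3 (3 ∷ 0 ∷ 1 ∷ 4 ∷ 5 ∷ 2 ∷ []) ∷ good 1675 ∷ good 825 ∷ good 814 ∷ good 661 ∷
  good 283 ∷ good 109 ∷ iso 3 (3 ∷ 1 ∷ 0 ∷ 4 ∷ 5 ∷ 2 ∷ []) ∷ good 1617 ∷ good 810 ∷ good 854 ∷ good 305 ∷ good 3499 ∷
  good 1450 ∷ good 1179 ∷ good 428 ∷ good 326 ∷ good 818 ∷ good 297 ∷ good 422 ∷ good 1563 ∷
  good 426 ∷ good 846 ∷ iso 4 (5 ∷ 3 ∷ 4 ∷ 2 ∷ 1 ∷ 0 ∷ []) ∷ good 726 ∷ iso 4 (5 ∷ 2 ∷ 4 ∷ 3 ∷ 1 ∷ 0 ∷ []) ∷ iso 4 (5 ∷ 2 ∷ 3 ∷ 4 ∷ 1 ∷ 0 ∷ []) ∷ good 1129 ∷ good 182 ∷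
  good 206 ∷ iso 4 (5 ∷ 3 ∷ 4 ∷ 2 ∷ 0 ∷ 1 ∷ []) ∷ good 817 ∷ iso 4 (5 ∷ 2 ∷ 4 ∷ 3 ∷ 0 ∷ 1 ∷ []) ∷ iso 4 (5 ∷ 2 ∷ 3 ∷ 4 ∷ 0 ∷ 1 ∷ []) ∷ good 7895 ∷ good 801 ∷ good 665 ∷
  good 1822 ∷ good 3545 ∷ good 393 ∷ good 412 ∷ good 293 ∷ good 2508 ∷ good 1193 ∷ good 267 ∷
  good 53 ∷ good 1460 ∷ good 970 ∷ good 5 ∷ good 405 ∷ good 1441 ∷ good 1633 ∷ good 294 ∷
  good 45 ∷ good 882 ∷ good 412 ∷ good 142 ∷ good 54 ∷ good 3278 ∷ good 1451 ∷ good 185 ∷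
  good 204 ∷ good 1411 ∷ iso 3 (3 ∷ 0 ∷ 1 ∷ 5 ∷ 4 ∷ 2 ∷ []) ∷ good 205 ∷ iso 4 (4 ∷ 3 ∷ 5 ∷ 2 ∷ 1 ∷ 0 ∷ []) ∷ good 1157 ∷ good 884 ∷ iso 3 (4 ∷ 0 ∷ 2 ∷ 5 ∷ 3 ∷ 1 ∷ []) ∷
  iso 4 (3 ∷ 4 ∷ 5 ∷ 1 ∷ 2 ∷ 0 ∷ []) ∷ iso 2 (1 ∷ 2 ∷ 4 ∷ 5 ∷ 3 ∷ 0 ∷ []) ∷ iso 0 (0 ∷ 4 ∷ 2 ∷ 1 ∷ 3 ∷ 5 ∷ []) ∷ iso 0 (0 ∷ 3 ∷ 1 ∷ 2 ∷ 4 ∷ 5 ∷ []) ∷ good 1081 ∷ good 202 ∷ good 41 ∷ good 361 ∷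
  iso 1 (0 ∷ 4 ∷ 2 ∷ 1 ∷ 5 ∷ 3 ∷ []) ∷ iso 1 (0 ∷ 3 ∷ 1 ∷ 2 ∷ 5 ∷ 4 ∷ []) ∷ good 139 ∷ good 600 ∷ good 1443 ∷ iso 3 (2 ∷ 0 ∷ 1 ∷ 5 ∷ 4 ∷ 3 ∷ []) ∷ good 1414 ∷ good 138 ∷
  good 860 ∷ iso 4 (4 ∷ 2 ∷ 5 ∷ 3 ∷ 1 ∷ 0 ∷ []) ∷ good 1450 ∷ good 884 ∷ iso 2 (1 ∷ 2 ∷ 5 ∷ 4 ∷ 3 ∷ 0 ∷ []) ∷ iso 0 (0 ∷ 4 ∷ 3 ∷ 1 ∷ 2 ∷ 5 ∷ []) ∷ iso 3 (4 ∷ 0 ∷ 3 ∷ 5 ∷ 2 ∷ 1 ∷ []) ∷ iso 4 (2 ∷ 4 ∷ 5 ∷ 1 ∷ 3 ∷ 0 ∷ []) ∷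
  iso 0 (0 ∷ 2 ∷ 1 ∷ 3 ∷ 4 ∷ 5 ∷ []) ∷ good 273 ∷ good 779 ∷ iso 1 (0 ∷ 4 ∷ 3 ∷ 1 ∷ 5 ∷ 2 ∷ []) ∷ good 781 ∷ good 69 ∷ iso 1 (0 ∷ 2 ∷ 1 ∷ 3 ∷ 5 ∷ 4 ∷ []) ∷ good 4093 ∷
  good 3106 ∷ good 3220 ∷ good 1762 ∷ good 2892 ∷ good 603 ∷ good 1611 ∷ good 186 ∷ good 2375 ∷
  good 854 ∷ good 492 ∷ good 986 ∷ good 1630 ∷ good 217 ∷ good 1701 ∷ good 1033 ∷ good 1053 ∷
  good 781 ∷ good 1820 ∷ good 141 ∷ good 54 ∷ good 301 ∷ good 969 ∷ good 910 ∷ good 179 ∷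
  good 235 ∷ good 1603 ∷ good 585 ∷ good 677 ∷ iso 3 (3 ∷ 1 ∷ 0 ∷ 5 ∷ 4 ∷ 2 ∷ []) ∷ good 718 ∷ iso 4 (4 ∷ 3 ∷ 5 ∷ 2 ∷ 0 ∷ 1 ∷ []) ∷ good 387 ∷
  good 213 ∷ good 835 ∷ good 218 ∷ iso 1 (0 ∷ 5 ∷ 3 ∷ 1 ∷ 4 ∷ 2 ∷ []) ∷ good 582 ∷ good 817 ∷ iso 3 (4 ∷ 1 ∷ 2 ∷ 5 ∷ 3 ∷ 0 ∷ []) ∷ iso 4 (3 ∷ 4 ∷ 5 ∷ 0 ∷ 2 ∷ 1 ∷ []) ∷
  iso 2 (0 ∷ 2 ∷ 4 ∷ 5 ∷ 3 ∷ 1 ∷ []) ∷ iso 0 (1 ∷ 4 ∷ 2 ∷ 0 ∷ 3 ∷ 5 ∷ []) ∷ iso 0 (1 ∷ 3 ∷ 0 ∷ 2 ∷ 4 ∷ 5 ∷ []) ∷ iso 1 (1 ∷ 3 ∷ 0 ∷ 2 ∷ 5 ∷ 4 ∷ []) ∷ good 1469 ∷ good 358 ∷ good 1438 ∷ iso 3 (2 ∷ 1 ∷ 0 ∷ 5 ∷ 4 ∷ 3 ∷ []) ∷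
  good 417 ∷ good 812 ∷ good 845 ∷ iso 4 (4 ∷ 2 ∷ 5 ∷ 3 ∷ 0 ∷ 1 ∷ []) ∷ good 236 ∷ good 209 ∷ iso 1 (0 ∷ 5 ∷ 2 ∷ 1 ∷ 4 ∷ 3 ∷ []) ∷ good 188 ∷
  good 406 ∷ good 1428 ∷ good 978 ∷ iso 2 (0 ∷ 2 ∷ 5 ∷ 4 ∷ 3 ∷ 1 ∷ []) ∷ iso 0 (1 ∷ 4 ∷ 3 ∷ 0 ∷ 2 ∷ 5 ∷ []) ∷ iso 3 (4 ∷ 1 ∷ 3 ∷ 5 ∷ 2 ∷ 0 ∷ []) ∷ iso 4 (2 ∷ 4 ∷ 5 ∷ 0 ∷ 3 ∷ 1 ∷ []) ∷ iso 0 (1 ∷ 2 ∷ 0 ∷ 3 ∷ 4 ∷ 5 ∷ []) ∷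
  iso 1 (1 ∷ 2 ∷ 0 ∷ 3 ∷ 5 ∷ 4 ∷ []) ∷ good 337 ∷ good 601 ∷ good 3717 ∷ good 241 ∷ good 5734 ∷ good 2218 ∷ good 2740 ∷
  good 917 ∷ good 6689 ∷ good 331 ∷ good 3964 ∷ good 441 ∷ good 862 ∷ good 398 ∷ good 1262 ∷
  good 26 ∷ good 830 ∷ good 869 ∷ good 1689 ∷ good 2819 ∷ good 1557 ∷ good 3406 ∷ good 613 ∷
  good 346 ∷ good 1402 ∷ good 1574 ∷ good 3225 ∷ good 2786 ∷ good 338 ∷ good 3870 ∷ good 1685 ∷
  good 1660 ∷ good 305 ∷ good 1799 ∷ good 410 ∷ good 73 ∷ good 209 ∷ good 1969 ∷ iso 3 (1 ∷ 0 ∷ 2 ∷ 4 ∷ 5 ∷ 3 ∷ []) ∷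
  good 310 ∷ good 3946 ∷ good 346 ∷ good 1708 ∷ good 986 ∷ good 553 ∷ good 1937 ∷ iso 3 (1 ∷ 2 ∷ 0 ∷ 4 ∷ 5 ∷ 3 ∷ []) ∷
  good 54 ∷ good 7878 ∷ good 565 ∷ good 722 ∷ good 1969 ∷ good 1050 ∷ good 1628 ∷ good 1107 ∷
  good 838 ∷ good 700 ∷ good 354 ∷ good 1923 ∷ good 881 ∷ good 481 ∷ good 242 ∷ good 241 ∷
  good 3114 ∷ good 1974 ∷ good 1724 ∷ good 470 ∷ good 350 ∷ good 206 ∷ good 557 ∷ good 242 ∷
  good 837 ∷ good 826 ∷ good 1692 ∷ good 105 ∷ good 843 ∷ good 1516 ∷ good 779 ∷ iso 3 (4 ∷ 0 ∷ 1 ∷ 5 ∷ 3 ∷ 2 ∷ []) ∷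
  iso 4 (3 ∷ 4 ∷ 5 ∷ 2 ∷ 1 ∷ 0 ∷ []) ∷ good 1697 ∷ iso 3 (3 ∷ 0 ∷ 2 ∷ 5 ∷ 4 ∷ 1 ∷ []) ∷ good 565 ∷ iso 4 (4 ∷ 3 ∷ 5 ∷ 1 ∷ 2 ∷ 0 ∷ []) ∷ iso 2 (1 ∷ 2 ∷ 3 ∷ 5 ∷ 4 ∷ 0 ∷ []) ∷ iso 0 (0 ∷ 4 ∷ 1 ∷ 2 ∷ 3 ∷ 5 ∷ []) ∷ iso 0 (0 ∷ 3 ∷ 2 ∷ 1 ∷ 4 ∷ 5 ∷ []) ∷
  good 1635 ∷ good 841 ∷ good 860 ∷ good 150 ∷ iso 1 (0 ∷ 3 ∷ 2 ∷ 1 ∷ 5 ∷ 4 ∷ []) ∷ iso 1 (0 ∷ 4 ∷ 1 ∷ 2 ∷ 5 ∷ 3 ∷ []) ∷ good 7794 ∷ good 3110 ∷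
  good 3527 ∷ good 1675 ∷ good 2028 ∷ good 1566 ∷ good 2035 ∷ iso 3 (3 ∷ 0 ∷ 2 ∷ 4 ∷ 5 ∷ 1 ∷ []) ∷ good 3366 ∷ good 281 ∷
  good 81 ∷ good 970 ∷ good 1939 ∷ good 242 ∷ good 241 ∷ good 2139 ∷ good 1709 ∷ good 1610 ∷
  iso 3 (3 ∷ 2 ∷ 0 ∷ 4 ∷ 5 ∷ 1 ∷ []) ∷ good 1652 ∷ good 781 ∷ good 905 ∷ good 974 ∷ good 2614 ∷ good 419 ∷ good 1110 ∷
  good 333 ∷ good 1434 ∷ good 147 ∷ good 690 ∷ iso 4 (5 ∷ 3 ∷ 4 ∷ 1 ∷ 2 ∷ 0 ∷ []) ∷ good 1772 ∷ good 206 ∷ good 988 ∷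
  good 409 ∷ good 149 ∷ iso 4 (5 ∷ 1 ∷ 4 ∷ 3 ∷ 2 ∷ 0 ∷ []) ∷ iso 4 (5 ∷ 1 ∷ 3 ∷ 4 ∷ 2 ∷ 0 ∷ []) ∷ good 468 ∷ good 202 ∷ good 721 ∷ iso 4 (5 ∷ 3 ∷ 4 ∷ 1 ∷ 0 ∷ 2 ∷ []) ∷
  good 846 ∷ iso 4 (5 ∷ 1 ∷ 4 ∷ 3 ∷ 0 ∷ 2 ∷ []) ∷ iso 4 (5 ∷ 1 ∷ 3 ∷ 4 ∷ 0 ∷ 2 ∷ []) ∷ good 3371 ∷ good 1769 ∷ good 1628 ∷ iso 3 (1 ∷ 0 ∷ 2 ∷ 5 ∷ 4 ∷ 3 ∷ []) ∷ good 1978 ∷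
  good 779 ∷ iso 2 (1 ∷ 2 ∷ 3 ∷ 4 ∷ 5 ∷ 0 ∷ []) ∷ iso 0 (0 ∷ 4 ∷ 3 ∷ 2 ∷ 1 ∷ 5 ∷ []) ∷ good 1926 ∷ good 179 ∷ good 60 ∷ iso 4 (4 ∷ 1 ∷ 5 ∷ 3 ∷ 2 ∷ 0 ∷ []) ∷ iso 3 (4 ∷ 0 ∷ 3 ∷ 5 ∷ 1 ∷ 2 ∷ []) ∷
  iso 4 (1 ∷ 4 ∷ 5 ∷ 2 ∷ 3 ∷ 0 ∷ []) ∷ iso 0 (0 ∷ 1 ∷ 2 ∷ 3 ∷ 4 ∷ 5 ∷ []) ∷ good 1539 ∷ good 179 ∷ iso 1 (0 ∷ 4 ∷ 3 ∷ 2 ∷ 5 ∷ 1 ∷ []) ∷ good 781 ∷ good 389 ∷ iso 1 (0 ∷ 1 ∷ 2 ∷ 3 ∷ 5 ∷ 4 ∷ []) ∷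
  good 6799 ∷ good 2523 ∷ good 3437 ∷ good 947 ∷ good 4092 ∷ good 2022 ∷ good 395 ∷ good 837 ∷
  good 2332 ∷ good 283 ∷ good 1621 ∷ good 781 ∷ good 81 ∷ good 777 ∷ good 219 ∷ good 1802 ∷
  good 1939 ∷ good 782 ∷ good 915 ∷ good 474 ∷ good 914 ∷ good 141 ∷ good 549 ∷ good 54 ∷
  good 2182 ∷ good 295 ∷ good 1978 ∷ good 51 ∷ good 1635 ∷ good 554 ∷ good 835 ∷ good 421 ∷
  good 1618 ∷ iso 3 (3 ∷ 2 ∷ 0 ∷ 5 ∷ 4 ∷ 1 ∷ []) ∷ good 982 ∷ iso 4 (4 ∷ 3 ∷ 5 ∷ 1 ∷ 0 ∷ 2 ∷ []) ∷ iso 1 (0 ∷ 5 ∷ 3 ∷ 2 ∷ 4 ∷ 1 ∷ []) ∷ good 391 ∷ good 853 ∷ iso 3 (4 ∷ 2 ∷ 1 ∷ 5 ∷ 3 ∷ 0 ∷ []) ∷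
  iso 4 (3 ∷ 4 ∷ 5 ∷ 0 ∷ 1 ∷ 2 ∷ []) ∷ iso 1 (1 ∷ 5 ∷ 4 ∷ 2 ∷ 3 ∷ 0 ∷ []) ∷ iso 2 (0 ∷ 1 ∷ 4 ∷ 5 ∷ 3 ∷ 2 ∷ []) ∷ iso 0 (2 ∷ 4 ∷ 1 ∷ 0 ∷ 3 ∷ 5 ∷ []) ∷ iso 0 (2 ∷ 3 ∷ 0 ∷ 1 ∷ 4 ∷ 5 ∷ []) ∷ good 331 ∷ good 358 ∷ good 1945 ∷
  iso 3 (1 ∷ 2 ∷ 0 ∷ 5 ∷ 4 ∷ 3 ∷ []) ∷ good 953 ∷ good 972 ∷ iso 1 (0 ∷ 5 ∷ 1 ∷ 2 ∷ 4 ∷ 3 ∷ []) ∷ good 391 ∷ good 172 ∷ good 35 ∷ iso 4 (4 ∷ 1 ∷ 5 ∷ 3 ∷ 0 ∷ 2 ∷ []) ∷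
  good 882 ∷ good 442 ∷ good 1641 ∷ good 721 ∷ iso 2 (0 ∷ 1 ∷ 5 ∷ 4 ∷ 3 ∷ 2 ∷ []) ∷ iso 0 (2 ∷ 4 ∷ 3 ∷ 0 ∷ 1 ∷ 5 ∷ []) ∷ iso 3 (4 ∷ 2 ∷ 3 ∷ 5 ∷ 1 ∷ 0 ∷ []) ∷ iso 4 (1 ∷ 4 ∷ 5 ∷ 0 ∷ 3 ∷ 2 ∷ []) ∷
  iso 0 (2 ∷ 1 ∷ 0 ∷ 3 ∷ 4 ∷ 5 ∷ []) ∷ iso 1 (2 ∷ 1 ∷ 0 ∷ 3 ∷ 5 ∷ 4 ∷ []) ∷ good 568 ∷ good 7894 ∷ good 4647 ∷ good 2204 ∷ good 4786 ∷ good 3122 ∷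
  good 3107 ∷ good 1686 ∷ good 124 ∷ good 2267 ∷ good 1305 ∷ good 393 ∷ good 2186 ∷ good 1946 ∷
  good 1922 ∷ good 2205 ∷ good 658 ∷ good 1946 ∷ good 2835 ∷ good 285 ∷ good 1770 ∷ good 1133 ∷
  good 410 ∷ good 654 ∷ good 1353 ∷ good 3541 ∷ good 3369 ∷ good 1321 ∷ good 1139 ∷ good 760 ∷
  good 1633 ∷ good 1635 ∷ good 325 ∷ good 1611 ∷ good 27 ∷ good 1362 ∷ good 201 ∷ good 325 ∷
  good 444 ∷ good 590 ∷ good 914 ∷ good 846 ∷ good 1697 ∷ iso 3 (0 ∷ 1 ∷ 2 ∷ 4 ∷ 5 ∷ 3 ∷ []) ∷ good 37 ∷ good 1724 ∷
  iso 3 (0 ∷ 2 ∷ 1 ∷ 4 ∷ 5 ∷ 3 ∷ []) ∷ good 945 ∷ good 5202 ∷ good 2248 ∷ good 676 ∷ good 941 ∷ good 692 ∷ good 1748 ∷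
  good 275 ∷ good 37 ∷ good 643 ∷ good 286 ∷ good 267 ∷ good 569 ∷ good 1644 ∷ good 177 ∷
  good 3529 ∷ good 1970 ∷ good 1566 ∷ good 470 ∷ good 78 ∷ good 985 ∷ good 374 ∷ good 406 ∷
  good 141 ∷ good 470 ∷ good 2243 ∷ good 346 ∷ good 1682 ∷ good 209 ∷ good 365 ∷ good 202 ∷
  iso 3 (4 ∷ 1 ∷ 0 ∷ 5 ∷ 3 ∷ 2 ∷ []) ∷ iso 4 (3 ∷ 4 ∷ 5 ∷ 2 ∷ 0 ∷ 1 ∷ []) ∷ good 917 ∷ good 45 ∷ good 810 ∷ good 281 ∷ iso 1 (0 ∷ 5 ∷ 4 ∷ 1 ∷ 3 ∷ 2 ∷ []) ∷ good 92 ∷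
  iso 3 (3 ∷ 1 ∷ 2 ∷ 5 ∷ 4 ∷ 0 ∷ []) ∷ good 45 ∷ iso 4 (4 ∷ 3 ∷ 5 ∷ 0 ∷ 2 ∷ 1 ∷ []) ∷ iso 2 (0 ∷ 2 ∷ 3 ∷ 5 ∷ 4 ∷ 1 ∷ []) ∷ iso 0 (1 ∷ 4 ∷ 0 ∷ 2 ∷ 3 ∷ 5 ∷ []) ∷ iso 0 (1 ∷ 3 ∷ 2 ∷ 0 ∷ 4 ∷ 5 ∷ []) ∷ iso 1 (1 ∷ 4 ∷ 0 ∷ 2 ∷ 5 ∷ 3 ∷ []) ∷ good 6602 ∷
  good 3131 ∷ good 3217 ∷ good 1564 ∷ good 1997 ∷ good 334 ∷ good 9 ∷ good 325 ∷ good 932 ∷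
  good 1642 ∷ good 330 ∷ good 37 ∷ good 1566 ∷ good 809 ∷ good 873 ∷ good 77 ∷ good 1709 ∷
  good 38 ∷ good 1396 ∷ good 137 ∷ good 949 ∷ good 465 ∷ good 214 ∷ good 698 ∷ good 3670 ∷
  good 409 ∷ good 1644 ∷ good 558 ∷ good 938 ∷ good 469 ∷ good 554 ∷ good 21 ∷ good 391 ∷
  good 982 ∷ iso 3 (4 ∷ 2 ∷ 0 ∷ 5 ∷ 3 ∷ 1 ∷ []) ∷ iso 4 (3 ∷ 4 ∷ 5 ∷ 1 ∷ 0 ∷ 2 ∷ []) ∷ iso 1 (0 ∷ 5 ∷ 4 ∷ 2 ∷ 3 ∷ 1 ∷ []) ∷ good 1958 ∷ iso 3 (3 ∷ 2 ∷ 1 ∷ 5 ∷ 4 ∷ 0 ∷ []) ∷ good 946 ∷ iso 4 (4 ∷ 3 ∷ 5 ∷ 0 ∷ 1 ∷ 2 ∷ []) ∷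
  iso 1 (1 ∷ 5 ∷ 3 ∷ 2 ∷ 4 ∷ 0 ∷ []) ∷ iso 2 (0 ∷ 1 ∷ 3 ∷ 5 ∷ 4 ∷ 2 ∷ []) ∷ iso 0 (2 ∷ 4 ∷ 0 ∷ 1 ∷ 3 ∷ 5 ∷ []) ∷ iso 0 (2 ∷ 3 ∷ 1 ∷ 0 ∷ 4 ∷ 5 ∷ []) ∷ good 7948 ∷ good 3270 ∷ good 3365 ∷ good 283 ∷
  good 2778 ∷ good 396 ∷ good 649 ∷ iso 3 (3 ∷ 1 ∷ 2 ∷ 4 ∷ 5 ∷ 0 ∷ []) ∷ good 1897 ∷ good 1934 ∷ good 365 ∷ iso 3 (3 ∷ 2 ∷ 1 ∷ 4 ∷ 5 ∷ 0 ∷ []) ∷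
  good 741 ∷ good 405 ∷ good 1682 ∷ good 185 ∷ good 1033 ∷ good 886 ∷ good 241 ∷ good 1653 ∷
  good 550 ∷ good 817 ∷ good 505 ∷ good 3286 ∷ good 1115 ∷ good 1113 ∷ good 179 ∷ good 1788 ∷
  good 554 ∷ good 835 ∷ iso 4 (5 ∷ 3 ∷ 4 ∷ 0 ∷ 2 ∷ 1 ∷ []) ∷ good 1764 ∷ good 466 ∷ good 686 ∷ iso 4 (5 ∷ 3 ∷ 4 ∷ 0 ∷ 1 ∷ 2 ∷ []) ∷ good 1114 ∷
  good 849 ∷ good 842 ∷ good 89 ∷ good 177 ∷ iso 4 (5 ∷ 0 ∷ 4 ∷ 3 ∷ 2 ∷ 1 ∷ []) ∷ iso 4 (5 ∷ 0 ∷ 3 ∷ 4 ∷ 2 ∷ 1 ∷ []) ∷ good 206 ∷ iso 4 (5 ∷ 0 ∷ 4 ∷ 3 ∷ 1 ∷ 2 ∷ []) ∷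
  iso 4 (5 ∷ 0 ∷ 3 ∷ 4 ∷ 1 ∷ 2 ∷ []) ∷ good 565 ∷ good 1558 ∷ good 355 ∷ iso 3 (0 ∷ 1 ∷ 2 ∷ 5 ∷ 4 ∷ 3 ∷ []) ∷ good 377 ∷ good 139 ∷ iso 2 (0 ∷ 2 ∷ 3 ∷ 4 ∷ 5 ∷ 1 ∷ []) ∷
  iso 0 (1 ∷ 4 ∷ 3 ∷ 2 ∷ 0 ∷ 5 ∷ []) ∷ good 1637 ∷ good 819 ∷ iso 1 (1 ∷ 4 ∷ 3 ∷ 2 ∷ 5 ∷ 0 ∷ []) ∷ good 939 ∷ good 557 ∷ good 849 ∷ iso 4 (4 ∷ 0 ∷ 5 ∷ 3 ∷ 2 ∷ 1 ∷ []) ∷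
  iso 3 (4 ∷ 1 ∷ 3 ∷ 5 ∷ 0 ∷ 2 ∷ []) ∷ iso 4 (0 ∷ 4 ∷ 5 ∷ 2 ∷ 3 ∷ 1 ∷ []) ∷ iso 0 (1 ∷ 0 ∷ 2 ∷ 3 ∷ 4 ∷ 5 ∷ []) ∷ good 469 ∷ good 442 ∷ iso 1 (1 ∷ 0 ∷ 2 ∷ 3 ∷ 5 ∷ 4 ∷ []) ∷ good 1541 ∷ good 673 ∷
  good 925 ∷ iso 3 (0 ∷ 2 ∷ 1 ∷ 5 ∷ 4 ∷ 3 ∷ []) ∷ good 1366 ∷ good 460 ∷ iso 1 (1 ∷ 5 ∷ 0 ∷ 2 ∷ 4 ∷ 3 ∷ []) ∷ good 1125 ∷ good 779 ∷ iso 2 (0 ∷ 1 ∷ 3 ∷ 4 ∷ 5 ∷ 2 ∷ []) ∷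
  iso 0 (2 ∷ 4 ∷ 3 ∷ 1 ∷ 0 ∷ 5 ∷ []) ∷ good 259 ∷ good 561 ∷ good 178 ∷ iso 4 (4 ∷ 0 ∷ 5 ∷ 3 ∷ 1 ∷ 2 ∷ []) ∷ good 781 ∷ good 389 ∷ iso 3 (4 ∷ 2 ∷ 3 ∷ 5 ∷ 0 ∷ 1 ∷ []) ∷
  iso 4 (0 ∷ 4 ∷ 5 ∷ 1 ∷ 3 ∷ 2 ∷ []) ∷ iso 0 (2 ∷ 0 ∷ 1 ∷ 3 ∷ 4 ∷ 5 ∷ []) ∷ iso 1 (2 ∷ 0 ∷ 1 ∷ 3 ∷ 5 ∷ 4 ∷ []) ∷
  []

fanᵗ : Table
fanᵗ = table fanᵉ
  (461 ∷ 1949 ∷ 1926 ∷ 1934 ∷ 422 ∷ 982 ∷ 974 ∷ 841 ∷ 453 ∷ [])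
  ((good 3890 ∷ good 6858 ∷ good 4265 ∷ good 4758 ∷ good 341 ∷ good 457 ∷ good 7350 ∷ good 7350 ∷ good 5302 ∷ good 5813 ∷ good 5782 ∷ []) ∷
   (good 7330 ∷ good 858 ∷ good 5301 ∷ good 917 ∷ good 7925 ∷ good 3365 ∷ good 1445 ∷ good 854 ∷ good 7241 ∷ good 3369 ∷ good 2405 ∷ []) ∷
   (good 4818 ∷ good 2405 ∷ good 1382 ∷ good 853 ∷ good 7925 ∷ good 4762 ∷ good 297 ∷ good 7397 ∷ good 7705 ∷ good 3861 ∷ good 2345 ∷ []) ∷
   (good 7334 ∷ good 421 ∷ good 6342 ∷ good 4294 ∷ good 422 ∷ good 6869 ∷ good 4521 ∷ good 3369 ∷ good 393 ∷ good 7705 ∷ good 4953 ∷ []) ∷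
   (good 5282 ∷ good 6746 ∷ good 3178 ∷ good 1317 ∷ good 1445 ∷ good 3673 ∷ good 921 ∷ good 7337 ∷ good 1194 ∷ good 3609 ∷ good 4517 ∷ []) ∷
   (good 4262 ∷ iso 0 (5 ∷ 4 ∷ 3 ∷ 2 ∷ 7 ∷ 6 ∷ 1 ∷ 0 ∷ []) ∷ good 4262 ∷ good 2405 ∷ good 7706 ∷ good 3897 ∷ good 5541 ∷ good 3930 ∷ good 7273 ∷ good 2906 ∷ good 6374 ∷ []) ∷
   (good 7738 ∷ good 6221 ∷ good 7269 ∷ good 4294 ∷ good 3430 ∷ good 4266 ∷ good 3925 ∷ good 5782 ∷ good 7765 ∷ good 2409 ∷ good 7766 ∷ []) ∷
   (good 4298 ∷ good 7802 ∷ good 422 ∷ good 6342 ∷ good 3893 ∷ good 3929 ∷ good 6341 ∷ good 3862 ∷ good 7802 ∷ good 6873 ∷ good 389 ∷ []) ∷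
   (iso 0 (1 ∷ 2 ∷ 3 ∷ 4 ∷ 7 ∷ 6 ∷ 5 ∷ 0 ∷ []) ∷ good 7338 ∷ good 6361 ∷ good 3926 ∷ good 6873 ∷ good 1318 ∷ good 854 ∷ good 7337 ∷ good 325 ∷ good 7865 ∷ good 7866 ∷ []) ∷ [])
  (1837 ∷ 558 ∷ 13961 ∷ 1962 ∷ 1613 ∷ 12726 ∷ 12110 ∷ 4749 ∷ 782 ∷ 910 ∷ 15789 ∷ 3698 ∷ [])
  18 349

zigzagᵗ : Table
zigzagᵗ = table zigzagᵉ
  (1770 ∷ 514 ∷ 509 ∷ 737 ∷ 13 ∷ 13 ∷ 13 ∷ 98 ∷ 2034 ∷ [])
  ((good 1141 ∷ good 1098 ∷ good 6134 ∷ good 6102 ∷ good 7161 ∷ iso 0 (6 ∷ 1 ∷ 2 ∷ 3 ∷ 7 ∷ 4 ∷ 5 ∷ 0 ∷ []) ∷ good 7158 ∷ good 4725 ∷ good 1109 ∷ good 1030 ∷ good 7082 ∷ []) ∷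
   (good 2086 ∷ good 6105 ∷ good 7097 ∷ good 6134 ∷ good 6106 ∷ good 2041 ∷ good 2042 ∷ good 3462 ∷ good 57 ∷ good 121 ∷ good 2438 ∷ []) ∷
   (good 2038 ∷ good 8073 ∷ good 8149 ∷ good 6137 ∷ good 4154 ∷ good 2441 ∷ good 117 ∷ good 7689 ∷ good 118 ∷ good 2954 ∷ good 8133 ∷ []) ∷
   (good 6149 ∷ good 2314 ∷ iso 0 (6 ∷ 4 ∷ 5 ∷ 0 ∷ 7 ∷ 1 ∷ 2 ∷ 3 ∷ []) ∷ good 6153 ∷ good 2038 ∷ good 1269 ∷ good 5241 ∷ good 5753 ∷ good 2313 ∷ good 4089 ∷ good 5878 ∷ []) ∷
   (good 2041 ∷ good 262 ∷ good 7161 ∷ good 6149 ∷ good 6149 ∷ good 8181 ∷ good 2954 ∷ good 9 ∷ good 5238 ∷ good 6661 ∷ good 6661 ∷ []) ∷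
   (good 7161 ∷ good 1090 ∷ good 1030 ∷ good 2053 ∷ good 6138 ∷ good 5242 ∷ good 2442 ∷ good 4729 ∷ good 122 ∷ good 6138 ∷ good 3465 ∷ []) ∷
   (good 7093 ∷ good 7098 ∷ good 1109 ∷ good 1029 ∷ good 2438 ∷ good 2310 ∷ good 8182 ∷ good 57 ∷ good 6133 ∷ good 2950 ∷ good 2054 ∷ []) ∷
   (good 6665 ∷ good 58 ∷ good 7065 ∷ good 6149 ∷ good 1094 ∷ good 7049 ∷ good 1033 ∷ good 5749 ∷ good 57 ∷ good 1098 ∷ good 7798 ∷ []) ∷
   (good 1533 ∷ good 6157 ∷ good 1029 ∷ good 2437 ∷ good 5754 ∷ good 2826 ∷ good 2438 ∷ good 6133 ∷ good 2042 ∷ good 7801 ∷ good 393 ∷ []) ∷ [])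
  (16178 ∷ 1005 ∷ 13297 ∷ 13358 ∷ 10418 ∷ 14289 ∷ 2446 ∷ 498 ∷ 12298 ∷ 494 ∷ 5681 ∷ 3689 ∷ [])
  0 475

wheelᵗ : Table
wheelᵗ = table wheelᵉ
  (1450 ∷ 2314 ∷ 1653 ∷ 3437 ∷ 914 ∷ 2041 ∷ 2625 ∷ 3394 ∷ 1190 ∷ 642 ∷ [])
  ((good 15757 ∷ good 1653 ∷ good 5862 ∷ good 11257 ∷ good 5637 ∷ good 14806 ∷ good 5669 ∷ good 5685 ∷ good 10517 ∷ good 14602 ∷ good 6665 ∷ good 8761 ∷ []) ∷
   (good 13321 ∷ good 9722 ∷ good 2758 ∷ good 10714 ∷ good 6282 ∷ good 9594 ∷ good 13706 ∷ good 9722 ∷ good 6805 ∷ good 2506 ∷ good 1574 ∷ good 9530 ∷ []) ∷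
   (good 9769 ∷ good 12294 ∷ good 3818 ∷ good 6342 ∷ good 8761 ∷ good 12554 ∷ good 13622 ∷ good 5350 ∷ good 5653 ∷ good 8757 ∷ good 2630 ∷ good 9253 ∷ []) ∷
   (good 8725 ∷ good 12554 ∷ good 3705 ∷ good 11365 ∷ good 13577 ∷ good 7626 ∷ good 6602 ∷ good 10518 ∷ good 9525 ∷ good 12821 ∷ good 6857 ∷ good 8730 ∷ []) ∷
   (good 14813 ∷ good 9014 ∷ good 14810 ∷ good 11722 ∷ good 12825 ∷ good 7369 ∷ good 5605 ∷ good 9510 ∷ good 6598 ∷ good 12570 ∷ good 10313 ∷ good 2809 ∷ []) ∷
   (good 5510 ∷ good 2637 ∷ good 634 ∷ good 1253 ∷ good 4505 ∷ good 1545 ∷ good 6278 ∷ good 8757 ∷ good 9273 ∷ good 9509 ∷ good 14873 ∷ good 5638 ∷ []) ∷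
   (good 10601 ∷ good 6282 ∷ good 5285 ∷ good 3658 ∷ good 3782 ∷ good 10841 ∷ good 3829 ∷ good 3669 ∷ good 4633 ∷ good 7365 ∷ good 10522 ∷ good 11626 ∷ []) ∷
   (good 14738 ∷ good 3830 ∷ good 9717 ∷ good 10713 ∷ good 13321 ∷ good 13737 ∷ good 601 ∷ good 1782 ∷ good 5641 ∷ good 13626 ∷ good 15749 ∷ good 3526 ∷ []) ∷
   (good 13741 ∷ good 2762 ∷ good 4490 ∷ good 10869 ∷ good 9766 ∷ good 4618 ∷ good 8822 ∷ good 13738 ∷ good 10581 ∷ good 13750 ∷ good 10522 ∷ good 11721 ∷ []) ∷
   (good 7122 ∷ good 2522 ∷ good 3177 ∷ good 2649 ∷ good 14138 ∷ good 13862 ∷ good 7398 ∷ good 10505 ∷ good 9770 ∷ good 7878 ∷ good 2694 ∷ good 5801 ∷ []) ∷ [])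
  ([])
  35 1015

hatᵗ : Table
hatᵗ = table hatᵉ
  (93 ∷ 2170 ∷ 857 ∷ 3161 ∷ 2293 ∷ 2110 ∷ 3254 ∷ 3685 ∷ 1913 ∷ 3209 ∷ [])
  ((good 3622 ∷ good 12578 ∷ good 8873 ∷ good 15622 ∷ good 7834 ∷ good 7514 ∷ good 3413 ∷ good 8949 ∷ good 14762 ∷ good 3402 ∷ good 8886 ∷ good 8997 ∷ []) ∷
   (good 13014 ∷ good 601 ∷ good 8549 ∷ good 15705 ∷ good 3561 ∷ good 649 ∷ good 3753 ∷ good 985 ∷ good 8522 ∷ good 3798 ∷ good 12441 ∷ good 15626 ∷ []) ∷
   (good 7718 ∷ good 15906 ∷ good 7833 ∷ good 602 ∷ good 3286 ∷ good 681 ∷ good 8857 ∷ good 15781 ∷ good 1381 ∷ good 729 ∷ good 12554 ∷ good 3433 ∷ []) ∷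
   (good 15705 ∷ good 16133 ∷ good 7834 ∷ good 554 ∷ good 726 ∷ good 15573 ∷ good 15622 ∷ good 8921 ∷ good 3769 ∷ good 233 ∷ good 7829 ∷ good 8549 ∷ []) ∷
   (good 3926 ∷ good 13222 ∷ good 3113 ∷ good 3925 ∷ good 3754 ∷ good 3318 ∷ good 8549 ∷ good 3941 ∷ good 8745 ∷ good 12581 ∷ good 7641 ∷ good 3590 ∷ []) ∷
   (good 13142 ∷ good 15897 ∷ good 12442 ∷ good 3942 ∷ good 15657 ∷ good 13269 ∷ good 12826 ∷ good 518 ∷ good 602 ∷ good 233 ∷ good 250 ∷ good 8533 ∷ []) ∷
   (good 13861 ∷ good 8538 ∷ good 14890 ∷ good 15782 ∷ good 8949 ∷ good 14490 ∷ good 13065 ∷ good 8874 ∷ good 746 ∷ good 14665 ∷ good 12565 ∷ good 5926 ∷ []) ∷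
   (good 8854 ∷ good 15645 ∷ good 3402 ∷ good 357 ∷ good 3626 ∷ good 12581 ∷ good 8789 ∷ good 7322 ∷ good 3625 ∷ good 13578 ∷ good 13125 ∷ good 726 ∷ []) ∷
   (good 15770 ∷ good 3842 ∷ good 12842 ∷ good 15865 ∷ good 3321 ∷ good 8490 ∷ good 3801 ∷ good 12582 ∷ good 13014 ∷ good 870 ∷ good 7897 ∷ good 361 ∷ []) ∷
   (good 9029 ∷ good 3733 ∷ good 3754 ∷ good 8405 ∷ good 486 ∷ good 681 ∷ good 7466 ∷ good 3286 ∷ good 15014 ∷ good 12953 ∷ good 7461 ∷ good 16137 ∷ []) ∷ [])
  (25198 ∷ 19790 ∷ 3406 ∷ 15178 ∷ 29165 ∷ 24753 ∷ [])
  13 895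

bookᵗ : Table
bookᵗ = table bookᵉ
  (1445 ∷ 1894 ∷ 618 ∷ 582 ∷ 1302 ∷ 1753 ∷ 106 ∷ 601 ∷ 601 ∷ [])
  ((good 5782 ∷ good 5805 ∷ good 4453 ∷ good 5813 ∷ good 2662 ∷ good 613 ∷ good 166 ∷ good 2469 ∷ good 5722 ∷ good 2469 ∷ good 2661 ∷ []) ∷
   (good 4454 ∷ good 3734 ∷ good 2662 ∷ good 7573 ∷ good 5450 ∷ good 2789 ∷ good 2697 ∷ good 2633 ∷ good 678 ∷ good 7769 ∷ good 682 ∷ []) ∷
   (good 5401 ∷ good 2669 ∷ good 617 ∷ good 5722 ∷ good 7514 ∷ good 7514 ∷ good 5401 ∷ good 2965 ∷ good 554 ∷ good 2662 ∷ good 6425 ∷ []) ∷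
   (good 5542 ∷ good 425 ∷ good 421 ∷ good 2681 ∷ good 2730 ∷ good 7770 ∷ good 4458 ∷ good 2454 ∷ good 1690 ∷ good 2789 ∷ good 2729 ∷ []) ∷
   (good 3734 ∷ good 1941 ∷ good 5718 ∷ good 7514 ∷ good 2665 ∷ good 2330 ∷ good 5718 ∷ good 5274 ∷ good 4454 ∷ good 5461 ∷ good 3734 ∷ []) ∷
   (good 1958 ∷ good 418 ∷ good 2966 ∷ good 2473 ∷ good 2537 ∷ good 5654 ∷ good 1689 ∷ good 2965 ∷ good 7509 ∷ good 5525 ∷ good 5545 ∷ []) ∷
   (good 2405 ∷ good 7510 ∷ good 3718 ∷ good 7605 ∷ good 7766 ∷ good 5530 ∷ good 7509 ∷ good 6501 ∷ good 3733 ∷ good 2709 ∷ good 5530 ∷ []) ∷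
   (good 2649 ∷ good 1682 ∷ good 2378 ∷ good 6490 ∷ good 5529 ∷ good 1702 ∷ good 5721 ∷ good 3734 ∷ good 5782 ∷ good 2725 ∷ good 2646 ∷ []) ∷
   (good 2669 ∷ good 7574 ∷ good 613 ∷ good 2473 ∷ good 7770 ∷ good 677 ∷ good 617 ∷ good 2474 ∷ good 2470 ∷ good 5546 ∷ good 5722 ∷ []) ∷ [])
  (13238 ∷ 13966 ∷ 11541 ∷ 10858 ∷ 849 ∷ 12949 ∷ 905 ∷ 5294 ∷ 1450 ∷ 12970 ∷ 8401 ∷ 5421 ∷ 8402 ∷ 16041 ∷ 5929 ∷ 13038 ∷ 11053 ∷ 10582 ∷ [])
  26 499

eightᵗ : Table
eightᵗ = table eightᵉ
  (3077 ∷ 21117 ∷ 3813 ∷ 14269 ∷ 6394 ∷ 7265 ∷ 4217 ∷ 12161 ∷ 27646 ∷ 7789 ∷ 15885 ∷ 28653 ∷ 28689 ∷ [])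
  ((good 108038 ∷ good 20486 ∷ good 14394 ∷ good 22937 ∷ good 79750 ∷ good 84346 ∷ good 42918 ∷ good 20486 ∷ good 47642 ∷ good 63513 ∷ good 110585 ∷ good 67558 ∷ good 110582 ∷ good 99942 ∷ good 23033 ∷ []) ∷
   (good 14390 ∷ good 81846 ∷ good 100297 ∷ good 77834 ∷ good 52858 ∷ good 108298 ∷ good 83434 ∷ good 29061 ∷ good 57353 ∷ good 81994 ∷ good 79238 ∷ good 79237 ∷ good 31130 ∷ good 53237 ∷ good 122489 ∷ []) ∷
   (good 108133 ∷ good 105494 ∷ good 96758 ∷ good 57898 ∷ good 25002 ∷ good 106453 ∷ good 22937 ∷ good 96313 ∷ good 34313 ∷ good 12293 ∷ good 57957 ∷ good 49077 ∷ good 48694 ∷ good 116854 ∷ good 79897 ∷ []) ∷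
   (good 42506 ∷ good 72853 ∷ good 108165 ∷ good 83050 ∷ good 48790 ∷ good 47765 ∷ good 78858 ∷ good 118393 ∷ good 93561 ∷ good 84213 ∷ good 90341 ∷ good 31129 ∷ good 86009 ∷ good 69366 ∷ good 85238 ∷ []) ∷
   (good 102137 ∷ good 88085 ∷ good 45061 ∷ good 16873 ∷ good 55925 ∷ good 79114 ∷ good 102005 ∷ good 36870 ∷ good 80794 ∷ good 75658 ∷ good 99946 ∷ good 30774 ∷ good 36470 ∷ good 8585 ∷ good 84217 ∷ []) ∷
   (good 40473 ∷ good 12682 ∷ good 38409 ∷ good 16869 ∷ good 75686 ∷ good 126201 ∷ good 78085 ∷ good 110586 ∷ good 67562 ∷ good 106441 ∷ good 55417 ∷ good 48666 ∷ good 20486 ∷ good 88085 ∷ good 105498 ∷ []) ∷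
   (good 10149 ∷ good 41482 ∷ good 28662 ∷ good 51318 ∷ good 100297 ∷ good 106457 ∷ good 46601 ∷ good 85493 ∷ good 74118 ∷ good 20870 ∷ good 60533 ∷ good 41477 ∷ good 91557 ∷ good 22650 ∷ good 24581 ∷ []) ∷
   (good 59493 ∷ good 86042 ∷ good 103961 ∷ good 99945 ∷ good 84086 ∷ good 90101 ∷ good 108538 ∷ good 16458 ∷ good 83045 ∷ good 85493 ∷ good 49242 ∷ good 110533 ∷ good 42890 ∷ good 112153 ∷ good 77797 ∷ []) ∷
   (good 40969 ∷ good 106013 ∷ good 22646 ∷ good 53253 ∷ good 42981 ∷ good 116453 ∷ good 115813 ∷ good 47126 ∷ good 49253 ∷ good 59433 ∷ good 29065 ∷ good 8586 ∷ good 81818 ∷ good 48662 ∷ good 14214 ∷ []) ∷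
   (good 37385 ∷ good 8230 ∷ good 108485 ∷ good 52857 ∷ good 107530 ∷ good 61046 ∷ good 31125 ∷ good 14746 ∷ good 31734 ∷ good 104006 ∷ good 85498 ∷ good 15257 ∷ good 79894 ∷ good 31221 ∷ good 99946 ∷ []) ∷
   (good 17389 ∷ good 96309 ∷ good 84474 ∷ good 53253 ∷ good 99334 ∷ good 47765 ∷ good 78085 ∷ good 30773 ∷ good 114198 ∷ good 111626 ∷ good 20870 ∷ good 103430 ∷ good 39446 ∷ good 110197 ∷ good 56442 ∷ []) ∷
   (good 90213 ∷ good 102010 ∷ good 110586 ∷ good 19450 ∷ good 57349 ∷ good 37638 ∷ good 42886 ∷ good 20485 ∷ good 91237 ∷ good 16458 ∷ good 116709 ∷ good 106006 ∷ good 90598 ∷ good 16454 ∷ good 114581 ∷ []) ∷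
   (good 108418 ∷ good 25578 ∷ good 73626 ∷ good 27638 ∷ good 63605 ∷ good 18409 ∷ good 61049 ∷ good 34762 ∷ good 57337 ∷ good 42505 ∷ good 17381 ∷ good 118774 ∷ good 66665 ∷ good 106393 ∷ good 120389 ∷ []) ∷ [])
  (91154 ∷ 103669 ∷ 252973 ∷ 176301 ∷ 89866 ∷ 57390 ∷ 128813 ∷ 108461 ∷ 8977 ∷ 82962 ∷ 166901 ∷ 176946 ∷ 51154 ∷ 91149 ∷ 105709 ∷ 172178 ∷ 228405 ∷ 228718 ∷ 253673 ∷ 16469 ∷ [])
  56 8021

-- One orientation for each edge that can be added to the eight-vertex graph. Its 15 missing edges
-- are listed in both directions, hence 30 entries.
eight⁺ : List ℕ
eight⁺ =
  10559 ∷ 1650 ∷ 6002 ∷ 12492 ∷ 6413 ∷ 4808 ∷ 3077 ∷ 10639 ∷ 14016 ∷ 6654 ∷ 12952 ∷ 6607 ∷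
  9728 ∷ 7112 ∷ 3903 ∷ 3382 ∷ 2060 ∷ 12480 ∷ 13517 ∷ 13823 ∷ 6604 ∷ 3842 ∷ 1843 ∷ 3133 ∷
  7428 ∷ 2048 ∷ 10686 ∷ 2061 ∷ 14541 ∷ 10227 ∷
  []

pack : ∀ {allowed m h Y} (t : Table) → okTable allowed m h Y t ≡ true → ExtTable allowed m h Y (Table.graph t)
pack (table X a b c d e) ok = extTable a b c d e ok

excs₄ excs₆ : List Edges
excs₄ = K₄⁻ᵉ ∷ K₄ᵉ ∷ []
excs₆ = fanᵉ ∷ zigzagᵉ ∷ wheelᵉ ∷ hatᵉ ∷ bookᵉ ∷ []

abstract
  table₃ : CodeTable 1 2 []
  table₃ = codeTable codes3 refl

  table₄ : CodeTable 2 2 excs₄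
  table₄ = codeTable codes4 refl

  table₅ : CodeTable 3 3 []
  table₅ = codeTable codes5 refl

  table₆ : CodeTable 4 3 excs₆
  table₆ = codeTable codes6 refl

  fan-ext : ExtTable true 6 3 eightᵉ fanᵉ
  fan-ext = pack fanᵗ refl

  zigzag-ext : ExtTable true 6 3 eightᵉ zigzagᵉ
  zigzag-ext = pack zigzagᵗ refl

  wheel-ext : ExtTable true 6 3 eightᵉ wheelᵉ
  wheel-ext = pack wheelᵗ refl

  hat-ext : ExtTable true 6 3 eightᵉ hatᵉ
  hat-ext = pack hatᵗ refl

  book-ext : ExtTable true 6 3 eightᵉ bookᵉ
  book-ext = pack bookᵗ refl

  eight-ext : ExtTable false 8 4 eightᵉ eightᵉ
  eight-ext = pack eightᵗ refl

  eight-edges : EdgeTable 8 4 eightᵉ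
  eight-edges = edgeTable eight⁺ refl

  K₄⁻-four : Certified₄ 4 2 K₄⁻ᵉ
  K₄⁻-four = certified₄ 0 19 refl

  K₄-four : Certified₄ 4 2 K₄ᵉ
  K₄-four = certified₄ 4 31 refl

-- Labelled graphs inside a vertex subset.

ext : ∀ {n} → (ℕ → Fin n) → ℕ → Fin n → ℕ → Fin n
ext f m w i = Data.Bool.if i ≡ᵇ m then w else f i

ext-new : ∀ {n} (f : ℕ → Fin n) m w → ext f m w m ≡ w
ext-new f m w rewrite ≡ᵇ-refl m = refl

ext-old : ∀ {n} (f : ℕ → Fin n) m w {i} → i < m → ext f m w i ≡ f i
ext-old f m w {i} lt rewrite ≡ᵇ-false {i} {m} (λ { refl → <-irrefl refl lt }) = refl

<suc-split : ∀ {i m} → i < suc m → i ≡ m ⊎ i < m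
<suc-split {i} {m} lt with i Data.Nat.≟ m
... | yes e = inj₁ e
... | no ne = inj₂ (≤∧≢⇒< (≤-pred lt) ne)

bounded : ℕ → Edges → Bool
bounded m = allᵇ (λ a → (proj₁ a <ᵇ m) ∧ (proj₂ a <ᵇ m))

bounded-∈ : ∀ {m es i j} → bounded m es ≡ true → (i , j) ∈ es → i < m × j < m
bounded-∈ {m} {es} {i} {j} ok mem = <ᵇ⇒< i m (subst Data.Bool.T (sym (proj₁ x)) tt) , <ᵇ⇒< j m (subst Data.Bool.T (sym (proj₂ x)) tt)
  where x = ∧-true {i <ᵇ m} (allᵇ-∈ {p = λ a → (proj₁ a <ᵇ m) ∧ (proj₂ a <ᵇ m)} ok mem)

eight-bound : ∀ {i j} → (i , j) ∈ eightᵉ → i < 8 × j < 8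
eight-bound = bounded-∈ refl

module _ {n : ℕ} {E : Graph n} {S : Fin n → Bool} where

  emb-sub : ∀ {E' m es} → (∀ x y → E' x y ≡ true → E x y ≡ true) → Emb m es E' S → Emb m es E S
  emb-sub i e = record { Emb e ; edge = λ mem → let a , b , c = Emb.edge e mem in a , b , i _ _ c }

  exact-emb : ∀ {m X} → (∀ {i j} → (i , j) ∈ X → i < m × j < m) → Exact m X E S → Emb m X E S
  exact-emb b e = record { Exact e ; edge = λ mem → let x , y = b mem in x , y , trans (Exact.same e x y) (∨-introˡ (∈-arc mem)) }

  emb-edge : ∀ {m es i j} (e : Emb m es E S) → i < m → j < m → E (Emb.f e i) (Emb.f e j) ≡ true → Emb m ((i , j) ∷ es) E S
  emb-edge e li lj q = record { Emb e ; edge = λ { (here refl) → li , lj , q ; (there mem) → Emb.edge e mem } }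

  emb-ext : ∀ {m es w} (e : Emb m es E (S - w)) → S w ≡ true → ∀ {i j} → i < m → j < m →
            E w (Emb.f e i) ≡ true → E w (Emb.f e j) ≡ true → Emb (suc m) (onEdge m (i , j) es) E S
  emb-ext {m} {es} {w} e sw {i₀} {j₀} li lj ei ej = record { f = g ; inS = inS' ; onto = onto' ; inj = inj' ; edge = edge' }
    where
    open Emb e
    g = ext f m w
    old : ∀ {i} → i < m → g i ≡ f i
    old = ext-old f m w
    inS' : ∀ {i} → i < suc m → S (g i) ≡ true
    inS' lt with <suc-split lt
    ... | inj₁ refl rewrite ext-new f m w = sw
    ... | inj₂ l rewrite old l = -⊆ {S = S} (inS l)
    onto' : ∀ {v} → S v ≡ true → ∃ λ i → i < suc m × g i ≡ v
    onto' {v} sv with v ≟ w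
    ... | yes refl = m , ≤-refl , ext-new f m w
    ... | no ne with onto (-intro {S = S} sv ne)
    ...   | i , l , q = i , m<n⇒m<1+n l , trans (old l) q
    inj' : ∀ {i j} → i < suc m → j < suc m → g i ≡ g j → i ≡ j
    inj' {i} {j} a b q with <suc-split a | <suc-split b
    ... | inj₁ refl | inj₁ refl = refl
    ... | inj₁ refl | inj₂ l = ⊥-elim (-≢ {S = S} (inS l) (trans (sym (old l)) (trans (sym q) (ext-new f m w))))
    ... | inj₂ l | inj₁ refl = ⊥-elim (-≢ {S = S} (inS l) (trans (sym (old l)) (trans q (ext-new f m w))))
    ... | inj₂ l | inj₂ l' = inj l l' (trans (sym (old l)) (trans q (old l')))
    edge' : ∀ {i j} → (i , j) ∈ onEdge m (i₀ , j₀) es → i < suc m × j < suc m × E (g i) (g j) ≡ true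
    edge' (here refl) = ≤-refl , m<n⇒m<1+n li , trans (cong₂ E (ext-new f m w) (old li)) ei
    edge' (there (here refl)) = ≤-refl , m<n⇒m<1+n lj , trans (cong₂ E (ext-new f m w) (old lj)) ej
    edge' (there (there mem)) with edge mem
    ... | a , b , q = m<n⇒m<1+n a , m<n⇒m<1+n b , trans (cong₂ E (old a) (old b)) q

  perm-props : ∀ {m} π → permᵇ m π ≡ true → (∀ {i} → i < m → image π i < m) × (∀ {i} → i < m → ∃ λ j → j < m × image π j ≡ i) ×
               (∀ {i j} → i < m → j < m → image π i ≡ image π j → i ≡ j)
  perm-props {m} π ok = lt , sur , inj
    where
    row : ∀ {i} → i < m → (image π i <ᵇ m) ≡ true × (anyᵇ (λ j → image π j ≡ᵇ i) (upTo m) ≡ true × allᵇ (λ j → (i ≡ᵇ j) ∨ not (image π i ≡ᵇ image π j)) (upTo m) ≡ true)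
    row {i} l = let a , b = ∧-true {image π i <ᵇ m} (allᵇ-∈ ok (∈-upTo⁺ l)) in a , ∧-true b
    lt : ∀ {i} → i < m → image π i < m
    lt {i} l = <ᵇ⇒< (image π i) m (subst Data.Bool.T (sym (proj₁ (row l))) tt)
    sur : ∀ {i} → i < m → ∃ λ j → j < m × image π j ≡ i
    sur {i} l with anyᵇ-elim (upTo m) (proj₁ (proj₂ (row l)))
    ... | j , mem , q = j , ∈-upTo⁻ mem , ≡ᵇ-true q
    inj : ∀ {i j} → i < m → j < m → image π i ≡ image π j → i ≡ j
    inj {i} {j} l l' q with ∨-true {i ≡ᵇ j} (allᵇ-∈ (proj₂ (proj₂ (row l))) (∈-upTo⁺ l'))
    ... | inj₁ z = ≡ᵇ-true z
    ... | inj₂ z = clash (subst (λ y → (image π i ≡ᵇ y) ≡ true) q (≡ᵇ-refl (image π i))) (not-true z)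

fan-bound : ∀ {i j} → (i , j) ∈ fanᵉ → i < 6 × j < 6
fan-bound = bounded-∈ refl

zigzag-bound : ∀ {i j} → (i , j) ∈ zigzagᵉ → i < 6 × j < 6
zigzag-bound = bounded-∈ refl

wheel-bound : ∀ {i j} → (i , j) ∈ wheelᵉ → i < 6 × j < 6
wheel-bound = bounded-∈ refl

hat-bound : ∀ {i j} → (i , j) ∈ hatᵉ → i < 6 × j < 6
hat-bound = bounded-∈ refl

book-bound : ∀ {i j} → (i , j) ∈ bookᵉ → i < 6 × j < 6
book-bound = bounded-∈ refl

Small₆ : Edges → Set
Small₆ X = ExtTable true 6 3 eightᵉ X × (∀ {i j} → (i , j) ∈ X → i < 6 × j < 6)

small₆ : ∀ i → nth excs₆ i ≡ [] ⊎ Small₆ (nth excs₆ i)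
small₆ 0 = inj₂ (fan-ext , fan-bound)
small₆ 1 = inj₂ (zigzag-ext , zigzag-bound)
small₆ 2 = inj₂ (wheel-ext , wheel-bound)
small₆ 3 = inj₂ (hat-ext , hat-bound)
small₆ 4 = inj₂ (book-ext , book-bound)
-- Past the end of the list `nth` returns the empty edge list, which the edge q p will refute.
small₆ (suc (suc (suc (suc (suc i))))) = inj₁ refl

Small₄ : Edges → Set
Small₄ X = Certified₄ 4 2 X × (∀ {i j} → (i , j) ∈ X → i < 4 × j < 4)

small₄ : ∀ i → nth excs₄ i ≡ [] ⊎ Small₄ (nth excs₄ i)
small₄ 0 = inj₂ (K₄⁻-four , bounded-∈ refl)
small₄ 1 = inj₂ (K₄-four , bounded-∈ refl)
small₄ (suc (suc i)) = inj₁ refl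

-- The index j stands for 4 + 2 j vertices and the bound 2 + j, in step with the induction.
Exceptional : ∀ {n} → ℕ → Graph n → (Fin n → Bool) → Set
Exceptional 0 E S = ∃ λ i → Small₄ (nth excs₄ i) × Exact 4 (nth excs₄ i) E S
Exceptional 1 E S = ∃ λ i → Small₆ (nth excs₆ i) × Exact 6 (nth excs₆ i) E S
Exceptional 2 E S = Exact 8 eightᵉ E S
Exceptional _ E S = ⊥

-- Graphs with a vertex order.

-- An order r of the vertices, starting with the edge qp, in which the earlier neighbours
-- of every later vertex induce a nonempty graph without isolated vertices.
module Ordered {n : ℕ} (r : Fin n → ℕ) (r-inj : ∀ {u v} → r u ≡ r v → u ≡ v) (p q : Fin n)
               (p<q : r p < r q) (q-second : ∀ v → v ≢ p → v ≢ q → r q < r v) where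

  record Str (E : Graph n) (S : Fin n → Bool) : Set where
    field
      E-sym : ∀ u v → E u v ≡ E v u
      irr : ∀ u → E u u ≡ false
      p∈ : S p ≡ true
      q∈ : S q ≡ true
      qp : E q p ≡ true
      down : ∀ {v x} → S v ≡ true → E v x ≡ true → r x < r v → S x ≡ true
      base : ∀ {v} → S v ≡ true → v ≢ p → v ≢ q → ∃ λ x → E v x ≡ true × r x < r v
      pair : ∀ {v x} → S v ≡ true → v ≢ p → v ≢ q → E v x ≡ true → r x < r v →
             ∃ λ y → E v y ≡ true × r y < r v × E x y ≡ true

  -- These are the vertices whose deletion keeps all the conditions of `Str`: no remaining vertex
  -- has such a vertex among its earlier neighbours, and the roots stay.
  record End (E : Graph n) (S : Fin n → Bool) (w : Fin n) : Set where
    constructor mkEnd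
    field
      ∈S : S w ≡ true
      ≢p : w ≢ p
      ≢q : w ≢ q
      last : ∀ x → S x ≡ true → E w x ≡ true → r x < r w

  End? : ∀ E S w → Dec (End E S w)
  End? E S w with S w Bool.≟ true | w ≟ p | w ≟ q | all? (λ x → (S x Bool.≟ true) →-dec ((E w x Bool.≟ true) →-dec (r x <? r w)))
  ... | yes a | no b | no c | yes d = yes (mkEnd a b c d)
  ... | no a | _ | _ | _ = no λ e → a (End.∈S e)
  ... | _ | yes b | _ | _ = no λ e → End.≢p e b
  ... | _ | _ | yes c | _ = no λ e → End.≢q e c
  ... | _ | _ | _ | no d = no λ e → d (End.last e)

  module _ {E : Graph n} {S : Fin n → Bool} (str : Str E S) where
    open Str str

    ≢-edge : ∀ {u v} → E u v ≡ true → u ≢ v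
    ≢-edge {u} e refl = clash e (irr u)

    E-flip : ∀ {u v} → E u v ≡ true → E v u ≡ true
    E-flip {u} {v} e = trans (E-sym v u) e

    later : ∀ {u v} → E u v ≡ true → r u < r v ⊎ r v < r u
    later {u} {v} e with <-cmp (r u) (r v)
    ... | tri< a _ _ = inj₁ a
    ... | tri≈ _ b _ = ⊥-elim (≢-edge e (r-inj b))
    ... | tri> _ _ c = inj₂ c

    removeEnd : ∀ {w} → End E S w → Str E (S - w)
    removeEnd {w} e = record
      { E-sym = E-sym ; irr = irr
      ; p∈ = -intro {S = S} p∈ (≢-sym ≢p) ; q∈ = -intro {S = S} q∈ (≢-sym ≢q) ; qp = qp
      ; down = λ {v} {x} sv ex lt → -intro {S = S} (down (-⊆ {S = S} sv) ex lt)
                 λ { refl → <-asym lt (last v (-⊆ {S = S} sv) (E-flip ex)) }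
      ; base = λ sv → base (-⊆ {S = S} sv) ; pair = λ sv → pair (-⊆ {S = S} sv) }
      where open End e

    -- The latest vertex of S apart from p and q qualifies; the roots are no later neighbours since
    -- they come before everything else.
    exists-end : ∀ {k} → size S ≡ 3 + k → ∃ λ w → End E S w
    exists-end {k} sz with argmax r (S - p - q) inhab
      where
      inhab : ∃ λ w → (S - p - q) w ≡ true
      inhab = size-inhabited (S - p - q) {k}
        (suc-injective (suc-injective (trans (sym (cong suc (size-remove (S - p) (-intro {S = S} q∈ λ { refl → <-irrefl refl p<q })))) (trans (sym (size-remove S p∈)) sz))))
    ... | w , sw , mx = w , mkEnd w∈ w≢p w≢q lst
      where
      w∈ : S w ≡ true
      w∈ = -⊆ {S = S} (-⊆ {S = S - p} sw)
      w≢p : w ≢ p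
      w≢p = -≢ {S = S} (-⊆ {S = S - p} sw)
      w≢q : w ≢ q
      w≢q = -≢ {S = S - p} sw
      lst : ∀ x → S x ≡ true → E w x ≡ true → r x < r w
      lst x sx ex with later ex
      ... | inj₂ lt = lt
      ... | inj₁ lt with x ≟ p | x ≟ q
      ...   | yes refl | _ = ⊥-elim (<-asym (<-≤-trans p<q ≤-refl) (≤-trans (q-second w w≢p w≢q) (≤-trans (<⇒≤ lt) ≤-refl)))
      ...   | no _ | yes refl = ⊥-elim (<-asym lt (q-second w w≢p w≢q))
      ...   | no a | no b = ⊥-elim (<-irrefl refl (<-≤-trans lt (mx x (-intro {S = S - p} (-intro {S = S} sx a) b))))

    base₂ : ∀ {v} → S v ≡ true → v ≢ p → v ≢ q → ∃ λ x → ∃ λ y →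
            E v x ≡ true × E v y ≡ true × E x y ≡ true × r x < r v × r y < r v
    base₂ sv a b with base sv a b
    ... | x , ex , lx with pair sv a b ex lx
    ...   | y , ey , ly , exy = x , y , ex , ey , exy , lx , ly

    mate : ∀ {w x} → End E S w → S x ≡ true → E w x ≡ true → ∃ λ y → E w y ≡ true × S y ≡ true × E x y ≡ true
    mate e sx ex with pair (End.∈S e) (End.≢p e) (End.≢q e) ex (End.last e _ sx ex)
    ... | y , ey , ly , exy = y , ey , down (End.∈S e) ey ly , exy

  module Prune (E : Graph n) (u a b : Fin n) where

   abstract
    prune : Graph n
    prune x y = E x y ∧ (ok x y ∧ ok y x)
      where
      ok : Fin n → Fin n → Bool
      ok x y = not (x == u) ∨ ((y == a) ∨ (y == b))

    prune⊆ : ∀ x y → prune x y ≡ true → E x y ≡ true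
    prune⊆ x y e = proj₁ (∧-true e)

    prune-sym : (∀ x y → E x y ≡ E y x) → ∀ x y → prune x y ≡ prune y x
    prune-sym s x y = cong₂ _∧_ (s x y) (Bool.∧-comm (not (x == u) ∨ ((y == a) ∨ (y == b))) _)

    prune-nbr : ∀ x → prune u x ≡ true → x ≡ a ⊎ x ≡ b
    prune-nbr x e with ∨-true {x == a} (subst (λ z → not z ∨ ((x == a) ∨ (x == b)) ≡ true) (≡⇒== {u = u} refl) (proj₁ (∧-true (proj₂ (∧-true {E u x} e)))))
    ... | inj₁ z = inj₁ (==⇒≡ z)
    ... | inj₂ z = inj₂ (==⇒≡ z)

    prune-keep : ∀ {x y} → E x y ≡ true → x ≢ u → y ≢ u → prune x y ≡ true
    prune-keep e nx ny = ∧-intro e (∧-intro (∨-introˡ (not-false (≢⇒==f nx))) (∨-introˡ (not-false (≢⇒==f ny))))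

    prune-a : E u a ≡ true → u ≢ a → prune u a ≡ true
    prune-a e ne = ∧-intro e (∧-intro (∨-introʳ {not (u == u)} (∨-introˡ (≡⇒== {u = a} refl))) (∨-introˡ (not-false (≢⇒==f (≢-sym ne)))))

    prune-b : E u b ≡ true → u ≢ b → prune u b ≡ true
    prune-b e ne = ∧-intro e (∧-intro (∨-introʳ {not (u == u)} (∨-introʳ {b == a} (≡⇒== {u = b} refl))) (∨-introˡ (not-false (≢⇒==f (≢-sym ne)))))

   -- No other vertex has the end u as an earlier neighbour, so deleting edges at u affects the
   -- condition at u alone. There it still holds because a and b are adjacent.
   pruneStr : ∀ {S} → Str E S → End E S u → E u a ≡ true → E u b ≡ true → E a b ≡ true → S a ≡ true → S b ≡ true →
              Str (prune) S
   pruneStr {S} str en ua ub ab sa sb = record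
     { E-sym = prune-sym E-sym
     ; irr = λ x → ≢true λ e → clash (prune⊆ x x e) (irr x)
     ; p∈ = p∈ ; q∈ = q∈ ; qp = prune-keep qp (≢-sym (End.≢q en)) (≢-sym (End.≢p en))
     ; down = λ sv e lt → down sv (prune⊆ _ _ e) lt
     ; base = base' ; pair = pair' }
     where
     open Str str
     u≢a = ≢-edge str ua
     u≢b = ≢-edge str ub
     not-u : ∀ {v x} → S v ≡ true → E v x ≡ true → r x < r v → x ≢ u
     not-u {v} sv e lt refl = <-asym lt (End.last en v sv (E-flip str e))
     base' : ∀ {v} → S v ≡ true → v ≢ p → v ≢ q → ∃ λ x → prune v x ≡ true × r x < r v
     base' {v} sv n₁ n₂ with v ≟ u
     ... | yes refl = a , prune-a ua u≢a , End.last en a sa ua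
     ... | no ne with base sv n₁ n₂
     ...   | x , ex , lx = x , prune-keep ex ne (not-u sv ex lx) , lx
     pair' : ∀ {v x} → S v ≡ true → v ≢ p → v ≢ q → prune v x ≡ true → r x < r v →
             ∃ λ y → prune v y ≡ true × r y < r v × prune x y ≡ true
     pair' {v} {x} sv n₁ n₂ e lt with v ≟ u
     ... | no ne with pair sv n₁ n₂ (prune⊆ _ _ e) lt
     ...   | y , ey , ly , exy = y , prune-keep ey ne (not-u sv ey ly) , ly , prune-keep exy (not-u sv (prune⊆ _ _ e) lt) (not-u sv ey ly)
     pair' {v} {x} sv n₁ n₂ e lt | yes refl with prune-nbr x e
     ...   | inj₁ refl = b , prune-b ub u≢b , End.last en b sb ub , prune-keep ab (≢-sym u≢a) (≢-sym u≢b)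
     ...   | inj₂ refl = a , prune-a ua u≢a , End.last en a sa ua , prune-keep (E-flip str ab) (≢-sym u≢b) (≢-sym u≢a)

  open Prune

  -- When the reduced graph is exceptional, `lift` has nothing to start from. This record then tells
  -- enough about v and w to find the extension in a table. In the third case for w the edge x a may
  -- have been deleted by pruning at x, which leaves x at most the neighbours y and b.
  record Attach (E E' : Graph n) (S' : Fin n → Bool) (v w : Fin n) : Set where
    field
      {x y} : Fin n
      x∈ : S' x ≡ true
      y∈ : S' y ≡ true
      vx : E v x ≡ true
      vy : E v y ≡ true
      xy : E' x y ≡ true
      next : (Σ (Fin n) λ a → Σ (Fin n) λ b → S' a ≡ true × S' b ≡ true × E w a ≡ true × E w b ≡ true × E' a b ≡ true)
             ⊎ (E w v ≡ true × E w x ≡ true)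
             ⊎ (Σ (Fin n) λ a → Σ (Fin n) λ b → S' a ≡ true × E w x ≡ true × E w a ≡ true × E x a ≡ true ×
                 (∀ z → E' x z ≡ true → z ≡ y ⊎ z ≡ b))

  record Reduction (E : Graph n) (S : Fin n → Bool) : Set where
    field
      {E'} : Graph n
      {v w} : Fin n
      v∈ : S v ≡ true
      w∈ : S w ≡ true
      v≢w : v ≢ w
      E'⊆E : ∀ x y → E' x y ≡ true → E x y ≡ true
      str' : Str E' (S - w - v)
      -- The reduced graph will have at least six vertices, hence the bound 3 + j. Some walks
      -- supplied by the lifting lemmas have four arcs, which 4 + j just admits.
      lift : ∀ j → Good E' (S - w - v) (3 + j) → Good E S (4 + j)
      attach : Attach E E' (S - w - v) v w

  record FourEnds (E : Graph n) (S : Fin n → Bool) : Set where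
    field
      {w₁ w₂ w₃ w₄} : Fin n
      e₁ : End E S w₁
      e₂ : End E S w₂
      e₃ : End E S w₃
      e₄ : End E S w₄
      n₁₂ : w₁ ≢ w₂
      n₁₃ : w₁ ≢ w₃
      n₁₄ : w₁ ≢ w₄
      n₂₃ : w₂ ≢ w₃
      n₂₄ : w₂ ≢ w₄
      n₃₄ : w₃ ≢ w₄

  end⊆ : ∀ {E S T w} → End E S w → (∀ x → T x ≡ true → S x ≡ true) → T w ≡ true → End E T w
  end⊆ e i t = mkEnd t (End.≢p e) (End.≢q e) λ x tx → End.last e x (i x tx)

  end-sub : ∀ {E E' S w} → End E S w → (∀ x y → E' x y ≡ true → E x y ≡ true) → End E' S w
  end-sub e i = mkEnd (End.∈S e) (End.≢p e) (End.≢q e) λ x sx ex → End.last e x sx (i _ _ ex)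

  -- Reductions by two vertices.

  module _ {E : Graph n} {S : Fin n → Bool} (str : Str E S) where
    open Str str using (E-sym; irr)
    open Extend E irr E-sym S

    private
      fl : ∀ {u v} → E u v ≡ true → E v u ≡ true
      fl = E-flip str
      ne : ∀ {u v} → E u v ≡ true → u ≢ v
      ne = ≢-edge str

    -- Up to reversing all arcs, u is passed along a → u → b.
    with-thru : ∀ {E' S' j u a b} → (∀ x y → E' x y ≡ E' y x) → (∀ x y → E' x y ≡ true → E x y ≡ true) → (∀ x → S' x ≡ true → S x ≡ true) →
      (∀ x → E' u x ≡ true → x ≡ a ⊎ x ≡ b) → S' u ≡ true → S' a ≡ true → u ≢ a → Good E' S' (3 + j) →
      Σ (Graph n) λ D → Or E' S' D × All-walks S' (3 + j) D × Start E S S' (3 + j) D × Thru S' (2 + j) D a u b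
    with-thru {E'} {S'} {j} {u} s i i' nb su sa ua (D , o , aw) with thru o aw su sa ua nb (λ x e → nb x (trans (s _ _) e))
    ... | inj₁ t = D , o , aw , start i i' o aw , t
    ... | inj₂ t = rev D , or-rev s o , (λ a b → revW (aw b a)) , start i i' (or-rev s o) (λ a b → revW (aw b a)) , rev-thru t

    nonadjacent-ends : ∀ {w w'} → End E S w → End E S w' → E w w' ≡ true → ⊥
    nonadjacent-ends e e' x = <-asym (End.last e _ (End.∈S e') x) (End.last e' _ (End.∈S e) (fl x))

    exposed : ∀ {w v} → End E (S - w) v → ¬ End E S v → E v w ≡ true
    exposed {w} {v} e ¬e with split (E v w)
    ... | inj₁ x = x
    ... | inj₂ x = ⊥-elim (¬e (mkEnd (-⊆ {S = S} (End.∈S e)) (End.≢p e) (End.≢q e) lst))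
      where
      lst : ∀ y → S y ≡ true → E v y ≡ true → r y < r v
      lst y sy ey with y ≟ w
      ... | yes refl = clash ey x
      ... | no q = End.last e y (-intro {S = S} sy q) ey

    reduce-B : ∀ {w v x z} → End E S w → End E (S - w) v → E w v ≡ true → E w x ≡ true → S x ≡ true → E v x ≡ true →
               E w z ≡ true → S z ≡ true → z ≢ v → z ≢ x → Reduction E S
    reduce-B {w} {v} {x} {z} ew ev wv wx sx vx wz sz z≢v z≢x with mate (removeEnd str ew) ev (-intro {S = S} sx (≢-sym (ne wx))) vx
    ... | y , vy , sy , xy = record
      { v∈ = v∈ ; w∈ = End.∈S ew ; v≢w = v≢w ; E'⊆E = λ _ _ e → e ; str' = removeEnd (removeEnd str ew) ev
      ; lift = λ j g → add-B (start (λ _ _ e → e) (λ u s → -⊆ {S = S} (-⊆ {S = S - w} s)) (proj₁ (proj₂ g)) (proj₂ (proj₂ g)))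
                 (fl wv) vx wx vy wz (ne xy) (≢-sym z≢x) x∈' y∈' z∈'
      ; attach = record { x∈ = x∈' ; y∈ = y∈' ; vx = vx ; vy = vy ; xy = xy ; next = inj₂ (inj₁ (wv , wx)) } }
      where
      v∈ = -⊆ {S = S} (End.∈S ev)
      v≢w = -≢ {S = S} (End.∈S ev)
      open Two v∈ (End.∈S ew) v≢w
      x∈' : (S - w - v) x ≡ true
      x∈' = -intro {S = S - w} (-intro {S = S} sx (≢-sym (ne wx))) (≢-sym (ne vx))
      y∈' : (S - w - v) y ≡ true
      y∈' = -intro {S = S - w} sy (≢-sym (ne vy))
      z∈' : (S - w - v) z ≡ true
      z∈' = -intro {S = S - w} (-intro {S = S} sz (≢-sym (ne wz))) z≢v

    -- What is left when neither `reduce-B` nor `reduce-F` applies: w exposes v as an end, but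
    -- removing both exposes nothing more. So the two together behave like a single end whose
    -- removal exposes nothing.
    record TypeTwo (w : Fin n) : Set where
      field
        {v y} : Fin n
        wv : E w v ≡ true
        wy : E w y ≡ true
        vy : E v y ≡ true
        y∈ : S y ≡ true
        only : ∀ x → S x ≡ true → E w x ≡ true → x ≡ v ⊎ x ≡ y
        ve : End E (S - w) v
        rest : ∀ u → End E (S - w - v) u → End E S u

    -- Removing w exposes v, and removing v exposes u, which can therefore be pruned to a triangle.
    -- The triangle depends on the position of y: it may be u itself (`add-F₂`), a neighbour of u
    -- (`add-F₃`) or neither (`add-F₁`).
    reduce-F : ∀ {w v y u} → End E S w → End E (S - w) v → E w v ≡ true → E w y ≡ true → E v y ≡ true → S y ≡ true →
               End E (S - w - v) u → E u v ≡ true → Reduction E S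
    reduce-F {w} {v} {y} {u} ew ev wv wy vy sy eu uv = go
      where
      v∈ = -⊆ {S = S} (End.∈S ev)
      v≢w = -≢ {S = S} (End.∈S ev)
      S' = S - w - v
      sub : ∀ x → S' x ≡ true → S x ≡ true
      sub x s = -⊆ {S = S} (-⊆ {S = S - w} s)
      open Two v∈ (End.∈S ew) v≢w
      str₁ = removeEnd str ew
      str₂ = removeEnd str₁ ev
      u∈ = End.∈S eu
      u≢v = -≢ {S = S - w} u∈
      y∈ : S' y ≡ true
      y∈ = -intro {S = S - w} (-intro {S = S} sy (≢-sym (ne wy))) (≢-sym (ne vy))
      in₂ : ∀ {z} → E v z ≡ true → (S - w) z ≡ true → S' z ≡ true
      in₂ e s = -intro {S = S - w} s (≢-sym (ne e))
      go : Reduction E S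
      go with y ≟ u
      ... | yes refl with mate str₁ ev (-⊆ {S = S - w} u∈) (fl uv)
      ...   | a , va , sa , ua with mate str₂ eu (in₂ va sa) ua
      ...     | b , ub , sb , ab = record
        { v∈ = v∈ ; w∈ = End.∈S ew ; v≢w = v≢w ; E'⊆E = prune⊆ E u a b ; str' = pruneStr E u a b str₂ eu ua ub ab (in₂ va sa) sb
        ; lift = λ j g → let D , _ , _ , st , t = with-thru (prune-sym E u a b E-sym) (prune⊆ E u a b) sub (prune-nbr E u a b) u∈ (in₂ va sa) (ne ua) g in
                   add-F₂ st t (in₂ va sa) u∈ (≢-sym (ne ua)) ua va (fl uv) wv wy
        ; attach = record { x∈ = u∈ ; y∈ = in₂ va sa ; vx = fl uv ; vy = va ; xy = prune-a E u a b ua (ne ua) ; next = inj₂ (inj₁ (wv , wy)) } }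
      go | no y≢u with split (E u y)
      ... | inj₁ uy with mate str₂ eu y∈ uy
      ...   | b , ub , sb , yb = record
        { v∈ = v∈ ; w∈ = End.∈S ew ; v≢w = v≢w ; E'⊆E = prune⊆ E u y b ; str' = pruneStr E u y b str₂ eu uy ub yb y∈ sb
        ; lift = λ j g → let D , _ , _ , st , t = with-thru (prune-sym E u y b E-sym) (prune⊆ E u y b) sub (prune-nbr E u y b) u∈ y∈ (ne uy) g in
                   add-F₃ st t y∈ u∈ sb y≢u (ne yb) (ne ub) uy yb vy (fl uv) wv wy
        ; attach = record { x∈ = y∈ ; y∈ = u∈ ; vx = vy ; vy = fl uv ; xy = trans (prune-sym E u y b E-sym y u) (prune-a E u y b uy (ne uy)) ; next = inj₂ (inj₁ (wv , wy)) } }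
      go | no y≢u | inj₂ ¬uy with mate str₁ ev (-⊆ {S = S - w} u∈) (fl uv) | mate str₁ ev (-⊆ {S = S - w} y∈) vy
      ...   | a , va , sa , ua | c , vc , sc , yc with mate str₂ eu (in₂ va sa) ua
      ...     | b , ub , sb , ab = record
        { v∈ = v∈ ; w∈ = End.∈S ew ; v≢w = v≢w ; E'⊆E = prune⊆ E u a b ; str' = pruneStr E u a b str₂ eu ua ub ab (in₂ va sa) sb
        ; lift = λ j g → let D , _ , _ , st , t = with-thru (prune-sym E u a b E-sym) (prune⊆ E u a b) sub (prune-nbr E u a b) u∈ (in₂ va sa) (ne ua) g in
                   add-F₁ st t (in₂ va sa) u∈ y∈ (λ { refl → clash ua ¬uy }) (≢-sym y≢u) va (fl uv) vy wv wy
        ; attach = record { x∈ = y∈ ; y∈ = in₂ vc sc ; vx = vy ; vy = vc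
                          ; xy = prune-keep E u a b yc y≢u (λ { refl → clash (fl yc) ¬uy }) ; next = inj₂ (inj₁ (wv , wy)) } }

    -- A newly exposed vertex must be adjacent to what was just removed. So a chain of exposures w,
    -- v, u has the shape needed for a reduction, and otherwise it stops after w or after v.
    classify : ∀ {w} → End E S w → Reduction E S ⊎ (∀ v → End E (S - w) v → End E S v) ⊎ TypeTwo w
    classify {w} ew with any? (λ v → End? E (S - w) v ×-dec ¬? (End? E S v))
    ... | no none = inj₂ (inj₁ all-old)
      where
      all-old : ∀ v → End E (S - w) v → End E S v
      all-old v ev with End? E S v
      ... | yes e = e
      ... | no ¬e = ⊥-elim (none (v , ev , ¬e))
    ... | yes (v , ev , ¬e) with fl (exposed ev ¬e)
    ...   | wv with mate str ew (-⊆ {S = S} (End.∈S ev)) wv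
    ...     | x , wx , sx , vx with any? (λ z → ((E w z Bool.≟ true) ×-dec (S z Bool.≟ true)) ×-dec (¬? (z ≟ v) ×-dec ¬? (z ≟ x)))
    ...       | yes (z , (wz , sz) , (zv , zx)) = inj₁ (reduce-B ew ev wv wx sx vx wz sz zv zx)
    ...       | no none with any? (λ u → End? E (S - w - v) u ×-dec ¬? (End? E S u))
    ...         | yes (u , eu , ¬eu) = inj₁ (reduce-F ew ev wv wx vx sx eu uv)
      where
      only : ∀ z → S z ≡ true → E w z ≡ true → z ≡ v ⊎ z ≡ x
      only z sz wz with z ≟ v | z ≟ x
      ... | yes a | _ = inj₁ a
      ... | no _ | yes b = inj₂ b
      ... | no a | no b = ⊥-elim (none (z , (wz , sz) , (a , b)))
      u∈₁ = -⊆ {S = S - w} (End.∈S eu)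
      uv : E u v ≡ true
      uv with split (E u v) | split (E u w)
      ... | inj₁ a | _ = a
      ... | inj₂ a | inj₁ b with only u (-⊆ {S = S} u∈₁) (fl b)
      ...   | inj₁ c = ⊥-elim (-≢ {S = S - w} (End.∈S eu) c)
      ...   | inj₂ refl = fl vx
      uv | inj₂ a | inj₂ b = ⊥-elim (¬eu (mkEnd (-⊆ {S = S} u∈₁) (End.≢p eu) (End.≢q eu) lst))
        where
        lst : ∀ y → S y ≡ true → E u y ≡ true → r y < r u
        lst y sy ey with y ≟ w | y ≟ v
        ... | yes refl | _ = clash ey b
        ... | no _ | yes refl = clash ey a
        ... | no c | no d = End.last eu y (-intro {S = S - w} (-intro {S = S} sy c) d) ey
    ...         | no none' = inj₂ (inj₂ (record { wv = wv ; wy = wx ; vy = vx ; y∈ = sx ; only = only ; ve = ev ; rest = rest }))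
      where
      only : ∀ z → S z ≡ true → E w z ≡ true → z ≡ v ⊎ z ≡ x
      only z sz wz with z ≟ v | z ≟ x
      ... | yes a | _ = inj₁ a
      ... | no _ | yes b = inj₂ b
      ... | no a | no b = ⊥-elim (none (z , (wz , sz) , (a , b)))
      rest : ∀ u → End E (S - w - v) u → End E S u
      rest u eu with End? E S u
      ... | yes e = e
      ... | no ¬e = ⊥-elim (none' (u , eu , ¬e))

    module Pair {w₁ w₂} (e₁ : End E S w₁) (e₂ : End E S w₂) (w₁≢w₂ : w₁ ≢ w₂) where
      S' = S - w₂ - w₁
      w₁∈ = End.∈S e₁
      w₂∈ = End.∈S e₂
      sub : ∀ x → S' x ≡ true → S x ≡ true
      sub x s = -⊆ {S = S} (-⊆ {S = S - w₂} s)
      open Two w₁∈ w₂∈ w₁≢w₂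
      e₁' : End E (S - w₂) w₁
      e₁' = end⊆ e₁ (λ x s → -⊆ {S = S} s) (-intro {S = S} w₁∈ w₁≢w₂)
      str₁ = removeEnd str e₂
      str₂ : Str E S'
      str₂ = removeEnd str₁ e₁'
      in₁ : ∀ {z} → E w₁ z ≡ true → S z ≡ true → S' z ≡ true
      in₁ e s = -intro {S = S - w₂} (-intro {S = S} s (λ { refl → nonadjacent-ends e₁ e₂ e })) (≢-sym (ne e))
      in₂ : ∀ {z} → E w₂ z ≡ true → S z ≡ true → S' z ≡ true
      in₂ e s = -intro {S = S - w₂} (-intro {S = S} s (≢-sym (ne e))) (λ { refl → nonadjacent-ends e₂ e₁ e })

      -- The vertex c has become an end, so it can be pruned to a triangle with a neighbour x that
      -- it shares with w₁.
      reduce-G : ∀ {c} → End E S' c → E c w₁ ≡ true → E c w₂ ≡ true → Reduction E S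
      reduce-G {c} ec cw₁ cw₂ with mate str e₁ (sub c (End.∈S ec)) (fl cw₁) | mate str e₂ (sub c (End.∈S ec)) (fl cw₂)
      ... | x , wx , sx , cx | y , wy , sy , cy with mate str₂ ec (in₁ wx sx) cx
      ...   | b , cb , sb , xb = record
        { v∈ = w₁∈ ; w∈ = w₂∈ ; v≢w = w₁≢w₂ ; E'⊆E = prune⊆ E c x b ; str' = pruneStr E c x b str₂ ec cx cb xb (in₁ wx sx) sb
        ; lift = λ j g → let D , _ , _ , st , t = with-thru (prune-sym E c x b E-sym) (prune⊆ E c x b) sub (prune-nbr E c x b) (End.∈S ec) (in₁ wx sx) (ne cx) g in
                   add-G st t (in₁ wx sx) (End.∈S ec) (in₂ wy sy) (≢-sym (ne cx)) (≢-sym (ne cy)) wx (fl cw₁) (fl cw₂) wy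
        ; attach = record { x∈ = End.∈S ec ; y∈ = in₁ wx sx ; vx = fl cw₁ ; vy = wx ; xy = prune-a E c x b cx (ne cx)
                          ; next = inj₂ (inj₂ (y , b , in₂ wy sy , fl cw₂ , wy , cy , prune-nbr E c x b)) } }

      -- The third end w₃ stays and is pruned. As a vertex of degree two next to c it makes c faster
      -- to reach, up to reversing all arcs.
      reduce-111 : ∀ {w₃ c} → End E S w₃ → w₃ ≢ w₁ → w₃ ≢ w₂ → S c ≡ true → E c w₁ ≡ true → E c w₂ ≡ true → E c w₃ ≡ true → Reduction E S
      reduce-111 {w₃} {c} e₃ n₁ n₂ sc c₁ c₂ c₃ with mate str e₁ sc (fl c₁) | mate str e₂ sc (fl c₂) | mate str e₃ sc (fl c₃)
      ... | x , wx , sx , cx | y , wy , sy , cy | z , wz , sz , cz = record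
        { v∈ = w₁∈ ; w∈ = w₂∈ ; v≢w = w₁≢w₂ ; E'⊆E = prune⊆ E w₃ c z ; str' = pruneStr E w₃ c z str₂ e₃' (fl c₃) wz cz c∈ (in₃ wz sz)
        ; lift = λ j g → let D , _ , _ , st , t = with-thru (prune-sym E w₃ c z E-sym) (prune⊆ E w₃ c z) sub (prune-nbr E w₃ c z) (End.∈S e₃') c∈ (≢-sym (ne c₃)) g in
                   add-111 st t c∈ (in₁ wx sx) (in₂ wy sy) x≢w₃ y≢w₃ (fl c₁) wx (fl c₂) wy (ne cx) (ne cy)
        ; attach = record { x∈ = c∈ ; y∈ = in₁ wx sx ; vx = fl c₁ ; vy = wx ; xy = prune-keep E w₃ c z cx (ne c₃) x≢w₃
                          ; next = inj₁ (c , y , c∈ , in₂ wy sy , fl c₂ , wy , prune-keep E w₃ c z cy (ne c₃) y≢w₃) } }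
        where
        e₃' : End E S' w₃
        e₃' = end⊆ e₃ sub (-intro {S = S - w₂} (-intro {S = S} (End.∈S e₃) n₂) n₁)
        c∈ = in₁ (fl c₁) sc
        in₃ : ∀ {a} → E w₃ a ≡ true → S a ≡ true → S' a ≡ true
        in₃ e s = -intro {S = S - w₂} (-intro {S = S} s (λ { refl → nonadjacent-ends e₃ e₂ e })) (λ { refl → nonadjacent-ends e₃ e₁ e })
        x≢w₃ : x ≢ w₃
        x≢w₃ refl = nonadjacent-ends e₁ e₃ wx
        y≢w₃ : y ≢ w₃
        y≢w₃ refl = nonadjacent-ends e₂ e₃ wy

      module _ (t₂ : TypeTwo w₂) where
        open TypeTwo t₂ renaming (v to v₂; y to y₂; wv to wv₂; wy to wy₂; vy to vy₂; y∈ to y₂∈; ve to ve₂)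

        v₂∉w₁ : E w₁ v₂ ≡ true → ⊥
        v₂∉w₁ e = <-asym (End.last e₁ _ (-⊆ {S = S} (End.∈S ve₂)) e) (End.last ve₂ _ (-intro {S = S} w₁∈ w₁≢w₂) (fl e))

        ev₂ : End E S' v₂
        ev₂ = end⊆ ve₂ (λ x s → -⊆ {S = S - w₂} s) (in₂ wv₂ (-⊆ {S = S} (End.∈S ve₂)))

        y₂∈' : S' y₂ ≡ true
        y₂∈' = in₂ wy₂ y₂∈

        -- Removing w₂ exposes v₂, which is pruned to a triangle on the edge v₂ y₂. If c differs
        -- from y₂, the deleted edge c v₂ may be used again as an arc; if c equals y₂, it belongs to
        -- the triangle.
        reduce-12 : ∀ {c} → S c ≡ true → E c w₁ ≡ true → E c v₂ ≡ true → Reduction E S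
        reduce-12 {c} sc cw cv with mate str e₁ sc (fl cw) | mate str₂ ev₂ y₂∈' vy₂ | c ≟ y₂
        ... | x , wx , sx , cx | s , vs , ss , ys | no c≢y = record
          { v∈ = w₁∈ ; w∈ = w₂∈ ; v≢w = w₁≢w₂ ; E'⊆E = prune⊆ E v₂ s y₂ ; str' = pruneStr E v₂ s y₂ str₂ ev₂ vs vy₂ (fl ys) ss y₂∈'
          ; lift = λ j g → let D , _ , _ , st , t = with-thru (prune-sym E v₂ s y₂ E-sym) (prune⊆ E v₂ s y₂) sub (prune-nbr E v₂ s y₂) (End.∈S ev₂) ss (ne vs) g in
                     add-12a st t (End.∈S ev₂) y₂∈' (in₁ (fl cw) sc) (in₁ wx sx) (ne vy₂) x≢v₂ (≢-sym (ne cx)) c≢y cv wv₂ wy₂ (fl cw) wx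
          ; attach = record { x∈ = in₁ (fl cw) sc ; y∈ = in₁ wx sx ; vx = fl cw ; vy = wx ; xy = prune-keep E v₂ s y₂ cx (ne cv) x≢v₂
                            ; next = inj₁ (v₂ , y₂ , End.∈S ev₂ , y₂∈' , wv₂ , wy₂ , prune-b E v₂ s y₂ vy₂ (ne vy₂)) } }
          where
          x≢v₂ : x ≢ v₂
          x≢v₂ refl = v₂∉w₁ wx
        ... | x , wx , sx , cx | s , vs , ss , ys | yes refl = record
          { v∈ = w₁∈ ; w∈ = w₂∈ ; v≢w = w₁≢w₂ ; E'⊆E = prune⊆ E v₂ c s ; str' = pruneStr E v₂ c s str₂ ev₂ vy₂ vs ys y₂∈' ss
          ; lift = λ j g → let D , _ , _ , st , t = with-thru (prune-sym E v₂ c s E-sym) (prune⊆ E v₂ c s) sub (prune-nbr E v₂ c s) (End.∈S ev₂) y₂∈' (ne vy₂) g in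
                     add-12b st t (End.∈S ev₂) y₂∈' (in₁ wx sx) (ne vy₂) (≢-sym (ne cx)) cx wv₂ wy₂ (fl cw) wx
          ; attach = record { x∈ = y₂∈' ; y∈ = in₁ wx sx ; vx = fl cw ; vy = wx ; xy = prune-keep E v₂ c s cx (ne cv) x≢v₂
                            ; next = inj₁ (v₂ , c , End.∈S ev₂ , y₂∈' , wv₂ , wy₂ , prune-a E v₂ c s vy₂ (ne vy₂)) } }
          where
          x≢v₂ : x ≢ v₂
          x≢v₂ refl = v₂∉w₁ wx

    module Pair₂ {w₁ w₂} (e₁ : End E S w₁) (e₂ : End E S w₂) (w₁≢w₂ : w₁ ≢ w₂) (t₁ : TypeTwo w₁) (t₂ : TypeTwo w₂) where
      open Pair e₁ e₂ w₁≢w₂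
      open Two w₁∈ w₂∈ w₁≢w₂
      open TypeTwo t₁ renaming (v to v₁; y to y₁; wv to wv₁; wy to wy₁; vy to vy₁; y∈ to y₁∈; ve to ve₁)
      open TypeTwo t₂ renaming (v to v₂; y to y₂; wv to wv₂; wy to wy₂; vy to vy₂; y∈ to y₂∈; ve to ve₂)

      ev₁' : End E S' v₁
      ev₁' = end⊆ ve₁ (λ x s → -intro {S = S} (sub x s) (-≢ {S = S - w₂} s)) (in₁ wv₁ (-⊆ {S = S} (End.∈S ve₁)))
      ev₂' : End E S' v₂
      ev₂' = ev₂ t₂

      v₁≢v₂ : v₁ ≢ v₂
      v₁≢v₂ refl = v₂∉w₁ t₂ wv₁

      ¬v₁v₂ : E v₁ v₂ ≡ true → ⊥
      ¬v₁v₂ e = <-asym (End.last ev₁' _ (End.∈S ev₂') e) (End.last ev₂' _ (End.∈S ev₁') (fl e))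

      y₁∈' = in₁ wy₁ y₁∈
      y₂∈″ = in₂ wy₂ y₂∈

      -- Both exposed vertices are pruned. They are ends of the same set and hence not adjacent, so
      -- neither pruning touches the edges kept by the other.
      module Both {s₁ s₂} (vs₁ : E v₁ s₁ ≡ true) (ss₁ : S' s₁ ≡ true) (ys₁ : E y₁ s₁ ≡ true)
                  (vs₂ : E v₂ s₂ ≡ true) (ss₂ : S' s₂ ≡ true) (ys₂ : E y₂ s₂ ≡ true) where
        E₁ = prune E v₁ s₁ y₁
        E₂ = prune E₁ v₂ s₂ y₂
        E₁⊆ : ∀ x y → E₁ x y ≡ true → E x y ≡ true
        E₁⊆ = prune⊆ E v₁ s₁ y₁
        E₂⊆ : ∀ x y → E₂ x y ≡ true → E x y ≡ true
        E₂⊆ x y e = E₁⊆ x y (prune⊆ E₁ v₂ s₂ y₂ x y e)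
        keep₁ : ∀ {a} → E v₂ a ≡ true → E₁ v₂ a ≡ true
        keep₁ e = prune-keep E v₁ s₁ y₁ e (≢-sym v₁≢v₂) (λ { refl → ¬v₁v₂ (fl e) })
        ≢v₂ : ∀ {a} → E v₁ a ≡ true → a ≢ v₂
        ≢v₂ e refl = ¬v₁v₂ e
        ≢v₁ : ∀ {a} → E v₂ a ≡ true → a ≢ v₁
        ≢v₁ e refl = ¬v₁v₂ (fl e)
        sy₁ : E₁ s₂ y₂ ≡ true
        sy₁ = prune-keep E v₁ s₁ y₁ (fl ys₂) (≢v₁ vs₂) (≢v₁ vy₂)
        st₁ : Str E₁ S'
        st₁ = pruneStr E v₁ s₁ y₁ str₂ ev₁' vs₁ vy₁ (fl ys₁) ss₁ y₁∈'
        st₂ : Str E₂ S'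
        st₂ = pruneStr E₁ v₂ s₂ y₂ st₁ (end-sub ev₂' E₁⊆) (keep₁ vs₂) (keep₁ vy₂) sy₁ ss₂ y₂∈″
        E₂-sym = Str.E-sym st₂
        nb₁ : ∀ x → E₂ v₁ x ≡ true → x ≡ s₁ ⊎ x ≡ y₁
        nb₁ x e = prune-nbr E v₁ s₁ y₁ x (prune⊆ E₁ v₂ s₂ y₂ v₁ x e)
        nb₂ : ∀ x → E₂ v₂ x ≡ true → x ≡ s₂ ⊎ x ≡ y₂
        nb₂ = prune-nbr E₁ v₂ s₂ y₂
        att : Attach E E₂ S' w₁ w₂
        att = record { x∈ = End.∈S ev₁' ; y∈ = y₁∈' ; vx = wv₁ ; vy = wy₁
                     ; xy = prune-keep E₁ v₂ s₂ y₂ (prune-b E v₁ s₁ y₁ vy₁ (ne vy₁)) v₁≢v₂ (≢v₂ vy₁)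
                     ; next = inj₁ (v₂ , y₂ , End.∈S ev₂' , y₂∈″ , wv₂ , wy₂ , prune-b E₁ v₂ s₂ y₂ (keep₁ vy₂) (ne vy₂)) }
        mk : (∀ j {D} → Start E S S' (3 + j) D → Thru S' (2 + j) D s₁ v₁ y₁ →
                Thru S' (2 + j) D s₂ v₂ y₂ ⊎ Thru S' (2 + j) D y₂ v₂ s₂ → Good E S (4 + j)) → Reduction E S
        mk f = record
          { v∈ = w₁∈ ; w∈ = w₂∈ ; v≢w = w₁≢w₂ ; E'⊆E = E₂⊆ ; str' = st₂ ; attach = att
          ; lift = λ j g → let D , o , aw , st , t = with-thru E₂-sym E₂⊆ sub nb₁ (End.∈S ev₁') ss₁ (ne vs₁) g in
                     f j st t (thru o aw (End.∈S ev₂') ss₂ (ne vs₂) nb₂ (λ x e → nb₂ x (trans (E₂-sym _ _) e))) }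

      -- If c is exactly one of y₁ and y₂, then it is adjacent to w₁ or w₂ itself and `reduce-12`
      -- applies. If it is neither, two arcs through c are available in the mixed case; if it is
      -- both, it is the hub.
      reduce-22 : ∀ {c} → S c ≡ true → E c v₁ ≡ true → E c v₂ ≡ true → Reduction E S
      reduce-22 {c} sc cv₁ cv₂ with c ≟ y₁ | c ≟ y₂
      ... | yes refl | no _ = reduce-12 t₂ sc (fl wy₁) cv₂
      ... | no _ | yes refl = Pair.reduce-12 e₂ e₁ (≢-sym w₁≢w₂) t₁ sc (fl wy₂) cv₁
      ... | no a | no b with mate str₂ ev₁' y₁∈' vy₁ | mate str₂ ev₂' y₂∈″ vy₂
      ...   | s₁ , vs₁ , ss₁ , ys₁ | s₂ , vs₂ , ss₂ , ys₂ = mk f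
        where
        open Both vs₁ ss₁ ys₁ vs₂ ss₂ ys₂
        c∈ : S' c ≡ true
        c∈ = -intro {S = S - w₂} (-intro {S = S} sc cw₂) λ { refl → v₂∉w₁ t₂ cv₂ }
          where
          cw₂ : c ≢ w₂
          cw₂ refl = <-asym (End.last e₂ _ (-⊆ {S = S} (End.∈S ve₁)) cv₁) (End.last ve₁ _ (-intro {S = S} w₂∈ (≢-sym w₁≢w₂)) (fl cv₁))
        f : ∀ j {D} → Start E S S' (3 + j) D → Thru S' (2 + j) D s₁ v₁ y₁ →
            Thru S' (2 + j) D s₂ v₂ y₂ ⊎ Thru S' (2 + j) D y₂ v₂ s₂ → Good E S (4 + j)
        f j st t (inj₁ t') = add-22-same st t t' (End.∈S ev₁') y₁∈' (End.∈S ev₂') y₂∈″ (ne vy₁) (ne vy₂) v₁≢v₂ wv₁ wy₁ wv₂ wy₂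
        f j st t (inj₂ t') = add-22-mixed st t t' (End.∈S ev₁') y₁∈' (End.∈S ev₂') y₂∈″ c∈ (ne vy₁) (ne vy₂) v₁≢v₂ (≢v₁ vy₂) a b cv₁ (fl cv₂) wv₁ wy₁ wv₂ wy₂
      reduce-22 {c} sc cv₁ cv₂ | yes refl | yes refl with mate str₂ ev₁' y₁∈' vy₁ | mate str₂ ev₂' y₂∈″ vy₂
      ...   | s₁ , vs₁ , ss₁ , ys₁ | s₂ , vs₂ , ss₂ , ys₂ = mk f
        where
        open Both vs₁ ss₁ ys₁ vs₂ ss₂ ys₂
        f : ∀ j {D} → Start E S S' (3 + j) D → Thru S' (2 + j) D s₁ v₁ c →
            Thru S' (2 + j) D s₂ v₂ c ⊎ Thru S' (2 + j) D c v₂ s₂ → Good E S (4 + j)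
        f j st t (inj₁ t') = add-22-hub (start-rev E-sym st) (rev-thru t) (inj₁ (rev-thru t')) (End.∈S ev₁') (End.∈S ev₂') y₁∈' (ne vy₁) (ne vy₂) wv₁ wy₁ wv₂ wy₂
        f j st t (inj₂ t') = add-22-hub (start-rev E-sym st) (rev-thru t) (inj₂ (rev-thru t')) (End.∈S ev₁') (End.∈S ev₂') y₁∈' (ne vy₁) (ne vy₂) wv₁ wy₁ wv₂ wy₂

    -- What is to be removed with an end so that no new end appears: nothing more, or also the
    -- vertex that it exposes.
    data Arm (w : Fin n) : Set where
      one : (∀ v → End E (S - w) v → End E S v) → Arm w
      two : TypeTwo w → Arm w

    _⊖_ : ∀ {w} → (Fin n → Bool) → Arm w → (Fin n → Bool)
    _⊖_ {w} T (one _) = T - w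
    _⊖_ {w} T (two t) = T - w - TypeTwo.v t

    _∈ₐ_ : ∀ {w} → Fin n → Arm w → Set
    _∈ₐ_ {w} x (one _) = x ≡ w
    _∈ₐ_ {w} x (two t) = x ≡ w ⊎ x ≡ TypeTwo.v t

    Touches : ∀ {w} → Arm w → Fin n → Set
    Touches {w} (one _) c = E c w ≡ true
    Touches {w} (two t) c = E c (TypeTwo.v t) ≡ true

    touches? : ∀ {w} (a : Arm w) c → Dec (Touches a c)
    touches? {w} (one _) c = E c w Bool.≟ true
    touches? {w} (two t) c = E c (TypeTwo.v t) Bool.≟ true

    ⊖⊆ : ∀ {w T} (a : Arm w) {x} → (T ⊖ a) x ≡ true → T x ≡ true
    ⊖⊆ {w} {T} (one _) s = -⊆ {S = T} s
    ⊖⊆ {w} {T} (two t) s = -⊆ {S = T} (-⊆ {S = T - w} s)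

    ⊖∉ : ∀ {w T} (a : Arm w) {x} → (T ⊖ a) x ≡ true → ¬ (x ∈ₐ a)
    ⊖∉ {w} {T} (one _) s = -≢ {S = T} s
    ⊖∉ {w} {T} (two t) s (inj₁ z) = -≢ {S = T} (-⊆ {S = T - w} s) z
    ⊖∉ {w} {T} (two t) s (inj₂ z) = -≢ {S = T - w} s z

    ⊖-split : ∀ {w T} (a : Arm w) {x} → T x ≡ true → (T ⊖ a) x ≡ true ⊎ x ∈ₐ a
    ⊖-split {w} {T} (one _) {x} s with x ≟ w
    ... | yes z = inj₂ z
    ... | no z = inj₁ (-intro {S = T} s z)
    ⊖-split {w} {T} (two t) {x} s with x ≟ w | x ≟ TypeTwo.v t
    ... | yes z | _ = inj₂ (inj₁ z)
    ... | no _ | yes z = inj₂ (inj₂ z)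
    ... | no y | no z = inj₁ (-intro {S = T - w} (-intro {S = T} s y) z)

    -- In a longer arm w has only the neighbours v and y, so a vertex outside the arm that sees w is
    -- y, and y sees v as well.
    touch : ∀ {w} (a : Arm w) {c x} → S c ≡ true → ¬ (c ∈ₐ a) → x ∈ₐ a → E c x ≡ true → Touches a c
    touch (one _) sc nc refl e = e
    touch (two t) sc nc (inj₂ refl) e = e
    touch (two t) {c} sc nc (inj₁ refl) e with TypeTwo.only t c sc (fl e)
    ... | inj₁ z = ⊥-elim (nc (inj₂ z))
    ... | inj₂ refl = fl (TypeTwo.vy t)

    arm-old : ∀ {w} (a : Arm w) v → End E (S ⊖ a) v → End E S v
    arm-old (one f) = f
    arm-old (two t) = TypeTwo.rest t

    arm-of : ∀ {w} → End E S w → Reduction E S ⊎ Arm w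
    arm-of e with classify e
    ... | inj₁ x = inj₁ x
    ... | inj₂ (inj₁ f) = inj₂ (one f)
    ... | inj₂ (inj₂ t) = inj₂ (two t)

    -- Otherwise c would become an end with the removal of the arm, but this removal exposes
    -- nothing.
    later-outside : ∀ {w} (a : Arm w) {c} → S c ≡ true → c ≢ p → c ≢ q → ¬ (c ∈ₐ a) → ¬ End E S c →
                    ∃ λ x → (S ⊖ a) x ≡ true × E c x ≡ true × ¬ (r x < r c)
    later-outside a {c} sc np nq nc ¬e
      with any? (λ x → ((S ⊖ a) x Bool.≟ true) ×-dec ((E c x Bool.≟ true) ×-dec ¬? (r x <? r c)))
    ... | yes z = z
    ... | no none = ⊥-elim (¬e (arm-old a c (mkEnd c∈ np nq lst)))
      where
      c∈ : (S ⊖ a) c ≡ true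
      c∈ with ⊖-split {T = S} a sc
      ... | inj₁ z = z
      ... | inj₂ z = ⊥-elim (nc z)
      lst : ∀ x → (S ⊖ a) x ≡ true → E c x ≡ true → r x < r c
      lst x sx ex with r x <? r c
      ... | yes z = z
      ... | no z = ⊥-elim (none (x , sx , ex , z))

    self : ∀ {w} (a : Arm w) → w ∈ₐ a
    self (one _) = refl
    self (two _) = inj₁ refl

    ⊖-intro : ∀ {w T} (a : Arm w) {x} → T x ≡ true → ¬ (x ∈ₐ a) → (T ⊖ a) x ≡ true
    ⊖-intro {T = T} a s nx with ⊖-split {T = T} a s
    ... | inj₁ z = z
    ... | inj₂ z = ⊥-elim (nx z)

    width : ∀ {w} → Arm w → ℕ
    width (one _) = 1
    width (two _) = 2

    Within : ∀ {w} → Arm w → (Fin n → Bool) → Set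
    Within {w} a T = ∀ x → x ∈ₐ a → T x ≡ true

    ⊖-str : ∀ {w T} → End E S w → (a : Arm w) → Str E T → (∀ x → T x ≡ true → S x ≡ true) → Within a T → Str E (T ⊖ a)
    ⊖-str e (one _) st i wi = removeEnd st (end⊆ e i (wi _ refl))
    ⊖-str {w} {T} e (two t) st i wi = removeEnd (removeEnd st (end⊆ e i (wi _ (inj₁ refl))))
      (end⊆ (TypeTwo.ve t) (λ x s → -intro {S = S} (i x (-⊆ {S = T} s)) (-≢ {S = T} s))
        (-intro {S = T} (wi _ (inj₂ refl)) (-≢ {S = S} (End.∈S (TypeTwo.ve t)))))

    ⊖-size : ∀ {w T} (a : Arm w) → Within a T → size T ≡ width a + size (T ⊖ a)
    ⊖-size {w} {T} (one _) wi = size-remove T (wi _ refl)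
    ⊖-size {w} {T} (two t) wi = trans (size-remove T (wi _ (inj₁ refl)))
      (cong suc (size-remove (T - w) (-intro {S = T} (wi _ (inj₂ refl)) (-≢ {S = S} (End.∈S (TypeTwo.ve t))))))

    within-S : ∀ {w} → End E S w → (a : Arm w) → Within a S
    within-S e (one _) x refl = End.∈S e
    within-S e (two t) x (inj₁ refl) = End.∈S e
    within-S e (two t) x (inj₂ refl) = -⊆ {S = S} (End.∈S (TypeTwo.ve t))

    disjoint : ∀ {w₁ w₂} → End E S w₁ → End E S w₂ → w₁ ≢ w₂ → (a₁ : Arm w₁) (a₂ : Arm w₂) → ∀ x → x ∈ₐ a₁ → ¬ (x ∈ₐ a₂)
    disjoint e₁ e₂ ne' (one _) (one _) x refl = ne'
    disjoint e₁ e₂ ne' (one _) (two t) x refl (inj₁ z) = ne' z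
    disjoint e₁ e₂ ne' (one _) (two t) x refl (inj₂ refl) = nonadjacent-ends e₁ e₂ (fl (TypeTwo.wv t))
    disjoint e₁ e₂ ne' (two t) (one _) x (inj₁ refl) z = ne' z
    disjoint e₁ e₂ ne' (two t) (one _) x (inj₂ refl) refl = nonadjacent-ends e₁ e₂ (TypeTwo.wv t)
    disjoint e₁ e₂ ne' (two t) (two t') x (inj₁ refl) (inj₁ z) = ne' z
    disjoint e₁ e₂ ne' (two t) (two t') x (inj₁ refl) (inj₂ refl) = nonadjacent-ends e₁ e₂ (fl (TypeTwo.wv t'))
    disjoint e₁ e₂ ne' (two t) (two t') x (inj₂ refl) (inj₁ refl) = nonadjacent-ends e₁ e₂ (TypeTwo.wv t)
    disjoint e₁ e₂ ne' (two t) (two t') x (inj₂ refl) (inj₂ z) = Pair₂.v₁≢v₂ e₁ e₂ ne' t t' z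

    within-⊖ : ∀ {w₁ w₂ T} → End E S w₁ → End E S w₂ → w₁ ≢ w₂ → (a₁ : Arm w₁) (a₂ : Arm w₂) → Within a₂ T → Within a₂ (T ⊖ a₁)
    within-⊖ {T = T} e₁ e₂ ne' a₁ a₂ wi x m with ⊖-split {T = T} a₁ (wi x m)
    ... | inj₁ z = z
    ... | inj₂ z = ⊥-elim (disjoint e₁ e₂ ne' a₁ a₂ x z m)

    pair : ∀ {w₁ w₂} → End E S w₁ → End E S w₂ → w₁ ≢ w₂ → (a₁ : Arm w₁) (a₂ : Arm w₂) → ∀ {c} → S c ≡ true →
           Touches a₁ c → Touches a₂ c → End E ((S ⊖ a₂) ⊖ a₁) c → Reduction E S
    pair e₁ e₂ ne' (one _) (one _) sc t₁ t₂ ec = Pair.reduce-G e₁ e₂ ne' ec t₁ t₂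
    pair e₁ e₂ ne' (one _) (two t) sc t₁ t₂ ec = Pair.reduce-12 e₁ e₂ ne' t sc t₁ t₂
    pair e₁ e₂ ne' (two t) (one _) sc t₁ t₂ ec = Pair.reduce-12 e₂ e₁ (≢-sym ne') t sc t₂ t₁
    pair e₁ e₂ ne' (two t) (two t') sc t₁ t₂ ec = Pair₂.reduce-22 e₁ e₂ ne' t t' sc t₁ t₂

    triple : ∀ {w₁ w₂ w₃} → End E S w₁ → End E S w₂ → End E S w₃ → w₁ ≢ w₂ → w₁ ≢ w₃ → w₂ ≢ w₃ →
             (a₁ : Arm w₁) (a₂ : Arm w₂) (a₃ : Arm w₃) → ∀ {c} → S c ≡ true →
             Touches a₁ c → Touches a₂ c → Touches a₃ c → Reduction E S
    triple e₁ e₂ e₃ n₁₂ n₁₃ n₂₃ (one _) (one _) (one _) sc t₁ t₂ t₃ = Pair.reduce-111 e₁ e₂ n₁₂ e₃ (≢-sym n₁₃) (≢-sym n₂₃) sc t₁ t₂ t₃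
    triple e₁ e₂ e₃ n₁₂ n₁₃ n₂₃ (one _) (one _) (two t) sc t₁ t₂ t₃ = Pair.reduce-12 e₁ e₃ n₁₃ t sc t₁ t₃
    triple e₁ e₂ e₃ n₁₂ n₁₃ n₂₃ (one _) (two t) _ sc t₁ t₂ t₃ = Pair.reduce-12 e₁ e₂ n₁₂ t sc t₁ t₂
    triple e₁ e₂ e₃ n₁₂ n₁₃ n₂₃ (two t) (one _) _ sc t₁ t₂ t₃ = Pair.reduce-12 e₂ e₁ (≢-sym n₁₂) t sc t₂ t₁
    triple e₁ e₂ e₃ n₁₂ n₁₃ n₂₃ (two t) (two t') _ sc t₁ t₂ t₃ = Pair₂.reduce-22 e₁ e₂ n₁₂ t t' sc t₁ t₂

    -- Two adjacent earlier neighbours of the exposed vertex lie in T, hence they are p and q in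
    -- some order.
    root-touch : ∀ {w} {T : Fin n → Bool} → End E S w → (t : TypeTwo w) → (∀ x → S x ≡ true → E (TypeTwo.v t) x ≡ true → r x < r (TypeTwo.v t) → T x ≡ true) →
                 (∀ x → T x ≡ true → x ≡ p ⊎ x ≡ q) → E q (TypeTwo.v t) ≡ true
    root-touch {T = T} e t inT pq with base₂ str v∈ (End.≢p (TypeTwo.ve t)) (End.≢q (TypeTwo.ve t))
      where v∈ = -⊆ {S = S} (End.∈S (TypeTwo.ve t))
    ... | x , y , vx , vy , xy , lx , ly with pq x (inT x (Str.down str v∈ vx lx) vx lx) | pq y (inT y (Str.down str v∈ vy ly) vy ly)
      where v∈ = -⊆ {S = S} (End.∈S (TypeTwo.ve t))
    ...   | inj₂ refl | _ = fl vx
    ...   | inj₁ _ | inj₂ refl = fl vy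
    ...   | inj₁ refl | inj₁ refl = ⊥-elim (ne xy refl)

    only-roots : ∀ {T} → Str E T → size T ≡ 2 → ∀ x → T x ≡ true → x ≡ p ⊎ x ≡ q
    only-roots {T} st sz x tx with x ≟ p | x ≟ q
    ... | yes a | _ = inj₁ a
    ... | no _ | yes b = inj₂ b
    ... | no a | no b = clash (-intro {S = T - p} (-intro {S = T} tx a) b) (size-empty (T - p - q)
            (suc-injective (suc-injective (trans (cong suc (sym (size-remove (T - p) (-intro {S = T} (Str.q∈ st) λ { refl → <-irrefl refl p<q }))))
              (trans (sym (size-remove T (Str.p∈ st))) sz)))) x)

    -- At most three ends give a reduction.

    module Finale {k : ℕ} (sz : size S ≡ 8 + k) where

      -- After both arms are removed an end c remains. It was no end of S, so by `later-outside` it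
      -- has a later neighbour outside either arm, which must lie in the other one. Hence c touches
      -- both.
      two-arms : ∀ {w₁ w₂} (e₁ : End E S w₁) (e₂ : End E S w₂) (n₁₂ : w₁ ≢ w₂) → (∀ w → End E S w → w ≡ w₁ ⊎ w ≡ w₂) →
                 (a₁ : Arm w₁) (a₂ : Arm w₂) → Reduction E S
      two-arms {w₁} {w₂} e₁ e₂ n₁₂ ends a₁ a₂ = go (exists-end str-T (proj₂ big))
        where
        T = (S ⊖ a₁) ⊖ a₂
        wi₁ = within-S e₁ a₁
        wi₂ = within-⊖ {T = S} e₁ e₂ n₁₂ a₁ a₂ (within-S e₂ a₂)
        str-T : Str E T
        str-T = ⊖-str e₂ a₂ (⊖-str e₁ a₁ str (λ _ s → s) wi₁) (λ _ s → ⊖⊆ {T = S} a₁ s) wi₂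
        T⊆ : ∀ {x} → T x ≡ true → S x ≡ true
        T⊆ s = ⊖⊆ {T = S} a₁ (⊖⊆ {T = S ⊖ a₁} a₂ s)
        total : width a₁ + (width a₂ + size T) ≡ 8 + k
        total = trans (sym (trans (⊖-size {T = S} a₁ wi₁) (cong (width a₁ +_) (⊖-size {T = S ⊖ a₁} a₂ wi₂)))) sz
        big : ∃ λ l → size T ≡ 3 + l
        big = lem a₁ a₂ total
          where
          lem : ∀ {w w'} (a : Arm w) (b : Arm w') {m} → width a + (width b + m) ≡ 8 + k → ∃ λ l → m ≡ 3 + l
          lem (one _) (one _) refl = _ , refl
          lem (one _) (two _) refl = _ , refl
          lem (two _) (one _) refl = _ , refl
          lem (two _) (two _) refl = _ , refl
        go : (∃ λ c → End E T c) → Reduction E S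
        go (c , ec) = pair e₁ e₂ n₁₂ a₁ a₂ c∈ tc₁ tc₂ end'
          where
          c∈T = End.∈S ec
          c∈ = T⊆ c∈T
          c∉₁ = ⊖∉ {T = S} a₁ (⊖⊆ {T = S ⊖ a₁} a₂ c∈T)
          c∉₂ = ⊖∉ {T = S ⊖ a₁} a₂ c∈T
          ¬e : ¬ End E S c
          ¬e e with ends c e
          ... | inj₁ refl = c∉₁ (self a₁)
          ... | inj₂ refl = c∉₂ (self a₂)
          tc₂ : Touches a₂ c
          tc₂ with later-outside a₁ c∈ (End.≢p ec) (End.≢q ec) c∉₁ ¬e
          ... | x , sx , ex , nl with ⊖-split {T = S ⊖ a₁} a₂ sx
          ...   | inj₁ tx = ⊥-elim (nl (End.last ec x tx ex))
          ...   | inj₂ m = touch a₂ c∈ c∉₂ m ex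
          tc₁ : Touches a₁ c
          tc₁ with later-outside a₂ c∈ (End.≢p ec) (End.≢q ec) c∉₂ ¬e
          ... | x , sx , ex , nl with ⊖-split {T = S} a₁ (⊖⊆ {T = S} a₂ sx)
          ...   | inj₂ m = touch a₁ c∈ c∉₁ m ex
          ...   | inj₁ s₁ with ⊖-split {T = S ⊖ a₁} a₂ s₁
          ...     | inj₁ tx = ⊥-elim (nl (End.last ec x tx ex))
          ...     | inj₂ m = ⊥-elim (⊖∉ {T = S} a₂ sx m)
          end' : End E ((S ⊖ a₂) ⊖ a₁) c
          end' = end⊆ ec (λ x s → ⊖-intro {T = S ⊖ a₁} a₂ (⊖-intro {T = S} a₁ (⊖⊆ {T = S} a₂ (⊖⊆ {T = S ⊖ a₂} a₁ s)) (⊖∉ {T = S ⊖ a₂} a₁ s)) (⊖∉ {T = S} a₂ (⊖⊆ {T = S ⊖ a₂} a₁ s)))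
                   (⊖-intro {T = S ⊖ a₂} a₁ (⊖-intro {T = S} a₂ c∈ c∉₂) c∉₁)

      -- As with two arms, an end c of the rest must touch at least two of the arms, and an
      -- untouched third arm does not prevent c from being exposed. If the rest is too small to have
      -- an end, q takes the place of c.
      three-arms : ∀ {w₁ w₂ w₃} (e₁ : End E S w₁) (e₂ : End E S w₂) (e₃ : End E S w₃) (n₁₂ : w₁ ≢ w₂) (n₁₃ : w₁ ≢ w₃) (n₂₃ : w₂ ≢ w₃) →
                   (∀ w → End E S w → w ≡ w₁ ⊎ w ≡ w₂ ⊎ w ≡ w₃) →
                   (a₁ : Arm w₁) (a₂ : Arm w₂) (a₃ : Arm w₃) → Reduction E S
      three-arms {w₁} {w₂} {w₃} e₁ e₂ e₃ n₁₂ n₁₃ n₂₃ ends a₁ a₂ a₃ = finish' (big a₁ a₂ a₃ total)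
        where
        T = ((S ⊖ a₁) ⊖ a₂) ⊖ a₃
        wi₁ = within-S e₁ a₁
        wi₂ = within-⊖ {T = S} e₁ e₂ n₁₂ a₁ a₂ (within-S e₂ a₂)
        wi₃ = within-⊖ {T = S ⊖ a₁} e₂ e₃ n₂₃ a₂ a₃ (within-⊖ {T = S} e₁ e₃ n₁₃ a₁ a₃ (within-S e₃ a₃))
        str-T : Str E T
        str-T = ⊖-str e₃ a₃ (⊖-str e₂ a₂ (⊖-str e₁ a₁ str (λ _ s → s) wi₁) (λ _ s → ⊖⊆ {T = S} a₁ s) wi₂) (λ _ s → ⊖⊆ {T = S} a₁ (⊖⊆ {T = S ⊖ a₁} a₂ s)) wi₃
        T∈ : ∀ {x} → S x ≡ true → ¬ (x ∈ₐ a₁) → ¬ (x ∈ₐ a₂) → ¬ (x ∈ₐ a₃) → T x ≡ true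
        T∈ s x₁ x₂ x₃ = ⊖-intro {T = (S ⊖ a₁) ⊖ a₂} a₃ (⊖-intro {T = S ⊖ a₁} a₂ (⊖-intro {T = S} a₁ s x₁) x₂) x₃
        total : width a₁ + (width a₂ + (width a₃ + size T)) ≡ 8 + k
        total = trans (sym (trans (⊖-size {T = S} a₁ wi₁) (cong (width a₁ +_) (trans (⊖-size {T = S ⊖ a₁} a₂ wi₂) (cong (width a₂ +_) (⊖-size {T = (S ⊖ a₁) ⊖ a₂} a₃ wi₃)))))) sz
        Small : ∀ {w w'} → Arm w → Arm w' → Set
        Small (two _) (two _) = size T ≡ 2
        Small _ _ = ⊥
        big : (b₁ : Arm w₁) (b₂ : Arm w₂) (b₃ : Arm w₃) → width b₁ + (width b₂ + (width b₃ + size T)) ≡ 8 + k →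
              (∃ λ l → size T ≡ 3 + l) ⊎ Small b₁ b₂
        big (one _) (one _) (one _) z = inj₁ (_ , suc-injective (suc-injective (suc-injective z)))
        big (one _) (one _) (two _) z = inj₁ (_ , suc-injective (suc-injective (suc-injective (suc-injective z))))
        big (one _) (two _) (one _) z = inj₁ (_ , suc-injective (suc-injective (suc-injective (suc-injective z))))
        big (two _) (one _) (one _) z = inj₁ (_ , suc-injective (suc-injective (suc-injective (suc-injective z))))
        big (one _) (two _) (two _) z = inj₁ (_ , suc-injective (suc-injective (suc-injective (suc-injective (suc-injective z)))))
        big (two _) (one _) (two _) z = inj₁ (_ , suc-injective (suc-injective (suc-injective (suc-injective (suc-injective z)))))
        big (two _) (two _) (one _) z = inj₁ (_ , suc-injective (suc-injective (suc-injective (suc-injective (suc-injective z)))))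
        -- Three arms of two vertices each leave only two vertices of eight; in all other cases at
        -- least three remain.
        big (two _) (two _) (two _) z = lem _ (suc-injective (suc-injective (suc-injective (suc-injective (suc-injective (suc-injective z))))))
          where
          lem : ∀ m → size T ≡ 2 + m → (∃ λ l → size T ≡ 3 + l) ⊎ (size T ≡ 2)
          lem zero z = inj₂ z
          lem (suc m) z = inj₁ (m , z)
        small : (b₁ : Arm w₁) (b₂ : Arm w₂) → b₁ ≡ a₁ → b₂ ≡ a₂ → Small b₁ b₂ → Reduction E S
        small (two t₁) (two t₂) refl refl z = Pair₂.reduce-22 e₁ e₂ n₁₂ t₁ t₂ (Str.q∈ str)
            (root-touch {T = T} e₁ t₁ in₁ (only-roots str-T z)) (root-touch {T = T} e₂ t₂ in₂ (only-roots str-T z))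
          where
          v₁ = TypeTwo.v t₁
          v₂ = TypeTwo.v t₂
          v₁∈ = -⊆ {S = S} (End.∈S (TypeTwo.ve t₁))
          v₂∈ = -⊆ {S = S} (End.∈S (TypeTwo.ve t₂))
          not-last : ∀ {w v x} → End E S w → S v ≡ true → E v x ≡ true → r x < r v → x ≢ w
          not-last e sv ex lt refl = <-asym lt (End.last e _ sv (fl ex))
          arm₃ : ∀ {w w'} (e : End E S w) (e' : End E S w') → w ≢ w' → (t : TypeTwo w) (a : Arm w') → ∀ {x} → S x ≡ true →
                 E (TypeTwo.v t) x ≡ true → r x < r (TypeTwo.v t) → ¬ (x ∈ₐ a)
          arm₃ e e' n t (one _) sx ex lt m = not-last e' (-⊆ {S = S} (End.∈S (TypeTwo.ve t))) ex lt m
          arm₃ e e' n t (two _) sx ex lt (inj₁ m) = not-last e' (-⊆ {S = S} (End.∈S (TypeTwo.ve t))) ex lt m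
          arm₃ e e' n t (two t') sx ex lt (inj₂ refl) = Pair₂.¬v₁v₂ e e' n t t' ex
          own : ∀ {w} (e : End E S w) (t : TypeTwo w) → ∀ {x} → E (TypeTwo.v t) x ≡ true → r x < r (TypeTwo.v t) → ¬ (x ∈ₐ two t)
          own e t ex lt (inj₁ m) = not-last e (-⊆ {S = S} (End.∈S (TypeTwo.ve t))) ex lt m
          own e t ex lt (inj₂ m) = ne ex (sym m)
          in₁ : ∀ x → S x ≡ true → E v₁ x ≡ true → r x < r v₁ → T x ≡ true
          in₁ x sx ex lt = T∈ sx (own e₁ t₁ ex lt) (arm₃ e₁ e₂ n₁₂ t₁ a₂ sx ex lt) (arm₃ e₁ e₃ n₁₃ t₁ a₃ sx ex lt)
          in₂ : ∀ x → S x ≡ true → E v₂ x ≡ true → r x < r v₂ → T x ≡ true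
          in₂ x sx ex lt = T∈ sx (arm₃ e₂ e₁ (≢-sym n₁₂) t₂ a₁ sx ex lt) (own e₂ t₂ ex lt) (arm₃ e₂ e₃ n₂₃ t₂ a₃ sx ex lt)
        finish' : (∃ λ l → size T ≡ 3 + l) ⊎ Small a₁ a₂ → Reduction E S
        finish' (inj₂ z) = small a₁ a₂ refl refl z
        finish' (inj₁ (l , z)) with exists-end str-T z
        ... | c , ec = touching (touches? a₁ c) (touches? a₂ c) (touches? a₃ c)
          where
          c₂ = ⊖⊆ {T = (S ⊖ a₁) ⊖ a₂} a₃ (End.∈S ec)
          c₁ = ⊖⊆ {T = S ⊖ a₁} a₂ c₂
          c∈ = ⊖⊆ {T = S} a₁ c₁
          c∉₁ = ⊖∉ {T = S} a₁ c₁
          c∉₂ = ⊖∉ {T = S ⊖ a₁} a₂ c₂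
          c∉₃ = ⊖∉ {T = (S ⊖ a₁) ⊖ a₂} a₃ (End.∈S ec)
          ¬e : ¬ End E S c
          ¬e e with ends c e
          ... | inj₁ refl = c∉₁ (self a₁)
          ... | inj₂ (inj₁ refl) = c∉₂ (self a₂)
          ... | inj₂ (inj₂ refl) = c∉₃ (self a₃)
          untouched : ∀ {w x} (a : Arm w) → ¬ (c ∈ₐ a) → ¬ Touches a c → E c x ≡ true → ¬ (x ∈ₐ a)
          untouched a nc nt ex m = nt (touch a c∈ nc m ex)
          -- If c touches only two arms, it is an end once these are removed.
          end-of : ∀ {w w' w″} (a : Arm w) (b : Arm w') (d : Arm w″) → ¬ (c ∈ₐ a) → ¬ (c ∈ₐ b) → ¬ (c ∈ₐ d) → ¬ Touches d c →
                   (∀ {x} → S x ≡ true → ¬ (x ∈ₐ a) → ¬ (x ∈ₐ b) → ¬ (x ∈ₐ d) → T x ≡ true) → End E ((S ⊖ b) ⊖ a) c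
          end-of a b d ca cb cd nt inT = mkEnd (⊖-intro {T = S ⊖ b} a (⊖-intro {T = S} b c∈ cb) ca) (End.≢p ec) (End.≢q ec) λ x sx ex →
            End.last ec x (inT (⊖⊆ {T = S} b (⊖⊆ {T = S ⊖ b} a sx)) (⊖∉ {T = S ⊖ b} a sx) (⊖∉ {T = S} b (⊖⊆ {T = S ⊖ b} a sx)) (untouched d cd nt ex)) ex
          -- c has a later neighbour outside every single arm, so it touches two arms.
          other : ∀ {w} (a : Arm w) → ¬ (c ∈ₐ a) → ∃ λ x → (S ⊖ a) x ≡ true × E c x ≡ true × ¬ (r x < r c)
          other a nc = later-outside a c∈ (End.≢p ec) (End.≢q ec) nc ¬e
          stuck : ∀ {w} (a : Arm w) → ¬ (c ∈ₐ a) → (∀ x → S x ≡ true → E c x ≡ true → ¬ (r x < r c) → x ∈ₐ a) → ⊥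
          stuck a nc f with other a nc
          ... | x , sx , ex , nl = ⊖∉ {T = S} a sx (f x (⊖⊆ {T = S} a sx) ex nl)
          mem : ∀ x → S x ≡ true → E c x ≡ true → ¬ (r x < r c) → x ∈ₐ a₁ ⊎ x ∈ₐ a₂ ⊎ x ∈ₐ a₃
          mem x sx ex nl with ⊖-split {T = S} a₁ sx
          ... | inj₂ m = inj₁ m
          ... | inj₁ s₁ with ⊖-split {T = S ⊖ a₁} a₂ s₁
          ...   | inj₂ m = inj₂ (inj₁ m)
          ...   | inj₁ s₂ with ⊖-split {T = (S ⊖ a₁) ⊖ a₂} a₃ s₂
          ...     | inj₂ m = inj₂ (inj₂ m)
          ...     | inj₁ s₃ = ⊥-elim (nl (End.last ec x s₃ ex))
          touching : Dec (Touches a₁ c) → Dec (Touches a₂ c) → Dec (Touches a₃ c) → Reduction E S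
          touching (yes t₁) (yes t₂) (yes t₃) = triple e₁ e₂ e₃ n₁₂ n₁₃ n₂₃ a₁ a₂ a₃ c∈ t₁ t₂ t₃
          touching (yes t₁) (yes t₂) (no ¬t₃) = pair e₁ e₂ n₁₂ a₁ a₂ c∈ t₁ t₂ (end-of a₁ a₂ a₃ c∉₁ c∉₂ c∉₃ ¬t₃ T∈)
          touching (yes t₁) (no ¬t₂) (yes t₃) = pair e₁ e₃ n₁₃ a₁ a₃ c∈ t₁ t₃ (end-of a₁ a₃ a₂ c∉₁ c∉₃ c∉₂ ¬t₂ λ s x₁ x₃ x₂ → T∈ s x₁ x₂ x₃)
          touching (no ¬t₁) (yes t₂) (yes t₃) = pair e₂ e₃ n₂₃ a₂ a₃ c∈ t₂ t₃ (end-of a₂ a₃ a₁ c∉₂ c∉₃ c∉₁ ¬t₁ λ s x₂ x₃ x₁ → T∈ s x₁ x₂ x₃)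
          touching (no ¬t₁) (no ¬t₂) _ = ⊥-elim (stuck a₃ c∉₃ λ x sx ex nl → lem x ex (mem x sx ex nl))
            where
            lem : ∀ x → E c x ≡ true → x ∈ₐ a₁ ⊎ x ∈ₐ a₂ ⊎ x ∈ₐ a₃ → x ∈ₐ a₃
            lem x ex (inj₁ m) = ⊥-elim (untouched a₁ c∉₁ ¬t₁ ex m)
            lem x ex (inj₂ (inj₁ m)) = ⊥-elim (untouched a₂ c∉₂ ¬t₂ ex m)
            lem x ex (inj₂ (inj₂ m)) = m
          touching (no ¬t₁) (yes _) (no ¬t₃) = ⊥-elim (stuck a₂ c∉₂ λ x sx ex nl → lem x ex (mem x sx ex nl))
            where
            lem : ∀ x → E c x ≡ true → x ∈ₐ a₁ ⊎ x ∈ₐ a₂ ⊎ x ∈ₐ a₃ → x ∈ₐ a₂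
            lem x ex (inj₁ m) = ⊥-elim (untouched a₁ c∉₁ ¬t₁ ex m)
            lem x ex (inj₂ (inj₁ m)) = m
            lem x ex (inj₂ (inj₂ m)) = ⊥-elim (untouched a₃ c∉₃ ¬t₃ ex m)
          touching (yes _) (no ¬t₂) (no ¬t₃) = ⊥-elim (stuck a₁ c∉₁ λ x sx ex nl → lem x ex (mem x sx ex nl))
            where
            lem : ∀ x → E c x ≡ true → x ∈ₐ a₁ ⊎ x ∈ₐ a₂ ⊎ x ∈ₐ a₃ → x ∈ₐ a₁
            lem x ex (inj₁ m) = m
            lem x ex (inj₂ (inj₁ m)) = ⊥-elim (untouched a₂ c∉₂ ¬t₂ ex m)
            lem x ex (inj₂ (inj₂ m)) = ⊥-elim (untouched a₃ c∉₃ ¬t₃ ex m)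

      -- The rest has at least three vertices and hence an end, which would be an old end different
      -- from w₁.
      one-arm : ∀ {w₁} → End E S w₁ → (∀ w → End E S w → w ≡ w₁) → Arm w₁ → ⊥
      one-arm {w₁} e₁ ends a with exists-end (⊖-str e₁ a str (λ _ s → s) (within-S e₁ a)) (proj₂ (big a (trans (sym (⊖-size {T = S} a (within-S e₁ a))) sz)))
        where
        big : ∀ {m} (a : Arm w₁) → width a + m ≡ 8 + k → ∃ λ l → m ≡ 3 + l
        big (one _) refl = _ , refl
        big (two _) refl = _ , refl
      ... | c , ec with ends c (arm-old a c ec)
      ...   | refl = ⊖∉ {T = S} a (End.∈S ec) (self a)

      reduce : Reduction E S ⊎ FourEnds E S
      reduce with exists-end str sz
      ... | w₁ , e₁ with any? (λ w → End? E S w ×-dec ¬? (w ≟ w₁))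
      ...   | no none with arm-of e₁
      ...     | inj₁ x = inj₁ x
      ...     | inj₂ a₁ = ⊥-elim (one-arm e₁ only a₁)
        where
        only : ∀ w → End E S w → w ≡ w₁
        only w e with w ≟ w₁
        ... | yes z = z
        ... | no z = ⊥-elim (none (w , e , z))
      reduce | w₁ , e₁ | yes (w₂ , e₂ , n₂₁) with any? (λ w → End? E S w ×-dec (¬? (w ≟ w₁) ×-dec ¬? (w ≟ w₂)))
      ...   | no none with arm-of e₁ | arm-of e₂
      ...     | inj₁ x | _ = inj₁ x
      ...     | inj₂ _ | inj₁ x = inj₁ x
      ...     | inj₂ a₁ | inj₂ a₂ = inj₁ (two-arms e₁ e₂ (≢-sym n₂₁) only a₁ a₂)
        where
        only : ∀ w → End E S w → w ≡ w₁ ⊎ w ≡ w₂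
        only w e with w ≟ w₁ | w ≟ w₂
        ... | yes z | _ = inj₁ z
        ... | no _ | yes z = inj₂ z
        ... | no y | no z = ⊥-elim (none (w , e , y , z))
      reduce | w₁ , e₁ | yes (w₂ , e₂ , n₂₁) | yes (w₃ , e₃ , n₃₁ , n₃₂) with any? (λ w → End? E S w ×-dec (¬? (w ≟ w₁) ×-dec (¬? (w ≟ w₂) ×-dec ¬? (w ≟ w₃))))
      ...   | yes (w₄ , e₄ , n₄₁ , n₄₂ , n₄₃) = inj₂ (record
              { e₁ = e₁ ; e₂ = e₂ ; e₃ = e₃ ; e₄ = e₄ ; n₁₂ = ≢-sym n₂₁ ; n₁₃ = ≢-sym n₃₁ ; n₁₄ = ≢-sym n₄₁
              ; n₂₃ = ≢-sym n₃₂ ; n₂₄ = ≢-sym n₄₂ ; n₃₄ = ≢-sym n₄₃ })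
      ...   | no none with arm-of e₁ | arm-of e₂ | arm-of e₃
      ...     | inj₁ x | _ | _ = inj₁ x
      ...     | inj₂ _ | inj₁ x | _ = inj₁ x
      ...     | inj₂ _ | inj₂ _ | inj₁ x = inj₁ x
      ...     | inj₂ a₁ | inj₂ a₂ | inj₂ a₃ = inj₁ (three-arms e₁ e₂ e₃ (≢-sym n₂₁) (≢-sym n₃₁) (≢-sym n₃₂) only a₁ a₂ a₃)
        where
        only : ∀ w → End E S w → w ≡ w₁ ⊎ w ≡ w₂ ⊎ w ≡ w₃
        only w e with w ≟ w₁ | w ≟ w₂ | w ≟ w₃
        ... | yes z | _ | _ = inj₁ z
        ... | no _ | yes z | _ = inj₂ (inj₁ z)
        ... | no _ | no _ | yes z = inj₂ (inj₂ z)
        ... | no x | no y | no z = ⊥-elim (none (w , e , x , y , z))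

  -- Recognising small and exceptional vertex sets.

  record Enum (m : ℕ) (E : Graph n) (S : Fin n → Bool) : Set where
    field
      f : ℕ → Fin n
      inS : ∀ {i} → i < m → S (f i) ≡ true
      onto : ∀ {v} → S v ≡ true → ∃ λ i → i < m × f i ≡ v
      inj : ∀ {i j} → i < m → j < m → f i ≡ f j → i ≡ j
      root : E (f 1) (f 0) ≡ true
      valid : ∀ i → 2 ≤ i → i < m → (∃ λ j → j < i × E (f i) (f j) ≡ true) ×
              (∀ j → j < i → E (f i) (f j) ≡ true → ∃ λ l → l < i × E (f i) (f l) ≡ true × E (f j) (f l) ≡ true)

  -- Vertices are numbered by removing ends one after the other, not by r. An end has all its
  -- remaining neighbours among its earlier neighbours, so the code obtained is still one of those
  -- listed.
  enum : ∀ k {E S} → Str E S → size S ≡ 2 + k → Enum (2 + k) E S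
  enum zero {E} {S} str sz = record { f = f ; inS = inS ; onto = onto ; inj = inj ; root = Str.qp str ; valid = λ i a b → ⊥-elim (no-mid a b) }
    where
    f : ℕ → Fin n
    f zero = p
    f (suc _) = q
    inS : ∀ {i} → i < 2 → S (f i) ≡ true
    inS {zero} _ = Str.p∈ str
    inS {suc _} _ = Str.q∈ str
    onto : ∀ {v} → S v ≡ true → ∃ λ i → i < 2 × f i ≡ v
    onto {v} sv with only-roots str str sz v sv
    ... | inj₁ refl = 0 , s≤s z≤n , refl
    ... | inj₂ refl = 1 , s≤s (s≤s z≤n) , refl
    p≢q : p ≢ q
    p≢q e = <-irrefl (cong r e) p<q
    inj : ∀ {i j} → i < 2 → j < 2 → f i ≡ f j → i ≡ j
    inj {zero} {zero} _ _ _ = refl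
    inj {zero} {suc zero} _ _ e = ⊥-elim (p≢q e)
    inj {suc zero} {zero} _ _ e = ⊥-elim (p≢q (sym e))
    inj {suc zero} {suc zero} _ _ _ = refl
    inj {suc (suc _)} (s≤s (s≤s ())) _ _
    inj {_} {suc (suc _)} _ (s≤s (s≤s ())) _
    no-mid : ∀ {i} → 2 ≤ i → i < 2 → ⊥
    no-mid (s≤s (s≤s _)) (s≤s (s≤s ()))
  enum (suc k) {E} {S} str sz with exists-end str sz
  ... | w , ew = record { f = g ; inS = inS' ; onto = onto' ; inj = inj' ; root = root' ; valid = valid' }
    where
    open End ew
    m = 2 + k
    open Enum (enum k (removeEnd str ew) (suc-injective (trans (sym (size-remove S ∈S)) sz)))
    g = ext f m w
    old : ∀ {i} → i < m → g i ≡ f i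
    old = ext-old f m w
    new = ext-new f m w
    inS' : ∀ {i} → i < suc m → S (g i) ≡ true
    inS' lt with <suc-split lt
    ... | inj₁ refl rewrite new = ∈S
    ... | inj₂ l rewrite old l = -⊆ {S = S} (inS l)
    onto' : ∀ {v} → S v ≡ true → ∃ λ i → i < suc m × g i ≡ v
    onto' {v} sv with v ≟ w
    ... | yes refl = m , ≤-refl , new
    ... | no ne with onto (-intro {S = S} sv ne)
    ...   | i , l , e = i , m<n⇒m<1+n l , trans (old l) e
    inj' : ∀ {i j} → i < suc m → j < suc m → g i ≡ g j → i ≡ j
    inj' {i} {j} a b e with <suc-split a | <suc-split b
    ... | inj₁ refl | inj₁ refl = refl
    ... | inj₁ refl | inj₂ l = ⊥-elim (-≢ {S = S} (inS l) (trans (sym (old l)) (trans (sym e) new)))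
    ... | inj₂ l | inj₁ refl = ⊥-elim (-≢ {S = S} (inS l) (trans (sym (old l)) (trans e new)))
    ... | inj₂ l | inj₂ l' = inj l l' (trans (sym (old l)) (trans e (old l')))
    root' : E (g 1) (g 0) ≡ true
    root' = trans (cong₂ E (old (s≤s (s≤s z≤n))) (old (s≤s z≤n))) root
    lookup-w : ∀ {x} → E w x ≡ true → r x < r w → ∃ λ j → j < m × f j ≡ x
    lookup-w {x} e l = onto (-intro {S = S} (Str.down str ∈S e l) (λ { refl → <-irrefl refl l }))
    valid' : ∀ i → 2 ≤ i → i < suc m → (∃ λ j → j < i × E (g i) (g j) ≡ true) ×
             (∀ j → j < i → E (g i) (g j) ≡ true → ∃ λ l → l < i × E (g i) (g l) ≡ true × E (g j) (g l) ≡ true)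
    valid' i i≥2 lt with <suc-split lt
    ... | inj₂ li = (let j , lj , e = proj₁ v in j , lj , trans (cong₂ E (old li) (old (<-trans lj li))) e) ,
                    λ j lj e → let l , ll , e₁ , e₂ = proj₂ v j lj (trans (sym (cong₂ E (old li) (old (<-trans lj li)))) e) in
                      l , ll , trans (cong₂ E (old li) (old (<-trans ll li))) e₁ , trans (cong₂ E (old (<-trans lj li)) (old (<-trans ll li))) e₂
      where v = valid i i≥2 li
    ... | inj₁ refl = first , second
      where
      first : ∃ λ j → j < m × E (g m) (g j) ≡ true
      first with Str.base str ∈S ≢p ≢q
      ... | x , e , l with lookup-w e l
      ...   | j , lj , refl = j , lj , trans (cong₂ E new (old lj)) e
      second : ∀ j → j < m → E (g m) (g j) ≡ true → ∃ λ l → l < m × E (g m) (g l) ≡ true × E (g j) (g l) ≡ true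
      second j lj e with mate str ew (-⊆ {S = S} (inS lj)) (trans (sym (cong₂ E new (old lj))) e)
      ... | y , ey , sy , exy with lookup-w ey (last y sy ey)
      ...   | l , ll , refl = l , ll , trans (cong₂ E new (old ll)) ey , trans (cong₂ E (old lj) (old ll)) exy

  module _ {E : Graph n} {S : Fin n → Bool} (str : Str E S) where
    open Str str using (E-sym; irr)

    by-cert : ∀ {m es k} → Emb m es E S → Certified m k es → Good E S k
    by-cert e (certified b ok) = Realise.realise E irr E-sym S e b ok

    match : ∀ {m X es} → (e : Emb m es E S) → (∀ {i j} → i < m → j < m → adj es i j ≡ E (Emb.f e i) (Emb.f e j)) →
            Matches m X es → Exact m X E S
    match {m} {X} {es} e ad (matches π ok) = record
      { f = λ j → f (image π j) ; inS = λ l → inS (lt l) ; onto = onto' ; inj = λ a b z → proj₂ (proj₂ pp) a b (inj (lt a) (lt b) z) ; same = same }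
      where
      open Emb e
      pp = perm-props {E = E} {S = S} {m} π (proj₁ (∧-true {permᵇ m π} ok))
      lt : ∀ {i} → i < m → image π i < m
      lt = proj₁ pp
      onto' : ∀ {v} → S v ≡ true → ∃ λ j → j < m × f (image π j) ≡ v
      onto' sv with onto sv
      ... | a , la , z with proj₁ (proj₂ pp) la
      ...   | j , lj , y = j , lj , trans (cong f y) z
      eqᵇ : ℕ → ℕ → Bool
      eqᵇ x y = not (adj X x y xor adj es (image π x) (image π y))
      xor-eq : ∀ {x y} → x xor y ≡ false → x ≡ y
      xor-eq {true} {true} _ = refl
      xor-eq {false} {false} _ = refl
      same : ∀ {a b} → a < m → b < m → E (f (image π a)) (f (image π b)) ≡ adj X a b
      same {a} {b} la lb = trans (sym (ad (lt la) (lt lb)))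
        (sym (xor-eq (not-true (allᵇ-∈ {p = eqᵇ a} (allᵇ-∈ {p = λ x → allᵇ (eqᵇ x) (upTo m)} (proj₂ (∧-true {permᵇ m π} ok)) (∈-upTo⁺ la)) (∈-upTo⁺ lb)))))

    by-code : ∀ {k l Xs} → size S ≡ 2 + k → CodeTable k l Xs → Good E S l ⊎ (∃ λ i → Exact (2 + k) (nth Xs i) E S)
    by-code {k} {l} {Xs} sz tab = go (code-lookup tab (codeOf-∈ k root valid))
      where
      open Enum (enum k str sz)
      open Coding E irr E-sym f
      emb : Emb (2 + k) (edgesOf (codeOf (2 + k))) E S
      emb = record { f = f ; inS = inS ; onto = onto ; inj = inj
                   ; edge = λ mem → let a , b , e = edges-sound (2 + k) mem in a , <-trans b a , e }
      go : Certified (2 + k) l (edgesOf (codeOf (2 + k))) ⊎ (∃ λ i → Matches (2 + k) (nth Xs i) (edgesOf (codeOf (2 + k)))) →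
           Good E S l ⊎ (∃ λ i → Exact (2 + k) (nth Xs i) E S)
      go (inj₁ c) = inj₁ (by-cert emb c)
      go (inj₂ (i , mt)) = inj₂ (i , match emb (adj-code (2 + k)) mt)

    -- If the copy of X is not induced, some missing edge of X is present, and X with that single
    -- edge added already has a certificate.
    contains : ∀ {m k X} → EdgeTable m k X → Emb m X E S → Good E S k ⊎ Exact m X E S
    contains {m} {k} {X} tab e with split (anyᵇ (λ a → E (Emb.f e (proj₁ a)) (Emb.f e (proj₂ a))) (nonEdges m X))
    ... | inj₁ z with anyᵇ-elim (nonEdges m X) z
    ...   | (i , j) , mem , ed = inj₁ (by-cert (emb-edge e (proj₁ (nonEdges-bound m X mem)) (proj₂ (nonEdges-bound m X mem)) ed) (edge-lookup tab mem))
    contains {m} {k} {X} tab e | inj₂ z = inj₂ (record { Emb e ; same = same })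
      where
      open Emb e
      same : ∀ {i j} → i < m → j < m → E (f i) (f j) ≡ adj X i j
      same {i} {j} li lj with split (adj X i j)
      ... | inj₁ q with adj-∈ X q
      ...   | inj₁ mm = trans (proj₂ (proj₂ (edge mm))) (sym q)
      ...   | inj₂ mm = trans (E-sym _ _) (trans (proj₂ (proj₂ (edge mm))) (sym q))
      same {i} {j} li lj | inj₂ q with i Data.Nat.≟ j
      ...   | yes refl = trans (irr (f i)) (sym q)
      ...   | no ne = trans (≢true λ y → clash (anyᵇ-intro {p = λ a → E (f (proj₁ a)) (f (proj₂ a))} (nonEdges-∈ m X li lj q ne) y) z) (sym q)

    relabel : ∀ {m X es} → (∀ {i j} → (i , j) ∈ X → i < m × j < m) → Emb m es E S → Relabels m X es → Emb m X E S
    relabel {m} {X} {es} bd e (relabels π ok) = record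
      { f = λ j → f (image π j) ; inS = λ l → inS (lt l) ; onto = onto' ; inj = λ a b z → proj₂ (proj₂ pp) a b (inj (lt a) (lt b) z) ; edge = edge' }
      where
      open Emb e
      pp = perm-props {E = E} {S = S} {m} π (proj₁ (∧-true {permᵇ m π} ok))
      lt : ∀ {i} → i < m → image π i < m
      lt = proj₁ pp
      onto' : ∀ {v} → S v ≡ true → ∃ λ j → j < m × f (image π j) ≡ v
      onto' sv with onto sv
      ... | a , la , z with proj₁ (proj₂ pp) la
      ...   | j , lj , y = j , lj , trans (cong f y) z
      edge' : ∀ {i j} → (i , j) ∈ X → i < m × j < m × E (f (image π i)) (f (image π j)) ≡ true
      edge' {i} {j} mem with adj-∈ es {image π i} {image π j} (allᵇ-∈ {p = λ a → adj es (image π (proj₁ a)) (image π (proj₂ a))} (proj₂ (∧-true {permᵇ m π} ok)) mem)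
      ... | inj₁ mm = proj₁ (bd mem) , proj₂ (bd mem) , proj₂ (proj₂ (edge mm))
      ... | inj₂ mm = proj₁ (bd mem) , proj₂ (bd mem) , trans (E-sym _ _) (proj₂ (proj₂ (edge mm)))

    module Ext {allowed m h Y X} (tab : ExtTable allowed m h Y X)
               (bd : ∀ {i j} → (i , j) ∈ X → i < m × j < m) where

      ext-one : ∀ {w x y} → Exact m X E (S - w) → S w ≡ true → (S - w) x ≡ true → (S - w) y ≡ true →
                E w x ≡ true → E w y ≡ true → E x y ≡ true → Good E S (1 + h)
      ext-one {w} ex sw sx sy wx wy xy with Exact.onto ex sx | Exact.onto ex sy
      ... | i , li , refl | j , lj , refl with adj-∈ X (trans (sym (Exact.same ex li lj)) xy)
      ...   | inj₁ mem = by-cert (emb-ext (exact-emb bd ex) sw li lj wx wy) (table-ext₁ tab mem)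
      ...   | inj₂ mem = by-cert (emb-ext (exact-emb bd ex) sw lj li wy wx) (table-ext₁ tab mem)

      Outcome : Set
      Outcome = Good E S (1 + h) ⊎ (allowed ≡ true × (∃ λ es → Emb (2 + m) es E S × Relabels (2 + m) Y es))

      private
        use : ∀ {es} → Emb (2 + m) es E S → Certified (2 + m) (1 + h) es ⊎ (allowed ≡ true × Relabels (2 + m) Y es) → Outcome
        use e (inj₁ c) = inj₁ (by-cert e c)
        use {es} e (inj₂ (z , rl)) = inj₂ (z , es , e , rl)

      module _ {E' : Graph n} {v w : Fin n} (sub : ∀ x y → E' x y ≡ true → E x y ≡ true) (sv : S v ≡ true) (sw : S w ≡ true) (v≢w : v ≢ w)
               (ex : Exact m X E' (S - w - v)) where
        open Exact ex using (f)

        private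
          base-emb : Emb m X E (S - w - v)
          base-emb = emb-sub sub (exact-emb bd ex)
          sv' : (S - w) v ≡ true
          sv' = -intro {S = S} sv v≢w
          g = ext f m v
          old : ∀ {i} → i < m → g i ≡ f i
          old = ext-old f m v

        two-step : ∀ {i j k l} → (i , j) ∈ X → (k , l) ∈ onEdge m (i , j) X → E v (f i) ≡ true → E v (f j) ≡ true →
                   E w (g k) ≡ true → E w (g l) ≡ true → Outcome
        two-step {i} {j} {k} {l} mem mem' vi vj wk wl =
          let e₁ = emb-ext base-emb sv' (proj₁ (bd mem)) (proj₂ (bd mem)) vi vj
              lk , ll , _ = Emb.edge e₁ mem'
          in use (emb-ext e₁ sw lk ll wk wl) (table-ext₂ tab mem mem')

        -- The possibilities for w in `Attach` are an edge of X, the new edge from v to x, and an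
        -- edge that pruning may have deleted. The last is covered by the extra certificates unless
        -- the edge belongs to X after all.
        exceptional : Attach E E' (S - w - v) v w → Outcome
        exceptional at with Exact.onto ex (Attach.x∈ at) | Exact.onto ex (Attach.y∈ at)
        ... | i , li , fi | j , lj , fj = go (adj-∈ X (trans (sym (trans (cong₂ E' (sym fi) (sym fj)) (Exact.same ex li lj))) xy))
          where
          open Attach at
          vi : E v (f i) ≡ true
          vi = trans (cong (E v) fi) vx
          vj : E v (f j) ≡ true
          vj = trans (cong (E v) fj) vy
          atw : ∀ {k z} → k < m → f k ≡ z → E w z ≡ true → E w (g k) ≡ true
          atw lk refl e = trans (cong (E w) (old lk)) e
          new : E w v ≡ true → E w (g m) ≡ true
          new e = trans (cong (E w) (ext-new f m v)) e
          on-edge : ∀ {k l} → k < m → l < m → adj X k l ≡ true → E w (f k) ≡ true → E w (f l) ≡ true → (i , j) ∈ X ⊎ (j , i) ∈ X → Outcome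
          on-edge lk ll ad wk wl (inj₁ mem) with adj-∈ X ad
          ... | inj₁ z = two-step mem (there (there z)) vi vj (atw lk refl wk) (atw ll refl wl)
          ... | inj₂ z = two-step mem (there (there z)) vi vj (atw ll refl wl) (atw lk refl wk)
          on-edge lk ll ad wk wl (inj₂ mem) with adj-∈ X ad
          ... | inj₁ z = two-step mem (there (there z)) vj vi (atw lk refl wk) (atw ll refl wl)
          ... | inj₂ z = two-step mem (there (there z)) vj vi (atw ll refl wl) (atw lk refl wk)
          dir-adj : (i , j) ∈ X ⊎ (j , i) ∈ X → adj X i j ≡ true
          dir-adj (inj₁ z) = ∨-introˡ (∈-arc z)
          dir-adj (inj₂ z) = ∨-introʳ {arc X i j} (∈-arc z)
          go : (i , j) ∈ X ⊎ (j , i) ∈ X → Outcome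
          go dir with next
          ... | inj₁ (a , b , sa , sb , wa , wb , ab) with Exact.onto ex sa | Exact.onto ex sb
          ...   | k , lk , refl | l , ll , refl = on-edge lk ll (trans (sym (Exact.same ex lk ll)) ab) wa wb dir
          go (inj₁ mem) | inj₂ (inj₁ (wv , wx)) = two-step mem (here refl) vi vj (new wv) (atw li fi wx)
          go (inj₂ mem) | inj₂ (inj₁ (wv , wx)) = two-step mem (there (here refl)) vj vi (new wv) (atw li fi wx)
          go dir | inj₂ (inj₂ (a , b , sa , wx , wa , xa , only)) with Exact.onto ex sa
          ...   | l , ll , refl with split (adj X i l)
          ...     | inj₁ ad = on-edge li ll ad (trans (cong (E w) fi) wx) wa dir
          ...     | inj₂ nad = inj₁ (by-cert emb (table-extra tab (triples-∈ m X li lj ll cnd)))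
            where
            ij : adj X i j ≡ true
            ij = dir-adj dir
            i≢l : i ≢ l
            i≢l refl = clash (trans (cong (λ z → E z (f i)) fi) xa) (irr (f i))
            nbr : ∀ {k e} → k < m → (∀ {z} → z < m → f z ≡ b → z ≡ e) → not (adj X i k) ∨ ((k ≡ᵇ j) ∨ (k ≡ᵇ e)) ≡ true
            nbr {k} {e} lk isb with split (adj X i k)
            ... | inj₂ z = ∨-introˡ (not-false z)
            ... | inj₁ z with only (f k) (trans (cong (λ y → E' y (f k)) (sym fi)) (trans (Exact.same ex li lk) z))
            ...   | inj₁ y = ∨-introʳ {not (adj X i k)} (∨-introˡ (subst (λ o → (k ≡ᵇ o) ≡ true) (Exact.inj ex lk lj (trans y (sym fj))) (≡ᵇ-refl k)))
            ...   | inj₂ y = ∨-introʳ {not (adj X i k)} (∨-introʳ {k ≡ᵇ j} (subst (λ o → (k ≡ᵇ o) ≡ true) (isb lk y) (≡ᵇ-refl k)))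
            deg : anyᵇ (λ e → allᵇ (λ k → not (adj X i k) ∨ ((k ≡ᵇ j) ∨ (k ≡ᵇ e))) (upTo m)) (upTo m) ≡ true
            deg with split ((S - w - v) b)
            ... | inj₁ sb with Exact.onto ex sb
            ...   | e , le , fe = anyᵇ-intro {p = λ e → allᵇ (λ k → not (adj X i k) ∨ ((k ≡ᵇ j) ∨ (k ≡ᵇ e))) (upTo m)} (∈-upTo⁺ le)
                    (allᵇ-intro (upTo m) λ k mem → nbr (∈-upTo⁻ mem) λ lz fz → Exact.inj ex lz le (trans fz (sym fe)))
            -- If b is not among the remaining vertices, then j is the only possible neighbour of i
            -- and serves as both bounds.
            deg | inj₂ sb = anyᵇ-intro {p = λ e → allᵇ (λ k → not (adj X i k) ∨ ((k ≡ᵇ j) ∨ (k ≡ᵇ e))) (upTo m)} (∈-upTo⁺ lj)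
                    (allᵇ-intro (upTo m) λ k mem → nbr (∈-upTo⁻ mem) λ { lz refl → clash (Exact.inS ex lz) sb })
            cnd : cond m X (i , j , l) ≡ true
            cnd = ∧-intro (∧-intro ij (not-false (≡ᵇ-false i≢l))) (∧-intro (not-false nad) deg)
            e₁ : Emb (suc m) (onEdge m (i , j) X) E (S - w)
            e₁ = emb-ext base-emb sv' li lj vi vj
            li' = m<n⇒m<1+n li
            ll' = m<n⇒m<1+n ll
            e₂ : Emb (suc m) ((i , l) ∷ onEdge m (i , j) X) E (S - w)
            e₂ = emb-edge e₁ li' ll' (trans (cong₂ E (trans (old li) fi) (old ll)) xa)
            emb : Emb (2 + m) (extraEdges m X (i , j , l)) E S
            emb = emb-ext e₂ sw li' ll' (atw li fi wx) (atw ll refl wa)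

  -- Four ends at once.

  module _ {E : Graph n} {S : Fin n → Bool} (str : Str E S) where
    open Str str using (E-sym; irr; qp)

    not-empty : ∀ {m} → Exact m [] E S → ⊥
    not-empty e with Exact.onto e (Str.q∈ str) | Exact.onto e (Str.p∈ str)
    ... | i , li , refl | j , lj , refl = clash qp (Exact.same e li lj)

    end-base : ∀ {w} → End E S w → ∃ λ x → ∃ λ y → (S - w) x ≡ true × (S - w) y ≡ true × E w x ≡ true × E w y ≡ true × E x y ≡ true
    end-base e with base₂ str (End.∈S e) (End.≢p e) (End.≢q e)
    ... | x , y , wx , wy , xy , lx , ly =
      x , y , -intro {S = S} (Str.down str (End.∈S e) wx lx) (≢-sym (≢-edge str wx)) ,
      -intro {S = S} (Str.down str (End.∈S e) wy ly) (≢-sym (≢-edge str wy)) , wx , wy , xy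

    module Four (fe : FourEnds E S) where
      open FourEnds fe

      S₁ = S - w₁
      S₂ = S₁ - w₂
      S₃ = S₂ - w₃
      core = S₃ - w₄

      S₁⊆ : ∀ {x} → S₁ x ≡ true → S x ≡ true
      S₁⊆ = -⊆ {S = S}
      S₂⊆ : ∀ {x} → S₂ x ≡ true → S x ≡ true
      S₂⊆ s = S₁⊆ (-⊆ {S = S₁} s)
      S₃⊆ : ∀ {x} → S₃ x ≡ true → S x ≡ true
      S₃⊆ s = S₂⊆ (-⊆ {S = S₂} s)
      core⊆ : ∀ {x} → core x ≡ true → S x ≡ true
      core⊆ s = S₃⊆ (-⊆ {S = S₃} s)
      core-intro : ∀ {x} → S x ≡ true → x ≢ w₁ → x ≢ w₂ → x ≢ w₃ → x ≢ w₄ → core x ≡ true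
      core-intro s a b c d = -intro {S = S₃} (-intro {S = S₂} (-intro {S = S₁} (-intro {S = S} s a) b) c) d

      in₂ : S₁ w₂ ≡ true
      in₂ = -intro {S = S} (End.∈S e₂) (≢-sym n₁₂)
      in₃ : S₂ w₃ ≡ true
      in₃ = -intro {S = S₁} (-intro {S = S} (End.∈S e₃) (≢-sym n₁₃)) (≢-sym n₂₃)
      in₄ : S₃ w₄ ≡ true
      in₄ = -intro {S = S₂} (-intro {S = S₁} (-intro {S = S} (End.∈S e₄) (≢-sym n₁₄)) (≢-sym n₂₄)) (≢-sym n₃₄)

      core-str : Str E core
      core-str = removeEnd (removeEnd (removeEnd (removeEnd str e₁) (end⊆ e₂ (λ _ → S₁⊆) in₂)) (end⊆ e₃ (λ _ → S₂⊆) in₃)) (end⊆ e₄ (λ _ → S₃⊆) in₄)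

      core-size : ∀ {k} → size S ≡ 4 + k → size core ≡ k
      core-size sz = suc-injective (suc-injective (suc-injective (suc-injective (trans (sym (trans (size-remove S (End.∈S e₁))
        (cong suc (trans (size-remove S₁ in₂) (cong suc (trans (size-remove S₂ in₃) (cong suc (size-remove S₃ in₄)))))))) sz))))

      core-base : ∀ {w} → End E S w → ∃ λ x → ∃ λ y → core x ≡ true × core y ≡ true × E w x ≡ true × E w y ≡ true × E x y ≡ true
      core-base {w} e with end-base e
      ... | x , y , sx , sy , wx , wy , xy = x , y , inC wx (-⊆ {S = S} sx) , inC wy (-⊆ {S = S} sy) , wx , wy , xy
        where
        no-end : ∀ {z w'} → E w z ≡ true → End E S w' → z ≢ w'
        no-end wz e' refl = nonadjacent-ends str e e' wz
        inC : ∀ {z} → E w z ≡ true → S z ≡ true → core z ≡ true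
        inC wz s = core-intro s (no-end wz e₁) (no-end wz e₂) (no-end wz e₃) (no-end wz e₄)

      open Extend E irr E-sym S

      module Attach₄ (K : ℕ) (In Out : Fin n → Set) (In⊆ : ∀ x → In x → core x ≡ true) (Out⊆ : ∀ x → Out x → core x ≡ true)
                     (choose : ∀ {x y} → core x ≡ true → core y ≡ true → E x y ≡ true → (In x × Out y) ⊎ (In y × Out x)) where
        open Near core (λ _ → core⊆) K In Out In⊆ Out⊆

        add : ∀ {T w} → End E S w → T w ≡ true → (∀ u → core u ≡ true → T u ≡ true × u ≢ w) → Stage (T - w) → Stage T
        add e tw out st with core-base e
        ... | x , y , sx , sy , wx , wy , xy with choose sx sy xy
        ...   | inj₁ (i , o) = grow st (End.∈S e) tw out i o (≢-edge str xy) wx wy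
        ...   | inj₂ (i , o) = grow st (End.∈S e) tw out i o (≢-sym (≢-edge str xy)) wy wx

        attach-all : Stage core → Good E S (2 + K)
        attach-all st = finish-all (add e₁ (End.∈S e₁) (λ u c → core⊆ c , -≢ {S = S} (-⊆ {S = S₁} (-⊆ {S = S₂} (-⊆ {S = S₃} c))))
          (add e₂ in₂ (λ u c → -⊆ {S = S₁} (-⊆ {S = S₂} (-⊆ {S = S₃} c)) , -≢ {S = S₁} (-⊆ {S = S₂} (-⊆ {S = S₃} c)))
          (add e₃ in₃ (λ u c → -⊆ {S = S₂} (-⊆ {S = S₃} c) , -≢ {S = S₂} (-⊆ {S = S₃} c))
          (add e₄ in₄ (λ u c → -⊆ {S = S₃} c , -≢ {S = S₃} c) st))))

      four-good : ∀ {K} → Good E core K → Good E S (2 + K)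
      four-good {K} (D , o , aw) = Attach₄.attach-all K (λ x → core x ≡ true) (λ x → core x ≡ true) (λ _ c → c) (λ _ c → c) (λ a b _ → inj₁ (a , b))
        (record { D = D ; oriented = Start.oriented st ; fresh = Start.fresh st
                ; core-core = λ a b → weaken₁ (weaken₁ (aw a b)) ; core-in = λ a b → weaken₁ (aw a b) ; out-core = λ a b → weaken₁ (aw a b)
                ; out-in = aw ; attached = λ u c → inj₁ c })
        where st = start {E = E} {S = S} (λ _ _ e → e) (λ _ → core⊆) o aw

      -- The graded bounds of `Stage` leave an exceptional core two extra steps for its own
      -- distances. The directions σ are chosen independently of the orientation of the core: a new
      -- vertex on an edge is entered from the tail and left towards the head, so only heads and
      -- tails need the shorter walks.
      four-exact : ∀ {m h X} → (∀ {i j} → (i , j) ∈ X → i < m × j < m) → Certified₄ m h X → Exact m X E core → Good E S (2 + h)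
      four-exact {m} {h} {X} bd (certified₄ a b ok) ex = Attach₄.attach-all h In Out In⊆ Out⊆ choose
        (record { D = D ; oriented = D-or (λ _ → core⊆) okA ; fresh = fresh
                ; core-core = cc ; core-in = ci ; out-core = oc ; out-in = oi ; attached = λ u c → inj₁ c })
        where
        open Exact ex
        σ = orient X b
        emb = exact-emb bd ex
        open Realise E irr E-sym core emb a using (D; D-or; D-elim; as; as-edge; reach-walk)
        okA = proj₁ (∧-true {antisymᵇ as} ok)
        full half quarter : List (List Bool) → Bool
        full t = allᵇ (λ i → allᵇ (at (nth t i)) (upTo m)) (upTo m)
        half t = allᵇ (λ e → allᵇ (λ h → at (nth t h) (proj₁ e) ∧ at (nth t (proj₂ e)) h) (upTo m)) σ
        quarter t = allᵇ (λ e → allᵇ (λ e' → at (nth t (proj₂ e)) (proj₁ e')) σ) σ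
        ok' : full (reach m as (2 + h)) ∧ (half (reach m as (1 + h)) ∧ quarter (reach m as h)) ≡ true
        ok' = proj₂ (∧-true {antisymᵇ as} ok)
        ok″ = proj₂ (∧-true {full (reach m as (2 + h))} ok')
        In Out : Fin n → Set
        In x = ∃ λ i → ∃ λ j → (i , j) ∈ σ × x ≡ f i
        Out y = ∃ λ i → ∃ λ j → (i , j) ∈ σ × y ≡ f j
        σ-bd : ∀ {i j} → (i , j) ∈ σ → i < m × j < m
        σ-bd mem with orient-∈ X b mem
        ... | inj₁ z = bd z
        ... | inj₂ z = proj₂ (bd z) , proj₁ (bd z)
        In⊆ : ∀ x → In x → core x ≡ true
        In⊆ x (i , j , mem , refl) = inS (proj₁ (σ-bd mem))
        Out⊆ : ∀ x → Out x → core x ≡ true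
        Out⊆ x (i , j , mem , refl) = inS (proj₂ (σ-bd mem))
        choose : ∀ {x y} → core x ≡ true → core y ≡ true → E x y ≡ true → (In x × Out y) ⊎ (In y × Out x)
        choose sx sy xy with onto sx | onto sy
        ... | i , li , refl | j , lj , refl = go (dir (adj-∈ X (trans (sym (same li lj)) xy)))
          where
          dir : (i , j) ∈ X ⊎ (j , i) ∈ X → (i , j) ∈ σ ⊎ (j , i) ∈ σ
          dir (inj₁ z) = ∈-orient X b z
          dir (inj₂ z) with ∈-orient X b z
          ... | inj₁ y = inj₂ y
          ... | inj₂ y = inj₁ y
          go : (i , j) ∈ σ ⊎ (j , i) ∈ σ → (In (f i) × Out (f j)) ⊎ (In (f j) × Out (f i))
          go (inj₁ z) = inj₁ ((i , j , z , refl) , (i , j , z , refl))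
          go (inj₂ z) = inj₂ ((j , i , z , refl) , (j , i , z , refl))
        fresh : ∀ u → core u ≡ false → Fresh D u
        fresh u nc x = (λ d → bad₁ d) , (λ d → bad₂ d)
          where
          bad₁ : D x u ≡ true → ⊥
          bad₁ d with D-elim d
          ... | i , j , mem , _ , refl = clash (inS (proj₁ (proj₂ (as-edge mem)))) nc
          bad₂ : D u x ≡ true → ⊥
          bad₂ d with D-elim d
          ... | i , j , mem , refl , _ = clash (inS (proj₁ (as-edge mem))) nc
        cc : ∀ {u v} → core u ≡ true → core v ≡ true → Walk D (2 + h) u v
        cc su sv with onto su | onto sv
        ... | i , li , refl | j , lj , refl = reach-walk (2 + h) i j (allᵇ-∈ {p = at (nth (reach m as (2 + h)) i)}
                (allᵇ-∈ {p = λ i → allᵇ (at (nth (reach m as (2 + h)) i)) (upTo m)} (proj₁ (∧-true {full (reach m as (2 + h))} ok')) (∈-upTo⁺ li)) (∈-upTo⁺ lj))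
        halves : ∀ {i j k} → (i , j) ∈ σ → k < m → at (nth (reach m as (1 + h)) k) i ∧ at (nth (reach m as (1 + h)) j) k ≡ true
        halves {i} {j} {k} mem lk = allᵇ-∈ {p = λ k → at (nth (reach m as (1 + h)) k) i ∧ at (nth (reach m as (1 + h)) j) k}
          (allᵇ-∈ {p = λ e → allᵇ (λ h' → at (nth (reach m as (1 + h)) h') (proj₁ e) ∧ at (nth (reach m as (1 + h)) (proj₂ e)) h') (upTo m)}
            (proj₁ (∧-true {half (reach m as (1 + h))} ok″)) mem) (∈-upTo⁺ lk)
        ci : ∀ {u x} → core u ≡ true → In x → Walk D (1 + h) u x
        ci su (i , j , mem , refl) with onto su
        ... | k , lk , refl = reach-walk (1 + h) k i (proj₁ (∧-true (halves mem lk)))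
        oc : ∀ {y v} → Out y → core v ≡ true → Walk D (1 + h) y v
        oc (i , j , mem , refl) sv with onto sv
        ... | k , lk , refl = reach-walk (1 + h) j k (proj₂ (∧-true {at (nth (reach m as (1 + h)) k) i} (halves mem lk)))
        oi : ∀ {y x} → Out y → In x → Walk D h y x
        oi (i , j , mem , refl) (k , l , mem' , refl) = reach-walk h j k (allᵇ-∈ {p = λ e' → at (nth (reach m as h) j) (proj₁ e')}
          (allᵇ-∈ {p = λ e → allᵇ (λ e' → at (nth (reach m as h) (proj₂ e)) (proj₁ e')) σ} (proj₂ (∧-true {half (reach m as (1 + h))} ok″)) mem) mem')

      four-exceptional : ∀ j → Exceptional j E core → Good E S (4 + j)
      four-exceptional 0 (i , (c , bd) , ex) = four-exact bd c ex
      four-exceptional 1 (i , (t , bd) , ex) = four-exact bd (table-four t) ex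
      four-exceptional 2 ex = four-exact eight-bound (table-four eight-ext) ex
      four-exceptional (suc (suc (suc j))) ()

  even-base : ∀ {E S} → Str E S → Good E S 2 ⊎ (∃ λ i → Exact 4 (nth excs₄ i) E S) → Good E S 2 ⊎ Exceptional 0 E S
  even-base str (inj₁ g) = inj₁ g
  even-base {E} {S} str (inj₂ (i , ex)) = go (small₄ i)
    where
    go : nth excs₄ i ≡ [] ⊎ Small₄ (nth excs₄ i) → Good E S 2 ⊎ Exceptional 0 E S
    go (inj₁ z) = ⊥-elim (not-empty str (subst (λ X → Exact 4 X E S) z ex))
    go (inj₂ s) = inj₂ (i , s , ex)

  even-base₆ : ∀ {E S} → Str E S → Good E S 3 ⊎ (∃ λ i → Exact 6 (nth excs₆ i) E S) → Good E S 3 ⊎ Exceptional 1 E S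
  even-base₆ str (inj₁ g) = inj₁ g
  even-base₆ {E} {S} str (inj₂ (i , ex)) = go (small₆ i)
    where
    go : nth excs₆ i ≡ [] ⊎ Small₆ (nth excs₆ i) → Good E S 3 ⊎ Exceptional 1 E S
    go (inj₁ z) = ⊥-elim (not-empty str (subst (λ X → Exact 6 X E S) z ex))
    go (inj₂ s) = inj₂ (i , s , ex)

  by-four : ∀ j {E S} (str : Str E S) (fe : FourEnds E S) → Good E (Four.core str fe) (2 + j) ⊎ Exceptional j E (Four.core str fe) → Good E S (4 + j)
  by-four j str fe (inj₁ g) = Four.four-good str fe g
  by-four j str fe (inj₂ ex) = Four.four-exceptional str fe j ex

  module _ {E : Graph n} {S : Fin n → Bool} (str : Str E S) (red : Reduction E S) where
    open Reduction red

    reduced-size : ∀ {k} → size S ≡ 2 + k → size (S - w - v) ≡ k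
    reduced-size sz = suc-injective (suc-injective (trans (sym (trans (size-remove S w∈) (cong suc (size-remove (S - w) (-intro {S = S} v∈ v≢w))))) sz))

    by-reduction : ∀ j → Good E' (S - w - v) (3 + j) ⊎ Exceptional (suc j) E' (S - w - v) → Good E S (4 + j) ⊎ Exceptional (2 + j) E S
    by-reduction j (inj₁ g) = inj₁ (lift j g)
    by-reduction 0 (inj₂ (i , (t , bd) , ex)) = go (Ext.exceptional str t bd E'⊆E v∈ w∈ v≢w ex attach)
      where
      go : Ext.Outcome str t bd → Good E S 4 ⊎ Exceptional 2 E S
      go (inj₁ g) = inj₁ g
      go (inj₂ (_ , es , e , rl)) = contains str eight-edges (relabel str eight-bound e rl)
    by-reduction 1 (inj₂ ex) = go (Ext.exceptional str eight-ext eight-bound E'⊆E v∈ w∈ v≢w ex attach)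
      where
      go : Ext.Outcome str eight-ext eight-bound → Good E S 5 ⊎ Exceptional 3 E S
      go (inj₁ g) = inj₁ g
      go (inj₂ (() , _))

  -- The induction on the number of vertices.

  Even : ℕ → Set
  Even j = ∀ {E S} → Str E S → size S ≡ 4 + j * 2 → Good E S (2 + j) ⊎ Exceptional j E S

  even-step : ∀ j → Even (suc j) → Even j → Even (suc (suc j))
  even-step j ih₁ ih₂ {E} {S} str sz = go (Finale.reduce str {j * 2} sz)
    where
    go : Reduction E S ⊎ FourEnds E S → Good E S (4 + j) ⊎ Exceptional (2 + j) E S
    go (inj₂ fe) = inj₁ (by-four j str fe (ih₂ (Four.core-str str fe) (Four.core-size str fe sz)))
    go (inj₁ red) = by-reduction str red j (ih₁ (Reduction.str' red) (reduced-size str red sz))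

  even : ∀ j → Even j
  even 0 str sz = even-base str (by-code str sz table₄)
  even 1 str sz = even-base₆ str (by-code str sz table₆)
  even (suc (suc j)) = even-step j (even (suc j)) (even j)

  by-end : ∀ j {E S w} (str : Str E S) → End E S w → Good E (S - w) (3 + j) ⊎ Exceptional (suc j) E (S - w) → Good E S (4 + j)
  by-end j {E} {S} {w} str ew res = go (end-base str ew) j res
    where
    go : (∃ λ x → ∃ λ y → (S - w) x ≡ true × (S - w) y ≡ true × E w x ≡ true × E w y ≡ true × E x y ≡ true) →
         ∀ j → Good E (S - w) (3 + j) ⊎ Exceptional (suc j) E (S - w) → Good E S (4 + j)
    go (x , y , sx , sy , wx , wy , xy) j (inj₁ (D , o , aw)) =
      Extend.add-one E (Str.irr str) (Str.E-sym str) S (End.∈S ew) (start (λ _ _ e → e) (λ _ → -⊆ {S = S}) o aw) wx wy (≢-edge str xy) sx sy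
    go (x , y , sx , sy , wx , wy , xy) 0 (inj₂ (i , (t , bd) , ex)) = Ext.ext-one str t bd ex (End.∈S ew) sx sy wx wy xy
    go (x , y , sx , sy , wx , wy , xy) 1 (inj₂ ex) = Ext.ext-one str eight-ext eight-bound ex (End.∈S ew) sx sy wx wy xy

  only-good : ∀ {m k E S} → Str E S → Good E S k ⊎ (∃ λ i → Exact m (nth [] i) E S) → Good E S k
  only-good str (inj₁ g) = g
  only-good str (inj₂ (i , ex)) = ⊥-elim (not-empty str ex)

  -- The bound rises when an even size grows by one, which pays for putting back a single end. No
  -- exceptions occur, since every extension of an exceptional graph by one vertex on an edge has a
  -- certificate.
  odd : ∀ j {E S} → Str E S → size S ≡ 5 + j * 2 → Good E S (3 + j)
  odd 0 str sz = only-good str (by-code str sz table₅)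
  odd (suc j) {E} {S} str sz = go (exists-end str sz)
    where
    go : (∃ λ w → End E S w) → Good E S (4 + j)
    go (w , ew) = by-end j str ew (even (suc j) (removeEnd str ew) (suc-injective (trans (sym (size-remove S (End.∈S ew))) sz)))

  three : ∀ {E S} → Str E S → size S ≡ 3 → Good E S 2
  three str sz = only-good str (by-code str sz table₃)

-- Counting in lists.

module _ {A : Set} where

  count-mono : ∀ {P Q : A → Bool} xs → (∀ x → P x ≡ true → Q x ≡ true) → count P xs ≤ count Q xs
  count-mono [] f = z≤n
  count-mono {P} {Q} (x ∷ xs) f with P x in px | Q x in qx
  ... | true | true = s≤s (count-mono xs f)
  ... | true | false = clash (f x px) qx
  ... | false | true = m≤n⇒m≤1+n (count-mono xs f)
  ... | false | false = count-mono xs f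

  count-strict : ∀ {P Q : A → Bool} {y} xs → (∀ x → P x ≡ true → Q x ≡ true) → y ∈ xs → P y ≡ false → Q y ≡ true → count P xs < count Q xs
  count-strict (x ∷ xs) f (here refl) p q rewrite p | q = s≤s (count-mono xs f)
  count-strict {P} {Q} (x ∷ xs) f (there m) p q with P x in px | Q x in qx
  ... | true | true = s≤s (count-strict xs f m p q)
  ... | true | false = clash (f x px) qx
  ... | false | true = m≤n⇒m≤1+n (count-strict xs f m p q)
  ... | false | false = count-strict xs f m p q

  count-∨ : ∀ {P Q : A → Bool} xs → (∀ x → P x ≡ true → Q x ≡ true → ⊥) → count P xs + count Q xs ≤ count (λ x → P x ∨ Q x) xs
  count-∨ [] d = z≤n
  count-∨ {P} {Q} (x ∷ xs) d with P x in px | Q x in qx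
  ... | true | true = ⊥-elim (d x px qx)
  ... | true | false = s≤s (count-∨ xs d)
  ... | false | true = ≤-trans (≤-reflexive (+-suc _ _)) (s≤s (count-∨ xs d))
  ... | false | false = count-∨ xs d

  count-split : ∀ {P Q R : A → Bool} xs → (∀ x → P x ≡ true → Q x ≡ true ⊎ R x ≡ true) → count P xs ≤ count Q xs + count R xs
  count-split [] d = z≤n
  count-split {P} {Q} {R} (x ∷ xs) d with P x in px | Q x in qx | R x in rx
  ... | true | true | true = s≤s (≤-trans (count-split xs d) (+-monoʳ-≤ (count Q xs) (n≤1+n _)))
  ... | true | true | false = s≤s (count-split xs d)
  ... | true | false | true = ≤-trans (s≤s (count-split xs d)) (≤-reflexive (sym (+-suc _ _)))
  ... | true | false | false with d x px
  ...   | inj₁ e = clash e qx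
  ...   | inj₂ e = clash e rx
  count-split {P} {Q} {R} (x ∷ xs) d | false | true | true = m≤n⇒m≤1+n (≤-trans (count-split xs d) (+-monoʳ-≤ (count Q xs) (n≤1+n _)))
  count-split {P} {Q} {R} (x ∷ xs) d | false | true | false = m≤n⇒m≤1+n (count-split xs d)
  count-split {P} {Q} {R} (x ∷ xs) d | false | false | true = ≤-trans (count-split xs d) (+-monoʳ-≤ (count Q xs) (n≤1+n _))
  count-split {P} {Q} {R} (x ∷ xs) d | false | false | false = count-split xs d

  count-length : ∀ (P : A → Bool) xs → count P xs ≤ length xs
  count-length P [] = z≤n
  count-length P (x ∷ xs) with P x
  ... | true = s≤s (count-length P xs)
  ... | false = m≤n⇒m≤1+n (count-length P xs)

  count-all : ∀ {P : A → Bool} xs → (∀ x → P x ≡ true) → count P xs ≡ length xs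
  count-all [] f = refl
  count-all (x ∷ xs) f rewrite f x = cong suc (count-all xs f)

count-inject : ∀ {A B : Set} (_≟_ : (x y : B) → Dec (x ≡ y)) {P : A → Bool} {Q : B → Bool} (g : A → B) xs ys → Unique xs →
  (∀ x → x ∈ xs → P x ≡ true → Q (g x) ≡ true × g x ∈ ys) →
  (∀ x y → x ∈ xs → y ∈ xs → P x ≡ true → P y ≡ true → g x ≡ g y → x ≡ y) →
  count P xs ≤ count Q ys
count-inject _≟_ g [] ys u f inj = z≤n
count-inject {A} {B} _≟_ {P} {Q} g (x ∷ xs) ys (nx ∷ u) f inj with P x in px
... | false = count-inject _≟_ g xs ys u (λ y m → f y (there m)) (λ y z m m' → inj y z (there m) (there m'))
... | true = ≤-trans (s≤s (count-inject _≟_ {P} {Q'} g xs ys u f' (λ y z m m' → inj y z (there m) (there m'))))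
                     (count-strict {P = Q'} {Q} {g x} ys (λ y e → proj₁ (∧-true e)) (proj₂ fx) off (proj₁ fx))
  where
  fx = f x (here refl) px
  Q' : B → Bool
  Q' y = Q y ∧ not ⌊ y ≟ g x ⌋
  off : Q' (g x) ≡ false
  off with g x ≟ g x
  ... | yes _ = ≢true λ e → clash (proj₂ (∧-true {Q (g x)} e)) refl
  ... | no ne = ⊥-elim (ne refl)
  f' : ∀ y → y ∈ xs → P y ≡ true → Q' (g y) ≡ true × g y ∈ ys
  f' y m py = ∧-intro (proj₁ (f y (there m) py)) distinct , proj₂ (f y (there m) py)
    where
    distinct : not ⌊ g y ≟ g x ⌋ ≡ true
    distinct with g y ≟ g x
    ... | no _ = refl
    ... | yes e = ⊥-elim (lookup nx m (sym (inj y x (there m) (here refl) py px e)))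

count-one : ∀ {A : Set} {P : A → Bool} xs → Unique xs → (∀ x y → P x ≡ true → P y ≡ true → x ≡ y) → count P xs ≤ 1
count-one xs u f = count-inject {B = ⊤} (λ _ _ → yes refl) {Q = λ _ → true} (λ _ → tt) xs (tt ∷ []) u (λ _ _ _ → refl , here refl) (λ x y _ _ p q _ → f x y p q)

least : (f : ℕ → Bool) → ∀ k → f k ≡ true → ∃ λ m → f m ≡ true × (∀ i → f i ≡ true → m ≤ i)
least f k e with split (f 0)
... | inj₁ z = 0 , z , λ _ _ → z≤n
least f zero e | inj₂ z = clash e z
least f (suc k) e | inj₂ z with least (λ i → f (suc i)) k e
... | m , a , b = suc m , a , λ { zero q → clash q z ; (suc i) q → s≤s (b i q) }

-- Closures of finite sets, with levels.

module Closure {A : Set} (xs : List A) (complete : ∀ a → a ∈ xs) (seed : A → Bool) (R : A → A → Bool) where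

  grow : (A → Bool) → A → Bool
  grow X a = X a ∨ anyᵇ (λ b → X b ∧ R b a) xs

  stage : ℕ → A → Bool
  stage zero = seed
  stage (suc k) = grow (stage k)

  stage-step : ∀ {k a} → stage k a ≡ true → stage (suc k) a ≡ true
  stage-step e = ∨-introˡ e

  stage-mono : ∀ {k l a} → k ≤ l → stage k a ≡ true → stage l a ≡ true
  stage-mono {l = l} p e with m≤n⇒m<n∨m≡n p
  ... | inj₂ refl = e
  stage-mono {k} {suc l} {a} p e | inj₁ lt = stage-step {l} {a} (stage-mono (≤-pred lt) e)

  Stable : ℕ → Set
  Stable k = ∀ a → stage (suc k) a ≡ true → stage k a ≡ true

  -- A stage that is not stable gains an element, so without a stable stage the counts would exceed
  -- the length of the list.
  progress : ∀ k → (∃ λ j → Stable j) ⊎ (k ≤ count (stage k) xs)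
  progress zero = inj₂ z≤n
  progress (suc k) with progress k
  ... | inj₁ s = inj₁ s
  ... | inj₂ le with split (anyᵇ (λ a → stage (suc k) a ∧ not (stage k a)) xs)
  ...   | inj₂ none = inj₁ (k , λ a e → ≢false λ z → clash (anyᵇ-intro {p = λ a → stage (suc k) a ∧ not (stage k a)} (complete a) (∧-intro e (not-false z))) none)
  ...   | inj₁ some with anyᵇ-elim xs some
  ...     | a , m , e = inj₂ (≤-trans (s≤s le) (count-strict xs (λ x → stage-step {k} {x}) m (not-true (proj₂ (∧-true {stage (suc k) a} e))) (proj₁ (∧-true e))))

  private
    stable : ∃ λ j → Stable j
    stable with progress (suc (length xs))
    ... | inj₁ s = s
    ... | inj₂ le = ⊥-elim (<-irrefl refl (≤-trans le (count-length _ xs)))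

  abstract
    X : A → Bool
    X = stage (proj₁ stable)

    -- The first stage containing a; 0 is a mere default outside the closure.
    lev : A → ℕ
    lev a with split (stage (proj₁ stable) a)
    ... | inj₁ e = proj₁ (least (λ k → stage k a) (proj₁ stable) e)
    ... | inj₂ _ = 0

    lev-stage : ∀ {a} → X a ≡ true → stage (lev a) a ≡ true
    lev-stage {a} e with split (stage (proj₁ stable) a)
    ... | inj₁ e' = proj₁ (proj₂ (least (λ k → stage k a) (proj₁ stable) e'))
    ... | inj₂ z = clash e z

    lev-least : ∀ {a k} → X a ≡ true → stage k a ≡ true → lev a ≤ k
    lev-least {a} {k} e s with split (stage (proj₁ stable) a)
    ... | inj₁ e' = proj₂ (proj₂ (least (λ k → stage k a) (proj₁ stable) e')) k s
    ... | inj₂ z = clash e z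

    seed⊆ : ∀ {a} → seed a ≡ true → X a ≡ true
    seed⊆ {a} e = stage-mono {0} {proj₁ stable} {a} z≤n e

    closed : ∀ {a b} → X a ≡ true → R a b ≡ true → X b ≡ true
    closed {a} {b} e q = proj₂ stable b (∨-introʳ {stage (proj₁ stable) b} (anyᵇ-intro {p = λ c → stage (proj₁ stable) c ∧ R c b} (complete a) (∧-intro e q)))

    stage⊆ : ∀ k {a} → stage k a ≡ true → X a ≡ true
    stage⊆ zero e = seed⊆ e
    stage⊆ (suc k) {a} e with ∨-true {stage k a} e
    ... | inj₁ z = stage⊆ k z
    ... | inj₂ z with anyᵇ-elim xs z
    ...   | b , m , w = closed (stage⊆ k (proj₁ (∧-true w))) (proj₂ (∧-true {stage k b} w))

  pred : ∀ {a} → X a ≡ true → seed a ≡ true ⊎ (∃ λ b → X b ≡ true × R b a ≡ true × lev b < lev a)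
  pred {a} e = go (lev a) refl (lev-stage e)
    where
    go : ∀ k → k ≡ lev a → stage k a ≡ true → seed a ≡ true ⊎ (∃ λ b → X b ≡ true × R b a ≡ true × lev b < lev a)
    go zero _ s = inj₁ s
    go (suc k) q s with ∨-true {stage k a} s
    ... | inj₁ z = ⊥-elim (<-irrefl refl (≤-trans (s≤s (lev-least e z)) (≤-reflexive q)))
    ... | inj₂ z with anyᵇ-elim xs z
    ...   | b , m , w = inj₂ (b , stage⊆ k (proj₁ (∧-true w)) , proj₂ (∧-true {stage k b} w) ,
              ≤-trans (s≤s (lev-least (stage⊆ k (proj₁ (∧-true w))) (proj₁ (∧-true w)))) (≤-reflexive q))

  minimal : (P : A → Set) → (∀ a → seed a ≡ true → P a) → (∀ a b → P a → R a b ≡ true → P b) → ∀ a → X a ≡ true → P a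
  minimal P s c a e = go (suc (lev a)) a e (n<1+n (lev a))
    where
    go : ∀ k a → X a ≡ true → lev a < k → P a
    go (suc k) a e lt with pred e
    ... | inj₁ z = s a z
    ... | inj₂ (b , xb , rba , l) = c b a (go k b xb (≤-trans l (≤-pred lt))) rba

iter-+ : ∀ {A : Set} (f : A → A) a b x → iter f (a + b) x ≡ iter f a (iter f b x)
iter-+ f zero b x = refl
iter-+ f (suc a) b x = cong f (iter-+ f a b x)

iter-shift : ∀ {A : Set} (f : A → A) k x → iter f k (f x) ≡ f (iter f k x)
iter-shift f zero x = refl
iter-shift f (suc k) x = cong f (iter-shift f k x)

⌊⌋-elim : ∀ {A : Set} (d : Dec A) → ⌊ d ⌋ ≡ true → A
⌊⌋-elim (yes a) _ = a

⌊⌋-intro : ∀ {A : Set} (d : Dec A) → A → ⌊ d ⌋ ≡ true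
⌊⌋-intro (yes _) _ = refl
⌊⌋-intro (no q) a = ⊥-elim (q a)

-- From lists to ranks, full orientations and isomorphisms.

-- Vertices listed newest first.
data Order {n} (E : Graph n) : List (Fin n) → Set where
  rootEdge : ∀ {p q} → E q p ≡ true → Order E (q ∷ p ∷ [])
  add : ∀ {v L} → Order E L → ¬ v ∈ L → (∃ λ x → x ∈ L × E v x ≡ true) →
        (∀ x → x ∈ L → E v x ≡ true → ∃ λ y → y ∈ L × E v y ≡ true × E x y ≡ true) → Order E (v ∷ L)

full : ∀ {n} → Fin n → Bool
full _ = true

-- The position counted from the oldest vertex, so that the roots get 0 and 1. Vertices that are not
-- listed get 0 by default.
index : ∀ {n} → List (Fin n) → Fin n → ℕ
index [] x = 0
index (v ∷ L) x = if x == v then length L else index L x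

module Rank {n : ℕ} {G : Graph n} (irr : ∀ u → G u u ≡ false) where

  index-new : ∀ v (L : List (Fin n)) → index (v ∷ L) v ≡ length L
  index-new v L rewrite ≡⇒== {u = v} refl = refl

  index-≢ : ∀ {v x} (L : List (Fin n)) → x ≢ v → index (v ∷ L) x ≡ index L x
  index-≢ L ne rewrite ≢⇒==f ne = refl

  ∈-≢ : ∀ {v x} {L : List (Fin n)} → ¬ v ∈ L → x ∈ L → x ≢ v
  ∈-≢ nv m refl = nv m

  older : ∀ {v x} {L : List (Fin n)} → x ∈ (v ∷ L) → x ≢ v → x ∈ L
  older (here q) ne = ⊥-elim (ne q)
  older (there m) ne = m

  edge-≢ : ∀ {x y} → G x y ≡ true → x ≢ y
  edge-≢ e refl = clash e (irr _)

  index-< : ∀ {L x} → Order G L → x ∈ L → index L x < length L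
  index-< {q ∷ p ∷ []} {x} (rootEdge e) m with split (x == q)
  ... | inj₁ z rewrite z = ≤-refl
  ... | inj₂ z with older m (==f⇒≢ z)
  ...   | here refl rewrite z | ≡⇒== {u = p} refl = s≤s z≤n
  index-< {v ∷ L} {x} (add o nv _ _) m with split (x == v)
  ... | inj₁ z rewrite z = ≤-refl
  ... | inj₂ z rewrite z = m<n⇒m<1+n (index-< o (older m (==f⇒≢ z)))

  index-inj : ∀ {L x y} → Order G L → x ∈ L → y ∈ L → index L x ≡ index L y → x ≡ y
  index-inj {q ∷ p ∷ []} (rootEdge e) (here refl) (here refl) i = refl
  index-inj {q ∷ p ∷ []} (rootEdge e) (there (here refl)) (there (here refl)) i = refl
  index-inj {q ∷ p ∷ []} (rootEdge e) (here refl) (there (here refl)) i rewrite ≡⇒== {u = q} refl | ≢⇒==f (λ z → edge-≢ e (sym z)) | ≡⇒== {u = p} refl with i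
  ... | ()
  index-inj {q ∷ p ∷ []} (rootEdge e) (there (here refl)) (here refl) i rewrite ≡⇒== {u = q} refl | ≢⇒==f (λ z → edge-≢ e (sym z)) | ≡⇒== {u = p} refl with i
  ... | ()
  index-inj {v ∷ L} (add o nv _ _) (here refl) (here refl) i = refl
  index-inj {v ∷ L} (add o nv _ _) (here refl) (there m) i =
    ⊥-elim (<-irrefl (trans (sym (index-≢ L (∈-≢ nv m))) (trans (sym i) (index-new v L))) (index-< o m))
  index-inj {v ∷ L} (add o nv _ _) (there m) (here refl) i =
    ⊥-elim (<-irrefl (trans (sym (index-≢ L (∈-≢ nv m))) (trans i (index-new v L))) (index-< o m))
  index-inj {v ∷ L} (add o nv _ _) (there m) (there m') i =
    index-inj o m m' (trans (sym (index-≢ L (∈-≢ nv m))) (trans i (index-≢ L (∈-≢ nv m'))))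

  roots : ∀ {L} → Order G L → ∃ λ p → ∃ λ q → p ∈ L × q ∈ L × index L p ≡ 0 × index L q ≡ 1 × G q p ≡ true
  roots {q ∷ p ∷ []} (rootEdge e) = p , q , there (here refl) , here refl ,
    trans (index-≢ (p ∷ []) (λ z → edge-≢ e (sym z))) (index-new p []) , index-new q (p ∷ []) , e
  roots {v ∷ L} (add o nv _ _) with roots o
  ... | p , q , mp , mq , ip , iq , e = p , q , there mp , there mq , trans (index-≢ L (∈-≢ nv mp)) ip , trans (index-≢ L (∈-≢ nv mq)) iq , e

  Attached : List (Fin n) → Fin n → Set
  Attached L v = (∃ λ x → x ∈ L × G v x ≡ true × index L x < index L v) ×
    (∀ x → x ∈ L → G v x ≡ true → index L x < index L v → ∃ λ y → y ∈ L × G v y ≡ true × index L y < index L v × G x y ≡ true)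

  attached : ∀ {L v} → Order G L → v ∈ L → 2 ≤ index L v → Attached L v
  attached {q ∷ p ∷ []} {v} (rootEdge e) m le with index-< (rootEdge e) m
  ... | lt = ⊥-elim (<-irrefl refl (<-≤-trans lt le))
  attached {v ∷ L} (add o nv (x , mx , ex) pr) (here refl) le = (x , there mx , ex , below mx) , companion
    where
    below : ∀ {x} → x ∈ L → index (v ∷ L) x < index (v ∷ L) v
    below mx = subst (λ i → i < index (v ∷ L) v) (sym (index-≢ L (∈-≢ nv mx))) (subst (index L _ <_) (sym (index-new v L)) (index-< o mx))
    companion : ∀ x → x ∈ (v ∷ L) → G v x ≡ true → index (v ∷ L) x < index (v ∷ L) v →
                ∃ λ y → y ∈ (v ∷ L) × G v y ≡ true × index (v ∷ L) y < index (v ∷ L) v × G x y ≡ true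
    companion x m ex _ with pr x (older m (λ z → edge-≢ ex (sym z))) ex
    ... | y , my , ey , exy = y , there my , ey , below my , exy
  attached {w ∷ L} {v} (add o nw b pr) (there m) le with attached o m (subst (2 ≤_) (index-≢ L (∈-≢ nw m)) le)
  ... | (x , mx , ex , lx) , h = (x , there mx , ex , lower mx lx) , companion
    where
    lower : ∀ {x} → x ∈ L → index L x < index L v → index (w ∷ L) x < index (w ∷ L) v
    lower mx lx = subst (λ i → i < index (w ∷ L) v) (sym (index-≢ L (∈-≢ nw mx))) (subst (index L _ <_) (sym (index-≢ L (∈-≢ nw m))) lx)
    companion : ∀ x → x ∈ (w ∷ L) → G v x ≡ true → index (w ∷ L) x < index (w ∷ L) v →
                ∃ λ y → y ∈ (w ∷ L) × G v y ≡ true × index (w ∷ L) y < index (w ∷ L) v × G x y ≡ true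
    companion x mx ex lx with h x mx' ex (subst (λ i → i < index L v) (index-≢ L (∈-≢ nw mx')) (subst (index (w ∷ L) x <_) (index-≢ L (∈-≢ nw m)) lx))
      where
      mx' : x ∈ L
      mx' = older mx λ { refl → <-asym (subst (_< index (w ∷ L) v) (index-new w L) lx) (subst (_< length L) (sym (index-≢ L (∈-≢ nw m))) (index-< o m)) }
    ... | y , my , ey , ly , exy = y , there my , ey , lower my ly , exy

-- The edges left undirected are directed from the smaller to the larger vertex number; additional
-- arcs keep all walks.
complete-orientation : ∀ {n} {G : Graph n} {k} → (∀ u v → G u v ≡ G v u) → (∀ u → G u u ≡ false) → Good G full k → OrientedDiamLE G k
complete-orientation {n} {G} {k} G-sym irr (D , or ed an _ _ , w) = D' , (sub , tot , anti) , λ u v → mapW (λ x y → ∨-introˡ) (w refl refl)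
  where
  fill D' : Graph n
  fill u v = (G u v ∧ not (D v u)) ∧ ⌊ toℕ u <? toℕ v ⌋
  D' u v = D u v ∨ fill u v
  fill-elim : ∀ {u v} → fill u v ≡ true → G u v ≡ true × D v u ≡ false × toℕ u < toℕ v
  fill-elim {u} {v} e with ∧-true {G u v ∧ not (D v u)} e
  ... | x , y with toℕ u <? toℕ v
  ...   | yes lt = proj₁ (∧-true x) , not-true (proj₂ (∧-true {G u v} x)) , lt
  fill-elim {u} {v} e | x , () | no _
  fill-intro : ∀ {u v} → G u v ≡ true → D v u ≡ false → toℕ u < toℕ v → fill u v ≡ true
  fill-intro {u} {v} g d lt with toℕ u <? toℕ v
  ... | yes _ = ∧-intro (∧-intro g (not-false d)) refl
  ... | no nl = ⊥-elim (nl lt)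
  sub : ∀ u v → D' u v ≡ true → G u v ≡ true
  sub u v e with ∨-true {D u v} e
  ... | inj₁ z = ed u v z
  ... | inj₂ z = proj₁ (fill-elim z)
  tot : ∀ u v → G u v ≡ true → D' u v ≡ true ⊎ D' v u ≡ true
  tot u v g with split (D u v) | split (D v u)
  ... | inj₁ z | _ = inj₁ (∨-introˡ z)
  ... | inj₂ _ | inj₁ z = inj₂ (∨-introˡ z)
  ... | inj₂ y | inj₂ z with <-cmp (toℕ u) (toℕ v)
  ...   | tri< lt _ _ = inj₁ (∨-introʳ {D u v} (fill-intro g z lt))
  ...   | tri> _ _ gt = inj₂ (∨-introʳ {D v u} (fill-intro (trans (G-sym v u) g) y gt))
  ...   | tri≈ _ e _ = clash g (subst (λ x → G u x ≡ false) (toℕ-injective e) (irr u))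
  anti : ∀ u v → D' u v ≡ true → D' v u ≡ true → ⊥
  anti u v e e' with ∨-true {D u v} e | ∨-true {D v u} e'
  ... | inj₁ x | inj₁ y = an u v x y
  ... | inj₁ x | inj₂ y = clash x (proj₁ (proj₂ (fill-elim y)))
  ... | inj₂ x | inj₁ y = clash y (proj₁ (proj₂ (fill-elim x)))
  ... | inj₂ x | inj₂ y = <-asym (proj₂ (proj₂ (fill-elim x))) (proj₂ (proj₂ (fill-elim y)))

exact-≅ : ∀ {n m} {G : Graph n} {H : Graph m} {es} → (∀ a b → adj es (toℕ a) (toℕ b) ≡ H a b) → Exact m es G full → G ≅ H
exact-≅ {n} {m} {G} {H} {es} same-adj ex = mk↔ₛ′ to from to-from from-to , λ u v →
    trans (cong₂ G (sym (proj₂ (proj₂ (onto' u)))) (sym (proj₂ (proj₂ (onto' v)))))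
      (trans (same (proj₁ (proj₂ (onto' u))) (proj₁ (proj₂ (onto' v))))
        (trans (cong₂ (adj es) (sym (toℕ-fromℕ< (proj₁ (proj₂ (onto' u))))) (sym (toℕ-fromℕ< (proj₁ (proj₂ (onto' v)))))) (same-adj (to u) (to v))))
  where
  open Exact ex
  onto' : ∀ v → ∃ λ i → i < m × f i ≡ v
  onto' v = onto {v} refl
  to : Fin n → Fin m
  to v = fromℕ< (proj₁ (proj₂ (onto' v)))
  from : Fin m → Fin n
  from i = f (toℕ i)
  from-to : ∀ v → from (to v) ≡ v
  from-to v = trans (cong f (toℕ-fromℕ< (proj₁ (proj₂ (onto' v))))) (proj₂ (proj₂ (onto' v)))
  to-from : ∀ i → to (from i) ≡ i
  to-from i = toℕ-injective (inj (toℕ<n (to (from i))) (toℕ<n i) (from-to (from i)))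

agree? : ∀ {m} (es : Edges) (H : Graph m) → Set
agree? es H = True (all? λ a → all? λ b → adj es (toℕ a) (toℕ b) Bool.≟ H a b)

agree : ∀ {m} (es : Edges) (H : Graph m) → agree? es H → ∀ a b → adj es (toℕ a) (toℕ b) ≡ H a b
agree es H ok = toWitness ok

⌈even/2⌉ : ∀ j → ⌈ 4 + j * 2 /2⌉ ≡ 2 + j
⌈even/2⌉ j = cong (λ x → suc (suc x)) (lem j)
  where
  lem : ∀ j → ⌊ suc (j * 2) /2⌋ ≡ j
  lem zero = refl
  lem (suc j) = cong suc (lem j)

⌈odd/2⌉ : ∀ j → ⌈ 5 + j * 2 /2⌉ ≡ 3 + j
⌈odd/2⌉ j = cong (λ x → suc (suc (suc x))) (lem j)
  where
  lem : ∀ j → ⌊ j * 2 /2⌋ ≡ j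
  lem zero = refl
  lem (suc j) = cong suc (lem j)

data Size : ℕ → Set where
  is-three : Size 3
  is-even : ∀ j → Size (4 + j * 2)
  is-odd : ∀ j → Size (5 + j * 2)

classify : ∀ m → Size (3 + m)
classify zero = is-three
classify (suc zero) = is-even 0
classify (suc (suc m)) with classify m
... | is-three = is-odd 0
... | is-even j = is-even (suc j)
... | is-odd j = is-odd (suc j)

-- The outer face and the bounded faces.

module Near-triangulation {n : ℕ} {G : Graph n} {ρ : Rotation n} {o : Dart n} (nt : Is2ConnNearTriangulation G ρ o) where

  simple = proj₁ (proj₁ nt)
  connected = proj₁ (proj₂ (proj₁ nt))
  rotation = proj₁ (proj₂ (proj₂ (proj₁ nt)))
  euler = proj₂ (proj₂ (proj₂ (proj₁ nt)))

  G-irr : ∀ v → G v v ≡ false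
  G-irr = proj₁ simple

  G-sym : ∀ u v → G u v ≡ G v u
  G-sym = proj₂ simple

  G-flip : ∀ {u v} → G u v ≡ true → G v u ≡ true
  G-flip {u} {v} e = trans (G-sym v u) e

  G-≢ : ∀ {u v} → G u v ≡ true → u ≢ v
  G-≢ {u} e refl = clash e (G-irr u)

  ρ-nbr : ∀ {v u} → G v u ≡ true → G v (ρ v u) ≡ true
  ρ-nbr = proj₁ rotation _ _

  ρ-inj : ∀ {v u w} → G v u ≡ true → G v w ≡ true → ρ v u ≡ ρ v w → u ≡ w
  ρ-inj = proj₁ (proj₂ rotation) _ _ _

  ρ-orbit : ∀ {v u w} → G v u ≡ true → G v w ≡ true → ∃ λ k → iter (ρ v) k u ≡ w
  ρ-orbit = proj₂ (proj₂ rotation) _ _ _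

  ρ-iter : ∀ {v u} k → G v u ≡ true → G v (iter (ρ v) k u) ≡ true
  ρ-iter zero e = e
  ρ-iter (suc k) e = ρ-nbr (ρ-iter k e)

  φ : Dart n → Dart n
  φ = faceStep ρ

  outer-walk : ℕ → Dart n
  outer-walk k = iter φ k o

  o-dart : isDart G o ≡ true
  o-dart = proj₁ (proj₂ nt)

  φ-dart : ∀ d → isDart G d ≡ true → isDart G (φ d) ≡ true
  φ-dart (u , v) e = ρ-nbr (G-flip e)

  φ-inj : ∀ d d' → isDart G d ≡ true → isDart G d' ≡ true → φ d ≡ φ d' → d ≡ d'
  φ-inj (u , v) (u' , v') e e' q with ,-injective q
  ... | refl , q' = cong (_, v) (ρ-inj (G-flip e) (G-flip e') q')

  walk-dart : ∀ k → isDart G (outer-walk k) ≡ true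
  walk-dart zero = o-dart
  walk-dart (suc k) = φ-dart (outer-walk k) (walk-dart k)

  private
    cancel : ∀ a b → outer-walk (suc a) ≡ outer-walk (suc b) → outer-walk a ≡ outer-walk b
    cancel a b = φ-inj _ _ (walk-dart a) (walk-dart b)

    cancel* : ∀ i d → outer-walk i ≡ outer-walk (i + d) → o ≡ outer-walk d
    cancel* zero d q = q
    cancel* (suc i) d q = cancel* i d (cancel i (i + d) q)

  -- Among n + 1 tails on the outer walk two agree. As the outer face is bounded by a cycle the two
  -- darts agree, and injectivity of the face step moves the coincidence back to o.
  period : ∃ λ l → suc l ≤ n × outer-walk (suc l) ≡ o
  period with pigeonhole (n<1+n n) (λ i → proj₁ (outer-walk (toℕ i)))
  ... | i , j , i<j , q with toℕ j ∸ toℕ i in eq | m<n⇒0<n∸m i<j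
  ...   | suc l | _ = l , ≤-trans (subst (_≤ toℕ j) eq (m∸n≤m (toℕ j) (toℕ i))) (≤-pred (toℕ<n j)) ,
          sym (cancel* (toℕ i) (suc l) (trans (proj₂ (proj₂ (proj₂ (proj₂ nt))) (toℕ i) (toℕ j) q) (cong outer-walk (sym (trans (cong (toℕ i +_) (sym eq)) (m+[n∸m]≡n (<⇒≤ i<j)))))))

  len : ℕ
  len = suc (proj₁ period)

  len≤n : len ≤ n
  len≤n = proj₁ (proj₂ period)

  walk-len : outer-walk len ≡ o
  walk-len = proj₂ (proj₂ period)

  walk-mod : ∀ k → ∃ λ k' → k' < len × outer-walk k' ≡ outer-walk k
  walk-mod zero = 0 , s≤s z≤n , refl
  walk-mod (suc k) with walk-mod k
  ... | k' , lt , q with m≤n⇒m<n∨m≡n lt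
  ...   | inj₁ l = suc k' , l , cong φ q
  ...   | inj₂ e = 0 , s≤s z≤n , trans (sym walk-len) (trans (cong outer-walk (sym e)) (cong φ q))

  abstract
    Out : Graph n
    Out u v = anyᵇ (λ k → (proj₁ (outer-walk k) == u) ∧ (proj₂ (outer-walk k) == v)) (upTo n)

    out-elim : ∀ {u v} → Out u v ≡ true → ∃ λ k → outer-walk k ≡ (u , v)
    out-elim {u} {v} e with anyᵇ-elim (upTo n) e
    ... | k , _ , q = k , cong₂ _,_ (==⇒≡ (proj₁ (∧-true q))) (==⇒≡ (proj₂ (∧-true {proj₁ (outer-walk k) == u} q)))

    out-intro : ∀ {u v} k → outer-walk k ≡ (u , v) → Out u v ≡ true
    out-intro {u} {v} k q with walk-mod k
    ... | k' , lt , q' = anyᵇ-intro {p = λ k → (proj₁ (outer-walk k) == u) ∧ (proj₂ (outer-walk k) == v)} (∈-upTo⁺ (≤-trans lt len≤n))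
            (∧-intro (≡⇒== (cong proj₁ (trans q' q))) (≡⇒== (cong proj₂ (trans q' q))))

  out-dart : ∀ {u v} → Out u v ≡ true → G u v ≡ true
  out-dart e with out-elim e
  ... | k , q = subst (λ d → isDart G d ≡ true) q (walk-dart k)

  out-φ : ∀ {u v} → Out u v ≡ true → Out v (ρ v u) ≡ true
  out-φ e with out-elim e
  ... | k , q = out-intro (suc k) (cong φ q)

  out-φ⁻ : ∀ {u v} → G u v ≡ true → Out v (ρ v u) ≡ true → Out u v ≡ true
  out-φ⁻ {u} {v} d e with out-elim e
  ... | suc k , q = out-intro k (φ-inj _ (u , v) (walk-dart k) d q)
  ... | zero , q = out-intro (proj₁ period) (φ-inj _ (u , v) (walk-dart (proj₁ period)) d (trans walk-len q))

  out-tail : ∀ {v x y} → Out v x ≡ true → Out v y ≡ true → x ≡ y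
  out-tail e e' with out-elim e | out-elim e'
  ... | k , q | l , q' = cong proj₂ (trans (sym q) (trans (proj₂ (proj₂ (proj₂ (proj₂ nt))) k l (trans (cong proj₁ q) (sym (cong proj₁ q')))) q'))

  -- Each vertex is left by only one dart of the outer face. If both directions of an edge lay on
  -- it, the outer walk would go back and forth along this edge and have length two.
  not-both : ∀ {u v} → Out u v ≡ true → Out v u ≡ true → ⊥
  not-both {u} {v} e e' with out-elim e
  ... | k , q = proj₁ (proj₂ (proj₂ (proj₂ nt))) (sym (cancel* k 2 (trans q (sym (trans (cong outer-walk (+-comm k 2)) q₂)))))
    where
    a : ρ v u ≡ u
    a = out-tail (out-φ e) e'
    b : ρ u v ≡ v
    b = out-tail (out-φ e') e
    q₂ : outer-walk (2 + k) ≡ (u , v)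
    q₂ = trans (cong φ (trans (cong φ q) (cong (v ,_) a))) (cong (u ,_) b)

  -- Darts of the bounded faces.
  Inner : Graph n
  Inner u v = G u v ∧ not (Out u v)

  inner-dart : ∀ {u v} → Inner u v ≡ true → G u v ≡ true
  inner-dart e = proj₁ (∧-true e)

  inner-¬out : ∀ {u v} → Inner u v ≡ true → Out u v ≡ false
  inner-¬out {u} {v} e = not-true (proj₂ (∧-true {G u v} e))

  inner-intro : ∀ {u v} → G u v ≡ true → Out u v ≡ false → Inner u v ≡ true
  inner-intro d e = ∧-intro d (not-false e)

  inner-or-out : ∀ {u v} → G u v ≡ true → Inner u v ≡ true ⊎ Out u v ≡ true
  inner-or-out {u} {v} d with split (Out u v)
  ... | inj₁ e = inj₂ e
  ... | inj₂ e = inj₁ (inner-intro d e)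

  inner-φ : ∀ {u v} → Inner u v ≡ true → Inner v (ρ v u) ≡ true
  inner-φ e = inner-intro (ρ-nbr (G-flip (inner-dart e))) (≢true λ q → clash (out-φ⁻ (inner-dart e) q) (inner-¬out e))

  tri : ∀ {u v} → Inner u v ≡ true → ρ (ρ v u) v ≡ u × ρ u (ρ v u) ≡ v
  tri {u} {v} e with proj₁ (proj₂ (proj₂ nt)) (u , v) (inner-dart e) (λ { (k , q) → clash (out-intro k q) (inner-¬out e) })
  ... | q with ,-injective q
  ...   | a , b = a , trans (cong (λ z → ρ z (ρ v u)) (sym a)) b

  inner-φ² : ∀ {u v} → Inner u v ≡ true → Inner (ρ v u) u ≡ true
  inner-φ² {u} {v} e = subst (λ z → Inner (ρ v u) z ≡ true) (proj₁ (tri e)) (inner-φ (inner-φ e))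

  -- A spanning tree and a search in the dual graph.

  root : Fin n
  root = proj₁ o

  module Dist = Closure (allFin n) ∈-allFin (_== root) G

  depth : Fin n → ℕ
  depth = Dist.lev

  reached : ∀ x → Dist.X x ≡ true
  reached x = walk (proj₂ (connected root x)) (Dist.seed⊆ (≡⇒== {u = root} refl))
    where
    walk : ∀ {k u v} → Walk G k u v → Dist.X u ≡ true → Dist.X v ≡ true
    walk here e = e
    walk (step g w) e = walk w (Dist.closed e g)

  parent : ∀ x → x ≢ root → ∃ λ y → G y x ≡ true × depth y < depth x
  parent x ne with Dist.pred (reached x)
  ... | inj₁ e = ⊥-elim (ne (==⇒≡ e))
  ... | inj₂ (y , _ , g , lt) = y , g , lt

  abstract
    par : Fin n → Fin n
    par x with x ≟ root
    ... | yes _ = x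
    ... | no ne = proj₁ (parent x ne)

    par-edge : ∀ x → x ≢ root → G (par x) x ≡ true
    par-edge x ne with x ≟ root
    ... | yes e = ⊥-elim (ne e)
    ... | no ne' = proj₁ (proj₂ (parent x ne'))

    par-depth : ∀ x → x ≢ root → depth (par x) < depth x
    par-depth x ne with x ≟ root
    ... | yes e = ⊥-elim (ne e)
    ... | no ne' = proj₂ (proj₂ (parent x ne'))

  up : Graph n
  up u v = not (u == root) ∧ (par u == v)

  up-elim : ∀ {u v} → up u v ≡ true → u ≢ root × par u ≡ v
  up-elim {u} e = ==f⇒≢ (not-true (proj₁ (∧-true e))) , ==⇒≡ (proj₂ (∧-true {not (u == root)} e))

  up-intro : ∀ {u} → u ≢ root → up u (par u) ≡ true
  up-intro ne = ∧-intro (not-false (≢⇒==f ne)) (≡⇒== refl)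

  tree : Graph n
  tree u v = up u v ∨ up v u

  tree-sym : ∀ u v → tree u v ≡ tree v u
  tree-sym u v = Bool.∨-comm (up u v) (up v u)

  -- The faces reached from the outer face across non-tree edges.
  _≟ᵈ_ : (d d' : Dart n) → Dec (d ≡ d')
  _≟ᵈ_ = ≡-dec _≟_ _≟_

  crosses : Dart n → Dart n → Bool
  crosses (u , v) (u' , v') = ((u' == v) ∧ (v' == u)) ∧ (G u v ∧ not (tree u v))

  turns : Dart n → Dart n → Bool
  turns (u , v) (u' , v') = Inner u v ∧ ((u' == v) ∧ (v' == ρ v u))

  allDarts-∈ : ∀ d → d ∈ allDarts n
  allDarts-∈ (u , v) = ∈-cartesianProduct⁺ (∈-allFin u) (∈-allFin v)

  -- The search through faces is carried out on darts: a dart of a bounded face leads to the next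
  -- dart of this face, and any dart of a non-tree edge to its reverse.
  module Dual = Closure (allDarts n) allDarts-∈ (λ d → Out (proj₁ d) (proj₂ d)) (λ d d' → turns d d' ∨ crosses d d')

  X : Graph n
  X u v = Dual.X (u , v)

  X-φ : ∀ {u v} → G u v ≡ true → X u v ≡ true → X v (ρ v u) ≡ true
  X-φ {u} {v} d e with inner-or-out d
  ... | inj₂ q = Dual.seed⊆ (out-φ q)
  ... | inj₁ q = Dual.closed e (∨-introˡ (∧-intro q (∧-intro (≡⇒== {u = v} refl) (≡⇒== {u = ρ v u} refl))))

  X-φ⁻ : ∀ {u v} → G u v ≡ true → X v (ρ v u) ≡ true → X u v ≡ true
  X-φ⁻ {u} {v} d e with inner-or-out d
  ... | inj₂ q = Dual.seed⊆ q
  ... | inj₁ q = subst (λ z → X u z ≡ true) (proj₂ (tri q)) (X-φ (inner-dart (inner-φ² q)) (subst (λ z → X (ρ v u) z ≡ true) (proj₁ (tri q)) (X-φ (inner-dart (inner-φ q)) e)))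

  X-cross : ∀ {u v} → G u v ≡ true → tree u v ≡ false → X u v ≡ true → X v u ≡ true
  X-cross {u} {v} d t e = Dual.closed e (∨-introʳ {turns (u , v) (v , u)} (∧-intro (∧-intro (≡⇒== {u = v} refl) (≡⇒== {u = u} refl)) (∧-intro d (not-false t))))

  ≡-bool : ∀ {a b : Bool} → (a ≡ true → b ≡ true) → (b ≡ true → a ≡ true) → a ≡ b
  ≡-bool {true} {b} f g = sym (f refl)
  ≡-bool {false} {true} f g = g refl
  ≡-bool {false} {false} f g = refl

  X-φ≡ : ∀ {u v} → G u v ≡ true → X u v ≡ X v (ρ v u)
  X-φ≡ d = ≡-bool (X-φ d) (X-φ⁻ d)

  deepest : ∃ λ w → ∀ x → depth x ≤ depth w
  deepest with argmax depth (λ _ → true) (root , refl)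
  ... | w , _ , f = w , λ x → f x refl

  -- Round a vertex x, membership in X changes only at tree edges; a single change is impossible,
  -- so going up from the leaves it changes nowhere.
  X-tree : ∀ k x → depth (proj₁ deepest) ≤ depth x + k → x ≢ root → X x (par x) ≡ X (par x) x
  X-tree k x le ne = trans (sym last) (all j)
    where
    p = par x
    xp : G x p ≡ true
    xp = G-flip (par-edge x ne)
    other : ∀ {u} → G x u ≡ true → u ≢ p → X u x ≡ X x u
    other {u} g u≢p with split (tree u x)
    ... | inj₂ t = ≡-bool (X-cross (G-flip g) t) (X-cross g (trans (tree-sym x u) t))
    ... | inj₁ t with ∨-true {up u x} t
    ...   | inj₂ z = ⊥-elim (u≢p (sym (proj₂ (up-elim z))))
    ...   | inj₁ z with up-elim z
    ...     | nu , refl = below k le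
      where
      below : ∀ k → depth (proj₁ deepest) ≤ depth x + k → X u (par u) ≡ X (par u) u
      below zero le = ⊥-elim (<-irrefl refl (<-≤-trans (par-depth u nu) (≤-trans (proj₂ deepest u) (≤-trans le (≤-reflexive (+-identityʳ _))))))
      below (suc k) le = X-tree k u (≤-trans le (≤-trans (≤-reflexive (+-suc (depth x) k)) (+-monoˡ-≤ k (par-depth u nu)))) nu
    all : ∀ i → X (iter (ρ x) i p) x ≡ X p x
    all zero = refl
    all (suc i) with iter (ρ x) (suc i) p ≟ p
    ... | yes e = cong (λ z → X z x) e
    ... | no e = trans (other (ρ-iter (suc i) xp) e) (trans (sym (X-φ≡ (G-flip (ρ-iter i xp)))) (all i))
    orb = ρ-orbit (ρ-nbr xp) xp
    j = proj₁ orb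
    last : X (iter (ρ x) j p) x ≡ X x p
    last = trans (X-φ≡ (G-flip (ρ-iter j xp))) (cong (X x) (trans (sym (iter-shift (ρ x) j p)) (proj₂ orb)))

  X-sym : ∀ {u v} → G u v ≡ true → X u v ≡ true → X v u ≡ true
  X-sym {u} {v} g e with split (tree u v)
  ... | inj₂ t = X-cross g t e
  ... | inj₁ t with ∨-true {up u v} t
  ...   | inj₁ z with up-elim z
  ...     | nu , refl = trans (sym (X-tree (depth (proj₁ deepest)) u (m≤n+m _ _) nu)) e
  X-sym {u} {v} g e | inj₁ t | inj₂ z with up-elim z
  ...     | nv , refl = trans (X-tree (depth (proj₁ deepest)) v (m≤n+m _ _) nv) e

  X-around : ∀ {u v} → G u v ≡ true → X u v ≡ true → ∀ {w} → G w v ≡ true → X w v ≡ true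
  X-around {u} {v} g e h with ρ-orbit (G-flip g) (G-flip h)
  ... | k , refl = go k
    where
    go : ∀ k → X (iter (ρ v) k u) v ≡ true
    go zero = e
    go (suc k) = X-sym (ρ-nbr (ρ-iter k (G-flip g))) (X-φ (G-flip (ρ-iter k (G-flip g))) (go k))

  -- No edge separates X from its complement, so X contains all darts at a vertex as soon as it
  -- contains one, and connectedness of G spreads it everywhere.
  X-all : ∀ {u v} → G u v ≡ true → X u v ≡ true
  X-all {u} {v} g = into v (walk (proj₂ (connected (proj₂ o) v)) (λ h → X-around o-dart (Dual.seed⊆ (out-intro 0 refl)) h)) g
    where
    into : ∀ v → (∀ {w} → G w v ≡ true → X w v ≡ true) → G u v ≡ true → X u v ≡ true
    into v f = f
    walk : ∀ {k a b} → Walk G k a b → (∀ {w} → G w a ≡ true → X w a ≡ true) → ∀ {w} → G w b ≡ true → X w b ≡ true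
    walk here f = f
    walk (step h w) f = walk w λ h' → X-around h (X-sym (G-flip h) (f (G-flip h))) h'

  Face : Dart n → Dart n → Set
  Face t d = t ≡ d ⊎ t ≡ φ d ⊎ t ≡ φ (φ d)

  IsInner : Dart n → Set
  IsInner (u , v) = Inner u v ≡ true

  φ³ : ∀ d → IsInner d → φ (φ (φ d)) ≡ d
  φ³ (u , v) e = trans (cong (λ z → (z , ρ z (ρ v u))) (proj₁ (tri e))) (cong (u ,_) (proj₂ (tri e)))

  inner-step : ∀ d → IsInner d → IsInner (φ d)
  inner-step (u , v) e = inner-φ e

  face-inner : ∀ {t d} → IsInner d → Face t d → IsInner t
  face-inner e (inj₁ refl) = e
  face-inner {d = d} e (inj₂ (inj₁ refl)) = inner-step d e
  face-inner {d = d} e (inj₂ (inj₂ refl)) = inner-step (φ d) (inner-step d e)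

  face-sym : ∀ {t d} → IsInner d → Face t d → Face d t
  face-sym e (inj₁ refl) = inj₁ refl
  face-sym {d = d} e (inj₂ (inj₁ refl)) = inj₂ (inj₂ (sym (φ³ d e)))
  face-sym {d = d} e (inj₂ (inj₂ refl)) = inj₂ (inj₁ (sym (φ³ d e)))

  face-φ : ∀ {t d} → IsInner d → Face t d → Face (φ t) d
  face-φ e (inj₁ refl) = inj₂ (inj₁ refl)
  face-φ e (inj₂ (inj₁ refl)) = inj₂ (inj₂ refl)
  face-φ {d = d} e (inj₂ (inj₂ refl)) = inj₁ (φ³ d e)

  face-trans : ∀ {a b c} → IsInner c → Face a b → Face b c → Face a c
  face-trans e (inj₁ refl) f = f
  face-trans e (inj₂ (inj₁ refl)) f = face-φ e f
  face-trans e (inj₂ (inj₂ refl)) f = face-φ e (face-φ e f)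

  all-∈ : ∀ {A : Set} {p : A → Bool} {xs x} → LA.all p xs ≡ true → x ∈ xs → p x ≡ true
  all-∈ {p = p} {y ∷ _} e (here refl) = proj₁ (∧-true e)
  all-∈ {p = p} {y ∷ _} e (there m) = all-∈ (proj₂ (∧-true {p y} e)) m

  rep-le : ∀ {d} k → isFaceRep ρ d ≡ true → k < n * n → rank d ≤ rank (iter φ k d)
  rep-le {d} k e lt = ≤ᵇ⇒≤ _ _ (subst Data.Bool.T (sym (all-∈ {p = λ k → rank d ≤ᵇ rank (iter φ k d)} e (∈-upTo⁺ lt))) tt)

  rank-inj : ∀ {d d' : Dart n} → rank d ≡ rank d' → d ≡ d'
  rank-inj {u , v} {u' , v'} e with combine-injective u v u' v' (toℕ-injective
    (trans (toℕ-combine u v) (trans (cong (_+ toℕ v) (*-comm n (toℕ u))) (trans e (sym (trans (toℕ-combine u' v') (cong (_+ toℕ v') (*-comm n (toℕ u')))))))))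
  ... | refl , refl = refl

  private
    at-least-two : ∃ λ m → n ≡ 2 + m
    at-least-two = lem (proj₁ o) (proj₂ o) (G-≢ o-dart)
      where
      lem : ∀ {k} (u v : Fin k) → u ≢ v → ∃ λ m → k ≡ 2 + m
      lem {suc zero} zero zero ne = ⊥-elim (ne refl)
      lem {suc (suc m)} _ _ _ = m , refl

  -- Face representatives are defined by looking at n * n steps, which must be enough to go once
  -- round the outer cycle.
  n<n*n : suc n ≤ n * n
  n<n*n = subst (λ k → suc k ≤ k * k) (sym (proj₂ at-least-two)) (lem (proj₁ at-least-two))
    where
    lem : ∀ m → 3 + m ≤ (2 + m) * (2 + m)
    lem m = s≤s (s≤s (≤-trans (≤-reflexive (+-comm 1 m)) (+-monoʳ-≤ m (s≤s z≤n))))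

  n*n>2 : 2 < n * n
  n*n>2 = ≤-trans (s≤s (subst (2 ≤_) (sym (proj₂ at-least-two)) (s≤s (s≤s z≤n)))) n<n*n

  rep-face : ∀ {d t} → isFaceRep ρ d ≡ true → Face t d → rank d ≤ rank t
  rep-face e (inj₁ refl) = ≤-refl
  rep-face e (inj₂ (inj₁ refl)) = rep-le 1 e (<-trans (n<1+n 1) n*n>2)
  rep-face e (inj₂ (inj₂ refl)) = rep-le 2 e n*n>2

  same-rep : ∀ {d d' t} → IsInner d → IsInner d' → isFaceRep ρ d ≡ true → isFaceRep ρ d' ≡ true → Face t d → Face t d' → d ≡ d'
  same-rep i i' e e' f f' = rank-inj (≤-antisym (rep-face e (face-trans i (face-sym i' f') f)) (rep-face e' (face-trans i' (face-sym i f) f')))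

  outer-rep : ∀ {d d'} → Out (proj₁ d) (proj₂ d) ≡ true → Out (proj₁ d') (proj₂ d') ≡ true → isFaceRep ρ d ≡ true → isFaceRep ρ d' ≡ true → d ≡ d'
  outer-rep {d} {d'} x x' e e' with out-elim x | out-elim x'
  ... | i , p | j , p' with walk-mod i | walk-mod j
  ...   | i' , li , q | j' , lj , q' = rank-inj (≤-antisym (le i' j' li lj (trans q p) (trans q' p') e) (le j' i' lj li (trans q' p') (trans q p) e'))
    where
    len≤ : len ≤ n * n
    len≤ = ≤-trans len≤n (<⇒≤ n<n*n)
    le : ∀ {a b} i j → i < len → j < len → outer-walk i ≡ a → outer-walk j ≡ b → isFaceRep ρ a ≡ true → rank a ≤ rank b
    le i j li lj refl refl e with ≤-total i j
    ... | inj₁ i≤j = subst (λ z → rank (outer-walk i) ≤ rank z) (trans (sym (iter-+ φ (j ∸ i) i o)) (cong outer-walk (m∸n+n≡m i≤j)))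
                       (rep-le (j ∸ i) e (≤-trans (s≤s (m∸n≤m j i)) (≤-trans lj len≤)))
    ... | inj₂ j≤i = subst (λ z → rank (outer-walk i) ≤ rank z) (trans (sym (iter-+ φ (len ∸ i + j) i o)) (trans (cong outer-walk eq) (trans (iter-+ φ j len o) (cong (iter φ j) walk-len))))
                       (rep-le (len ∸ i + j) e (≤-trans (s≤s small) room))
      where
      eq : len ∸ i + j + i ≡ j + len
      eq = trans (cong (_+ i) (+-comm (len ∸ i) j)) (trans (+-assoc j (len ∸ i) i) (cong (j +_) (m∸n+n≡m (<⇒≤ li))))
      small : len ∸ i + j ≤ len
      small = ≤-trans (+-monoʳ-≤ (len ∸ i) j≤i) (≤-reflexive (m∸n+n≡m (<⇒≤ li)))
      room : suc len ≤ n * n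
      room = ≤-trans (s≤s len≤n) n<n*n

  -- The dart through which a face was first entered.
  record Entry (d : Dart n) : Set where
    field
      t : Dart n
      face : Face t d
      first : ∀ t' → Face t' d → Dual.lev t ≤ Dual.lev t'
      nontree : tree (proj₁ t) (proj₂ t) ≡ false
      drop : Dual.lev (swap t) < Dual.lev t

  -- The dart of lowest level was not reached by turning inside its own face and is no dart of the
  -- outer face, so the search came to it across a non-tree edge.
  entry : ∀ d → IsInner d → Entry d
  entry d i with min₃
    where
    l = Dual.lev
    min₃ : ∃ λ t → Face t d × (∀ t' → Face t' d → l t ≤ l t')
    min₃ with ≤-total (l d) (l (φ d)) | ≤-total (l d) (l (φ (φ d))) | ≤-total (l (φ d)) (l (φ (φ d)))
    ... | inj₁ a | inj₁ b | _ = d , inj₁ refl , λ { _ (inj₁ refl) → ≤-refl ; _ (inj₂ (inj₁ refl)) → a ; _ (inj₂ (inj₂ refl)) → b }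
    ... | inj₁ a | inj₂ b | _ = φ (φ d) , inj₂ (inj₂ refl) , λ { _ (inj₁ refl) → b ; _ (inj₂ (inj₁ refl)) → ≤-trans b a ; _ (inj₂ (inj₂ refl)) → ≤-refl }
    ... | inj₂ a | _ | inj₁ c = φ d , inj₂ (inj₁ refl) , λ { _ (inj₁ refl) → a ; _ (inj₂ (inj₁ refl)) → ≤-refl ; _ (inj₂ (inj₂ refl)) → c }
    ... | inj₂ a | _ | inj₂ c = φ (φ d) , inj₂ (inj₂ refl) , λ { _ (inj₁ refl) → ≤-trans c a ; _ (inj₂ (inj₁ refl)) → c ; _ (inj₂ (inj₂ refl)) → ≤-refl }
  ... | (u , v) , f , mn with Dual.pred (X-all (inner-dart (face-inner i f)))
  ...   | inj₁ z = clash z (inner-¬out (face-inner i f))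
  ...   | inj₂ ((a , b) , _ , r , lt) with ∨-true {turns (a , b) (u , v)} r
  ...     | inj₁ z = ⊥-elim (<-irrefl refl (<-≤-trans lt (mn (a , b) back)))
    where
    zi = proj₁ (∧-true {Inner a b} z)
    zz = proj₂ (∧-true {Inner a b} z)
    uv≡ : (u , v) ≡ φ (a , b)
    uv≡ = cong₂ _,_ (==⇒≡ (proj₁ (∧-true zz))) (==⇒≡ (proj₂ (∧-true {u == b} zz)))
    back : Face (a , b) d
    back = face-trans i (face-sym zi (inj₂ (inj₁ uv≡))) f
  ...     | inj₂ z with ==⇒≡ {u = u} {b} (proj₁ (∧-true (proj₁ (∧-true z)))) | ==⇒≡ {u = v} {a} (proj₂ (∧-true {u == b} (proj₁ (∧-true z))))
  ...       | refl | refl = record { t = u , v ; face = f ; first = mn ; drop = lt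
                ; nontree = trans (tree-sym u v) (not-true (proj₂ (∧-true {G v u} (proj₂ (∧-true {(u == u) ∧ (v == v)} z))))) }

  δ : Dart n → Dart n
  δ d with split (Inner (proj₁ d) (proj₂ d))
  ... | inj₁ i = Entry.t (entry d i)
  ... | inj₂ _ = d

  δ-entry : ∀ d → IsInner d → Σ (Entry d) λ e → δ d ≡ Entry.t e
  δ-entry d i with split (Inner (proj₁ d) (proj₂ d))
  ... | inj₁ i' = entry d i' , refl
  ... | inj₂ z = clash i z

  innerRep : Dart n → Bool
  innerRep d = Inner (proj₁ d) (proj₂ d) ∧ isFaceRep ρ d

  ir-inner : ∀ {d} → innerRep d ≡ true → IsInner d
  ir-inner e = proj₁ (∧-true e)

  ir-rep : ∀ {d} → innerRep d ≡ true → isFaceRep ρ d ≡ true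
  ir-rep {d} e = proj₂ (∧-true {Inner (proj₁ d) (proj₂ d)} e)

  δ-inj : ∀ {d d'} → innerRep d ≡ true → innerRep d' ≡ true → δ d ≡ δ d' → d ≡ d'
  δ-inj {d} {d'} e e' q with δ-entry d (ir-inner e) | δ-entry d' (ir-inner e')
  ... | en , p | en' , p' = same-rep (ir-inner e) (ir-inner e') (ir-rep e) (ir-rep e') (Entry.face en)
        (subst (λ z → Face z d') (trans (sym p') (trans (sym q) p)) (Entry.face en'))

  -- An entry dart has a higher level than its reverse, so no edge is the entry edge of faces on
  -- both of its sides.
  δ-swap : ∀ {d d'} → innerRep d ≡ true → innerRep d' ≡ true → δ d ≡ swap (δ d') → ⊥
  δ-swap {d} {d'} e e' q with δ-entry d (ir-inner e) | δ-entry d' (ir-inner e')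
  ... | en , p | en' , p' = <-asym (subst (λ z → Dual.lev (swap z) < Dual.lev z) (sym p) (Entry.drop en))
        (subst (λ z → Dual.lev z < Dual.lev (swap z)) (sym q) (subst (λ z → Dual.lev (swap z) < Dual.lev z) (sym p') (Entry.drop en')))

  -- Euler's formula: tree edges and entry edges exhaust all edges.

  -- Every non-tree edge is the entry edge of some face: otherwise Euler's formula leaves too few edges.
  module Counting (u₀ v₀ : Fin n) (g₀ : G u₀ v₀ ≡ true) (t₀ : tree u₀ v₀ ≡ false)
                  (none : ∀ d → innerRep d ≡ true → (δ d ≡ (u₀ , v₀) → ⊥) × (δ d ≡ (v₀ , u₀) → ⊥)) where

    eqᵈ : Dart n → Dart n → Bool
    eqᵈ d d' = ⌊ d ≟ᵈ d' ⌋

    eqᵈ-elim : ∀ {d d'} → eqᵈ d d' ≡ true → d ≡ d'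
    eqᵈ-elim = ⌊⌋-elim (_ ≟ᵈ _)

    eqᵈ-refl : ∀ d → eqᵈ d d ≡ true
    eqᵈ-refl d = ⌊⌋-intro (d ≟ᵈ d) refl

    -- Six disjoint sets of darts: tree edges, entry edges and the supposedly uncovered edge, each
    -- in both directions. With f bounded faces they number at least 2 (n - 1) + 2 f + 2, which is
    -- two more than Euler's formula permits.
    Q₁ Q₂ Q₃ Q₄ Q₅ Q₆ : Dart n → Bool
    Q₁ (u , v) = up u v
    Q₂ (u , v) = up v u
    Q₃ d = anyᵇ (λ c → innerRep c ∧ eqᵈ (δ c) d) (allDarts n)
    Q₄ d = Q₃ (swap d)
    Q₅ d = eqᵈ d (u₀ , v₀)
    Q₆ d = eqᵈ d (v₀ , u₀)

    Q₃-elim : ∀ {d} → Q₃ d ≡ true → ∃ λ c → innerRep c ≡ true × δ c ≡ d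
    Q₃-elim e with anyᵇ-elim (allDarts n) e
    ... | c , _ , q = c , proj₁ (∧-true q) , eqᵈ-elim (proj₂ (∧-true {innerRep c} q))

    δ-facts : ∀ {c} → innerRep c ≡ true → isDart G (δ c) ≡ true × tree (proj₁ (δ c)) (proj₂ (δ c)) ≡ false
    δ-facts {c} e with δ-entry c (ir-inner e)
    ... | en , p = subst (λ z → isDart G z ≡ true × tree (proj₁ z) (proj₂ z) ≡ false) (sym p)
                     (inner-dart (face-inner (ir-inner e) (Entry.face en)) , Entry.nontree en)

    Q₃-facts : ∀ {u v} → Q₃ (u , v) ≡ true → G u v ≡ true × tree u v ≡ false
    Q₃-facts e with Q₃-elim e
    ... | c , ir , refl = δ-facts ir

    Q₃₆ Q₄₆ Q₅₆ Q₂₆ Q₁₆ : Dart n → Bool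
    Q₅₆ d = Q₅ d ∨ Q₆ d
    Q₄₆ d = Q₄ d ∨ Q₅₆ d
    Q₃₆ d = Q₃ d ∨ Q₄₆ d
    Q₂₆ d = Q₂ d ∨ Q₃₆ d
    Q₁₆ d = Q₁ d ∨ Q₂₆ d

    Q₅₆-facts : ∀ {u v} → Q₅₆ (u , v) ≡ true → (G u v ≡ true × tree u v ≡ false) × (∀ c → innerRep c ≡ true → (δ c ≡ (u , v) → ⊥) × (δ c ≡ (v , u) → ⊥))
    Q₅₆-facts {u} {v} e with ∨-true {Q₅ (u , v)} e
    ... | inj₁ z with eqᵈ-elim z
    ...   | refl = (g₀ , t₀) , none
    Q₅₆-facts {u} {v} e | inj₂ z with eqᵈ-elim z
    ...   | refl = (G-flip g₀ , trans (tree-sym u v) t₀) , λ c i → proj₂ (none c i) , proj₁ (none c i)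

    Q₃₆-facts : ∀ {u v} → Q₃₆ (u , v) ≡ true → G u v ≡ true × tree u v ≡ false
    Q₃₆-facts {u} {v} e with ∨-true {Q₃ (u , v)} e
    ... | inj₁ z = Q₃-facts z
    ... | inj₂ z with ∨-true {Q₄ (u , v)} z
    ...   | inj₁ y = let a , b = Q₃-facts y in G-flip a , trans (tree-sym u v) b
    ...   | inj₂ y = proj₁ (Q₅₆-facts y)

    up-dart : ∀ {u v} → up u v ≡ true → G u v ≡ true
    up-dart z with up-elim z
    ... | nu , refl = G-flip (par-edge _ nu)

    Q₁₆-dart : ∀ d → Q₁₆ d ≡ true → isDart G d ≡ true
    Q₁₆-dart (u , v) e with ∨-true {up u v} e
    ... | inj₁ z = up-dart z
    ... | inj₂ z with ∨-true {up v u} z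
    ...   | inj₁ y = G-flip (up-dart y)
    ...   | inj₂ y = proj₁ (Q₃₆-facts y)

    d₅₆ : ∀ d → Q₅ d ≡ true → Q₆ d ≡ true → ⊥
    d₅₆ d a b = G-≢ g₀ (proj₁ (,-injective (trans (sym (eqᵈ-elim a)) (eqᵈ-elim b))))

    d₄ : ∀ d → Q₄ d ≡ true → Q₅₆ d ≡ true → ⊥
    d₄ (u , v) a b with Q₃-elim a
    ... | c , ir , q = proj₂ (proj₂ (Q₅₆-facts b) c ir) q

    d₃ : ∀ d → Q₃ d ≡ true → Q₄₆ d ≡ true → ⊥
    d₃ (u , v) a b with ∨-true {Q₄ (u , v)} b | Q₃-elim a
    ... | inj₂ z | c , ir , q = proj₁ (proj₂ (Q₅₆-facts z) c ir) q
    ... | inj₁ z | c , ir , q with Q₃-elim z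
    ...   | c' , ir' , q' = δ-swap ir ir' (trans q (cong swap (sym q')))

    d₂ : ∀ d → Q₂ d ≡ true → Q₃₆ d ≡ true → ⊥
    d₂ (u , v) a b = clash (∨-introʳ {up u v} a) (proj₂ (Q₃₆-facts b))

    d₁ : ∀ d → Q₁ d ≡ true → Q₂₆ d ≡ true → ⊥
    d₁ (u , v) a b with ∨-true {up v u} b
    ... | inj₂ z = clash (∨-introˡ {up u v} {up v u} a) (proj₂ (Q₃₆-facts z))
    ... | inj₁ z with up-elim a | up-elim z
    ...   | nu , refl | nv , q = <-asym (par-depth u nu) (subst (λ x → depth x < depth (par u)) q (par-depth (par u) nv))

    ds = allDarts n
    vs = allFin n

    nonroot : Fin n → Bool
    nonroot x = not (x == root)

    ds-unique : Unique ds
    ds-unique = cartesianProduct⁺ (allFin⁺ n) (allFin⁺ n)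

    total : count Q₁ ds + (count Q₂ ds + (count Q₃ ds + (count Q₄ ds + (count Q₅ ds + count Q₆ ds)))) ≤ numDarts G
    total = ≤-trans (+-monoʳ-≤ _ (≤-trans (+-monoʳ-≤ _ (≤-trans (+-monoʳ-≤ _ (≤-trans (+-monoʳ-≤ _ (count-∨ ds d₅₆)) (count-∨ ds d₄))) (count-∨ ds d₃))) (count-∨ ds d₂)))
              (≤-trans (count-∨ ds d₁) (count-mono ds Q₁₆-dart))

    a = count nonroot vs
    f = count innerRep ds

    c₁ : a ≤ count Q₁ ds
    c₁ = count-inject _≟ᵈ_ (λ x → (x , par x)) vs ds (allFin⁺ n) (λ x _ e → up-intro (==f⇒≢ (not-true e)) , allDarts-∈ _) (λ x y _ _ _ _ q → proj₁ (,-injective q))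
    c₂ : a ≤ count Q₂ ds
    c₂ = count-inject _≟ᵈ_ (λ x → (par x , x)) vs ds (allFin⁺ n) (λ x _ e → up-intro (==f⇒≢ (not-true e)) , allDarts-∈ _) (λ x y _ _ _ _ q → proj₂ (,-injective q))
    Q₃-intro : ∀ {d} → innerRep d ≡ true → Q₃ (δ d) ≡ true
    Q₃-intro {d} e = anyᵇ-intro {p = λ c → innerRep c ∧ eqᵈ (δ c) (δ d)} (allDarts-∈ d) (∧-intro e (eqᵈ-refl (δ d)))
    c₃ : f ≤ count Q₃ ds
    c₃ = count-inject _≟ᵈ_ {P = innerRep} δ ds ds ds-unique (λ d _ e → Q₃-intro {d} e , allDarts-∈ _) (λ d d' _ _ e e' → δ-inj {d} {d'} e e')
    c₄ : f ≤ count Q₄ ds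
    c₄ = count-inject _≟ᵈ_ {P = innerRep} (λ d → swap (δ d)) ds ds ds-unique (λ d _ e → Q₃-intro {d} e , allDarts-∈ _)
           (λ d d' _ _ e e' q → δ-inj {d} {d'} e e' (cong swap q))
    c₅ : 1 ≤ count Q₅ ds
    c₅ = ≤-trans (s≤s z≤n) (count-strict {P = λ _ → false} ds (λ _ ()) (allDarts-∈ (u₀ , v₀)) refl (eqᵈ-refl (u₀ , v₀)))
    c₆ : 1 ≤ count Q₆ ds
    c₆ = ≤-trans (s≤s z≤n) (count-strict {P = λ _ → false} ds (λ _ ()) (allDarts-∈ (v₀ , u₀)) refl (eqᵈ-refl (v₀ , u₀)))

    n≤ : n ≤ 1 + a
    n≤ = ≤-trans (≤-reflexive (trans (sym (length-tabulate {n = n} (λ x → x))) (sym (count-all {P = λ _ → true} vs (λ _ → refl)))))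
           (≤-trans (count-split {Q = _== root} {R = nonroot} vs (λ x _ → dec x)) (+-monoˡ-≤ a (count-one vs (allFin⁺ n) (λ x y p q → trans (==⇒≡ p) (sym (==⇒≡ q))))))
      where
      dec : ∀ x → (x == root) ≡ true ⊎ nonroot x ≡ true
      dec x with split (x == root)
      ... | inj₁ e = inj₁ e
      ... | inj₂ e = inj₂ (not-false e)

    F≤ : numFaces G ρ ≤ 1 + f
    F≤ = ≤-trans (count-split {Q = outRep} {R = innerRep} ds dec) (+-monoˡ-≤ f (count-one ds ds-unique λ d d' p q →
           outer-rep {d} {d'} (proj₁ (∧-true p)) (proj₁ (∧-true q)) (proj₂ (∧-true {Out (proj₁ d) (proj₂ d)} p)) (proj₂ (∧-true {Out (proj₁ d') (proj₂ d')} q))))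
      where
      outRep : Dart n → Bool
      outRep d = Out (proj₁ d) (proj₂ d) ∧ isFaceRep ρ d
      dec : ∀ d → isDart G d ∧ isFaceRep ρ d ≡ true → outRep d ≡ true ⊎ innerRep d ≡ true
      dec (u , v) e with inner-or-out (proj₁ (∧-true {G u v} e))
      ... | inj₁ z = inj₂ (∧-intro z (proj₂ (∧-true {G u v} e)))
      ... | inj₂ z = inj₁ (∧-intro z (proj₂ (∧-true {G u v} e)))

    absurd : ⊥
    absurd with +-cancelˡ-≤ M 4 2 (subst (_≤ M + 2) euler upper)
      where
      open import Data.Nat.Tactic.RingSolver using (solve-∀)
      M = numDarts G
      bound : a + (a + (f + (f + (1 + 1)))) ≤ M
      bound = ≤-trans (+-mono-≤ c₁ (+-mono-≤ c₂ (+-mono-≤ c₃ (+-mono-≤ c₄ (+-mono-≤ c₅ c₆))))) total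
      rearr : ∀ a f → 2 * (1 + a) + 2 * (1 + f) ≡ a + (a + (f + (f + (1 + 1)))) + 2
      rearr = solve-∀
      upper : 2 * n + 2 * numFaces G ρ ≤ M + 2
      upper = ≤-trans (+-mono-≤ (+-mono-≤ n≤ (+-mono-≤ n≤ z≤n)) (+-mono-≤ F≤ (+-mono-≤ F≤ z≤n))) (≤-trans (≤-reflexive (rearr a f)) (+-monoˡ-≤ 2 bound))
    ... | s≤s (s≤s ())

  entered : Fin n → Fin n → Dart n → Bool
  entered u v d = innerRep d ∧ (⌊ δ d ≟ᵈ (u , v) ⌋ ∨ ⌊ δ d ≟ᵈ (v , u) ⌋)

  covered : ∀ {u v} → G u v ≡ true → tree u v ≡ false → ∃ λ d → innerRep d ≡ true × (δ d ≡ (u , v) ⊎ δ d ≡ (v , u))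
  covered {u} {v} g t with split (anyᵇ (entered u v) (allDarts n))
  ... | inj₁ e with anyᵇ-elim (allDarts n) e
  ...   | d , _ , q with ∨-true {⌊ δ d ≟ᵈ (u , v) ⌋} (proj₂ (∧-true {innerRep d} q))
  ...     | inj₁ z = d , proj₁ (∧-true q) , inj₁ (⌊⌋-elim (δ d ≟ᵈ (u , v)) z)
  ...     | inj₂ z = d , proj₁ (∧-true q) , inj₂ (⌊⌋-elim (δ d ≟ᵈ (v , u)) z)
  covered {u} {v} g t | inj₂ e = ⊥-elim (Counting.absurd u v g t λ d i →
    (λ q → clash (anyᵇ-intro {p = entered u v} (allDarts-∈ d) (∧-intro i (∨-introˡ (⌊⌋-intro (δ d ≟ᵈ (u , v)) q)))) e) ,
    (λ q → clash (anyᵇ-intro {p = entered u v} (allDarts-∈ d) (∧-intro i (∨-introʳ {⌊ δ d ≟ᵈ (u , v) ⌋} (⌊⌋-intro (δ d ≟ᵈ (v , u)) q)))) e))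

  -- Functions on edges with zero sum around every bounded face.

  private
    maximum : (f : Dart n → ℕ) (ds : List (Dart n)) → ∃ λ b → ∀ d → d ∈ ds → f d ≤ b
    maximum f [] = 0 , λ _ ()
    maximum f (d ∷ ds) with maximum f ds
    ... | b , h = f d + b , λ { _ (here refl) → m≤m+n (f d) b ; e (there m) → ≤-trans (h e m) (m≤n+m b (f d)) }

    xor-change : ∀ a b c p q r → (a xor (p xor q)) xor ((b xor (q xor r)) xor (c xor (r xor p))) ≡ a xor (b xor c)
    xor-change = solve 6 (λ a b c p q r → (a :+ (p :+ q)) :+ ((b :+ (q :+ r)) :+ (c :+ (r :+ p))) := a :+ (b :+ c)) refl
      where open Data.Bool.Solver.xor-∧-Solver

    xor-zero : ∀ {a b} → a xor b ≡ false → a ≡ b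
    xor-zero {true} {true} _ = refl
    xor-zero {false} {false} _ = refl

    xor-last : ∀ {a b c} → a xor (b xor c) ≡ false → b ≡ false → c ≡ false → a ≡ false
    xor-last {false} _ _ _ = refl
    xor-last {true} () refl refl

    xor-mix : ∀ a b c a' b' c' → (a xor a') xor ((b xor b') xor (c xor c')) ≡ (a xor (b xor c)) xor (a' xor (b' xor c'))
    xor-mix = solve 6 (λ a b c a' b' c' → (a :+ a') :+ ((b :+ b') :+ (c :+ c')) := (a :+ (b :+ c)) :+ (a' :+ (b' :+ c'))) refl
      where open Data.Bool.Solver.xor-∧-Solver

    xor-self : ∀ a → a xor a ≡ false
    xor-self true = refl
    xor-self false = refl

    xor-tree : ∀ c p → c xor ((c xor p) xor p) ≡ false
    xor-tree = solve 2 (λ c p → c :+ ((c :+ p) :+ p) := con false) refl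
      where open Data.Bool.Solver.xor-∧-Solver

  module Potential (χ : Graph n) (χ-sym : ∀ u v → χ u v ≡ χ v u)
                   (zero-sum : ∀ {u v} → Inner u v ≡ true → χ u v xor (χ v (ρ v u) xor χ (ρ v u) u) ≡ false) where

    -- The sum modulo two along the tree path to the root. The first argument is fuel, and every
    -- value above the depth gives the same result.
    pot : ℕ → Fin n → Bool
    pot zero x = false
    pot (suc k) x = if x == root then false else χ x (par x) xor pot k (par x)

    pot-fuel : ∀ k l x → depth x < k → depth x < l → pot k x ≡ pot l x
    pot-fuel (suc k) (suc l) x a b with split (x == root)
    ... | inj₁ e rewrite e = refl
    ... | inj₂ e rewrite e = cong (χ x (par x) xor_) (pot-fuel k l (par x) (<-≤-trans lt (≤-pred a)) (<-≤-trans lt (≤-pred b)))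
      where lt = par-depth x (==f⇒≢ e)

    f : Fin n → Bool
    f x = pot (suc (depth x)) x

    f-par : ∀ x → x ≢ root → f x ≡ χ x (par x) xor f (par x)
    f-par x ne rewrite ≢⇒==f ne = cong (χ x (par x) xor_) (pot-fuel (depth x) (suc (depth (par x))) (par x) (par-depth x ne) (n<1+n _))

    χ' : Graph n
    χ' u v = χ u v xor (f u xor f v)

    χ'-sym : ∀ u v → χ' u v ≡ χ' v u
    χ'-sym u v = cong₂ _xor_ (χ-sym u v) (Bool.xor-comm (f u) (f v))

    χ'-up : ∀ {u v} → up u v ≡ true → χ' u v ≡ false
    χ'-up {u} e with up-elim e
    ... | nu , refl = trans (cong (λ z → χ u (par u) xor (z xor f (par u))) (f-par u nu)) (xor-tree (χ u (par u)) (f (par u)))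

    χ'-tree : ∀ {u v} → tree u v ≡ true → χ' u v ≡ false
    χ'-tree {u} {v} t with ∨-true {up u v} t
    ... | inj₁ e = χ'-up e
    ... | inj₂ e = trans (χ'-sym u v) (χ'-up e)

    on : Dart n → Bool
    on (u , v) = χ' u v

    face-sum : ∀ t → IsInner t → on t xor (on (φ t) xor on (φ (φ t))) ≡ false
    face-sum (u , v) i = trans (cong (λ z → χ' u v xor (χ' v (ρ v u) xor χ' (ρ v u) z)) (proj₁ (tri i)))
      (trans (xor-change (χ u v) (χ v (ρ v u)) (χ (ρ v u) u) (f u) (f v) (f (ρ v u))) (zero-sum i))

    φ-≢ : ∀ {t} → IsInner t → φ t ≢ t
    φ-≢ {u , v} i q = G-≢ (inner-dart i) (sym (proj₁ (,-injective q)))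

    private
      bnd = maximum Dual.lev (allDarts n)

    -- Downwards along the levels: both other edges of a face are tree edges or entries of later faces.
    at-entry : ∀ k d → innerRep d ≡ true → proj₁ bnd < Dual.lev (δ d) + k → on (δ d) ≡ false
    at-entry zero d ir lt = ⊥-elim (<-irrefl refl (<-≤-trans lt (≤-trans (≤-reflexive (+-identityʳ _)) (proj₂ bnd (δ d) (allDarts-∈ (δ d))))))
    at-entry (suc k) d ir lt with δ-entry d (ir-inner ir)
    ... | en , p = subst (λ z → on z ≡ false) (sym p) (xor-last (face-sum t ti) (side (φ t) (inj₂ (inj₁ refl)) (φ-≢ ti))
                     (side (φ (φ t)) (inj₂ (inj₂ refl)) (λ q → φ-≢ ti (trans (cong φ (sym q)) (φ³ t ti)))))
      where
      t = Entry.t en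
      ti : IsInner t
      ti = face-inner (ir-inner ir) (Entry.face en)
      side : ∀ s → Face s t → s ≢ t → on s ≡ false
      side (a , b) fs ne with split (tree a b)
      ... | inj₁ z = χ'-tree z
      ... | inj₂ z with covered (inner-dart (face-inner ti fs)) z
      ...   | d' , ir' , inj₁ q with δ-entry d' (ir-inner ir')
      ...     | en' , p' with same-rep (ir-inner ir) (ir-inner ir') (ir-rep ir) (ir-rep ir') (face-trans (ir-inner ir) fs (Entry.face en))
                                (subst (λ z → Face z d') (trans (sym p') q) (Entry.face en'))
      ...       | refl = ⊥-elim (ne (trans (sym q) p))
      side (a , b) fs ne | inj₂ z | d' , ir' , inj₂ q = trans (χ'-sym a b) (trans (cong on (sym q)) (at-entry k d' ir' later))
        where
        up' : Dual.lev (δ d) < Dual.lev (δ d')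
        up' with δ-entry d' (ir-inner ir')
        ... | en' , p' = ≤-<-trans (≤-trans (≤-reflexive (cong Dual.lev p)) (Entry.first en (a , b) (face-trans (ir-inner ir) fs (Entry.face en))))
                (subst (λ z → Dual.lev (swap z) < Dual.lev (δ d')) q (subst (λ z → Dual.lev (swap z) < Dual.lev z) (sym p') (Entry.drop en')))
        later : proj₁ bnd < Dual.lev (δ d') + k
        later = <-≤-trans lt (≤-trans (≤-reflexive (+-suc _ k)) (+-monoˡ-≤ k up'))

    vanishes : ∀ {u v} → G u v ≡ true → χ' u v ≡ false
    vanishes {u} {v} g with split (tree u v)
    ... | inj₁ t = χ'-tree t
    ... | inj₂ t with covered g t
    ...   | d , ir , q = fin q (at-entry (suc (proj₁ bnd)) d ir (m≤n+m _ _))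
      where
      fin : δ d ≡ (u , v) ⊎ δ d ≡ (v , u) → on (δ d) ≡ false → χ' u v ≡ false
      fin (inj₁ q) e = trans (cong on (sym q)) e
      fin (inj₂ q) e = trans (χ'-sym u v) (trans (cong on (sym q)) e)

  -- This is the vanishing of the first cohomology modulo two of the disc formed by the bounded
  -- faces.
  coboundary : (χ : Graph n) → (∀ u v → χ u v ≡ χ v u) →
    (∀ {u v} → Inner u v ≡ true → χ u v xor (χ v (ρ v u) xor χ (ρ v u) u) ≡ false) →
    ∃ λ (f : Fin n → Bool) → ∀ u v → G u v ≡ true → χ u v ≡ f u xor f v
  coboundary χ s z = f , λ u v g → xor-zero (vanishes g)
    where open Potential χ s z

  -- Unions of bounded faces, and discs.

  record Faces (A : Graph n) : Set where
    field
      inner : ∀ {u v} → A u v ≡ true → Inner u v ≡ true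
      next : ∀ {u v} → A u v ≡ true → A v (ρ v u) ≡ true

    dart : ∀ {u v} → A u v ≡ true → G u v ≡ true
    dart a = inner-dart (inner a)

    third : ∀ {u v} → A u v ≡ true → A (ρ v u) u ≡ true
    third {u} {v} a = subst (λ z → A (ρ v u) z ≡ true) (proj₁ (tri (inner a))) (next (next a))

    prev : ∀ {u v} → G u v ≡ true → A v (ρ v u) ≡ true → A u v ≡ true
    prev {u} {v} g a with inner-or-out g
    ... | inj₂ z = clash (out-φ z) (inner-¬out (inner a))
    ... | inj₁ i = subst (λ z → A u z ≡ true) (proj₂ (tri i)) (next (subst (λ z → A (ρ v u) z ≡ true) (proj₁ (tri i)) (next a)))

    before : ∀ {u v} → A v u ≡ true → ∃ λ t → A t v ≡ true × ρ v t ≡ u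
    before {u} {v} a = ρ u v , third a , proj₂ (tri (inner a))

  Bd : Graph n → Fin n → Fin n → Set
  Bd A t v = A t v ≡ true × A v t ≡ false

  bdᵇ : Graph n → Fin n → Bool
  bdᵇ A v = anyᵇ (λ t → A t v ∧ not (A v t)) (allFin n)

  bd-elim : ∀ {A v} → bdᵇ A v ≡ true → ∃ λ t → Bd A t v
  bd-elim {A} {v} e with anyᵇ-elim (allFin n) e
  ... | t , _ , q = t , proj₁ (∧-true q) , not-true (proj₂ (∧-true {A t v} q))

  bd-intro : ∀ {A v t} → Bd A t v → bdᵇ A v ≡ true
  bd-intro {A} {v} {t} (a , b) = anyᵇ-intro {p = λ t → A t v ∧ not (A v t)} (∈-allFin t) (∧-intro a (not-false b))

  -- Round v the boundary is left as often as it is entered.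
  parity : ∀ {A v u} → Faces A → A v u ≡ true → A u v ≡ false → ∃ λ t → Bd A t v
  parity {A} {v} {u} F a na with split (bdᵇ A v)
  ... | inj₁ e = bd-elim {A} e
  ... | inj₂ e with Faces.before F a
  ...   | t , at , _ with ρ-orbit (Faces.dart F a) (G-flip (Faces.dart F at))
  ...     | k , refl = clash at (off k)
    where
    g = Faces.dart F a
    off : ∀ i → A (iter (ρ v) i u) v ≡ false
    off zero = na
    off (suc i) = ≢true λ z → clash (bd-intro {A} (z , ≢true λ y → clash (Faces.prev F (G-flip (ρ-iter i g)) y) (off i))) e

  module _ {A : Graph n} (F : Faces A) (uniq : ∀ {w s t} → Bd A s w → Bd A t w → s ≡ t) where
    open Faces F

    -- The faces at v form a single fan.
    around : ∀ {v} (T : Fin n → Bool) → (∀ w → A w v ≡ true → A (ρ v w) v ≡ true → T w ≡ T (ρ v w)) →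
             ∀ {a b} → A a v ≡ true → A b v ≡ true → T a ≡ T b
    around {v} T st {a} {b} ea eb with origin
      where
      origin : ∃ λ s → G v s ≡ true × (∀ t → Bd A t v → t ≡ s)
      origin with split (bdᵇ A v)
      ... | inj₂ z = a , G-flip (dart ea) , λ t q → clash (bd-intro {A} q) z
      ... | inj₁ z with bd-elim {A} z
      ...   | s , q = s , G-flip (dart (proj₁ q)) , λ t q' → uniq q' q
    ... | s , g , only = trans (to ea) (sym (to eb))
      where
      run : ∀ i → A (iter (ρ v) i s) v ≡ true → T (iter (ρ v) i s) ≡ T s
      run zero _ = refl
      run (suc i) e with split (A (iter (ρ v) i s) v)
      ... | inj₁ z = trans (sym (st _ z e)) (run i z)
      ... | inj₂ z = cong T (only _ (e , ≢true λ y → clash (prev (G-flip (ρ-iter i g)) y) z))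
      to : ∀ {w} → A w v ≡ true → T w ≡ T s
      to e with ρ-orbit g (G-flip (dart e))
      ... | i , refl = run i e

    -- The fan of faces at w begins with t, and the next place in the rotation is not taken, so the
    -- fan consists of a single face.
    lone : ∀ {t w} → Bd A t w → A (ρ w t) w ≡ false → ∀ {a} → A a w ≡ true → a ≡ t
    lone {t} {w} (p , q) r {a} e = ==⇒≡ (trans (around (_== t) st e p) (≡⇒== {u = t} refl))
      where
      st : ∀ x → A x w ≡ true → A (ρ w x) w ≡ true → (x == t) ≡ (ρ w x == t)
      st x ax ay = trans (≢⇒==f (λ { refl → clash ay r })) (sym (≢⇒==f (λ z → clash (subst (λ y → A w y ≡ true) z (next ax)) q)))

  -- Connectedness is expressed by Boolean functions instead of paths. In `conn` they may vary only
  -- across edges interior to A; edges outside A count as links as well. This weak form of a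
  -- connected boundary passes to smaller discs and is what the coboundary argument uses. By
  -- `edges`, A is induced.
  record Disc (A : Graph n) : Set where
    field
      faces : Faces A
      uniq : ∀ {w s t} → Bd A s w → Bd A t w → s ≡ t
      conn : (f : Fin n → Bool) → (∀ u v → G u v ≡ true → A u v ∧ A v u ≡ false → f u ≡ f v) →
             ∀ {a b s t} → Bd A s a → Bd A t b → f a ≡ f b
      vconn : (f : Fin n → Bool) → (∀ u v → A u v ≡ true → f u ≡ f v) →
              ∀ {a b s t} → A s a ≡ true → A t b ≡ true → f a ≡ f b
      edges : ∀ {a b s t} → G a b ≡ true → A s a ≡ true → A t b ≡ true → A a b ≡ true ⊎ A b a ≡ true
      bdry : ∃ λ s → ∃ λ t → Bd A s t

  whole : Disc Inner
  whole = record { faces = record { inner = λ a → a ; next = inner-φ } ; uniq = λ a b → out-tail (out a) (out b)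
                 ; conn = conn' ; vconn = vconn' ; edges = λ g _ _ → either g
                 ; bdry = proj₂ o , proj₁ o , (inner-intro (G-flip o-dart) (≢true λ z → not-both z o-out) , ≢true λ z → clash o-out (inner-¬out z)) }
    where
    o-out : Out (proj₁ o) (proj₂ o) ≡ true
    o-out = out-intro 0 refl
    out : ∀ {t w} → Bd Inner t w → Out w t ≡ true
    out (a , b) with inner-or-out (G-flip (inner-dart a))
    ... | inj₁ z = clash z b
    ... | inj₂ z = z
    either : ∀ {a b} → G a b ≡ true → Inner a b ≡ true ⊎ Inner b a ≡ true
    either g with inner-or-out g
    ... | inj₁ z = inj₁ z
    ... | inj₂ z = inj₂ (inner-intro (G-flip g) (≢true λ y → not-both z y))
    conn' : (f : Fin n → Bool) → (∀ u v → G u v ≡ true → Inner u v ∧ Inner v u ≡ false → f u ≡ f v) →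
            ∀ {a b s t} → Bd Inner s a → Bd Inner t b → f a ≡ f b
    conn' f h p q = trans (to p) (sym (to q))
      where
      along : ∀ k → f (proj₁ (outer-walk k)) ≡ f (proj₁ o)
      along zero = refl
      along (suc k) = trans (sym (h _ _ (out-dart e) (≢true λ z → clash e (inner-¬out (proj₁ (∧-true z)))))) (along k)
        where
        e : Out (proj₁ (outer-walk k)) (proj₂ (outer-walk k)) ≡ true
        e = out-intro k refl
      to : ∀ {s a} → Bd Inner s a → f a ≡ f (proj₁ o)
      to p with out-elim (out p)
      ... | k , e = trans (cong f (sym (cong proj₁ e))) (along k)
    vconn' : (f : Fin n → Bool) → (∀ u v → Inner u v ≡ true → f u ≡ f v) →
             ∀ {a b s t} → Inner s a ≡ true → Inner t b ≡ true → f a ≡ f b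
    vconn' f h {a} {b} _ _ = walk (proj₂ (connected a b))
      where
      walk : ∀ {k u v} → Walk G k u v → f u ≡ f v
      walk here = refl
      walk (step g w) with either g
      ... | inj₁ z = trans (h _ _ z) (walk w)
      ... | inj₂ z = trans (sym (h _ _ z)) (walk w)

  -- A chord separates a disc.

  abstract
    eq : Dart n → Dart n → Bool
    eq d d' = ⌊ d ≟ᵈ d' ⌋

    eq-elim : ∀ {d d'} → eq d d' ≡ true → d ≡ d'
    eq-elim = ⌊⌋-elim (_ ≟ᵈ _)

    eq-intro : ∀ {d d'} → d ≡ d' → eq d d' ≡ true
    eq-intro = ⌊⌋-intro (_ ≟ᵈ _)

  eq-cong : ∀ {a b c d} → (a ≡ b → c ≡ d) → (c ≡ d → a ≡ b) → eq a b ≡ eq c d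
  eq-cong f g = ≡-bool (λ e → eq-intro (f (eq-elim e))) (λ e → eq-intro (g (eq-elim e)))

  -- Parity of the occurrences of the dart a on the face of p.
  mem : Dart n → Dart n → Bool
  mem p a = eq p a xor (eq (φ p) a xor eq (φ (φ p)) a)

  mem-turn : ∀ p a → IsInner p → IsInner a → mem p (φ a) ≡ mem p a
  mem-turn p a ip ia = trans (cong₂ _xor_ e₁ (cong₂ _xor_ (shift p ip) (shift (φ p) (inner-step p ip))))
                             (rotate (eq (φ (φ p)) a) (eq p a) (eq (φ p) a))
    where
    shift : ∀ q → IsInner q → eq (φ q) (φ a) ≡ eq q a
    shift q iq = eq-cong (φ-inj q a (inner-dart iq) (inner-dart ia)) (cong φ)
    e₁ : eq p (φ a) ≡ eq (φ (φ p)) a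
    e₁ = trans (cong (λ z → eq z (φ a)) (sym (φ³ p ip))) (shift (φ (φ p)) (inner-step (φ p) (inner-step p ip)))
    open Data.Bool.Solver.xor-∧-Solver
    rotate : ∀ x y z → x xor (y xor z) ≡ y xor (z xor x)
    rotate = solve 3 (λ x y z → x :+ (y :+ z) := y :+ (z :+ x)) refl

  edge : Dart n → Dart n → Bool
  edge a p = eq p a xor eq p (swap a)

  on : Graph n → Dart n → Bool
  on χ (u , v) = χ u v

  around-face : (Dart n → Bool) → Dart n → Bool
  around-face h p = h p xor (h (φ p) xor h (φ (φ p)))

  edge-sum : ∀ a p → around-face (edge a) p ≡ mem p a xor mem p (swap a)
  edge-sum a p = xor-mix (eq p a) (eq (φ p) a) (eq (φ (φ p)) a) (eq p (swap a)) (eq (φ p) (swap a)) (eq (φ (φ p)) (swap a))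

  edge-sym : ∀ a p → edge a (swap p) ≡ edge a p
  edge-sym a p = trans (cong₂ _xor_ (eq-cong {swap p} {a} {p} {swap a} (cong swap) (cong swap)) (eq-cong {swap p} {swap a} {p} {a} (cong swap) (cong swap)))
                       (Bool.xor-comm (eq p (swap a)) (eq p a))

  -- The faces of A reached from (b , d) without crossing the edge b d.
  module Side {A : Graph n} (F : Faces A) {b d : Fin n} (bd : A b d ≡ true) where
    open Faces F

    R : Dart n → Dart n → Bool
    R a a' = on A a ∧ (eq a' (φ a) ∨ ((on A (swap a) ∧ eq a' (swap a)) ∧ (not (eq a (b , d)) ∧ not (eq a (d , b)))))

    module Cl = Closure (allDarts n) allDarts-∈ (λ a → eq a (b , d)) R

    U : Graph n
    U u v = Cl.X (u , v)

    R-elim : ∀ {a a'} → R a a' ≡ true → on A a ≡ true × (a' ≡ φ a ⊎ (on A (swap a) ≡ true × a' ≡ swap a × a ≢ (b , d) × a ≢ (d , b)))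
    R-elim {a} {a'} e with ∨-true {eq a' (φ a)} (proj₂ (∧-true {on A a} e))
    ... | inj₁ z = proj₁ (∧-true e) , inj₁ (eq-elim z)
    ... | inj₂ z with ∧-true {on A (swap a) ∧ eq a' (swap a)} z
    ...   | x , y with ∧-true {on A (swap a)} x | ∧-true {not (eq a (b , d))} y
    ...     | x₁ , x₂ | y₁ , y₂ = proj₁ (∧-true e) , inj₂ (x₁ , eq-elim x₂ , (λ q → clash (eq-intro q) (not-true y₁)) , (λ q → clash (eq-intro q) (not-true y₂)))

    on-φ : ∀ {a} → on A a ≡ true → on A (φ a) ≡ true
    on-φ {u , v} e = next e

    R-target : ∀ {a a'} → R a a' ≡ true → on A a' ≡ true
    R-target {a} {a'} e with R-elim {a} {a'} e
    ... | x , inj₁ refl = on-φ {a} x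
    ... | x , inj₂ (y , refl , _) = y

    seed∈ : U b d ≡ true
    seed∈ = Cl.seed⊆ (eq-intro refl)

    U⊆A : ∀ {u v} → U u v ≡ true → A u v ≡ true
    U⊆A {u} {v} = Cl.minimal (λ a → on A a ≡ true) (λ a e → subst (λ z → on A z ≡ true) (sym (eq-elim e)) bd) (λ a a' _ → R-target {a} {a'}) (u , v)

    U-next : ∀ {u v} → U u v ≡ true → U v (ρ v u) ≡ true
    U-next {u} {v} e = Cl.closed e (∧-intro (U⊆A e) (∨-introˡ (eq-intro refl)))

    U-cross : ∀ {u v} → U u v ≡ true → A v u ≡ true → (u , v) ≢ (b , d) → (u , v) ≢ (d , b) → U v u ≡ true
    U-cross {u} {v} e a n₁ n₂ = Cl.closed e (∧-intro (U⊆A e) (∨-introʳ {eq (v , u) (φ (u , v))}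
      (∧-intro (∧-intro a (eq-intro refl)) (∧-intro (not-false (≢true λ z → n₁ (eq-elim z))) (not-false (≢true λ z → n₂ (eq-elim z)))))))

    U-faces : Faces U
    U-faces = record { inner = λ e → inner (U⊆A e) ; next = U-next }

    -- A dual path as a set of edges: those it crosses.
    record Path (a : Dart n) : Set where
      field
        χ : Dart n → Bool
        χ-sym : ∀ p → χ (swap p) ≡ χ p
        inside : ∀ u v → χ (u , v) ≡ true → A u v ∧ A v u ≡ true
        avoids : χ (b , d) ≡ false
        sums : ∀ p → IsInner p → around-face χ p ≡ mem p (b , d) xor mem p a

    paths : ∀ {u v} → U u v ≡ true → Path (u , v)
    paths {u} {v} = Cl.minimal Path origin move (u , v)
      where
      origin : ∀ a → eq a (b , d) ≡ true → Path a
      origin a e = subst Path (sym (eq-elim e)) record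
        { χ = λ _ → false ; χ-sym = λ _ → refl ; inside = λ _ _ () ; avoids = refl ; sums = λ p _ → sym (xor-self (mem p (b , d))) }
      move : ∀ a a' → Path a → R a a' ≡ true → Path a'
      move a a' P e with R-elim {a} {a'} e
      ... | x , inj₁ refl = record { Path P ; sums = λ p i → trans (Path.sums P p i) (cong (mem p (b , d) xor_) (sym (mem-turn p a i (inner x)))) }
      ... | x , inj₂ (y , refl , n₁ , n₂) = record { χ = χ' ; χ-sym = λ p → cong₂ _xor_ (χ-sym p) (edge-sym a p) ; inside = inside' ; avoids = avoids' ; sums = sums' }
        where
        open Path P
        -- Crossing an edge toggles it, so the sums around faces telescope modulo two to the first
        -- and the last face of the path.
        χ' : Dart n → Bool
        χ' p = χ p xor edge a p
        xor-true : ∀ {x y} → x xor y ≡ true → x ≡ true ⊎ y ≡ true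
        xor-true {true} _ = inj₁ refl
        xor-true {false} e = inj₂ e
        inside' : ∀ u v → χ' (u , v) ≡ true → A u v ∧ A v u ≡ true
        inside' u v e with xor-true {χ (u , v)} e
        ... | inj₁ z = inside u v z
        ... | inj₂ z with xor-true {eq (u , v) a} z
        ...   | inj₁ q with eq-elim q
        ...     | refl = ∧-intro x y
        inside' u v e | inj₂ z | inj₂ q with eq-elim q
        ...     | refl = ∧-intro y x
        avoids' : χ' (b , d) ≡ false
        avoids' = cong₂ _xor_ avoids (cong₂ _xor_ {eq (b , d) a} {false} (≢true λ z → n₁ (sym (eq-elim z))) (≢true λ z → n₂ (sym (cong swap (eq-elim z)))))
        open Data.Bool.Solver.xor-∧-Solver
        tele : ∀ x y z → (x xor y) xor (y xor z) ≡ x xor z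
        tele = solve 3 (λ x y z → (x :+ y) :+ (y :+ z) := x :+ z) refl
        sums' : ∀ p → IsInner p → around-face χ' p ≡ mem p (b , d) xor mem p (swap a)
        sums' p i = trans (xor-mix (χ p) (χ (φ p)) (χ (φ (φ p))) (edge a p) (edge a (φ p)) (edge a (φ (φ p))))
          (trans (cong₂ _xor_ (sums p i) (edge-sum a p)) (tele (mem p (b , d)) (mem p a) (mem p (swap a))))

    -- A dual cycle crossing b d once would be the coboundary of a function separating b from d.
    splits : (disc : Disc A) → A d b ≡ true → ∀ {s t} → Bd A s b → Bd A t d → U d b ≡ false
    splits disc db bb bd' = ≢true λ e → impossible (paths e)
      where
      impossible : Path (d , b) → ⊥
      impossible P = clash value (trans (cong (_xor f d) (Disc.conn disc f flat bb bd')) (xor-self (f d)))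
        where
        open Path P
        ψ : Dart n → Bool
        ψ p = χ p xor edge (b , d) p
        closed-up : ∀ p → IsInner p → around-face ψ p ≡ false
        closed-up p i = trans (xor-mix (χ p) (χ (φ p)) (χ (φ (φ p))) (edge (b , d) p) (edge (b , d) (φ p)) (edge (b , d) (φ (φ p))))
          (trans (cong₂ _xor_ (sums p i) (edge-sum (b , d) p)) (xor-self (mem p (b , d) xor mem p (d , b))))
        cob = coboundary (λ u v → ψ (u , v)) (λ u v → cong₂ _xor_ (χ-sym (v , u)) (edge-sym (b , d) (v , u)))
          (λ {u} {v} i → trans (cong (λ z → ψ (u , v) xor (ψ (v , ρ v u) xor ψ (ρ v u , z))) (sym (proj₁ (tri i)))) (closed-up (u , v) i))
        f = proj₁ cob
        value : f b xor f d ≡ true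
        value = trans (sym (proj₂ cob b d (dart bd))) (cong₂ _xor_ avoids (cong₂ _xor_ (eq-intro {b , d} refl) (≢true {eq (b , d) (d , b)} λ z → G-≢ (dart bd) (proj₁ (,-injective (eq-elim z))))))
        flat : ∀ u v → G u v ≡ true → A u v ∧ A v u ≡ false → f u ≡ f v
        flat u v g na = xor-zero (trans (sym (proj₂ cob u v g)) (cong₂ _xor_ (≢true λ z → clash (inside u v z) na)
          (cong₂ _xor_ {eq (u , v) (b , d)} {false} (≢true λ z → clash (two (eq-elim z)) na) (≢true λ z → clash (two' (eq-elim z)) na))))
          where
          two : (u , v) ≡ (b , d) → A u v ∧ A v u ≡ true
          two refl = ∧-intro bd db
          two' : (u , v) ≡ (d , b) → A u v ∧ A v u ≡ true
          two' refl = ∧-intro db bd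

  -- Boundary vertices without chords.

  Chord : Graph n → Fin n → Fin n → Set
  Chord A b d = A b d ≡ true × A d b ≡ true × (∃ λ t → Bd A t d)

  -- A part of A that is cut off by the single edge v c: across every other edge of W the part can
  -- be left only by leaving A.
  record Pocket (A W : Graph n) (v c : Fin n) : Set where
    field
      faces : Faces W
      sub : ∀ {x y} → W x y ≡ true → A x y ≡ true
      mouth : W v c ≡ true
      outside : W c v ≡ false
      cross : ∀ {x y} → W x y ≡ true → A y x ≡ true → (x , y) ≢ (v , c) → W y x ≡ true

  module _ {A : Graph n} (disc : Disc A) where
    open Disc disc
    open Faces faces

    chordᵇ : Fin n → Fin n → Bool
    chordᵇ b d = A b d ∧ (A d b ∧ bdᵇ A d)

    chord? : ∀ b → (∃ λ d → Chord A b d) ⊎ (∀ d → Chord A b d → ⊥)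
    chord? b with split (anyᵇ (chordᵇ b) (allFin n))
    ... | inj₁ e with anyᵇ-elim (allFin n) e
    ...   | d , _ , q with ∧-true {A b d} q
    ...     | x , y with ∧-true {A d b} y
    ...       | y₁ , y₂ = inj₁ (d , x , y₁ , bd-elim {A} y₂)
    chord? b | inj₂ e = inj₂ λ { d (x , y , t , z) → clash (anyᵇ-intro {p = chordᵇ b} (∈-allFin d) (∧-intro x (∧-intro y (bd-intro {A} z)))) e }

    -- In a minimal pocket the boundary vertex before the mouth has no chord.
    search : ∀ k W v c → Pocket A W v c → count (on W) (allDarts n) < k →
             ∃ λ b → (∃ λ t → Bd A t b) × (∀ d → Chord A b d → ⊥)
    search (suc k) W v c P lt with parity (Pocket.faces P) (Pocket.mouth P) (Pocket.outside P)
    ... | b , wbv , nwvb with chord? b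
    ...   | inj₂ free = b , parity faces (Pocket.sub P wbv) (≢true λ a → clash (Pocket.cross P wbv a λ { refl → G-≢ (dart (Pocket.sub P wbv)) refl }) nwvb) , free
    ...   | inj₁ (d , bd , db , td) = smaller
      where
      open Pocket P using (sub; mouth; outside; cross) renaming (faces to W-faces)
      b≢v : b ≢ v
      b≢v refl = G-≢ (dart (sub wbv)) refl
      b≢c : b ≢ c
      b≢c refl = clash wbv outside
      tb : ∃ λ t → Bd A t b
      tb = parity faces (sub wbv) (≢true λ a → clash (cross wbv a λ { refl → b≢v refl }) nwvb)
      -- The mouth does not meet b, so going through the fan of faces at b never leaves W.
      at-b : ∀ {x} → A x b ≡ true → W x b ≡ true
      at-b {x} a with Faces.before W-faces wbv
      ... | t , wt , _ = trans (around faces uniq (λ w → W w b) st a (sub wt)) wt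
        where
        st : ∀ w → A w b ≡ true → A (ρ b w) b ≡ true → W w b ≡ W (ρ b w) b
        st w a a' = ≡-bool (λ e → cross (Faces.next W-faces e) a' λ { q → b≢v (cong proj₁ q) })
                           (λ e → Faces.prev W-faces (dart a) (cross e (next a) λ { q → b≢c (cong proj₂ q) }))
      wdb : W d b ≡ true
      wdb = at-b db
      wbd : W b d ≡ true
      wbd = cross wdb bd λ q → b≢c (cong proj₂ q)
      module S₁ = Side faces bd
      module S₂ = Side faces db
      not₁ : S₁.U d b ≡ false
      not₁ = S₁.splits disc db (proj₂ tb) (proj₂ td)
      not₂ : S₂.U b d ≡ false
      not₂ = S₂.splits disc bd (proj₂ td) (proj₂ tb)
      -- The search on one side of the chord can be run backwards. If it met the other side, the
      -- latter would contain d b, which it does not; so the two sides are disjoint.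
      back : ∀ a → S₂.Cl.X a ≡ true → S₁.Cl.X a ≡ true → S₁.Cl.X (d , b) ≡ true
      back = S₂.Cl.minimal (λ a → S₁.Cl.X a ≡ true → S₁.Cl.X (d , b) ≡ true) (λ a e x → subst (λ z → S₁.Cl.X z ≡ true) (eq-elim e) x) undo
        where
        undo : ∀ a a' → (S₁.Cl.X a ≡ true → S₁.Cl.X (d , b) ≡ true) → S₂.R a a' ≡ true → S₁.Cl.X a' ≡ true → S₁.Cl.X (d , b) ≡ true
        undo (x , y) a' h r u with S₂.R-elim {x , y} {a'} r
        ... | axy , inj₁ refl = h (Faces.prev S₁.U-faces (dart axy) u)
        ... | axy , inj₂ (ayx , refl , n₁ , n₂) = h (S₁.U-cross u axy (λ q → n₁ (cong swap q)) (λ q → n₂ (cong swap q)))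
      -- The side of the chord that avoids the old mouth cannot leave W. It is a pocket with the
      -- chord as its mouth, and it is smaller since v c is missing.
      descend : ∀ {p q} (pq : A p q ≡ true) → W p q ≡ true → Side.U faces pq q p ≡ false → Side.U faces pq v c ≡ false →
                ∃ λ b → (∃ λ t → Bd A t b) × (∀ d → Chord A b d → ⊥)
      descend {p} {q} pq wpq nqp out = search k S.U p q
        (record { faces = S.U-faces ; sub = S.U⊆A ; mouth = S.seed∈ ; outside = nqp ; cross = λ {x} {y} u a ne → S.U-cross u a ne (λ z → clash (subst (λ z → S.Cl.X z ≡ true) z u) nqp) })
        (<-≤-trans (count-strict (allDarts n) (λ { (x , y) u → proj₁ (stay x y u) }) (allDarts-∈ (v , c)) out mouth) (≤-pred lt))
        where
        module S = Side faces pq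
        stay : ∀ x y → S.U x y ≡ true → W x y ≡ true × S.U x y ≡ true
        stay x y = S.Cl.minimal (λ a → on W a ≡ true × S.Cl.X a ≡ true) (λ a e → subst (λ z → on W z ≡ true) (sym (eq-elim e)) wpq , Cl-seed a e) go (x , y)
          where
          Cl-seed : ∀ a → eq a (p , q) ≡ true → S.Cl.X a ≡ true
          Cl-seed a e = S.Cl.seed⊆ e
          go : ∀ a a' → on W a ≡ true × S.Cl.X a ≡ true → S.R a a' ≡ true → on W a' ≡ true × S.Cl.X a' ≡ true
          go (x , y) a' (w , u) r = target , S.Cl.closed u r
            where
            target : on W a' ≡ true
            target with S.R-elim {x , y} {a'} r
            ... | _ , inj₁ refl = Faces.next W-faces w
            ... | _ , inj₂ (ayx , refl , _) = cross w ayx λ z → clash (subst (λ z → S.Cl.X z ≡ true) z u) out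
      smaller : ∃ λ b → (∃ λ t → Bd A t b) × (∀ d → Chord A b d → ⊥)
      smaller with split (S₁.U v c) | split (S₂.U v c)
      ... | inj₂ z | _ = descend bd wbd not₁ z
      ... | inj₁ _ | inj₂ z = descend db wdb not₂ z
      ... | inj₁ y | inj₁ z = clash (back (v , c) z y) not₁

    chord-free : ∃ λ b → (∃ λ t → Bd A t b) × (∀ d → Chord A b d → ⊥)
    chord-free with bdry
    ... | v , c , a , na = search _ A v c (record { faces = faces ; sub = λ e → e ; mouth = a ; outside = na ; cross = λ _ e _ → e }) (n<1+n _)

  -- Removing vertices without chords.

  Listed : Graph n → Set
  Listed B = ∃ λ L → Order G L × (∀ x → x ∈ L → ∃ λ t → B t x ≡ true) × (∀ x t → B t x ≡ true → x ∈ L)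

  module Remove {A : Graph n} (disc : Disc A) {v s : Fin n} (bv : Bd A s v) (free : ∀ d → Chord A v d → ⊥) where
    open Disc disc
    open Faces faces

    touch : Graph n
    touch x y = (x == v) ∨ ((y == v) ∨ (ρ y x == v))

    A' : Graph n
    A' x y = A x y ∧ not (touch x y)

    A'⊆A : ∀ {x y} → A' x y ≡ true → A x y ≡ true
    A'⊆A e = proj₁ (∧-true e)

    untouched : ∀ {x y} → A' x y ≡ true → x ≢ v × y ≢ v × ρ y x ≢ v
    untouched {x} {y} e = (λ q → clash (∨-introˡ (≡⇒== q)) off) , (λ q → clash (∨-introʳ {x == v} (∨-introˡ (≡⇒== q))) off) ,
                          (λ q → clash (∨-introʳ {x == v} (∨-introʳ {y == v} (≡⇒== q))) off)
      where
      off : touch x y ≡ false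
      off = not-true (proj₂ (∧-true {A x y} e))

    keep : ∀ {x y} → A x y ≡ true → x ≢ v → y ≢ v → ρ y x ≢ v → A' x y ≡ true
    keep {x} {y} a p q r = ∧-intro a (not-false (≢true bad))
      where
      bad : touch x y ≡ true → ⊥
      bad e with ∨-true {x == v} e
      ... | inj₁ z = p (==⇒≡ z)
      ... | inj₂ z with ∨-true {y == v} z
      ...   | inj₁ y = q (==⇒≡ y)
      ...   | inj₂ y = r (==⇒≡ y)

    lost : ∀ {x y} → A' x y ≡ false → A x y ≡ true → x ≢ v → y ≢ v → ρ y x ≡ v
    lost {x} {y} e a p q with split (ρ y x == v)
    ... | inj₁ z = ==⇒≡ z
    ... | inj₂ z = clash (keep a p q (==f⇒≢ z)) e

    -- Some face at v has its edge opposite to v on the boundary. As v has no chord, the other two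
    -- edges lie on the boundary too. Each corner then carries just this face, and connectedness
    -- leaves no further faces in A.
    module Single {w : Fin n} (wv : A w v ≡ true) (nl : A w (ρ v w) ≡ false) where

      w' : Fin n
      w' = ρ v w

      w'w : A w' w ≡ true
      w'w = third wv

      vw' : A v w' ≡ true
      vw' = next wv

      nvw : A v w ≡ false
      nvw = ≢true λ e → free w (e , wv , w' , w'w , nl)

      nw'v : A w' v ≡ false
      nw'v = ≢true λ e → free w' (vw' , e , parity faces w'w nl)

      corner : Fin n → Bool
      corner x = (x == v) ∨ ((x == w) ∨ (x == w'))

      corner-v : ∀ {x} → x ≡ v → corner x ≡ true
      corner-v q = ∨-introˡ (≡⇒== q)

      corner-w : ∀ {x} → x ≡ w → corner x ≡ true
      corner-w {x} q = ∨-introʳ {x == v} (∨-introˡ (≡⇒== q))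

      corner-w' : ∀ {x} → x ≡ w' → corner x ≡ true
      corner-w' {x} q = ∨-introʳ {x == v} (∨-introʳ {x == w} (≡⇒== q))

      corner-elim : ∀ {x} → corner x ≡ true → x ≡ v ⊎ x ≡ w ⊎ x ≡ w'
      corner-elim {x} e with ∨-true {x == v} e
      ... | inj₁ z = inj₁ (==⇒≡ z)
      ... | inj₂ z with ∨-true {x == w} z
      ...   | inj₁ y = inj₂ (inj₁ (==⇒≡ y))
      ...   | inj₂ y = inj₂ (inj₂ (==⇒≡ y))

      back : ∀ {a b} → A a b ≡ true → corner b ≡ true → corner a ≡ true
      back {b = b} e c with corner-elim {b} c
      ... | inj₁ refl = corner-w (lone faces uniq (wv , nvw) nw'v e)
      ... | inj₂ (inj₁ refl) = corner-w' (lone faces uniq (w'w , nl) (subst (λ z → A z w ≡ false) (sym (proj₂ (tri (inner wv)))) nvw) e)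
      ... | inj₂ (inj₂ refl) = corner-v (lone faces uniq (vw' , nw'v) (subst (λ z → A z w' ≡ false) (sym (proj₁ (tri (inner wv)))) nl) e)

      only : ∀ {t a} → A t a ≡ true → corner a ≡ true
      only e = trans (vconn corner (λ x y a → ≡-bool (λ c → back {y} (next a) (back (third a) c)) (back {x} a)) e wv) (corner-v {v} refl)

      order : Listed A
      order = v ∷ w ∷ w' ∷ [] , add (rootEdge (G-flip (dart w'w))) new (w , here refl , G-flip (dart wv)) pair , from , to
        where
        new : ¬ v ∈ (w ∷ w' ∷ [])
        new (here q) = G-≢ (dart wv) (sym q)
        new (there (here q)) = G-≢ (dart vw') q
        pair : ∀ x → x ∈ (w ∷ w' ∷ []) → G v x ≡ true → ∃ λ y → y ∈ (w ∷ w' ∷ []) × G v y ≡ true × G x y ≡ true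
        pair x (here refl) _ = w' , there (here refl) , dart vw' , G-flip (dart w'w)
        pair x (there (here refl)) _ = w , here refl , G-flip (dart wv) , dart w'w
        from : ∀ x → x ∈ (v ∷ w ∷ w' ∷ []) → ∃ λ t → A t x ≡ true
        from x (here refl) = w , wv
        from x (there (here refl)) = w' , w'w
        from x (there (there (here refl))) = v , vw'
        to : ∀ x t → A t x ≡ true → x ∈ (v ∷ w ∷ w' ∷ [])
        to x t e with corner-elim {x} (only e)
        ... | inj₁ refl = here refl
        ... | inj₂ (inj₁ refl) = there (here refl)
        ... | inj₂ (inj₂ refl) = there (there (here refl))

    -- Here every edge opposite to v carries a further face of A, and deleting all faces at v leaves
    -- a disc again.
    module Many (linked : ∀ {w} → A w v ≡ true → A w (ρ v w) ≡ true) where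

      link : ∀ {w} → A w v ≡ true → A' w (ρ v w) ≡ true
      link {w} wv = keep (linked wv) (G-≢ (dart wv)) (λ q → G-≢ (dart (next wv)) (sym q)) degree-two
        where
        w' = ρ v w
        -- If the further face contained v as well, v would have only the neighbours w and w', and
        -- all darts leaving v would be in A, against the boundary dart from s to v.
        degree-two : ρ w' w ≢ v
        degree-two q = clash (all-in (proj₁ orb)) (subst (λ z → A v z ≡ false) (sym (proj₂ orb)) (proj₂ bv))
          where
          i = inner (linked wv)
          ρw' : ρ v w' ≡ w
          ρw' = subst (λ z → ρ z w' ≡ w) q (proj₁ (tri i))
          vw : A v w ≡ true
          vw = subst (λ z → A z w ≡ true) q (third (linked wv))
          two : ∀ i → iter (ρ v) i w ≡ w ⊎ iter (ρ v) i w ≡ w'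
          two zero = inj₁ refl
          two (suc i) with two i
          ... | inj₁ z = inj₂ (cong (ρ v) z)
          ... | inj₂ z = inj₁ (trans (cong (ρ v) z) ρw')
          orb = ρ-orbit (G-flip (dart wv)) (G-flip (dart (proj₁ bv)))
          all-in : ∀ i → A v (iter (ρ v) i w) ≡ true
          all-in i with two i
          ... | inj₁ z = subst (λ z → A v z ≡ true) (sym z) vw
          ... | inj₂ z = subst (λ z → A v z ≡ true) (sym z) (next wv)

      faces' : Faces A'
      faces' = record { inner = λ e → inner (A'⊆A e) ; next = next' }
        where
        next' : ∀ {x y} → A' x y ≡ true → A' y (ρ y x) ≡ true
        next' e with untouched e
        ... | p , q , r = keep (next (A'⊆A e)) q r (λ z → p (trans (sym (proj₁ (tri (inner (A'⊆A e))))) z))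

      -- A new boundary dart is the edge opposite to v in a deleted face, seen from the other side,
      -- and this determines t.
      bd' : ∀ {t x} → Bd A' t x → Bd A t x ⊎ (A v x ≡ true × t ≡ ρ x v)
      bd' {t} {x} (e , ne) with split (A x t) | untouched e
      ... | inj₂ z | _ = inj₁ (A'⊆A e , z)
      ... | inj₁ z | p , q , r with lost ne z q p
      ...   | refl = inj₂ (third z , sym (proj₂ (tri (inner z))))

      -- As v x is no chord, the old boundary dart into x is the one from v, which is deleted. So
      -- old and new boundary darts do not meet at x.
      mixed : ∀ {s x} → Bd A s x → A v x ≡ true → A' s x ≡ true → ⊥
      mixed {s} {x} b a e with split (A x v)
      ... | inj₁ z = free x (a , z , s , b)
      ... | inj₂ z = proj₁ (untouched e) (uniq b (a , z))

      uniq' : ∀ {x s t} → Bd A' s x → Bd A' t x → s ≡ t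
      uniq' {x} {s} {t} p q with bd' p | bd' q
      ... | inj₁ a | inj₁ b = uniq a b
      ... | inj₂ (_ , a) | inj₂ (_ , b) = trans a (sym b)
      ... | inj₁ a | inj₂ (b , _) = ⊥-elim (mixed a b (proj₁ p))
      ... | inj₂ (a , _) | inj₁ b = ⊥-elim (mixed b a (proj₁ q))

      conn' : (f : Fin n → Bool) → (∀ x y → G x y ≡ true → A' x y ∧ A' y x ≡ false → f x ≡ f y) →
              ∀ {a b s t} → Bd A' s a → Bd A' t b → f a ≡ f b
      conn' f h p q = trans (to p) (sym (to q))
        where
        to : ∀ {t a} → Bd A' t a → f a ≡ f v
        to {t} {a} p with bd' p
        ... | inj₁ z = conn f (λ x y g e → h x y g (≢true λ c → clash (∧-intro (A'⊆A (proj₁ (∧-true c))) (A'⊆A (proj₂ (∧-true {A' x y} c)))) e)) z bv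
        ... | inj₂ (z , _) = sym (h v a (dart z) (≢true λ c → proj₁ (untouched (proj₁ (∧-true c))) refl))

      survive : ∀ {x y} → A x y ≡ true → x ≢ v → y ≢ v → A' x y ≡ true ⊎ A' y x ≡ true
      survive {x} {y} a p q with split (A' x y)
      ... | inj₁ e = inj₁ e
      ... | inj₂ e with lost e a p q
      ...   | refl = inj₂ (subst (λ z → A' y z ≡ true) (proj₁ (tri (inner a))) (link (next a)))

      vertex : ∀ {t x} → A t x ≡ true → x ≢ v → ∃ λ t' → A' t' x ≡ true
      vertex {t} {x} a p with split (t == v)
      ... | inj₁ e with ==⇒≡ e
      ...   | refl with before a
      ...     | t' , b , refl = t' , link b
      vertex {t} {x} a p | inj₂ e with survive a (==f⇒≢ e) p
      ...   | inj₁ z = t , z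
      ...   | inj₂ z = ρ t x , Faces.third faces' z

      vconn' : (f : Fin n → Bool) → (∀ x y → A' x y ≡ true → f x ≡ f y) →
               ∀ {a b s t} → A' s a ≡ true → A' t b ≡ true → f a ≡ f b
      vconn' f h p q = trans (sym (f'-≢ (proj₁ (proj₂ (untouched p))))) (trans (vconn f' flat (A'⊆A p) (A'⊆A q)) (f'-≢ (proj₁ (proj₂ (untouched q)))))
        where
        f' : Fin n → Bool
        -- The deleted vertex gets the value at s. All neighbours of v in A share this value, as
        -- they are linked in A' along the fan of faces at v.
        f' x = if x == v then f s else f x
        f'-≢ : ∀ {x} → x ≢ v → f' x ≡ f x
        f'-≢ ne rewrite ≢⇒==f ne = refl
        f'-v : f' v ≡ f s
        f'-v rewrite ≡⇒== {u = v} refl = refl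
        into : ∀ {x} → A x v ≡ true → f x ≡ f s
        into e = around faces uniq f (λ w a _ → h w (ρ v w) (link a)) e (proj₁ bv)
        out : ∀ {x} → A v x ≡ true → f x ≡ f s
        out e with before e
        ... | t , a , refl = trans (sym (h t _ (link a))) (into a)
        flat : ∀ x y → A x y ≡ true → f' x ≡ f' y
        flat x y a with split (x == v) | split (y == v)
        ... | inj₁ p | inj₁ q = ⊥-elim (G-≢ (dart a) (trans (==⇒≡ p) (sym (==⇒≡ q))))
        ... | inj₁ p | inj₂ q with ==⇒≡ p
        ...   | refl = trans f'-v (sym (trans (f'-≢ (==f⇒≢ q)) (out a)))
        flat x y a | inj₂ p | inj₁ q with ==⇒≡ q
        ...   | refl = trans (f'-≢ (==f⇒≢ p)) (trans (into a) (sym f'-v))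
        flat x y a | inj₂ p | inj₂ q = trans (f'-≢ (==f⇒≢ p)) (trans (mid (survive a (==f⇒≢ p) (==f⇒≢ q))) (sym (f'-≢ (==f⇒≢ q))))
          where
          mid : A' x y ≡ true ⊎ A' y x ≡ true → f x ≡ f y
          mid (inj₁ e) = h x y e
          mid (inj₂ e) = sym (h y x e)

      disc' : Disc A'
      disc' = record { faces = faces' ; uniq = uniq' ; conn = conn' ; vconn = vconn' ; edges = edges'
                     ; bdry = s , ρ v s , link (proj₁ bv) , ≢true λ z → proj₂ (proj₂ (untouched z)) (proj₂ (tri' )) }
        where
        tri' : ρ (ρ v s) v ≡ s × ρ s (ρ v s) ≡ v
        tri' = tri (inner (proj₁ bv))
        edges' : ∀ {a b s t} → G a b ≡ true → A' s a ≡ true → A' t b ≡ true → A' a b ≡ true ⊎ A' b a ≡ true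
        edges' g p q with edges g (A'⊆A p) (A'⊆A q) | proj₁ (proj₂ (untouched p)) | proj₁ (proj₂ (untouched q))
        ... | inj₁ e | na | nb = survive e na nb
        ... | inj₂ e | na | nb with survive e nb na
        ...   | inj₁ z = inj₂ z
        ...   | inj₂ z = inj₁ z

      fewer : count (on A') (allDarts n) < count (on A) (allDarts n)
      fewer = count-strict (allDarts n) (λ { (x , y) e → A'⊆A e }) (allDarts-∈ (s , v)) (≢true λ e → proj₁ (proj₂ (untouched e)) refl) (proj₁ bv)

      extend : Listed A' → Listed A
      extend (L , ord , from , to) = v ∷ L , add ord (λ m → proj₁ (proj₂ (untouched (proj₂ (from v m)))) refl)
          (s , to s _ (proj₂ (vertex (third (proj₁ bv)) (G-≢ (dart (proj₁ bv))))) , G-flip (dart (proj₁ bv))) pair , from' , to'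
        where
        -- By `edges` every listed neighbour of v lies on the path formed by the edges opposite to
        -- v, and so does a neighbour of it.
        pair : ∀ x → x ∈ L → G v x ≡ true → ∃ λ y → y ∈ L × G v y ≡ true × G x y ≡ true
        pair x m g with edges g (proj₁ bv) (A'⊆A (proj₂ (from x m)))
        ... | inj₂ e = ρ v x , to _ _ (link e) , dart (next e) , dart (linked e)
        ... | inj₁ e with before e
        ...   | t , a , refl = t , to _ _ (Faces.third faces' (link a)) , G-flip (dart a) , G-flip (dart (linked a))
        from' : ∀ x → x ∈ (v ∷ L) → ∃ λ t → A t x ≡ true
        from' x (here refl) = s , proj₁ bv
        from' x (there m) = proj₁ (from x m) , A'⊆A (proj₂ (from x m))
        to' : ∀ x t → A t x ≡ true → x ∈ (v ∷ L)
        to' x t e with split (x == v)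
        ... | inj₁ z = here (==⇒≡ z)
        ... | inj₂ z = there (to x _ (proj₂ (vertex e (==f⇒≢ z))))

  peel : ∀ k A → Disc A → count (on A) (allDarts n) < k → Listed A
  peel (suc k) A disc lt with chord-free disc
  ... | v , (s , bv) , free with split (anyᵇ (λ w → A w v ∧ not (A w (ρ v w))) (allFin n))
  ...   | inj₁ e with anyᵇ-elim (allFin n) e
  ...     | w , _ , q = Remove.Single.order disc bv free (proj₁ (∧-true q)) (not-true (proj₂ (∧-true {A w v} q)))
  peel (suc k) A disc lt | v , (s , bv) , free | inj₂ e = extend (peel k A' disc' (<-≤-trans fewer (≤-pred lt)))
    where
    open Remove disc bv free
    open Many (λ {w} a → ≢false λ z → clash (anyᵇ-intro {p = λ w → A w v ∧ not (A w (ρ v w))} (∈-allFin w) (∧-intro a (not-false z))) e)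

  ordering : ∃ λ L → Order G L × (∀ x → x ∈ L)
  ordering with peel _ Inner whole (n<1+n _)
  ... | L , ord , _ , to = L , ord , λ x → all x
    where
    into : ∀ {x y} → G x y ≡ true → ∃ λ t → Inner t x ≡ true
    into {x} {y} g with inner-or-out (G-flip g)
    ... | inj₁ i = y , i
    ... | inj₂ z = ρ y x , inner-φ² (inner-intro g (≢true λ q → not-both q z))
    nbr : ∀ x → ∃ λ y → G x y ≡ true
    nbr x with split (x == proj₁ o)
    ... | inj₁ e with ==⇒≡ e
    ...   | refl = proj₂ o , o-dart
    nbr x | inj₂ e with connected x (proj₁ o)
    ...   | _ , here = ⊥-elim (==f⇒≢ e refl)
    ...   | _ , step g _ = _ , g
    all : ∀ x → x ∈ L
    all x = to x _ (proj₂ (into (proj₂ (nbr x))))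

  -- From the ordering to the bound.

  open Rank {G = G} G-irr

  private
    L = proj₁ ordering
    ord = proj₁ (proj₂ ordering)
    all-in = proj₂ (proj₂ ordering)
    rts = roots ord
    p = proj₁ rts
    q = proj₁ (proj₂ rts)
    ip : index L p ≡ 0
    ip = proj₁ (proj₂ (proj₂ (proj₂ (proj₂ rts))))
    iq : index L q ≡ 1
    iq = proj₁ (proj₂ (proj₂ (proj₂ (proj₂ (proj₂ rts)))))

    r : Fin n → ℕ
    r = index L

    r-inj : ∀ {u v} → r u ≡ r v → u ≡ v
    r-inj {u} {v} = index-inj ord (all-in u) (all-in v)

    p<q : r p < r q
    p<q = subst (r p <_) (sym iq) (subst (_< 1) (sym ip) (s≤s z≤n))

    past-roots : ∀ {v} → v ≢ p → v ≢ q → 2 ≤ r v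
    past-roots {v} np nq = lem (r v) refl
      where
      lem : ∀ k → k ≡ r v → 2 ≤ r v
      lem zero e = ⊥-elim (np (r-inj (trans (sym e) (sym ip))))
      lem (suc zero) e = ⊥-elim (nq (r-inj (trans (sym e) (sym iq))))
      lem (suc (suc k)) e = subst (2 ≤_) e (s≤s (s≤s z≤n))

    q-second : ∀ v → v ≢ p → v ≢ q → r q < r v
    q-second v np nq = subst (_< r v) (sym iq) (past-roots np nq)

  open Ordered r r-inj p q p<q q-second using (Str; even; odd; three; not-empty)

  structured : Str G full
  structured = record { E-sym = G-sym ; irr = G-irr ; p∈ = refl ; q∈ = refl ; qp = proj₂ (proj₂ (proj₂ (proj₂ (proj₂ (proj₂ rts))))) ; down = λ _ _ _ → refl
    ; base = λ {v} _ np nq → let x , _ , e , lt = proj₁ (attached ord (all-in v) (past-roots np nq)) in x , e , lt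
    ; pair = λ {v} {x} _ np nq e lt → let y , _ , e₁ , lt₁ , e₂ = proj₂ (attached ord (all-in v) (past-roots np nq)) x (all-in x) e lt in y , e₁ , lt₁ , e₂ }

  -- The third page of a book would be a third face at its spine.
  not-book : Exact 6 bookᵉ G full → ⊥
  not-book ex = pigeon (page 1 refl) (page 2 refl) (page 3 refl)
    where
    open Exact ex
    a b : Fin n
    a = f 4
    b = f 5
    isPage : ℕ → Bool
    -- The only common neighbour of i and 4 is 5, so a bounded face at the edge from i to 4 must be
    -- the triangle i 4 5.
    isPage i = (i <ᵇ 6) ∧ (adj bookᵉ i 4 ∧ allᵇ (λ k → not (adj bookᵉ i k ∧ adj bookᵉ 4 k) ∨ (k ≡ᵇ 5)) (upTo 6))
    page : ∀ i → isPage i ≡ true → ρ b a ≡ f i ⊎ ρ a b ≡ f i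
    page i ok = go (inner-or-out (trans (same li (s≤s (s≤s (s≤s (s≤s (s≤s z≤n)))))) (proj₁ (∧-true ok'))))
      where
      li : i < 6
      li = <ᵇ⇒< i 6 (subst Data.Bool.T (sym (proj₁ (∧-true ok))) tt)
      ok' = proj₂ (∧-true {i <ᵇ 6} ok)
      only : ∀ {x} → G (f i) x ≡ true → G a x ≡ true → x ≡ b
      only {x} e₁ e₂ with onto {x} refl
      ... | k , lk , refl with ∨-true {not (adj bookᵉ i k ∧ adj bookᵉ 4 k)} (allᵇ-∈ {p = λ k → not (adj bookᵉ i k ∧ adj bookᵉ 4 k) ∨ (k ≡ᵇ 5)} (proj₂ (∧-true {adj bookᵉ i 4} ok')) (∈-upTo⁺ lk))
      ...   | inj₂ z = cong f (≡ᵇ-true z)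
      ...   | inj₁ z = clash (∧-intro (trans (sym (same li lk)) e₁) (trans (sym (same {4} (s≤s (s≤s (s≤s (s≤s (s≤s z≤n))))) lk)) e₂)) (not-true z)
      go : Inner (f i) a ≡ true ⊎ Out (f i) a ≡ true → ρ b a ≡ f i ⊎ ρ a b ≡ f i
      go (inj₁ z) = inj₁ (subst (λ y → ρ y a ≡ f i) (only (G-flip (inner-dart (inner-φ² z))) (inner-dart (inner-φ z))) (proj₁ (tri z)))
      go (inj₂ z) = inj₂ (subst (λ y → ρ a y ≡ f i) (only (inner-dart (inner-φ y)) (G-flip (inner-dart (inner-φ² y)))) (proj₂ (tri y)))
        where
        y : Inner a (f i) ≡ true
        y = inner-intro (G-flip (out-dart z)) (≢true (not-both z))
    pages-differ : ∀ {i j} → i < 6 → j < 6 → i ≢ j → f i ≢ f j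
    pages-differ li lj ne e = ne (inj li lj e)
    pigeon : ρ b a ≡ f 1 ⊎ ρ a b ≡ f 1 → ρ b a ≡ f 2 ⊎ ρ a b ≡ f 2 → ρ b a ≡ f 3 ⊎ ρ a b ≡ f 3 → ⊥
    pigeon = λ { (inj₁ x) (inj₁ y) _ → d₁₂ (trans (sym x) y) ; (inj₂ x) (inj₂ y) _ → d₁₂ (trans (sym x) y)
               ; (inj₁ x) (inj₂ y) (inj₁ z) → d₁₃ (trans (sym x) z) ; (inj₁ x) (inj₂ y) (inj₂ z) → d₂₃ (trans (sym y) z)
               ; (inj₂ x) (inj₁ y) (inj₁ z) → d₂₃ (trans (sym y) z) ; (inj₂ x) (inj₁ y) (inj₂ z) → d₁₃ (trans (sym x) z) }
      where
      l₁ : 1 < 6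
      l₁ = s≤s (s≤s z≤n)
      l₂ : 2 < 6
      l₂ = s≤s (s≤s (s≤s z≤n))
      l₃ : 3 < 6
      l₃ = s≤s (s≤s (s≤s (s≤s z≤n)))
      d₁₂ = pages-differ l₁ l₂ (λ ())
      d₁₃ = pages-differ l₁ l₃ (λ ())
      d₂₃ = pages-differ l₂ l₃ (λ ())

  three-vertices : ∃ λ m → n ≡ 3 + m
  three-vertices = lem (proj₁ o) (proj₂ o) (ρ (proj₁ o) (proj₂ o)) (G-≢ o-dart) (λ q → G-≢ (inner-dart (inner-φ² i)) (sym q)) (G-≢ (inner-dart (inner-φ i)))
    where
    i : Inner (proj₂ o) (proj₁ o) ≡ true
    i = inner-intro (G-flip o-dart) (≢true (not-both (out-intro 0 refl)))
    lem : ∀ {k} (a b c : Fin k) → a ≢ b → b ≢ c → a ≢ c → ∃ λ m → k ≡ 3 + m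
    lem {1} zero zero _ x _ _ = ⊥-elim (x refl)
    lem {2} zero zero _ x _ _ = ⊥-elim (x refl)
    lem {2} (suc zero) (suc zero) _ x _ _ = ⊥-elim (x refl)
    lem {2} zero (suc zero) zero _ _ z = ⊥-elim (z refl)
    lem {2} zero (suc zero) (suc zero) _ y _ = ⊥-elim (y refl)
    lem {2} (suc zero) zero zero _ y _ = ⊥-elim (y refl)
    lem {2} (suc zero) zero (suc zero) _ _ z = ⊥-elim (z refl)
    lem {suc (suc (suc m))} _ _ _ _ _ _ = m , refl

  module _ (n₁ : ¬ (G ≅ K4⁻)) (n₂ : ¬ (G ≅ K4)) (n₃ : ¬ (G ≅ W5)) (n₄ : ¬ (G ≅ G6¹)) (n₅ : ¬ (G ≅ G6²))
           (n₆ : ¬ (G ≅ G6³)) (n₇ : ¬ (G ≅ G8¹)) where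

    not-exceptional : ∀ j → Exceptional j G full → ⊥
    not-exceptional 0 (i , _ , ex) = four i ex
      where
      four : ∀ i → Exact 4 (nth excs₄ i) G full → ⊥
      four 0 ex = n₁ (exact-≅ (agree K₄⁻ᵉ K4⁻ tt) ex)
      four 1 ex = n₂ (exact-≅ (agree K₄ᵉ K4 tt) ex)
      four (suc (suc i)) ex = not-empty structured ex
    not-exceptional 1 (i , _ , ex) = six i ex
      where
      six : ∀ i → Exact 6 (nth excs₆ i) G full → ⊥
      six 0 ex = n₄ (exact-≅ (agree fanᵉ G6¹ tt) ex)
      six 1 ex = n₅ (exact-≅ (agree zigzagᵉ G6² tt) ex)
      six 2 ex = n₃ (exact-≅ (agree wheelᵉ W5 tt) ex)
      six 3 ex = n₆ (exact-≅ (agree hatᵉ G6³ tt) ex)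
      six 4 ex = not-book ex
      six (suc (suc (suc (suc (suc i))))) ex = not-empty structured ex
    not-exceptional 2 ex = n₇ (exact-≅ (agree eightᵉ G8¹ tt) ex)

    by-size : ∀ {m} → n ≡ m → Size m → Good G full ⌈ m /2⌉
    by-size e is-three = three structured (trans (size-full n) e)
    by-size e (is-odd j) = subst (Good G full) (sym (⌈odd/2⌉ j)) (odd j structured (trans (size-full n) e))
    by-size e (is-even j) = subst (Good G full) (sym (⌈even/2⌉ j)) (go (even j structured (trans (size-full n) e)))
      where
      go : Good G full (2 + j) ⊎ Exceptional j G full → Good G full (2 + j)
      go (inj₁ g) = g
      go (inj₂ ex) = ⊥-elim (not-exceptional j ex)

    good-orientation : Good G full ⌈ n /2⌉
    good-orientation = subst (λ m → Good G full ⌈ m /2⌉) (sym (proj₂ three-vertices)) (by-size (proj₂ three-vertices) (classify (proj₁ three-vertices)))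

theorem1p3 : ∀ (n : ℕ) (G : Graph n) (ρ : Rotation n) (o : Dart n) →
    Is2ConnNearTriangulation G ρ o →
    ¬ (G ≅ K4⁻) → ¬ (G ≅ K4) → ¬ (G ≅ W5) → ¬ (G ≅ G6¹) → ¬ (G ≅ G6²) →
    ¬ (G ≅ G6³) → ¬ (G ≅ G8¹) →
    OrientedDiamLE G ⌈ n /2⌉
theorem1p3 n G ρ o nt n₁ n₂ n₃ n₄ n₅ n₆ n₇ =
  complete-orientation (proj₂ (proj₁ (proj₁ nt))) (proj₁ (proj₁ (proj₁ nt))) (Near-triangulation.good-orientation nt n₁ n₂ n₃ n₄ n₅ n₆ n₇)
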